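{- Let $n\ge1$ and put $A=(\zeta+1)^2p_{n-1}(\zeta)$, $B=\zeta^{n+1}\tilde p_n(\zeta)$, $C=(1+2\zeta)^{1+\chi(n\text{ even})}\big(1+\tfrac\zeta2\big)^{1+\chi(n\text{ odd})}p_n(\zeta)^2$, where $\chi(\text{true})=1,\chi(\text{false})=0$. Then the polynomial equation $AX-BY=C$ has a solution $(X,Y)$ in polynomials in $\zeta$ with $X=p_{n+1}$ and $\deg Y=\deg A$.
   Context: Let $\zeta$ be an indeterminate. Define $F(x,y,z)=(\zeta+2)xyz-\zeta(xy+yz+xz+x+y+z)+\zeta(2\zeta+1)$ and $G(x,y)=(\zeta+2)xy(x+y)-\zeta(x^2+y^2)-2(\zeta^2+3\zeta+1)xy+\zeta(2\zeta+1)(x+y)$. For $n\ge 0$ let $$S_n(x_1,\dots,x_n,y_1,\dots,y_n,z)=\frac{\prod_{i,j=1}^nG(x_i,y_j)}{\prod_{1\le i<j\le n}(x_j-x_i)(y_j-y_i)}\det_{1\le i,j\le n}\left(\frac{F(x_i,y_j,z)}{G(x_i,y_j)}\right)$$ ($S_0=1$); it is a polynomial in all variables and $\zeta$, symmetric in its $2n+1$ variables. Let $\delta_k=\lfloor k^2/4\rfloor$. For $n\ge0$ define $$p_n(\zeta)=\frac{(1+\frac\zeta2)^{n^2}\,S_n\big(\underbrace{2\zeta+1,\dots,2\zeta+1}_{n+1},\underbrace{\tfrac{\zeta}{\zeta+2},\dots,\tfrac{\zeta}{\zeta+2}}_{n}\big)}{(-1)^{\binom{n+1}2}\zeta^{n^2}(1+\zeta)^{n^2}(1+2\zeta)^{\delta_n}(1+\frac\zeta2)^{\delta_{n-1}}},$$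 and $p_{ -1}=1$; these are polynomials in $\zeta$. Put $\tilde p_n(\zeta)=\zeta^{n(n+1)/2}p_n(1/\zeta)$. -}

module Defs where

open import Data.Nat as ℕ using (ℕ; zero; suc)
open import Data.Nat.Combinatorics using (_C_)
open import Data.Integer using (+_)
open import Data.Rational using (ℚ; 0ℚ; 1ℚ; _+_; _*_; _-_; -_; _÷_; _≟_; ≢-nonZero)
open import Data.Rational using () renaming (_/_ to _//_)
open import Data.Fin using (Fin; zero; suc; punchIn; toℕ; _<_)
open import Data.List using (List; []; _∷_)
open import Data.Maybe using (Maybe; just; nothing)
open import Relation.Nullary using (yes; no; ¬_)
open import Relation.Binary.PropositionalEquality using (_≡_; _≢_)

ℕ→ℚ : ℕ → ℚ
ℕ→ℚ k = (+ k) // 1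

_^_ : ℚ → ℕ → ℚ
q ^ zero  = 1ℚ
q ^ suc k = q * (q ^ k)

-- total division; only ever used where the denominator is nonzero
_÷'_ : ℚ → ℚ → ℚ
p ÷' q with q ≟ 0ℚ
... | yes _ = 0ℚ
... | no q≢0 = _÷_ p q {{≢-nonZero q≢0}}

sgn : ℕ → ℚ
sgn k = (- 1ℚ) ^ k

sumF : ∀ {n} → (Fin n → ℚ) → ℚ
sumF {zero}  f = 0ℚ
sumF {suc n} f = f zero + sumF (λ i → f (suc i))

prodF : ∀ {n} → (Fin n → ℚ) → ℚ
prodF {zero}  f = 1ℚ
prodF {suc n} f = f zero * prodF (λ i → f (suc i))

prodLt : ∀ {n} → (Fin n → Fin n → ℚ) → ℚ
prodLt {zero}  f = 1ℚ
prodLt {suc n} f = prodF (λ j → f zero (suc j)) * prodLt (λ i j → f (suc i) (suc j))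

det : ∀ {n} → (Fin n → Fin n → ℚ) → ℚ
det {zero}  M = 1ℚ
det {suc n} M =
  sumF (λ j → sgn (toℕ j) * M zero j * det (λ a b → M (suc a) (punchIn j b)))

data MPoly (V : Set) : Set where
  con  : ℚ → MPoly V
  var  : V → MPoly V
  _⊕_  : MPoly V → MPoly V → MPoly V
  _⊗_  : MPoly V → MPoly V → MPoly V

evalM : ∀ {V} → MPoly V → (V → ℚ) → ℚ
evalM (con c) ρ = c
evalM (var v) ρ = ρ v
evalM (p ⊕ q) ρ = evalM p ρ + evalM q ρ
evalM (p ⊗ q) ρ = evalM p ρ * evalM q ρ

data SVar (n : ℕ) : Set where
  xv : Fin n → SVar n
  yv : Fin n → SVar n
  zv : SVar n
  ζv : SVar n

-- Univariate polynomials in ζ over ℚ: coefficient lists, constant term first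

Poly : Set
Poly = List ℚ

evalP : Poly → ℚ → ℚ
evalP []       t = 0ℚ
evalP (c ∷ cs) t = c + t * evalP cs t

-- degree; nothing = degree of the zero polynomial (−∞)
deg : Poly → Maybe ℕ
deg [] = nothing
deg (c ∷ cs) with deg cs
... | just d  = just (suc d)
... | nothing with c ≟ 0ℚ
...   | yes _ = nothing
...   | no  _ = just 0

addP : Poly → Poly → Poly
addP []       q        = q
addP (a ∷ p)  []       = a ∷ p
addP (a ∷ p)  (b ∷ q)  = (a + b) ∷ addP p q

scaleP : ℚ → Poly → Poly
scaleP c []       = []
scaleP c (a ∷ p)  = (c * a) ∷ scaleP c p

mulP : Poly → Poly → Poly
mulP []      q = []
mulP (a ∷ p) q = addP (scaleP a q) (0ℚ ∷ mulP p q)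

-- The data of the paper (ζ is written t below)

two : ℚ
two = ℕ→ℚ 2

Fp : ℚ → ℚ → ℚ → ℚ → ℚ
Fp t x y z = (t + two) * x * y * z - t * (x * y + y * z + x * z + x + y + z)
             + t * (two * t + 1ℚ)

Gp : ℚ → ℚ → ℚ → ℚ
Gp t x y = (t + two) * x * y * (x + y) - t * (x * x + y * y)
           - two * (t * t + ℕ→ℚ 3 * t + 1ℚ) * x * y
           + t * (two * t + 1ℚ) * (x + y)

IsS : (n : ℕ) → MPoly (SVar n) → Set
IsS n S =
  (x y : Fin n → ℚ) (z t : ℚ) →
  (∀ i j → Gp t (x i) (y j) ≢ 0ℚ) →
  evalM S (env x y z t) * prodLt (λ i j → (x j - x i) * (y j - y i))
    ≡ prodF (λ i → prodF (λ j → Gp t (x i) (y j)))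
      * det (λ i j → Fp t (x i) (y j) z ÷' Gp t (x i) (y j))
  where
  env : (Fin n → ℚ) → (Fin n → ℚ) → ℚ → ℚ → SVar n → ℚ
  env x y z t (xv i) = x i
  env x y z t (yv j) = y j
  env x y z t zv     = z
  env x y z t ζv     = t

δ : ℕ → ℕ
δ k = (k ℕ.* k) ℕ./ 4

-- environment for S_n(2ζ+1 (n+1 times), ζ/(ζ+2) (n times)), in argument
-- order x_1..x_n, y_1..y_n, z: the first n+1 slots x_1..x_n,y_1 get 2ζ+1
envP : (n : ℕ) → ℚ → SVar n → ℚ
envP n t (xv i)       = two * t + 1ℚ
envP n t (yv zero)    = two * t + 1ℚ
envP n t (yv (suc j)) = t ÷' (t + two)
envP n t zv           = t ÷' (t + two)
envP n t ζv           = t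

half : ℚ
half = (+ 1) // 2

-- P is p_n (as a polynomial in ζ), given S = S_n: for every ζ at which the
-- defining expression makes sense (ζ ∉ {0, -1, -1/2, -2}),
-- p_n(ζ) · (-1)^{C(n+1,2)} ζ^{n²} (1+ζ)^{n²} (1+2ζ)^{δ_n} (1+ζ/2)^{δ_{n-1}}
--   = (1+ζ/2)^{n²} S_n(...)
IsP : (n : ℕ) → MPoly (SVar n) → Poly → Set
IsP n S P =
  (t : ℚ) → t ≢ 0ℚ → 1ℚ + t ≢ 0ℚ → 1ℚ + two * t ≢ 0ℚ → t + two ≢ 0ℚ →
  evalP P t * (sgn (suc n C 2) * t ^ (n ℕ.* n) * (1ℚ + t) ^ (n ℕ.* n)
               * (1ℚ + two * t) ^ δ n * (1ℚ + half * t) ^ δ (n ℕ.∸ 1))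
    ≡ (1ℚ + half * t) ^ (n ℕ.* n) * evalM S (envP n t)

Apoly : Poly → Poly
Apoly Pprev = mulP (1ℚ ∷ two ∷ 1ℚ ∷ []) Pprev

-- B(ζ) = ζ^{n+1} p̃_n(ζ) = ζ^{n+1} ζ^{n(n+1)/2} p_n(1/ζ), for ζ ≠ 0
Bval : ℕ → Poly → ℚ → ℚ
Bval n P t = t ^ suc n * (t ^ ((n ℕ.* suc n) ℕ./ 2) * evalP P (1ℚ ÷' t))

χeven χodd : ℕ → ℕ
χeven zero          = 1
χeven (suc zero)    = 0
χeven (suc (suc k)) = χeven k
χodd k = 1 ℕ.∸ χeven k

Cval : ℕ → Poly → ℚ → ℚ
Cval n P t = (1ℚ + two * t) ^ suc (χeven n) * (1ℚ + half * t) ^ suc (χodd n)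
             * (evalP P t * evalP P t)

{-# OPTIONS --safe #-}
module Submission where

-- The Desnanot–Jacobi identity for the matrix F/G is a bilinear identity
--   (b − a)(d − c) S_{n+2}(a,b,c,d,v) S_n(v) = G(a,d) G(b,c) S_{n+1}(a,c,v) S_{n+1}(b,d,v) − G(a,c) G(b,d) S_{n+1}(a,d,v) S_{n+1}(b,c,v);
-- together with a three-term relation between F and G it yields, by induction, the symmetry of S_n in all 2n + 1 arguments. With
-- every argument equal to ξ₀ = 2ζ + 1 or ξ₁ = ζ/(ζ + 2) the values of G factor, and the bilinear identity writes P_{n+1} P_{n−1} +
-- ζ² ξ₀² P_n², where P_n = S_n(ξ₀^{n+1}, ξ₁^n), as a multiple of the product of S_n(ξ₀^n, ξ₁^{n+1}), which is p̃_n up to trivial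
-- factors by the covariance of S_n under inversion of all variables, and S_n(ξ₀^{n+2}, ξ₁^{n−1}). The latter, divided by its factors
-- ζ, ζ + 1, 2ζ + 1 and ζ + 2, is Y. That these factors divide it is read off the determinant by scaling the arguments near ζ = 0, −1
-- and −1/2 (and −2, by inversion). Finally deg Y = deg A means that the equation, reversed, does not vanish at 0. There the reversed
-- p_n takes, up to powers of 2, the value C(2n+1, n), which the bilinear identity determines near ζ = 0, and these binomials are
-- strictly log-convex.

open import Defs
open import Data.Bool using (Bool; true; false; if_then_else_)
open import Data.Empty using (⊥-elim)
open import Data.Fin using (Fin; zero; suc; punchIn; toℕ; fromℕ; inject₁)
open import Data.List using (List; []; _∷_; length)
open import Data.Maybe using (Maybe; just; nothing; maybe)
open import Data.Nat as ℕ using (ℕ; zero; suc; _≤_; _∸_)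
open import Data.Nat.Combinatorics using (nCk+nC[k+1]≡[n+1]C[k+1]; nC1≡n) renaming (_C_ to _choose_)
open import Data.Nat.DivMod using (m*n/n≡m; +-distrib-/; m*n%n≡0)
import Data.Nat.Properties as ℕP
import Data.Nat.Tactic.RingSolver as ℕR
open import Data.Product using (Σ; _×_; _,_; proj₁; proj₂)
open import Data.Rational as ℚ using (ℚ; 0ℚ; 1ℚ; _+_; _*_; _-_; -_; 1/_; _≟_; ≢-nonZero)
import Data.Rational.Properties as ℚP
open import Data.Sum using (_⊎_; inj₁; inj₂)
open import Data.Unit using (⊤; tt)
open import Data.Vec using (Vec; []; _∷_; lookup; map; tabulate)
open import Data.Vec.Properties using (lookup∘tabulate; tabulate∘lookup)
open import Level using (0ℓ)
open import Relation.Binary.Definitions using (tri<; tri≈; tri>)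
open import Relation.Binary.PropositionalEquality using (_≡_; _≢_; refl; sym; trans; cong; cong₂; subst; module ≡-Reasoning)
open import Relation.Nullary using (Dec; yes; no)
import Tactic.RingSolver.Core.AlmostCommutativeRing as ACR
import Tactic.RingSolver.NonReflective as NonReflective

-- The hypothesis on S_n speaks only of arguments with all G nonzero and fixes only the product of
-- S_n with two Vandermonde products, whereas the specialization has coinciding arguments, where
-- these products vanish. Identities are therefore proved for generic arguments, phrased between
-- polynomial functions and extended by density. The special values are those x for which G(x, y) is
-- a monomial in y: G(ξ₀, y) = 2(ζ + 1)² y² and G(ξ₁, y) = 2(ζ + 1)² ξ₁². The exponents of the
-- trivial factors are obtained as vanishing orders: the orders of the rows of the determinant minus
-- those of the Vandermonde products. Near ζ = 0 the leading coefficient of S_n is a Cauchy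
-- determinant when n + 1 arguments lie near ξ₀, but not when n + 1 lie near ξ₁, the case that
-- governs the reversed p_n; there the bilinear identity, with the Cauchy determinants as known
-- coefficients, becomes a recursion. Coefficient lists may end in zeros, so a degree d is
-- recognized by a polynomial that equals t^d P(1/t) for t ≠ 0 and is nonzero at 0.

0≟ℚ : (x : ℚ) → Maybe (0ℚ ≡ x)
0≟ℚ x with 0ℚ ≟ x
... | yes p = just p
... | no _  = nothing

ringℚ : ACR.AlmostCommutativeRing 0ℓ 0ℓ
ringℚ = ACR.fromCommutativeRing ℚP.+-*-commutativeRing 0≟ℚ

open NonReflective ringℚ using (Expr; Κ; solve) renaming (_⊕_ to _:+_; _⊗_ to _:*_; ⊝_ to :-_; _⊜_ to infix 4 _:=_)

infixl 6 _:-_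
_:-_ : ∀ {n} → Expr ℚ n → Expr ℚ n → Expr ℚ n
x :- y = x :+ :- y

:0 :1 :2 :3 :4 :6 :½ : ∀ {n} → Expr ℚ n
:0 = Κ 0ℚ
:1 = Κ 1ℚ
:2 = Κ two
:3 = Κ (ℕ→ℚ 3)
:4 = Κ (ℕ→ℚ 4)
:6 = Κ (ℕ→ℚ 6)
:½ = Κ half

-- Rational arithmetic

inv : (a : ℚ) → a ≢ 0ℚ → Σ ℚ λ b → a * b ≡ 1ℚ
inv a a≢0 = 1/_ a {{≢-nonZero a≢0}} , ℚP.*-inverseʳ a {{≢-nonZero a≢0}}

*-cancelˡ-≢0 : ∀ a {b c} → a ≢ 0ℚ → a * b ≡ a * c → b ≡ c
*-cancelˡ-≢0 a {b} {c} a≢0 eq = begin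
  b                ≡⟨ 1*- b ⟩
  1ℚ * b           ≡⟨ cong (_* b) (sym aa') ⟩
  a * a' * b       ≡⟨ swp a a' b ⟩
  a' * (a * b)     ≡⟨ cong (a' *_) eq ⟩
  a' * (a * c)     ≡⟨ sym (swp a a' c) ⟩
  a * a' * c       ≡⟨ cong (_* c) aa' ⟩
  1ℚ * c           ≡⟨ sym (1*- c) ⟩
  c                ∎
  where
  open ≡-Reasoning
  a'  = proj₁ (inv a a≢0)
  aa' = proj₂ (inv a a≢0)
  1*- : ∀ x → x ≡ 1ℚ * x
  1*- = solve 1 (λ x → x := :1 :* x) refl
  swp : ∀ x y z → x * y * z ≡ y * (x * z)
  swp = solve 3 (λ x y z → x :* y :* z := y :* (x :* z)) refl

*-zero-split : ∀ a {b} → a ≢ 0ℚ → a * b ≡ 0ℚ → b ≡ 0ℚ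
*-zero-split a a≢0 eq = *-cancelˡ-≢0 a a≢0 (trans eq (sym (ℚP.*-zeroʳ a)))

*-≢0 : ∀ {a b} → a ≢ 0ℚ → b ≢ 0ℚ → a * b ≢ 0ℚ
*-≢0 {a} a≢0 b≢0 eq = b≢0 (*-zero-split a a≢0 eq)

*-≢0ˡ : ∀ {a b} → a * b ≢ 0ℚ → a ≢ 0ℚ
*-≢0ˡ {a} {b} ab≢0 refl = ab≢0 (ℚP.*-zeroˡ b)

*-≢0ʳ : ∀ {a b} → a * b ≢ 0ℚ → b ≢ 0ℚ
*-≢0ʳ {a} {b} ab≢0 refl = ab≢0 (ℚP.*-zeroʳ a)

1≢0 : 1ℚ ≢ 0ℚ
1≢0 ()

-≡0 : ∀ {a b} → a - b ≡ 0ℚ → a ≡ b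
-≡0 {a} {b} eq = trans (lem a b) (trans (cong (_+ b) eq) (ℚP.+-identityˡ b))
  where
  lem : ∀ a b → a ≡ (a - b) + b
  lem = solve 2 (λ a b → a := (a :- b) :+ b) refl

≡-⇒0 : ∀ {a b} → a ≡ b → a - b ≡ 0ℚ
≡-⇒0 {a} refl = ℚP.+-inverseʳ a

+≡0 : ∀ {a b} → a + b ≡ 0ℚ → a ≡ - b
+≡0 {a} {b} eq = trans (lem a b) (trans (cong (_+ - b) eq) (ℚP.+-identityˡ (- b)))
  where
  lem : ∀ a b → a ≡ (a + b) + - b
  lem = solve 2 (λ a b → a := (a :+ b) :+ :- b) refl

double≡0 : ∀ {a} → a + a ≡ 0ℚ → a ≡ 0ℚ
double≡0 {a} eq = *-zero-split two (λ ()) (trans (lem a) eq)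
  where
  lem : ∀ a → two * a ≡ a + a
  lem = solve 1 (λ a → :2 :* a := a :+ a) refl

÷'-* : ∀ p {q} → q ≢ 0ℚ → (p ÷' q) * q ≡ p
÷'-* p {q} q≢0 with q ≟ 0ℚ
... | yes q≡0 = ⊥-elim (q≢0 q≡0)
... | no  q≢0' = begin
  p * q⁻¹ * q   ≡⟨ ℚP.*-assoc p q⁻¹ q ⟩
  p * (q⁻¹ * q) ≡⟨ cong (p *_) (ℚP.*-inverseˡ q {{≢-nonZero q≢0'}}) ⟩
  p * 1ℚ        ≡⟨ ℚP.*-identityʳ p ⟩
  p             ∎
  where
  open ≡-Reasoning
  q⁻¹ = 1/_ q {{≢-nonZero q≢0'}}

-- Finite sums and products

sumF-cong : ∀ {n} {f g : Fin n → ℚ} → (∀ i → f i ≡ g i) → sumF f ≡ sumF g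
sumF-cong {zero}  eq = refl
sumF-cong {suc n} eq = cong₂ _+_ (eq zero) (sumF-cong (λ i → eq (suc i)))

sumF-+ : ∀ {n} (f g : Fin n → ℚ) → sumF (λ i → f i + g i) ≡ sumF f + sumF g
sumF-+ {zero}  f g = refl
sumF-+ {suc n} f g = trans (cong (f zero + g zero +_) (sumF-+ (λ i → f (suc i)) (λ i → g (suc i)))) (lem (f zero) (g zero) (sumF (λ i → f (suc i))) (sumF (λ i → g (suc i))))
  where
  lem : ∀ a b c d → a + b + (c + d) ≡ a + c + (b + d)
  lem = solve 4 (λ a b c d → a :+ b :+ (c :+ d) := a :+ c :+ (b :+ d)) refl

sumF-* : ∀ {n} c (f : Fin n → ℚ) → sumF (λ i → c * f i) ≡ c * sumF f
sumF-* {zero}  c f = sym (ℚP.*-zeroʳ c)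
sumF-* {suc n} c f = trans (cong (c * f zero +_) (sumF-* c (λ i → f (suc i)))) (sym (ℚP.*-distribˡ-+ c (f zero) (sumF (λ i → f (suc i)))))

sumF-0 : ∀ {n} {f : Fin n → ℚ} → (∀ i → f i ≡ 0ℚ) → sumF f ≡ 0ℚ
sumF-0 {zero}  eq = refl
sumF-0 {suc n} eq = trans (cong₂ _+_ (eq zero) (sumF-0 (λ i → eq (suc i)))) refl

prodF-cong : ∀ {n} {f g : Fin n → ℚ} → (∀ i → f i ≡ g i) → prodF f ≡ prodF g
prodF-cong {zero}  eq = refl
prodF-cong {suc n} eq = cong₂ _*_ (eq zero) (prodF-cong (λ i → eq (suc i)))

prodF-* : ∀ {n} (f g : Fin n → ℚ) → prodF (λ i → f i * g i) ≡ prodF f * prodF g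
prodF-* {zero}  f g = refl
prodF-* {suc n} f g = trans (cong (f zero * g zero *_) (prodF-* (λ i → f (suc i)) (λ i → g (suc i)))) (lem (f zero) (g zero) (prodF (λ i → f (suc i))) (prodF (λ i → g (suc i))))
  where
  lem : ∀ a b c d → a * b * (c * d) ≡ a * c * (b * d)
  lem = solve 4 (λ a b c d → a :* b :* (c :* d) := a :* c :* (b :* d)) refl

prodF-≢0 : ∀ {n} {f : Fin n → ℚ} → (∀ i → f i ≢ 0ℚ) → prodF f ≢ 0ℚ
prodF-≢0 {zero}  nz = 1≢0
prodF-≢0 {suc n} nz = *-≢0 (nz zero) (prodF-≢0 (λ i → nz (suc i)))

prodF-≢0⁻ : ∀ {n} {f : Fin n → ℚ} → prodF f ≢ 0ℚ → ∀ i → f i ≢ 0ℚ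
prodF-≢0⁻ nz zero    = *-≢0ˡ nz
prodF-≢0⁻ {f = f} nz (suc i) = prodF-≢0⁻ (*-≢0ʳ {f zero} nz) i

prodF-punchIn : ∀ {n} (f : Fin (suc n) → ℚ) j → prodF f ≡ f j * prodF (λ k → f (punchIn j k))
prodF-punchIn f zero = refl
prodF-punchIn {suc n} f (suc j) = trans (cong (f zero *_) (prodF-punchIn (λ k → f (suc k)) j)) (lem (f zero) (f (suc j)) (prodF (λ k → f (suc (punchIn j k)))))
  where
  lem : ∀ a b c → a * (b * c) ≡ b * (a * c)
  lem = solve 3 (λ a b c → a :* (b :* c) := b :* (a :* c)) refl

prodLt-cong : ∀ {n} {f g : Fin n → Fin n → ℚ} → (∀ i j → f i j ≡ g i j) → prodLt f ≡ prodLt g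
prodLt-cong {zero}  eq = refl
prodLt-cong {suc n} eq = cong₂ _*_ (prodF-cong (λ j → eq zero (suc j))) (prodLt-cong (λ i j → eq (suc i) (suc j)))

prodLt-* : ∀ {n} (f g : Fin n → Fin n → ℚ) → prodLt (λ i j → f i j * g i j) ≡ prodLt f * prodLt g
prodLt-* {zero}  f g = refl
prodLt-* {suc n} f g =
  trans (cong₂ _*_ (prodF-* (λ j → f zero (suc j)) (λ j → g zero (suc j)))
                   (prodLt-* (λ i j → f (suc i) (suc j)) (λ i j → g (suc i) (suc j))))
    (lem (prodF (λ j → f zero (suc j))) (prodF (λ j → g zero (suc j))) (prodLt (λ i j → f (suc i) (suc j))) (prodLt (λ i j → g (suc i) (suc j))))
  where
  lem : ∀ a b c d → a * b * (c * d) ≡ a * c * (b * d)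
  lem = solve 4 (λ a b c d → a :* b :* (c :* d) := a :* c :* (b :* d)) refl

-- Determinants

Mat : ℕ → Set
Mat n = Fin n → Fin n → ℚ

det-cong : ∀ {n} (M N : Mat n) → (∀ i j → M i j ≡ N i j) → det M ≡ det N
det-cong {zero}  M N eq = refl
det-cong {suc n} M N eq = sumF-cong λ j →
  cong₂ _*_ (cong (sgn (toℕ j) *_) (eq zero j))
            (det-cong (λ a b → M (suc a) (punchIn j b)) (λ a b → N (suc a) (punchIn j b)) (λ a b → eq (suc a) (punchIn j b)))

infixr 5 _◂_
_◂_ : ∀ {n} {A : Set} → A → (Fin n → A) → Fin (suc n) → A
(u ◂ N) zero    = u
(u ◂ N) (suc i) = N i

det-linear₀ : ∀ {n} (u v : Fin (suc n) → ℚ) c (N : Fin n → Fin (suc n) → ℚ) →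
  det ((λ j → u j + c * v j) ◂ N) ≡ det (u ◂ N) + c * det (v ◂ N)
det-linear₀ {n} u v c N = begin
  sumF (λ j → sgn (toℕ j) * (u j + c * v j) * m j)
    ≡⟨ sumF-cong (λ j → lem (sgn (toℕ j)) (u j) c (v j) (m j)) ⟩
  sumF (λ j → sgn (toℕ j) * u j * m j + c * (sgn (toℕ j) * v j * m j))
    ≡⟨ sumF-+ (λ j → sgn (toℕ j) * u j * m j) (λ j → c * (sgn (toℕ j) * v j * m j)) ⟩
  det (u ◂ N) + sumF (λ j → c * (sgn (toℕ j) * v j * m j))
    ≡⟨ cong (det (u ◂ N) +_) (sumF-* c (λ j → sgn (toℕ j) * v j * m j)) ⟩
  det (u ◂ N) + c * det (v ◂ N) ∎
  where
  open ≡-Reasoning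
  m : Fin (suc n) → ℚ
  m j = det (λ a b → N a (punchIn j b))
  lem : ∀ s u c v m → s * (u + c * v) * m ≡ s * u * m + c * (s * v * m)
  lem = solve 5 (λ s u c v m → s :* (u :+ c :* v) :* m := s :* u :* m :+ c :* (s :* v :* m)) refl

-- dual j k is the position of j among the indices other than punchIn j k.
dual : ∀ {n} → Fin (suc n) → Fin n → Fin n
dual {suc n} zero    k       = zero
dual {suc n} (suc j) zero    = j
dual {suc n} (suc j) (suc k) = suc (dual j k)

punchIn-dual : ∀ {n} (j : Fin (suc n)) (k : Fin n) → punchIn (punchIn j k) (dual j k) ≡ j
punchIn-dual {suc n} zero    k       = refl
punchIn-dual {suc n} (suc j) zero    = refl
punchIn-dual {suc n} (suc j) (suc k) = cong suc (punchIn-dual j k)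

punchIn-punchIn-dual : ∀ {n} (j : Fin (suc (suc n))) (k : Fin (suc n)) b →
  punchIn (punchIn j k) (punchIn (dual j k) b) ≡ punchIn j (punchIn k b)
punchIn-punchIn-dual zero    k       b       = refl
punchIn-punchIn-dual (suc j) zero    b       = refl
punchIn-punchIn-dual (suc j) (suc k) zero    = refl
punchIn-punchIn-dual {suc n} (suc j) (suc k) (suc b) = cong suc (punchIn-punchIn-dual j k b)

-- Reversing the ordered pair of distinct indices (j, `punchIn j k`) is an involution without fixed
-- points that flips the sign of the term. The induction peels off the terms with j = 0 and those
-- with k = 0, which cancel one by one.
alternating-sum-0 : ∀ {n} (g : Fin (suc n) → Fin n → ℚ) →
  (∀ j k → g (punchIn j k) (dual j k) ≡ g j k) →
  sumF (λ j → sumF (λ k → sgn (toℕ j) * sgn (toℕ k) * g j k)) ≡ 0ℚ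
alternating-sum-0 {zero}  g symm = refl
alternating-sum-0 {suc n} g symm = begin
  sumF A + sumF (λ j → B j + sumF (C' j))
    ≡⟨ cong (sumF A +_) (sumF-+ B (λ j → sumF (C' j))) ⟩
  sumF A + (sumF B + sumF (λ j → sumF (C' j)))
    ≡⟨ cong (λ w → sumF A + (sumF B + w)) (sumF-cong (λ j → sumF-cong (λ k → negneg (sgn (toℕ j)) (sgn (toℕ k)) (g (suc j) (suc k))))) ⟩
  sumF A + (sumF B + sumF (λ j → sumF (C j)))
    ≡⟨ cong (λ w → sumF A + (sumF B + w)) (alternating-sum-0 (λ j k → g (suc j) (suc k)) (λ j k → symm (suc j) (suc k))) ⟩
  sumF A + (sumF B + 0ℚ)
    ≡⟨ cong (sumF A +_) (ℚP.+-identityʳ (sumF B)) ⟩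
  sumF A + sumF B
    ≡⟨ sym (sumF-+ A B) ⟩
  sumF (λ j → A j + B j)
    ≡⟨ sumF-0 (λ j → trans (cong (λ w → A j + sgn (suc (toℕ j)) * sgn 0 * w) (symm zero j)) (cancel (sgn (toℕ j)) (g zero j))) ⟩
  0ℚ ∎
  where
  open ≡-Reasoning
  A B : Fin (suc n) → ℚ
  A k = sgn 0 * sgn (toℕ k) * g zero k
  B j = sgn (suc (toℕ j)) * sgn 0 * g (suc j) zero
  C C' : Fin (suc n) → Fin n → ℚ
  C' j k = sgn (suc (toℕ j)) * sgn (suc (toℕ k)) * g (suc j) (suc k)
  C  j k = sgn (toℕ j) * sgn (toℕ k) * g (suc j) (suc k)
  negneg : ∀ a b c → (- 1ℚ * a) * (- 1ℚ * b) * c ≡ a * b * c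
  negneg = solve 3 (λ a b c → (:- :1 :* a) :* (:- :1 :* b) :* c := a :* b :* c) refl
  cancel : ∀ a b → 1ℚ * a * b + (- 1ℚ * a) * 1ℚ * b ≡ 0ℚ
  cancel = solve 2 (λ a b → :1 :* a :* b :+ (:- :1 :* a) :* :1 :* b := :0) refl

-- After expansion along two rows, the sum of both determinants has the coefficient u_j v_k + v_j
-- u_k times a minor. This is symmetric in the two deleted columns, while the sign alternates.
det-swap₀₁ : ∀ {n} (u v : Fin (suc (suc n)) → ℚ) (N : Fin n → Fin (suc (suc n)) → ℚ) →
  det (u ◂ v ◂ N) ≡ - det (v ◂ u ◂ N)
det-swap₀₁ {n} u v N = +≡0 (begin
  det (u ◂ v ◂ N) + det (v ◂ u ◂ N)
    ≡⟨ sym (sumF-+ (λ j → sgn (toℕ j) * u j * inner v j) (λ j → sgn (toℕ j) * v j * inner u j)) ⟩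
  sumF (λ j → sgn (toℕ j) * u j * inner v j + sgn (toℕ j) * v j * inner u j)
    ≡⟨ sumF-cong (λ j → trans (cong₂ _+_ (push u v j) (push v u j)) (sym (sumF-+ (term u v j) (term v u j)))) ⟩
  sumF (λ j → sumF (λ k → term u v j k + term v u j k))
    ≡⟨ sumF-cong (λ j → sumF-cong (λ k → regroup (sgn (toℕ j)) (sgn (toℕ k)) (u j) (v (punchIn j k)) (v j) (u (punchIn j k)) (m j k))) ⟩
  sumF (λ j → sumF (λ k → sgn (toℕ j) * sgn (toℕ k) * g j k))
    ≡⟨ alternating-sum-0 g g-sym ⟩
  0ℚ ∎)
  where
  open ≡-Reasoning
  m : Fin (suc (suc n)) → Fin (suc n) → ℚ
  m j k = det (λ a b → N a (punchIn j (punchIn k b)))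
  inner : (Fin (suc (suc n)) → ℚ) → Fin (suc (suc n)) → ℚ
  inner w j = sumF (λ k → sgn (toℕ k) * w (punchIn j k) * m j k)
  term : (w w' : Fin (suc (suc n)) → ℚ) → Fin (suc (suc n)) → Fin (suc n) → ℚ
  term w w' j k = sgn (toℕ j) * w j * (sgn (toℕ k) * w' (punchIn j k) * m j k)
  push : ∀ w w' j → sgn (toℕ j) * w j * inner w' j ≡ sumF (term w w' j)
  push w w' j = sym (sumF-* (sgn (toℕ j) * w j) (λ k → sgn (toℕ k) * w' (punchIn j k) * m j k))
  g : Fin (suc (suc n)) → Fin (suc n) → ℚ
  g j k = (u j * v (punchIn j k) + v j * u (punchIn j k)) * m j k
  g-sym : ∀ j k → g (punchIn j k) (dual j k) ≡ g j k
  g-sym j k = cong₂ _*_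
    (trans (cong₂ (λ p q → u (punchIn j k) * p + v (punchIn j k) * q) (cong v (punchIn-dual j k)) (cong u (punchIn-dual j k)))
           (comm (u (punchIn j k)) (v j) (v (punchIn j k)) (u j)))
    (det-cong (λ a b → N a (punchIn (punchIn j k) (punchIn (dual j k) b))) (λ a b → N a (punchIn j (punchIn k b)))
              (λ a b → cong (N a) (punchIn-punchIn-dual j k b)))
    where
    comm : ∀ a b c d → a * b + c * d ≡ d * c + b * a
    comm = solve 4 (λ a b c d → a :* b :+ c :* d := d :* c :+ b :* a) refl
  regroup : ∀ s r a b c d m → s * a * (r * b * m) + s * c * (r * d * m) ≡ s * r * ((a * b + c * d) * m)
  regroup = solve 7 (λ s r a b c d m → s :* a :* (r :* b :* m) :+ s :* c :* (r :* d :* m) := s :* r :* ((a :* b :+ c :* d) :* m)) refl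

det-equal₀₁ : ∀ {n} (u : Fin (suc (suc n)) → ℚ) (N : Fin n → Fin (suc (suc n)) → ℚ) → det (u ◂ u ◂ N) ≡ 0ℚ
det-equal₀₁ u N = double≡0 (trans (cong (_+ det (u ◂ u ◂ N)) (det-swap₀₁ u u N)) (ℚP.+-inverseˡ (det (u ◂ u ◂ N))))

-- `det` expands along the first row only. So the first row of N is cleaned by exchanging it with u
-- and using linearity at the top; the rows below are cleaned inside the minors, where the
-- restriction of u is again the first row.
det-rowops : ∀ {n} (u : Fin (suc n) → ℚ) (N : Fin n → Fin (suc n) → ℚ) (c : Fin n → ℚ) →
  det (u ◂ (λ i j → N i j + c i * u j)) ≡ det (u ◂ N)
det-rowops {zero}  u N c = det-cong (u ◂ (λ i j → N i j + c i * u j)) (u ◂ N) λ { zero j → refl }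
det-rowops {suc n} u N c = begin
  det (u ◂ N')                                 ≡⟨ det-cong (u ◂ N') (u ◂ r ◂ R') (λ { zero j → refl ; (suc zero) j → refl ; (suc (suc i)) j → refl }) ⟩
  det (u ◂ r ◂ R')                             ≡⟨ det-swap₀₁ u r R' ⟩
  - det (r ◂ u ◂ R')                           ≡⟨ cong -_ (det-linear₀ (N zero) u (c zero) (u ◂ R')) ⟩
  - (det (N zero ◂ u ◂ R') + c zero * det (u ◂ u ◂ R'))
    ≡⟨ cong (λ w → - (det (N zero ◂ u ◂ R') + c zero * w)) (det-equal₀₁ u R') ⟩
  - (det (N zero ◂ u ◂ R') + c zero * 0ℚ)      ≡⟨ drop (det (N zero ◂ u ◂ R')) (c zero) ⟩
  - det (N zero ◂ u ◂ R')                      ≡⟨ cong -_ (sumF-cong λ j → cong (sgn (toℕ j) * N zero j *_) (minor j)) ⟩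
  - det (N zero ◂ u ◂ R)                       ≡⟨ sym (det-swap₀₁ u (N zero) R) ⟩
  det (u ◂ N zero ◂ R)                         ≡⟨ det-cong (u ◂ N zero ◂ R) (u ◂ N) (λ { zero j → refl ; (suc zero) j → refl ; (suc (suc i)) j → refl }) ⟩
  det (u ◂ N)                                  ∎
  where
  open ≡-Reasoning
  N' : Fin (suc n) → Fin (suc (suc n)) → ℚ
  N' i j = N i j + c i * u j
  r : Fin (suc (suc n)) → ℚ
  r j = N zero j + c zero * u j
  R R' : Fin n → Fin (suc (suc n)) → ℚ
  R i = N (suc i)
  R' i = N' (suc i)
  drop : ∀ a b → - (a + b * 0ℚ) ≡ - a
  drop = solve 2 (λ a b → :- (a :+ b :* :0) := :- a) refl
  minor : ∀ j → det (λ a b → (u ◂ R') a (punchIn j b)) ≡ det (λ a b → (u ◂ R) a (punchIn j b))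
  minor j = begin
    det (λ a b → (u ◂ R') a (punchIn j b))
      ≡⟨ det-cong (λ a b → (u ◂ R') a (punchIn j b))
                  ((λ b → u (punchIn j b)) ◂ (λ a b → R a (punchIn j b) + c (suc a) * u (punchIn j b)))
                  (λ { zero b → refl ; (suc a) b → refl }) ⟩
    det ((λ b → u (punchIn j b)) ◂ (λ a b → R a (punchIn j b) + c (suc a) * u (punchIn j b)))
      ≡⟨ det-rowops (λ b → u (punchIn j b)) (λ a b → R a (punchIn j b)) (λ a → c (suc a)) ⟩
    det ((λ b → u (punchIn j b)) ◂ (λ a b → R a (punchIn j b)))
      ≡⟨ det-cong ((λ b → u (punchIn j b)) ◂ (λ a b → R a (punchIn j b))) (λ a b → (u ◂ R) a (punchIn j b))
                  (λ { zero b → refl ; (suc a) b → refl }) ⟩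
    det (λ a b → (u ◂ R) a (punchIn j b)) ∎

det-zero-column : ∀ {n} (M : Mat (suc n)) → (∀ i → M i zero ≡ 0ℚ) → det M ≡ 0ℚ
det-zero-column {n} M z = sumF-0 term
  where
  term : ∀ j → sgn (toℕ j) * M zero j * det (λ a b → M (suc a) (punchIn j b)) ≡ 0ℚ
  term zero = trans (cong (λ w → sgn 0 * w * det (λ a b → M (suc a) (suc b))) (z zero)) (lem (sgn 0) (det (λ a b → M (suc a) (suc b))))
    where
    lem : ∀ a b → a * 0ℚ * b ≡ 0ℚ
    lem = solve 2 (λ a b → a :* :0 :* b := :0) refl
  term (suc {suc n} j) = trans (cong (sgn (toℕ (suc j)) * M zero (suc j) *_)
                                     (det-zero-column (λ a b → M (suc a) (punchIn (suc j) b)) (λ a → z (suc a))))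
                               (ℚP.*-zeroʳ (sgn (toℕ (suc j)) * M zero (suc j)))

-- Pivot elimination and the Desnanot-Jacobi identity

-- The multipliers c enter through the equations they satisfy, so no division occurs; after the row
-- operations only the pivot survives in the first column. In this form the same c, restricted to
-- the relevant rows, serves every minor that contains the pivot.
schur : ∀ {n} (M : Mat (suc n)) (c : Fin n → ℚ) → (∀ i → M (suc i) zero + c i * M zero zero ≡ 0ℚ) →
  det M ≡ M zero zero * det (λ i j → M (suc i) (suc j) + c i * M zero (suc j))
schur {n} M c hc = begin
  det M                                        ≡⟨ det-cong M (M zero ◂ (λ i → M (suc i))) (λ { zero j → refl ; (suc i) j → refl }) ⟩
  det (M zero ◂ (λ i → M (suc i)))             ≡⟨ sym (det-rowops (M zero) (λ i → M (suc i)) c) ⟩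
  det (M zero ◂ N)                             ≡⟨ cong (sgn 0 * M zero zero * det (λ i j → N i (suc j)) +_) (sumF-0 rest) ⟩
  sgn 0 * M zero zero * det (λ i j → N i (suc j)) + 0ℚ  ≡⟨ lem (M zero zero) (det (λ i j → N i (suc j))) ⟩
  M zero zero * det (λ i j → N i (suc j))      ∎
  where
  open ≡-Reasoning
  N : Fin n → Fin (suc n) → ℚ
  N i j = M (suc i) j + c i * M zero j
  rest : ∀ j → sgn (toℕ (suc j)) * M zero (suc j) * det (λ a b → N a (punchIn (suc j) b)) ≡ 0ℚ
  rest j = trans (cong (sgn (toℕ (suc j)) * M zero (suc j) *_) (minor-0 j N hc)) (ℚP.*-zeroʳ (sgn (toℕ (suc j)) * M zero (suc j)))
    where
    minor-0 : ∀ {n} (j : Fin n) (N : Fin n → Fin (suc n) → ℚ) → (∀ i → N i zero ≡ 0ℚ) →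
      det (λ a b → N a (punchIn (suc j) b)) ≡ 0ℚ
    minor-0 {suc n} j N z = det-zero-column (λ a b → N a (punchIn (suc j) b)) z
  lem : ∀ a b → 1ℚ * a * b + 0ℚ ≡ a * b
  lem = solve 2 (λ a b → :1 :* a :* b :+ :0 := a :* b) refl

-- Rows and columns are listed with the common block first and the two bordering indices last.
keep : ∀ k → Fin 2 → Fin (suc k) → Fin (suc (suc k))
keep zero    e zero    = e
keep (suc k) e zero    = zero
keep (suc k) e (suc i) = suc (keep k e i)

common : ∀ k → Fin k → Fin (suc (suc k))
common (suc k) zero    = zero
common (suc k) (suc i) = suc (common k i)

set₀₀ : ∀ {n} → ℚ → Mat (suc n) → Mat (suc n)
set₀₀ s M zero    zero    = s
set₀₀ s M zero    (suc j) = M zero (suc j)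
set₀₀ s M (suc i) j       = M (suc i) j

det-affine₀₀ : ∀ {n} (M : Mat (suc n)) → Σ ℚ λ A → Σ ℚ λ B → ∀ s → det (set₀₀ s M) ≡ s * A + B
det-affine₀₀ M = det (λ a b → M (suc a) (suc b)) , _ , λ s → cong (_+ _) (lem s (det (λ a b → M (suc a) (suc b))))
  where
  lem : ∀ s m → 1ℚ * s * m ≡ s * m
  lem = solve 2 (λ s m → :1 :* s :* m := s :* m) refl

-- All six determinants contain the entry M₀₀ once the common block is nonempty. If it is nonzero,
-- eliminating it from all of them at once leaves the identity for a common block smaller by one,
-- multiplied by the square of the pivot. If it is zero, it is replaced by a variable s: each
-- determinant is affine in s, so the difference of both sides is quadratic in s and known to vanish
-- at all s ≠ 0.
dodgson : ∀ k (M : Mat (suc (suc k))) →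
  det M * det (λ i j → M (common k i) (common k j))
    ≡ det (λ i j → M (keep k zero i) (keep k zero j)) * det (λ i j → M (keep k (suc zero) i) (keep k (suc zero) j))
      - det (λ i j → M (keep k zero i) (keep k (suc zero) j)) * det (λ i j → M (keep k (suc zero) i) (keep k zero j))
dodgson zero M = lem (M zero zero) (M zero (suc zero)) (M (suc zero) zero) (M (suc zero) (suc zero))
  where
  lem : ∀ a b c d →
    (1ℚ * a * (1ℚ * d * 1ℚ + 0ℚ) + ((- 1ℚ * 1ℚ) * b * (1ℚ * c * 1ℚ + 0ℚ) + 0ℚ)) * 1ℚ
      ≡ (1ℚ * a * 1ℚ + 0ℚ) * (1ℚ * d * 1ℚ + 0ℚ) - (1ℚ * b * 1ℚ + 0ℚ) * (1ℚ * c * 1ℚ + 0ℚ)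
  lem = solve 4 (λ a b c d → (:1 :* a :* (:1 :* d :* :1 :+ :0) :+ ((:- :1 :* :1) :* b :* (:1 :* c :* :1 :+ :0) :+ :0)) :* :1 := (:1 :* a :* :1 :+ :0) :* (:1 :* d :* :1 :+ :0) :- (:1 :* b :* :1 :+ :0) :* (:1 :* c :* :1 :+ :0)) refl
dodgson (suc k) M = body
  where
  open ≡-Reasoning
  D : Fin 2 → Fin 2 → Mat (suc (suc (suc k))) → ℚ
  D e f N = det (λ i j → N (keep (suc k) e i) (keep (suc k) f j))
  D₂ D₀ : Mat (suc (suc (suc k))) → ℚ
  D₂ N = det N
  D₀ N = det (λ i j → N (common (suc k) i) (common (suc k) j))
  pivot : ∀ s → s ≢ 0ℚ → (N : Mat (suc (suc (suc k)))) → N zero zero ≡ s →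
    D₂ N * D₀ N ≡ D zero zero N * D (suc zero) (suc zero) N - D zero (suc zero) N * D (suc zero) zero N
  pivot s s≢0 N refl = begin
    D₂ N * D₀ N
      ≡⟨ cong₂ _*_ (schur N c hc) (schur (λ i j → N (common (suc k) i) (common (suc k) j)) (λ i → c (common k i)) (λ i → hc (common k i))) ⟩
    s * det N' * (s * d₀)
      ≡⟨ sq s (det N') d₀ ⟩
    s * s * (det N' * d₀)
      ≡⟨ cong (s * s *_) (dodgson k N') ⟩
    s * s * (d zero zero * d (suc zero) (suc zero) - d zero (suc zero) * d (suc zero) zero)
      ≡⟨ sq' s (d zero zero) (d (suc zero) (suc zero)) (d zero (suc zero)) (d (suc zero) zero) ⟩
    (s * d zero zero) * (s * d (suc zero) (suc zero)) - (s * d zero (suc zero)) * (s * d (suc zero) zero)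
      ≡⟨ sym (cong₂ _-_ (cong₂ _*_ (red zero zero) (red (suc zero) (suc zero))) (cong₂ _*_ (red zero (suc zero)) (red (suc zero) zero))) ⟩
    D zero zero N * D (suc zero) (suc zero) N - D zero (suc zero) N * D (suc zero) zero N ∎
    where
    s' = proj₁ (inv s s≢0)
    c : Fin (suc (suc k)) → ℚ
    c i = - (N (suc i) zero * s')
    hc : ∀ i → N (suc i) zero + c i * s ≡ 0ℚ
    hc i = trans (l (N (suc i) zero) s s') (trans (cong (λ w → N (suc i) zero * (1ℚ - w)) (proj₂ (inv s s≢0))) (z (N (suc i) zero)))
      where
      l : ∀ a s s' → a + (- (a * s')) * s ≡ a * (1ℚ - s * s')
      l = solve 3 (λ a s s' → a :+ (:- (a :* s')) :* s := a :* (:1 :- s :* s')) refl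
      z : ∀ a → a * (1ℚ - 1ℚ) ≡ 0ℚ
      z = solve 1 (λ a → a :* (:1 :- :1) := :0) refl
    N' : Mat (suc (suc k))
    N' i j = N (suc i) (suc j) + c i * N zero (suc j)
    d₀ = det (λ i j → N' (common k i) (common k j))
    d : Fin 2 → Fin 2 → ℚ
    d e f = det (λ i j → N' (keep k e i) (keep k f j))
    red : ∀ e f → D e f N ≡ s * d e f
    red e f = schur (λ i j → N (keep (suc k) e i) (keep (suc k) f j)) (λ i → c (keep k e i)) (λ i → hc (keep k e i))
    sq : ∀ s a b → s * a * (s * b) ≡ s * s * (a * b)
    sq = solve 3 (λ s a b → s :* a :* (s :* b) := s :* s :* (a :* b)) refl
    sq' : ∀ s a b c d → s * s * (a * b - c * d) ≡ (s * a) * (s * b) - (s * c) * (s * d)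
    sq' = solve 5 (λ s a b c d → s :* s :* (a :* b :- c :* d) := (s :* a) :* (s :* b) :- (s :* c) :* (s :* d)) refl
  Aff : (Mat (suc (suc (suc k))) → ℚ) → Set
  Aff f = Σ ℚ λ A → Σ ℚ λ B → ∀ s → f (set₀₀ s M) ≡ s * A + B
  aff₀ : Aff D₀
  aff₀ = proj₁ ab , proj₁ (proj₂ ab) , λ s → trans (det-cong (λ i j → set₀₀ s M (common (suc k) i) (common (suc k) j)) (set₀₀ s (λ i j → M (common (suc k) i) (common (suc k) j)))
                 (λ { zero zero → refl ; zero (suc j) → refl ; (suc i) j → refl })) (proj₂ (proj₂ ab) s)
    where
    ab = det-affine₀₀ (λ i j → M (common (suc k) i) (common (suc k) j))
  aff : ∀ e f → Aff (D e f)
  aff e f = proj₁ ab , proj₁ (proj₂ ab) , λ s → trans (det-cong (λ i j → set₀₀ s M (keep (suc k) e i) (keep (suc k) f j)) (set₀₀ s (λ i j → M (keep (suc k) e i) (keep (suc k) f j)))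
                 (λ { zero zero → refl ; zero (suc j) → refl ; (suc i) j → refl })) (proj₂ (proj₂ ab) s)
    where
    ab = det-affine₀₀ (λ i j → M (keep (suc k) e i) (keep (suc k) f j))
  restore : ∀ i j → M i j ≡ set₀₀ (M zero zero) M i j
  restore zero    zero    = refl
  restore zero    (suc j) = refl
  restore (suc i) j       = refl
  -- A quadratic polynomial in the entry M₀₀ that vanishes at 1, -1 and 2 vanishes at 0.
  degenerate : (aff₂ : Aff D₂) (a₀ : Aff D₀) (a₁ : Aff (D zero zero)) (a₂ : Aff (D (suc zero) (suc zero)))
    (a₃ : Aff (D zero (suc zero))) (a₄ : Aff (D (suc zero) zero)) →
    D₂ (set₀₀ 0ℚ M) * D₀ (set₀₀ 0ℚ M) ≡ D zero zero (set₀₀ 0ℚ M) * D (suc zero) (suc zero) (set₀₀ 0ℚ M) - D zero (suc zero) (set₀₀ 0ℚ M) * D (suc zero) zero (set₀₀ 0ℚ M)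
  degenerate (A₂ , B₂ , e₂) (A₀ , B₀ , e₀) (A₁ , B₁ , e₁) (A₃ , B₃ , e₃) (A₄ , B₄ , e₄) (A₅ , B₅ , e₅) =
    -≡0 (trans (at 0ℚ) vanish)
    where
    q : ℚ → ℚ
    q s = (s * A₂ + B₂) * (s * A₀ + B₀) - ((s * A₁ + B₁) * (s * A₃ + B₃) - (s * A₄ + B₄) * (s * A₅ + B₅))
    diff : ℚ → ℚ
    diff s = D₂ (set₀₀ s M) * D₀ (set₀₀ s M) - (D zero zero (set₀₀ s M) * D (suc zero) (suc zero) (set₀₀ s M) - D zero (suc zero) (set₀₀ s M) * D (suc zero) zero (set₀₀ s M))
    at : ∀ s → diff s ≡ q s
    at s = cong₂ _-_ (cong₂ _*_ (e₂ s) (e₀ s)) (cong₂ _-_ (cong₂ _*_ (e₁ s) (e₃ s)) (cong₂ _*_ (e₄ s) (e₅ s)))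
    val : ∀ s → s ≢ 0ℚ → q s ≡ 0ℚ
    val s s≢0 = trans (sym (at s)) (≡-⇒0 (pivot s s≢0 (set₀₀ s M) refl))
    product : ∀ s A B A' B' → (s * A + B) * (s * A' + B') ≡ s * s * (A * A') + (s * (A * B' + B * A') + B * B')
    product = solve 5 (λ s A B A' B' → (s :* A :+ B) :* (s :* A' :+ B') := s :* s :* (A :* A') :+ (s :* (A :* B' :+ B :* A') :+ B :* B')) refl
    gather : ∀ s p₁ q₁ r₁ p₂ q₂ r₂ p₃ q₃ r₃ →
      s * s * p₁ + (s * q₁ + r₁) - (s * s * p₂ + (s * q₂ + r₂) - (s * s * p₃ + (s * q₃ + r₃)))
        ≡ s * s * (p₁ - (p₂ - p₃)) + (s * (q₁ - (q₂ - q₃)) + (r₁ - (r₂ - r₃)))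
    gather = solve 10 (λ s p₁ q₁ r₁ p₂ q₂ r₂ p₃ q₃ r₃ → s :* s :* p₁ :+ (s :* q₁ :+ r₁) :- (s :* s :* p₂ :+ (s :* q₂ :+ r₂) :- (s :* s :* p₃ :+ (s :* q₃ :+ r₃))) := s :* s :* (p₁ :- (p₂ :- p₃)) :+ (s :* (q₁ :- (q₂ :- q₃)) :+ (r₁ :- (r₂ :- r₃)))) refl
    quadratic : Σ ℚ λ p → Σ ℚ λ b → Σ ℚ λ r → ∀ s → q s ≡ s * s * p + (s * b + r)
    quadratic = _ , _ , _ , λ s → trans (cong₂ _-_ (product s A₂ B₂ A₀ B₀) (cong₂ _-_ (product s A₁ B₁ A₃ B₃) (product s A₄ B₄ A₅ B₅)))
      (gather s (A₂ * A₀) (A₂ * B₀ + B₂ * A₀) (B₂ * B₀) (A₁ * A₃) (A₁ * B₃ + B₁ * A₃) (B₁ * B₃) (A₄ * A₅) (A₄ * B₅ + B₄ * A₅) (B₄ * B₅))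
    interpolate : ∀ p b r →
      ℕ→ℚ 3 * (0ℚ * 0ℚ * p + (0ℚ * b + r))
        ≡ ℕ→ℚ 3 * (1ℚ * 1ℚ * p + (1ℚ * b + r))
          + ((- 1ℚ * - 1ℚ * p + (- 1ℚ * b + r)) - (two * two * p + (two * b + r)))
    interpolate = solve 3 (λ p b r → :3 :* (:0 :* :0 :* p :+ (:0 :* b :+ r)) := :3 :* (:1 :* :1 :* p :+ (:1 :* b :+ r)) :+ ((:- :1 :* :- :1 :* p :+ (:- :1 :* b :+ r)) :- (:2 :* :2 :* p :+ (:2 :* b :+ r)))) refl
    vanish : q 0ℚ ≡ 0ℚ
    vanish = go quadratic
      where
      go : (Σ ℚ λ p → Σ ℚ λ b → Σ ℚ λ r → ∀ s → q s ≡ s * s * p + (s * b + r)) → q 0ℚ ≡ 0ℚ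
      go (p , b , r , eq) = trans (eq 0ℚ) (*-zero-split (ℕ→ℚ 3) (λ ()) (trans (interpolate p b r)
        (trans (cong₂ (λ v w → ℕ→ℚ 3 * v + w) (at₁ 1ℚ (λ ())) (cong₂ (λ v w → v - w) (at₁ (- 1ℚ) (λ ())) (at₁ two (λ ())))) refl)))
        where
        at₁ : ∀ s → s ≢ 0ℚ → s * s * p + (s * b + r) ≡ 0ℚ
        at₁ s s≢0 = trans (sym (eq s)) (val s s≢0)
  body : D₂ M * D₀ M ≡ D zero zero M * D (suc zero) (suc zero) M - D zero (suc zero) M * D (suc zero) zero M
  body = go (M zero zero ≟ 0ℚ)
    where
    go : Dec (M zero zero ≡ 0ℚ) → D₂ M * D₀ M ≡ D zero zero M * D (suc zero) (suc zero) M - D zero (suc zero) M * D (suc zero) zero M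
    go (no  M≢0) = pivot (M zero zero) M≢0 M refl
    go (yes M≡0) = trans (sym (cong₂ _*_ (det-cong (set₀₀ 0ℚ M) M same) on₀))
      (trans (degenerate (det-affine₀₀ M) aff₀ (aff zero zero) (aff (suc zero) (suc zero)) (aff zero (suc zero)) (aff (suc zero) zero))
             (cong₂ _-_ (cong₂ _*_ (on zero zero) (on (suc zero) (suc zero))) (cong₂ _*_ (on zero (suc zero)) (on (suc zero) zero))))
      where
      same : ∀ i j → set₀₀ 0ℚ M i j ≡ M i j
      same i j = trans (cong (λ w → set₀₀ w M i j) (sym M≡0)) (sym (restore i j))
      on₀ : D₀ (set₀₀ 0ℚ M) ≡ D₀ M
      on₀ = det-cong (λ i j → set₀₀ 0ℚ M (common (suc k) i) (common (suc k) j)) (λ i j → M (common (suc k) i) (common (suc k) j)) (λ i j → same (common (suc k) i) (common (suc k) j))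
      on : ∀ e f → D e f (set₀₀ 0ℚ M) ≡ D e f M
      on e f = det-cong (λ i j → set₀₀ 0ℚ M (keep (suc k) e i) (keep (suc k) f j)) (λ i j → M (keep (suc k) e i) (keep (suc k) f j)) (λ i j → same (keep (suc k) e i) (keep (suc k) f j))

-- Adjacent transpositions, row and column scaling, Cauchy's determinant

adj : ∀ {n} → Fin n → Fin (suc n) → Fin (suc n)
adj {suc n} zero    zero          = suc zero
adj {suc n} zero    (suc zero)    = zero
adj {suc n} zero    (suc (suc i)) = suc (suc i)
adj {suc n} (suc p) zero          = zero
adj {suc n} (suc p) (suc i)       = suc (adj p i)

sumF-neg : ∀ {n} (f : Fin n → ℚ) → sumF (λ i → - f i) ≡ - sumF f
sumF-neg f = trans (sumF-cong (λ i → lem (f i))) (trans (sumF-* (- 1ℚ) f) (sym (lem (sumF f))))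
  where
  lem : ∀ a → - a ≡ - 1ℚ * a
  lem = solve 1 (λ a → :- a := :- :1 :* a) refl

det-adj : ∀ {n} (r : Mat (suc n)) (p : Fin n) → det (λ i → r (adj p i)) ≡ - det r
det-adj {suc n} r zero = begin
  det (λ i → r (adj zero i))      ≡⟨ det-cong (λ i → r (adj zero i)) (r₁ ◂ r₀ ◂ N) (λ { zero j → refl ; (suc zero) j → refl ; (suc (suc i)) j → refl }) ⟩
  det (r₁ ◂ r₀ ◂ N)               ≡⟨ det-swap₀₁ r₁ r₀ N ⟩
  - det (r₀ ◂ r₁ ◂ N)             ≡⟨ cong -_ (det-cong (r₀ ◂ r₁ ◂ N) r (λ { zero j → refl ; (suc zero) j → refl ; (suc (suc i)) j → refl })) ⟩
  - det r                         ∎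
  where
  open ≡-Reasoning
  r₀ r₁ : Fin (suc (suc n)) → ℚ
  r₀ = r zero
  r₁ = r (suc zero)
  N : Fin n → Fin (suc (suc n)) → ℚ
  N i = r (suc (suc i))
det-adj {suc n} r (suc p) = trans
  (sumF-cong (λ j → trans (cong (sgn (toℕ j) * r zero j *_) (det-adj (λ a b → r (suc a) (punchIn j b)) p))
                          (lem (sgn (toℕ j) * r zero j) (det (λ a b → r (suc a) (punchIn j b))))))
  (sumF-neg (λ j → sgn (toℕ j) * r zero j * det (λ a b → r (suc a) (punchIn j b))))
  where
  lem : ∀ a b → a * - b ≡ - (a * b)
  lem = solve 2 (λ a b → a :* :- b := :- (a :* b)) refl

prodF-adj : ∀ {n} (f : Fin (suc n) → ℚ) (p : Fin n) → prodF (λ i → f (adj p i)) ≡ prodF f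
prodF-adj {suc n} f zero = lem (f (suc zero)) (f zero) (prodF (λ i → f (suc (suc i))))
  where
  lem : ∀ a b c → a * (b * c) ≡ b * (a * c)
  lem = solve 3 (λ a b c → a :* (b :* c) := b :* (a :* c)) refl
prodF-adj {suc n} f (suc p) = cong (f zero *_) (prodF-adj (λ i → f (suc i)) p)

vdm : ∀ {n} → (Fin n → ℚ) → ℚ
vdm x = prodLt (λ i j → x j - x i)

vdm-adj : ∀ {n} (x : Fin (suc n) → ℚ) (p : Fin n) → vdm (λ i → x (adj p i)) ≡ - vdm x
vdm-adj {suc n} x zero = lem (x zero) (x (suc zero)) (prodF (λ j → x (suc (suc j)) - x (suc zero))) (prodF (λ j → x (suc (suc j)) - x zero)) (vdm (λ i → x (suc (suc i))))
  where
  lem : ∀ a b c d e → (a - b) * c * (d * e) ≡ - ((b - a) * d * (c * e))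
  lem = solve 5 (λ a b c d e → (a :- b) :* c :* (d :* e) := :- ((b :- a) :* d :* (c :* e))) refl
vdm-adj {suc n} x (suc p) = trans
  (cong₂ _*_ (prodF-adj (λ j → x (suc j) - x zero) p) (vdm-adj (λ i → x (suc i)) p))
  (lem (prodF (λ j → x (suc j) - x zero)) (vdm (λ i → x (suc i))))
  where
  lem : ∀ a b → a * - b ≡ - (a * b)
  lem = solve 2 (λ a b → a :* :- b := :- (a :* b)) refl

det-scale : ∀ {n} (l r : Fin n → ℚ) (M : Mat n) → det (λ i j → l i * r j * M i j) ≡ prodF l * prodF r * det M
det-scale {zero}  l r M = refl
det-scale {suc n} l r M = begin
  sumF (λ j → sgn (toℕ j) * (l zero * r j * M zero j) * det (λ a b → l (suc a) * r (punchIn j b) * M (suc a) (punchIn j b)))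
    ≡⟨ sumF-cong term ⟩
  sumF (λ j → prodF l * prodF r * (sgn (toℕ j) * M zero j * m j))
    ≡⟨ sumF-* (prodF l * prodF r) (λ j → sgn (toℕ j) * M zero j * m j) ⟩
  prodF l * prodF r * det M ∎
  where
  open ≡-Reasoning
  m : Fin (suc n) → ℚ
  m j = det (λ a b → M (suc a) (punchIn j b))
  lem : ∀ s a b c d e f → s * (a * b * c) * (d * e * f) ≡ a * d * (b * e) * (s * c * f)
  lem = solve 7 (λ s a b c d e f → s :* (a :* b :* c) :* (d :* e :* f) := a :* d :* (b :* e) :* (s :* c :* f)) refl
  term : ∀ j → sgn (toℕ j) * (l zero * r j * M zero j) * det (λ a b → l (suc a) * r (punchIn j b) * M (suc a) (punchIn j b))
             ≡ prodF l * prodF r * (sgn (toℕ j) * M zero j * m j)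
  term j = trans
    (cong (sgn (toℕ j) * (l zero * r j * M zero j) *_) (det-scale (λ a → l (suc a)) (λ b → r (punchIn j b)) (λ a b → M (suc a) (punchIn j b))))
    (trans (lem (sgn (toℕ j)) (l zero) (r j) (M zero j) (prodF (λ a → l (suc a))) (prodF (λ b → r (punchIn j b))) (m j))
           (cong (λ w → prodF l * w * (sgn (toℕ j) * M zero j * m j)) (sym (prodF-punchIn r j))))

prodF-1 : ∀ {n} {f : Fin n → ℚ} → (∀ i → f i ≡ 1ℚ) → prodF f ≡ 1ℚ
prodF-1 {zero}  eq = refl
prodF-1 {suc n} eq = cong₂ _*_ (eq zero) (prodF-1 (λ i → eq (suc i)))

-- The homogeneous form with denominators p_j + q_j α_i covers the quadratic p that occurs near ζ =
-- 0. The Schur complement of a Cauchy matrix is again that matrix without its first row and column,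
-- with rows scaled by α_i - α_0 and columns by q_0 p_j - p_0 q_j, apart from entries of C. The
-- entries of C are given as inverses, so all denominators are nonzero.
cauchy : ∀ {n} (p q α : Fin n → ℚ) (C : Mat n) → (∀ i j → C i j * (p j + q j * α i) ≡ 1ℚ) →
  det C * prodF (λ i → prodF (λ j → p j + q j * α i)) ≡ vdm α * prodLt (λ i j → q i * p j - p i * q j)
cauchy {zero}  p q α C hC = refl
cauchy {suc n} p q α C hC = begin
  det C * (w zero zero * W₀ * prodF (λ i → w (suc i) zero * prodF (λ j → w (suc i) (suc j))))
    ≡⟨ cong₂ _*_ (trans (schur C c hc) (cong (C zero zero *_) (trans (det-cong C″ (λ i j → l i * r j * C' i j) entry) (det-scale l r C'))))
                 (cong (w zero zero * W₀ *_) (prodF-* (λ i → w (suc i) zero) (λ i → prodF (λ j → w (suc i) (suc j))))) ⟩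
  C zero zero * (prodF l * prodF r * det C') * (w zero zero * W₀ * (W₁ * W'))
    ≡⟨ cong₂ (λ a b → C zero zero * (a * b * det C') * (w zero zero * W₀ * (W₁ * W')))
             (prodF-* (λ i → C (suc i) zero) (λ i → α (suc i) - α zero)) (prodF-* (λ j → C zero (suc j)) (λ j → q zero * p (suc j) - p zero * q (suc j))) ⟩
  C zero zero * (C₁ * A * (C₀ * Q) * det C') * (w zero zero * W₀ * (W₁ * W'))
    ≡⟨ shuffle (C zero zero) C₁ A C₀ Q (det C') (w zero zero) W₀ W₁ W' ⟩
  (C zero zero * w zero zero) * (C₀ * W₀) * (C₁ * W₁) * (A * Q * (det C' * W'))
    ≡⟨ cong₂ _*_ (cong₂ _*_ (cong₂ _*_ (hC zero zero) (pair (λ j → C zero (suc j)) (λ j → w zero (suc j)) (λ j → hC zero (suc j))))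
                            (pair (λ i → C (suc i) zero) (λ i → w (suc i) zero) (λ i → hC (suc i) zero)))
                 (cong (A * Q *_) (cauchy (λ j → p (suc j)) (λ j → q (suc j)) (λ i → α (suc i)) C' (λ i j → hC (suc i) (suc j)))) ⟩
  1ℚ * 1ℚ * 1ℚ * (A * Q * (V * P))
    ≡⟨ collect A Q V P ⟩
  A * V * (Q * P) ∎
  where
  open ≡-Reasoning
  w : Mat (suc n)
  w i j = p j + q j * α i
  W₀ W₁ W' C₀ C₁ A Q V P : ℚ
  W₀ = prodF (λ j → w zero (suc j))
  W₁ = prodF (λ i → w (suc i) zero)
  W' = prodF (λ i → prodF (λ j → w (suc i) (suc j)))
  C₀ = prodF (λ j → C zero (suc j))
  C₁ = prodF (λ i → C (suc i) zero)
  A = prodF (λ i → α (suc i) - α zero)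
  Q = prodF (λ j → q zero * p (suc j) - p zero * q (suc j))
  V = vdm (λ i → α (suc i))
  P = prodLt (λ i j → q (suc i) * p (suc j) - p (suc i) * q (suc j))
  C' C″ : Mat n
  C' i j = C (suc i) (suc j)
  c l r : Fin n → ℚ
  c i = - (C (suc i) zero * w zero zero)
  l i = C (suc i) zero * (α (suc i) - α zero)
  r j = C zero (suc j) * (q zero * p (suc j) - p zero * q (suc j))
  C″ i j = C (suc i) (suc j) + c i * C zero (suc j)
  hc : ∀ i → C (suc i) zero + c i * C zero zero ≡ 0ℚ
  hc i = trans (f (C (suc i) zero) (w zero zero) (C zero zero)) (trans (cong (λ u → C (suc i) zero * (1ℚ - u)) (hC zero zero)) (z (C (suc i) zero)))
    where
    f : ∀ a b c → a + (- (a * b)) * c ≡ a * (1ℚ - c * b)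
    f = solve 3 (λ a b c → a :+ (:- (a :* b)) :* c := a :* (:1 :- c :* b)) refl
    z : ∀ a → a * (1ℚ - 1ℚ) ≡ 0ℚ
    z = solve 1 (λ a → a :* (:1 :- :1) := :0) refl
  entry : ∀ i j → C″ i j ≡ l i * r j * C' i j
  entry i j = begin
    -- The three units inserted below are C times its denominators; with them the difference of two
    -- products factors as a polynomial identity.
    c₁₁ + (- (c₁₀ * w zero zero)) * c₀₁
      ≡⟨ e₁ c₁₁ c₁₀ (w zero zero) c₀₁ ⟩
    1ℚ * 1ℚ * c₁₁ - 1ℚ * (c₁₀ * w zero zero * c₀₁)
      ≡⟨ sym (cong₂ (λ u v → u - v) (cong₂ (λ u v → u * v * c₁₁) (hC (suc i) zero) (hC zero (suc j))) (cong (_* (c₁₀ * w zero zero * c₀₁)) (hC (suc i) (suc j)))) ⟩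
    (c₁₀ * (p zero + q zero * α (suc i))) * (c₀₁ * (p (suc j) + q (suc j) * α zero)) * c₁₁ - (c₁₁ * (p (suc j) + q (suc j) * α (suc i))) * (c₁₀ * (p zero + q zero * α zero) * c₀₁)
      ≡⟨ e₂ c₁₁ c₁₀ c₀₁ (p zero) (q zero) (α zero) (p (suc j)) (q (suc j)) (α (suc i)) ⟩
    l i * r j * C' i j ∎
    where
    c₁₁ = C (suc i) (suc j)
    c₁₀ = C (suc i) zero
    c₀₁ = C zero (suc j)
    e₁ : ∀ a b c d → a + (- (b * c)) * d ≡ 1ℚ * 1ℚ * a - 1ℚ * (b * c * d)
    e₁ = solve 4 (λ a b c d → a :+ (:- (b :* c)) :* d := :1 :* :1 :* a :- :1 :* (b :* c :* d)) refl
    e₂ : ∀ c₁₁ c₁₀ c₀₁ p₀ q₀ α₀ p₁ q₁ α₁ →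
      (c₁₀ * (p₀ + q₀ * α₁)) * (c₀₁ * (p₁ + q₁ * α₀)) * c₁₁ - (c₁₁ * (p₁ + q₁ * α₁)) * (c₁₀ * (p₀ + q₀ * α₀) * c₀₁)
        ≡ c₁₀ * (α₁ - α₀) * (c₀₁ * (q₀ * p₁ - p₀ * q₁)) * c₁₁
    e₂ = solve 9 (λ c₁₁ c₁₀ c₀₁ p₀ q₀ α₀ p₁ q₁ α₁ → (c₁₀ :* (p₀ :+ q₀ :* α₁)) :* (c₀₁ :* (p₁ :+ q₁ :* α₀)) :* c₁₁ :- (c₁₁ :* (p₁ :+ q₁ :* α₁)) :* (c₁₀ :* (p₀ :+ q₀ :* α₀) :* c₀₁) := c₁₀ :* (α₁ :- α₀) :* (c₀₁ :* (q₀ :* p₁ :- p₀ :* q₁)) :* c₁₁) refl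
  pair : ∀ {m} (f g : Fin m → ℚ) → (∀ i → f i * g i ≡ 1ℚ) → prodF f * prodF g ≡ 1ℚ
  pair f g fg = trans (sym (prodF-* f g)) (prodF-1 fg)
  shuffle : ∀ c c₁ a c₀ q d w w₀ w₁ w' → c * (c₁ * a * (c₀ * q) * d) * (w * w₀ * (w₁ * w')) ≡ (c * w) * (c₀ * w₀) * (c₁ * w₁) * (a * q * (d * w'))
  shuffle = solve 10 (λ c c₁ a c₀ q d w w₀ w₁ w' → c :* (c₁ :* a :* (c₀ :* q) :* d) :* (w :* w₀ :* (w₁ :* w')) := (c :* w) :* (c₀ :* w₀) :* (c₁ :* w₁) :* (a :* q :* (d :* w'))) refl
  collect : ∀ a q v p → 1ℚ * 1ℚ * 1ℚ * (a * q * (v * p)) ≡ a * v * (q * p)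
  collect = solve 4 (λ a q v p → :1 :* :1 :* :1 :* (a :* q :* (v :* p)) := a :* v :* (q :* p)) refl

-- Polynomial functions

-- The natural numbers of ℚ, built by repeated addition of one so that their distinctness is an
-- induction. They are the sample points at which polynomials are tested.
ι : ℕ → ℚ
ι zero    = 0ℚ
ι (suc k) = 1ℚ + ι k

0≤ι : ∀ k → 0ℚ ℚ.≤ ι k
0≤ι zero    = ℚP.≤-refl
0≤ι (suc k) = ℚP.≤-trans (0≤ι k) (ℚP.≤-trans (ℚP.≤-reflexive (sym (ℚP.+-identityˡ (ι k)))) (ℚP.+-monoˡ-≤ (ι k) (ℚP.nonNegative⁻¹ 1ℚ)))

ι-suc≢0 : ∀ k → ι (suc k) ≢ 0ℚ
ι-suc≢0 k eq = ℚP.<⇒≢ (ℚP.<-≤-trans (ℚP.positive⁻¹ 1ℚ) (ℚP.≤-trans (ℚP.≤-reflexive (sym (ℚP.+-identityʳ 1ℚ))) (ℚP.+-monoʳ-≤ 1ℚ (0≤ι k)))) (sym eq)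

ι-+ : ∀ m n → ι (m ℕ.+ n) ≡ ι m + ι n
ι-+ zero    n = sym (ℚP.+-identityˡ (ι n))
ι-+ (suc m) n = trans (cong (1ℚ +_) (ι-+ m n)) (sym (ℚP.+-assoc 1ℚ (ι m) (ι n)))

ι-diff≢0 : ∀ m k → ι (suc k ℕ.+ m) - ι m ≢ 0ℚ
ι-diff≢0 m k eq = ι-suc≢0 k (trans (lem (ι (suc k)) (ι m)) (trans (cong (_- ι m) (sym (ι-+ (suc k) m))) eq))
  where
  lem : ∀ a b → a ≡ a + b - b
  lem = solve 2 (λ a b → a := a :+ b :- b) refl

^-+ : ∀ a m n → a ^ (m ℕ.+ n) ≡ a ^ m * a ^ n
^-+ a zero    n = sym (ℚP.*-identityˡ (a ^ n))
^-+ a (suc m) n = trans (cong (a *_) (^-+ a m n)) (sym (ℚP.*-assoc a (a ^ m) (a ^ n)))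

*-^ : ∀ a b n → (a * b) ^ n ≡ a ^ n * b ^ n
*-^ a b zero    = refl
*-^ a b (suc n) = trans (cong (a * b *_) (*-^ a b n)) (lem a b (a ^ n) (b ^ n))
  where
  lem : ∀ a b c d → a * b * (c * d) ≡ a * c * (b * d)
  lem = solve 4 (λ a b c d → a :* b :* (c :* d) := a :* c :* (b :* d)) refl

1-^ : ∀ n → 1ℚ ^ n ≡ 1ℚ
1-^ zero    = refl
1-^ (suc n) = trans (cong (1ℚ *_) (1-^ n)) refl

^-≢0 : ∀ {a} n → a ≢ 0ℚ → a ^ n ≢ 0ℚ
^-≢0 zero    a≢0 = 1≢0
^-≢0 (suc n) a≢0 = *-≢0 a≢0 (^-≢0 n a≢0)

evalP-addP : ∀ p q t → evalP (addP p q) t ≡ evalP p t + evalP q t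
evalP-addP []      q       t = sym (ℚP.+-identityˡ (evalP q t))
evalP-addP (a ∷ p) []      t = sym (ℚP.+-identityʳ (a + t * evalP p t))
evalP-addP (a ∷ p) (b ∷ q) t = trans (cong (λ w → a + b + t * w) (evalP-addP p q t)) (lem a b t (evalP p t) (evalP q t))
  where
  lem : ∀ a b t p q → a + b + t * (p + q) ≡ a + t * p + (b + t * q)
  lem = solve 5 (λ a b t p q → a :+ b :+ t :* (p :+ q) := a :+ t :* p :+ (b :+ t :* q)) refl

evalP-scaleP : ∀ c p t → evalP (scaleP c p) t ≡ c * evalP p t
evalP-scaleP c []      t = sym (ℚP.*-zeroʳ c)
evalP-scaleP c (a ∷ p) t = trans (cong (λ w → c * a + t * w) (evalP-scaleP c p t)) (lem c a t (evalP p t))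
  where
  lem : ∀ c a t p → c * a + t * (c * p) ≡ c * (a + t * p)
  lem = solve 4 (λ c a t p → c :* a :+ t :* (c :* p) := c :* (a :+ t :* p)) refl

evalP-mulP : ∀ p q t → evalP (mulP p q) t ≡ evalP p t * evalP q t
evalP-mulP []      q t = sym (ℚP.*-zeroˡ (evalP q t))
evalP-mulP (a ∷ p) q t = begin
  evalP (addP (scaleP a q) (0ℚ ∷ mulP p q)) t             ≡⟨ evalP-addP (scaleP a q) (0ℚ ∷ mulP p q) t ⟩
  evalP (scaleP a q) t + (0ℚ + t * evalP (mulP p q) t)    ≡⟨ cong₂ (λ v w → v + (0ℚ + t * w)) (evalP-scaleP a q t) (evalP-mulP p q t) ⟩
  a * evalP q t + (0ℚ + t * (evalP p t * evalP q t))      ≡⟨ lem a (evalP q t) t (evalP p t) ⟩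
  (a + t * evalP p t) * evalP q t                         ∎
  where
  open ≡-Reasoning
  lem : ∀ a q t p → a * q + (0ℚ + t * (p * q)) ≡ (a + t * p) * q
  lem = solve 4 (λ a q t p → a :* q :+ (:0 :+ t :* (p :* q)) := (a :+ t :* p) :* q) refl

-- Horner's scheme: the quotient by t - a has the partial values at a as its coefficients.
quotP : ℚ → Poly → Poly
quotP a []           = []
quotP a (c ∷ [])     = []
quotP a (c ∷ d ∷ cs) = evalP (d ∷ cs) a ∷ quotP a (d ∷ cs)

quotP-spec : ∀ a p t → evalP p t ≡ evalP p a + (t - a) * evalP (quotP a p) t
quotP-spec a []           t = lem t a
  where
  lem : ∀ t a → 0ℚ ≡ 0ℚ + (t - a) * 0ℚ
  lem = solve 2 (λ t a → :0 := :0 :+ (t :- a) :* :0) refl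
quotP-spec a (c ∷ [])     t = lem t a c
  where
  lem : ∀ t a c → c + t * 0ℚ ≡ c + a * 0ℚ + (t - a) * 0ℚ
  lem = solve 3 (λ t a c → c :+ t :* :0 := c :+ a :* :0 :+ (t :- a) :* :0) refl
quotP-spec a (c ∷ d ∷ cs) t = trans (cong (λ w → c + t * w) (quotP-spec a (d ∷ cs) t)) (lem t a c (evalP (d ∷ cs) a) (evalP (quotP a (d ∷ cs)) t))
  where
  lem : ∀ t a c p q → c + t * (p + (t - a) * q) ≡ c + a * p + (t - a) * (p + t * q)
  lem = solve 5 (λ t a c p q → c :+ t :* (p :+ (t :- a) :* q) := c :+ a :* p :+ (t :- a) :* (p :+ t :* q)) refl

length-quotP : ∀ a c p → length (quotP a (c ∷ p)) ≡ length p
length-quotP a c []      = refl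
length-quotP a c (d ∷ p) = cong suc (length-quotP a d p)

ZeroFun : Poly → Set
ZeroFun p = ∀ t → evalP p t ≡ 0ℚ

-- A root of the product among ι m, ι (m + 1), … is a root of one factor, which is then divided by the linear factor.
evalP-domain : ∀ n m p q → length p ℕ.+ length q ℕ.≤ n →
  (∀ k → evalP p (ι (k ℕ.+ m)) * evalP q (ι (k ℕ.+ m)) ≡ 0ℚ) → ZeroFun p ⊎ ZeroFun q
evalP-domain n       m []      q       _   h = inj₁ (λ t → refl)
evalP-domain n       m (a ∷ p) []      _   h = inj₂ (λ t → refl)
evalP-domain zero    m (a ∷ p) (b ∷ q) ()  h
evalP-domain (suc n) m (a ∷ p) (b ∷ q) len h = go (evalP (a ∷ p) (ι m) ≟ 0ℚ)
  where
  lift : ∀ c r → evalP (c ∷ r) (ι m) ≡ 0ℚ → ∀ t → evalP (c ∷ r) t ≡ (t - ι m) * evalP (quotP (ι m) (c ∷ r)) t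
  lift c r r0 t = trans (quotP-spec (ι m) (c ∷ r) t) (trans (cong (_+ (t - ι m) * evalP (quotP (ι m) (c ∷ r)) t) r0) (ℚP.+-identityˡ ((t - ι m) * evalP (quotP (ι m) (c ∷ r)) t)))
  zero-lift : ∀ c r → evalP (c ∷ r) (ι m) ≡ 0ℚ → ZeroFun (quotP (ι m) (c ∷ r)) → ZeroFun (c ∷ r)
  zero-lift c r r0 z t = trans (lift c r r0 t) (trans (cong ((t - ι m) *_) (z t)) (ℚP.*-zeroʳ (t - ι m)))
  assoc : ∀ x y z → x * y * z ≡ x * (y * z)
  assoc = solve 3 (λ x y z → x :* y :* z := x :* (y :* z)) refl
  assoc' : ∀ x y z → y * (x * z) ≡ x * (y * z)
  assoc' = solve 3 (λ x y z → y :* (x :* z) := x :* (y :* z)) refl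
  go : Dec (evalP (a ∷ p) (ι m) ≡ 0ℚ) → ZeroFun (a ∷ p) ⊎ ZeroFun (b ∷ q)
  go (yes p0) = step (evalP-domain n (suc m) (quotP (ι m) (a ∷ p)) (b ∷ q)
      (subst (λ l → l ℕ.+ length (b ∷ q) ℕ.≤ n) (sym (length-quotP (ι m) a p)) (ℕP.≤-pred len)) h')
    where
    -- The sample points now start at m + 1, where t - ι m is nonzero, so the vanishing of the
    -- product passes to the quotient.
    h' : ∀ k → evalP (quotP (ι m) (a ∷ p)) (ι (k ℕ.+ suc m)) * evalP (b ∷ q) (ι (k ℕ.+ suc m)) ≡ 0ℚ
    h' k rewrite ℕP.+-suc k m = *-zero-split (ι (suc k ℕ.+ m) - ι m) (ι-diff≢0 m k)
      (trans (sym (assoc (ι (suc k ℕ.+ m) - ι m) (evalP (quotP (ι m) (a ∷ p)) (ι (suc k ℕ.+ m))) (evalP (b ∷ q) (ι (suc k ℕ.+ m)))))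
             (trans (cong (_* evalP (b ∷ q) (ι (suc k ℕ.+ m))) (sym (lift a p p0 (ι (suc k ℕ.+ m))))) (h (suc k))))
    step : ZeroFun (quotP (ι m) (a ∷ p)) ⊎ ZeroFun (b ∷ q) → ZeroFun (a ∷ p) ⊎ ZeroFun (b ∷ q)
    step (inj₁ z) = inj₁ (zero-lift a p p0 z)
    step (inj₂ z) = inj₂ z
  go (no p≢0) = step (evalP-domain n (suc m) (a ∷ p) (quotP (ι m) (b ∷ q))
      (subst (λ l → length (a ∷ p) ℕ.+ l ℕ.≤ n) (sym (length-quotP (ι m) b q)) (ℕP.≤-pred (subst (ℕ._≤ suc n) (ℕP.+-suc (length (a ∷ p)) (length q)) len))) h')
    where
    q0 : evalP (b ∷ q) (ι m) ≡ 0ℚ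
    q0 = *-zero-split (evalP (a ∷ p) (ι m)) p≢0 (h 0)
    h' : ∀ k → evalP (a ∷ p) (ι (k ℕ.+ suc m)) * evalP (quotP (ι m) (b ∷ q)) (ι (k ℕ.+ suc m)) ≡ 0ℚ
    h' k rewrite ℕP.+-suc k m = *-zero-split (ι (suc k ℕ.+ m) - ι m) (ι-diff≢0 m k)
      (trans (sym (assoc' (ι (suc k ℕ.+ m) - ι m) (evalP (a ∷ p) (ι (suc k ℕ.+ m))) (evalP (quotP (ι m) (b ∷ q)) (ι (suc k ℕ.+ m)))))
             (trans (cong (evalP (a ∷ p) (ι (suc k ℕ.+ m)) *_) (sym (lift b q q0 (ι (suc k ℕ.+ m))))) (h (suc k))))
    step : ZeroFun (a ∷ p) ⊎ ZeroFun (quotP (ι m) (b ∷ q)) → ZeroFun (a ∷ p) ⊎ ZeroFun (b ∷ q)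
    step (inj₁ z) = inj₁ z
    step (inj₂ z) = inj₂ (zero-lift b q q0 z)

-- Multivariate polynomials and Zariski density

evalM-cong : ∀ {V} (P : MPoly V) {ρ ρ' : V → ℚ} → (∀ v → ρ v ≡ ρ' v) → evalM P ρ ≡ evalM P ρ'
evalM-cong (con c) eq = refl
evalM-cong (var v) eq = eq v
evalM-cong (p ⊕ q) eq = cong₂ _+_ (evalM-cong p eq) (evalM-cong q eq)
evalM-cong (p ⊗ q) eq = cong₂ _*_ (evalM-cong p eq) (evalM-cong q eq)

onLine : ∀ {V : Set} → (V → ℚ) → (V → ℚ) → ℚ → V → ℚ
onLine ρ ρ' s v = ρ v + s * (ρ' v - ρ v)

lineP : ∀ {V} → (V → ℚ) → (V → ℚ) → MPoly V → Poly
lineP ρ ρ' (con c) = c ∷ []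
lineP ρ ρ' (var v) = ρ v ∷ (ρ' v - ρ v) ∷ []
lineP ρ ρ' (p ⊕ q) = addP (lineP ρ ρ' p) (lineP ρ ρ' q)
lineP ρ ρ' (p ⊗ q) = mulP (lineP ρ ρ' p) (lineP ρ ρ' q)

evalP-lineP : ∀ {V} (ρ ρ' : V → ℚ) P s → evalP (lineP ρ ρ' P) s ≡ evalM P (onLine ρ ρ' s)
evalP-lineP ρ ρ' (con c) s = lem c s
  where
  lem : ∀ c s → c + s * 0ℚ ≡ c
  lem = solve 2 (λ c s → c :+ s :* :0 := c) refl
evalP-lineP ρ ρ' (var v) s = lem (ρ v) s (ρ' v - ρ v)
  where
  lem : ∀ c s d → c + s * (d + s * 0ℚ) ≡ c + s * d
  lem = solve 3 (λ c s d → c :+ s :* (d :+ s :* :0) := c :+ s :* d) refl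
evalP-lineP ρ ρ' (p ⊕ q) s = trans (evalP-addP (lineP ρ ρ' p) (lineP ρ ρ' q) s) (cong₂ _+_ (evalP-lineP ρ ρ' p s) (evalP-lineP ρ ρ' q s))
evalP-lineP ρ ρ' (p ⊗ q) s = trans (evalP-mulP (lineP ρ ρ' p) (lineP ρ ρ' q) s) (cong₂ _*_ (evalP-lineP ρ ρ' p s) (evalP-lineP ρ ρ' q s))

-- Restriction to the line from ρ to ρ' reduces the claim to one variable. There one of the two
-- factors vanishes identically, and it is not Q, whose value at the end of the line is nonzero.
evalM-domain : ∀ {V} (P Q : MPoly V) → (∀ ρ → evalM P ρ * evalM Q ρ ≡ 0ℚ) → ∀ ρ' → evalM Q ρ' ≢ 0ℚ → ∀ ρ → evalM P ρ ≡ 0ℚ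
evalM-domain P Q h ρ' Q≢0 ρ = go (evalP-domain _ 0 p q ℕP.≤-refl
    (λ k → trans (cong₂ _*_ (evalP-lineP ρ ρ' P (ι (k ℕ.+ 0))) (evalP-lineP ρ ρ' Q (ι (k ℕ.+ 0)))) (h (onLine ρ ρ' (ι (k ℕ.+ 0))))))
  where
  p = lineP ρ ρ' P
  q = lineP ρ ρ' Q
  start : ∀ a b → a ≡ a + 0ℚ * (b - a)
  start = solve 2 (λ a b → a := a :+ :0 :* (b :- a)) refl
  end : ∀ a b → b ≡ a + 1ℚ * (b - a)
  end = solve 2 (λ a b → b := a :+ :1 :* (b :- a)) refl
  go : ZeroFun p ⊎ ZeroFun q → evalM P ρ ≡ 0ℚ
  go (inj₁ z) = trans (evalM-cong P (λ v → start (ρ v) (ρ' v))) (trans (sym (evalP-lineP ρ ρ' P 0ℚ)) (z 0ℚ))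
  go (inj₂ z) = ⊥-elim (Q≢0 (trans (evalM-cong Q (λ v → end (ρ v) (ρ' v))) (trans (sym (evalP-lineP ρ ρ' Q 1ℚ)) (z 1ℚ))))

Env : Set → Set
Env V = V → ℚ

-- Identities are stated between functions; the expression is only a certificate. This avoids
-- comparing syntactically different expressions for the same polynomial.
IsPoly : ∀ {V} → (Env V → ℚ) → Set
IsPoly {V} f = Σ (MPoly V) λ P → ∀ ρ → evalM P ρ ≡ f ρ

module _ {V : Set} where

  poly-con : ∀ c → IsPoly {V} (λ ρ → c)
  poly-con c = con c , λ ρ → refl

  poly-var : ∀ v → IsPoly {V} (λ ρ → ρ v)
  poly-var v = var v , λ ρ → refl

  poly-+ : ∀ {f g : Env V → ℚ} → IsPoly f → IsPoly g → IsPoly (λ ρ → f ρ + g ρ)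
  poly-+ (P , p) (Q , q) = P ⊕ Q , λ ρ → cong₂ _+_ (p ρ) (q ρ)

  poly-* : ∀ {f g : Env V → ℚ} → IsPoly f → IsPoly g → IsPoly (λ ρ → f ρ * g ρ)
  poly-* (P , p) (Q , q) = P ⊗ Q , λ ρ → cong₂ _*_ (p ρ) (q ρ)

  poly-neg : ∀ {f : Env V → ℚ} → IsPoly f → IsPoly (λ ρ → - f ρ)
  poly-neg {f} (P , p) = con (- 1ℚ) ⊗ P , λ ρ → trans (cong (- 1ℚ *_) (p ρ)) (lem (f ρ))
    where
    lem : ∀ a → - 1ℚ * a ≡ - a
    lem = solve 1 (λ a → :- :1 :* a := :- a) refl

  poly-sub : ∀ {f g : Env V → ℚ} → IsPoly f → IsPoly g → IsPoly (λ ρ → f ρ - g ρ)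
  poly-sub p q = poly-+ p (poly-neg q)

  poly-^ : ∀ {f : Env V → ℚ} → IsPoly f → ∀ n → IsPoly (λ ρ → f ρ ^ n)
  poly-^ p zero    = poly-con 1ℚ
  poly-^ p (suc n) = poly-* p (poly-^ p n)

  poly-sumF : ∀ {n} {f : Fin n → Env V → ℚ} → (∀ i → IsPoly (f i)) → IsPoly (λ ρ → sumF (λ i → f i ρ))
  poly-sumF {zero}  p = poly-con 0ℚ
  poly-sumF {suc n} p = poly-+ (p zero) (poly-sumF (λ i → p (suc i)))

  poly-prodF : ∀ {n} {f : Fin n → Env V → ℚ} → (∀ i → IsPoly (f i)) → IsPoly (λ ρ → prodF (λ i → f i ρ))
  poly-prodF {zero}  p = poly-con 1ℚ
  poly-prodF {suc n} p = poly-* (p zero) (poly-prodF (λ i → p (suc i)))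

  poly-prodLt : ∀ {n} {f : Fin n → Fin n → Env V → ℚ} → (∀ i j → IsPoly (f i j)) → IsPoly (λ ρ → prodLt (λ i j → f i j ρ))
  poly-prodLt {zero}  p = poly-con 1ℚ
  poly-prodLt {suc n} p = poly-* (poly-prodF (λ j → p zero (suc j))) (poly-prodLt (λ i j → p (suc i) (suc j)))

  poly-det : ∀ {n} {f : Fin n → Fin n → Env V → ℚ} → (∀ i j → IsPoly (f i j)) → IsPoly (λ ρ → det (λ i j → f i j ρ))
  poly-det {zero}  p = poly-con 1ℚ
  poly-det {suc n} p = poly-sumF (λ j → poly-* (poly-* (poly-con (sgn (toℕ j))) (p zero j)) (poly-det (λ a b → p (suc a) (punchIn j b))))

  poly-eval : ∀ {W} (P : MPoly W) {e : W → Env V → ℚ} → (∀ w → IsPoly (e w)) → IsPoly (λ ρ → evalM P (λ w → e w ρ))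
  poly-eval (con c) p = poly-con c
  poly-eval (var w) p = p w
  poly-eval (P ⊕ Q) p = poly-+ (poly-eval P p) (poly-eval Q p)
  poly-eval (P ⊗ Q) p = poly-* (poly-eval P p) (poly-eval Q p)

  poly-≗ : ∀ {f g : Env V → ℚ} → IsPoly f → (∀ ρ → f ρ ≡ g ρ) → IsPoly g
  poly-≗ (P , p) eq = P , λ ρ → trans (p ρ) (eq ρ)

  -- Zariski density of the open set g ≠ 0, in the form of a principle for polynomial functions.
  Dense : (Env V → ℚ) → Set
  Dense g = ∀ f → IsPoly f → (∀ ρ → g ρ ≢ 0ℚ → f ρ ≡ 0ℚ) → ∀ ρ → f ρ ≡ 0ℚ

  -- The product f g vanishes everywhere, and one point with g ≠ 0 shows that g is not the zero
  -- factor.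
  dense : ∀ {g} → IsPoly g → ∀ ρ' → g ρ' ≢ 0ℚ → Dense g
  dense {g} (Q , q) ρ' g≢0 f (P , p) h ρ = trans (sym (p ρ)) (evalM-domain P Q pq ρ' (λ z → g≢0 (trans (sym (q ρ')) z)) ρ)
    where
    pq : ∀ ρ → evalM P ρ * evalM Q ρ ≡ 0ℚ
    pq ρ = trans (cong₂ _*_ (p ρ) (q ρ)) (go (g ρ ≟ 0ℚ))
      where
      go : Dec (g ρ ≡ 0ℚ) → f ρ * g ρ ≡ 0ℚ
      go (yes g0) = trans (cong (f ρ *_) g0) (ℚP.*-zeroʳ (f ρ))
      go (no g≢)  = trans (cong (_* g ρ) (h ρ g≢)) (ℚP.*-zeroˡ (g ρ))

  -- On g ≠ 0 the product f h vanishes, hence it vanishes everywhere by the density for g; the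
  -- density for h then removes h.
  dense-* : ∀ {g h} → IsPoly g → IsPoly h → Dense g → Dense h → Dense (λ ρ → g ρ * h ρ)
  dense-* {g} {h} pg ph dg dh f pf z = dh f pf (λ ρ h≢0 → *-zero-split (h ρ) h≢0 (trans (ℚP.*-comm (h ρ) (f ρ)) (fh ρ)))
    where
    fh : ∀ ρ → f ρ * h ρ ≡ 0ℚ
    fh = dg (λ ρ → f ρ * h ρ) (poly-* pf ph) λ ρ g≢0 → go ρ g≢0 (h ρ ≟ 0ℚ)
      where
      go : ∀ ρ → g ρ ≢ 0ℚ → Dec (h ρ ≡ 0ℚ) → f ρ * h ρ ≡ 0ℚ
      go ρ g≢0 (yes h0) = trans (cong (f ρ *_) h0) (ℚP.*-zeroʳ (f ρ))
      go ρ g≢0 (no h≢0) = trans (cong (_* h ρ) (z ρ (*-≢0 g≢0 h≢0))) (ℚP.*-zeroˡ (h ρ))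

  dense-⇒≡ : ∀ {g f f' : Env V → ℚ} → Dense g → IsPoly f → IsPoly f' → (∀ ρ → g ρ ≢ 0ℚ → f ρ ≡ f' ρ) → ∀ ρ → f ρ ≡ f' ρ
  dense-⇒≡ {f = f} {f'} d p p' h ρ = -≡0 (d (λ ρ → f ρ - f' ρ) (poly-sub p p') (λ ρ g≢0 → ≡-⇒0 (h ρ g≢0)) ρ)

-- Orders of vanishing

-- The variable nothing of Env (Maybe W) is the local parameter s.
at0 : ∀ {W} → Env (Maybe W) → Env (Maybe W)
at0 ρ nothing  = 0ℚ
at0 ρ (just w) = ρ (just w)

-- Constant term and quotient of division by the local parameter s, computed on expressions: P = P
-- at s = 0 plus s times `shiftM P`. The product rule resembles that of a difference quotient.
zeroM shiftM : ∀ {W} → MPoly (Maybe W) → MPoly (Maybe W)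
zeroM (con c)        = con c
zeroM (var nothing)  = con 0ℚ
zeroM (var (just w)) = var (just w)
zeroM (p ⊕ q)        = zeroM p ⊕ zeroM q
zeroM (p ⊗ q)        = zeroM p ⊗ zeroM q
shiftM (con c)        = con 0ℚ
shiftM (var nothing)  = con 1ℚ
shiftM (var (just w)) = con 0ℚ
shiftM (p ⊕ q)        = shiftM p ⊕ shiftM q
shiftM (p ⊗ q)        = (shiftM p ⊗ q) ⊕ (zeroM p ⊗ shiftM q)

evalM-zeroM : ∀ {W} (P : MPoly (Maybe W)) ρ → evalM (zeroM P) ρ ≡ evalM P (at0 ρ)
evalM-zeroM (con c)        ρ = refl
evalM-zeroM (var nothing)  ρ = refl
evalM-zeroM (var (just w)) ρ = refl
evalM-zeroM (p ⊕ q)        ρ = cong₂ _+_ (evalM-zeroM p ρ) (evalM-zeroM q ρ)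
evalM-zeroM (p ⊗ q)        ρ = cong₂ _*_ (evalM-zeroM p ρ) (evalM-zeroM q ρ)

evalM-shiftM : ∀ {W} (P : MPoly (Maybe W)) ρ → evalM P ρ ≡ evalM (zeroM P) ρ + ρ nothing * evalM (shiftM P) ρ
evalM-shiftM (con c)        ρ = lem c (ρ nothing)
  where
  lem : ∀ c s → c ≡ c + s * 0ℚ
  lem = solve 2 (λ c s → c := c :+ s :* :0) refl
evalM-shiftM (var nothing)  ρ = lem (ρ nothing)
  where
  lem : ∀ s → s ≡ 0ℚ + s * 1ℚ
  lem = solve 1 (λ s → s := :0 :+ s :* :1) refl
evalM-shiftM (var (just w)) ρ = lem (ρ (just w)) (ρ nothing)
  where
  lem : ∀ c s → c ≡ c + s * 0ℚ
  lem = solve 2 (λ c s → c := c :+ s :* :0) refl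
evalM-shiftM (p ⊕ q)        ρ = trans (cong₂ _+_ (evalM-shiftM p ρ) (evalM-shiftM q ρ))
  (lem (evalM (zeroM p) ρ) (ρ nothing) (evalM (shiftM p) ρ) (evalM (zeroM q) ρ) (evalM (shiftM q) ρ))
  where
  lem : ∀ a s b c d → a + s * b + (c + s * d) ≡ a + c + s * (b + d)
  lem = solve 5 (λ a s b c d → a :+ s :* b :+ (c :+ s :* d) := a :+ c :+ s :* (b :+ d)) refl
evalM-shiftM (p ⊗ q)        ρ = begin
  evalM p ρ * evalM q ρ                                          ≡⟨ cong (_* evalM q ρ) (evalM-shiftM p ρ) ⟩
  (p₀ + s * p₁) * evalM q ρ                                      ≡⟨ l₁ p₀ s p₁ (evalM q ρ) ⟩
  p₀ * evalM q ρ + s * (p₁ * evalM q ρ)                          ≡⟨ cong (λ w → p₀ * w + s * (p₁ * evalM q ρ)) (evalM-shiftM q ρ) ⟩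
  p₀ * (q₀ + s * q₁) + s * (p₁ * evalM q ρ)                      ≡⟨ l₂ p₀ q₀ s q₁ (p₁ * evalM q ρ) ⟩
  p₀ * q₀ + s * (p₁ * evalM q ρ + p₀ * q₁)                       ∎
  where
  open ≡-Reasoning
  s p₀ p₁ q₀ q₁ : ℚ
  s = ρ nothing
  p₀ = evalM (zeroM p) ρ
  p₁ = evalM (shiftM p) ρ
  q₀ = evalM (zeroM q) ρ
  q₁ = evalM (shiftM q) ρ
  l₁ : ∀ a s b c → (a + s * b) * c ≡ a * c + s * (b * c)
  l₁ = solve 4 (λ a s b c → (a :+ s :* b) :* c := a :* c :+ s :* (b :* c)) refl
  l₂ : ∀ a b s c d → a * (b + s * c) + s * d ≡ a * b + s * (d + a * c)
  l₂ = solve 5 (λ a b s c d → a :* (b :+ s :* c) :+ s :* d := a :* b :+ s :* (d :+ a :* c)) refl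

sumℕ : ∀ {n} → (Fin n → ℕ) → ℕ
sumℕ {zero}  a = 0
sumℕ {suc n} a = a zero ℕ.+ sumℕ (λ i → a (suc i))

sumLtℕ : ∀ {n} → (Fin n → Fin n → ℕ) → ℕ
sumLtℕ {zero}  a = 0
sumLtℕ {suc n} a = sumℕ (λ j → a zero (suc j)) ℕ.+ sumLtℕ (λ i j → a (suc i) (suc j))

module _ {W : Set} where

  private
    V : Set
    V = Maybe W

  poly-at0 : ∀ {f : Env V → ℚ} → IsPoly f → IsPoly (λ ρ → f (at0 ρ))
  poly-at0 (P , p) = zeroM P , λ ρ → trans (evalM-zeroM P ρ) (p (at0 ρ))

  dense-s : Dense (λ ρ → ρ (nothing {A = W}))
  dense-s = dense (poly-var nothing) (λ _ → 1ℚ) 1≢0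

  -- At s = 0 the product D S vanishes while D is not identically zero there, as the point ρ'
  -- witnesses. Hence S vanishes at s = 0 and is divisible by s.
  divide₁ : ∀ {D S R : Env V → ℚ} → IsPoly D → IsPoly S → IsPoly R → (∀ ρ → D ρ * S ρ ≡ ρ nothing * R ρ) →
    ∀ ρ' → D (at0 ρ') ≢ 0ℚ → Σ (Env V → ℚ) λ Q → IsPoly Q × (∀ ρ → S ρ ≡ ρ nothing * Q ρ) × (∀ ρ → D ρ * Q ρ ≡ R ρ)
  divide₁ {D} {S} {R} pD pS@(P , p) pR h ρ' D≢0 = Q , pQ , S≡sQ , D*Q
    where
    Q : Env V → ℚ
    Q ρ = evalM (shiftM P) ρ
    pQ : IsPoly Q
    pQ = shiftM P , λ ρ → refl
    S0 : ∀ ρ → S (at0 ρ) ≡ 0ℚ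
    S0 = dense (poly-at0 pD) ρ' D≢0 (λ ρ → S (at0 ρ)) (poly-at0 pS)
      (λ ρ D≢ → *-zero-split (D (at0 ρ)) D≢ (trans (h (at0 ρ)) (ℚP.*-zeroˡ (R (at0 ρ)))))
    S≡sQ : ∀ ρ → S ρ ≡ ρ nothing * Q ρ
    S≡sQ ρ = begin
      S ρ                                        ≡⟨ sym (p ρ) ⟩
      evalM P ρ                                  ≡⟨ evalM-shiftM P ρ ⟩
      evalM (zeroM P) ρ + ρ nothing * Q ρ        ≡⟨ cong (_+ ρ nothing * Q ρ) (trans (evalM-zeroM P ρ) (trans (p (at0 ρ)) (S0 ρ))) ⟩
      0ℚ + ρ nothing * Q ρ                       ≡⟨ ℚP.+-identityˡ (ρ nothing * Q ρ) ⟩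
      ρ nothing * Q ρ                            ∎
      where open ≡-Reasoning
    lem : ∀ a b c → a * (b * c) ≡ b * (a * c)
    lem = solve 3 (λ a b c → a :* (b :* c) := b :* (a :* c)) refl
    D*Q : ∀ ρ → D ρ * Q ρ ≡ R ρ
    D*Q = dense-⇒≡ dense-s (poly-* pD pQ) pR λ ρ s≢0 → *-cancelˡ-≢0 (ρ nothing) s≢0
      (trans (sym (lem (D ρ) (ρ nothing) (Q ρ))) (trans (cong (D ρ *_) (sym (S≡sQ ρ))) (h ρ)))

  divide : ∀ N {D S R : Env V → ℚ} → IsPoly D → IsPoly S → IsPoly R → (∀ ρ → D ρ * S ρ ≡ ρ nothing ^ N * R ρ) →
    ∀ ρ' → D (at0 ρ') ≢ 0ℚ → Σ (Env V → ℚ) λ Q → IsPoly Q × (∀ ρ → S ρ ≡ ρ nothing ^ N * Q ρ) × (∀ ρ → D ρ * Q ρ ≡ R ρ)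
  divide zero {D} {S} {R} pD pS pR h ρ' D≢0 = S , pS , (λ ρ → sym (ℚP.*-identityˡ (S ρ))) , λ ρ → trans (h ρ) (ℚP.*-identityˡ (R ρ))
  divide (suc N) {D} {S} {R} pD pS pR h ρ' D≢0 =
    go (divide₁ pD pS (poly-* (poly-^ (poly-var nothing) N) pR) (λ ρ → trans (h ρ) (ℚP.*-assoc (ρ nothing) (ρ nothing ^ N) (R ρ))) ρ' D≢0)
    where
    go : (Σ (Env V → ℚ) λ Q → IsPoly Q × (∀ ρ → S ρ ≡ ρ nothing * Q ρ) × (∀ ρ → D ρ * Q ρ ≡ ρ nothing ^ N * R ρ)) →
      Σ (Env V → ℚ) λ Q → IsPoly Q × (∀ ρ → S ρ ≡ ρ nothing ^ suc N * Q ρ) × (∀ ρ → D ρ * Q ρ ≡ R ρ)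
    go (Q₁ , pQ₁ , S≡ , DQ₁) = go' (divide N pD pQ₁ pR DQ₁ ρ' D≢0)
      where
      go' : (Σ (Env V → ℚ) λ Q → IsPoly Q × (∀ ρ → Q₁ ρ ≡ ρ nothing ^ N * Q ρ) × (∀ ρ → D ρ * Q ρ ≡ R ρ)) →
        Σ (Env V → ℚ) λ Q → IsPoly Q × (∀ ρ → S ρ ≡ ρ nothing ^ suc N * Q ρ) × (∀ ρ → D ρ * Q ρ ≡ R ρ)
      go' (Q , pQ , Q₁≡ , DQ) = Q , pQ , (λ ρ → trans (S≡ ρ) (trans (cong (ρ nothing *_) (Q₁≡ ρ)) (sym (ℚP.*-assoc (ρ nothing) (ρ nothing ^ N) (Q ρ))))) , DQ

  record Ord (N : ℕ) (f : Env V → ℚ) : Set where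
    constructor ord
    field
      cofactor    : Env V → ℚ
      cofactor-poly : IsPoly cofactor
      factors     : ∀ ρ → f ρ ≡ ρ nothing ^ N * cofactor ρ

  ord-0 : ∀ {f} → IsPoly f → Ord 0 f
  ord-0 {f} p = ord f p (λ ρ → sym (ℚP.*-identityˡ (f ρ)))

  ord-weaken : ∀ M {N f} → Ord (M ℕ.+ N) f → Ord M f
  ord-weaken M {N} {f} (ord g p eq) = ord (λ ρ → ρ nothing ^ N * g ρ) (poly-* (poly-^ (poly-var nothing) N) p)
    (λ ρ → trans (eq ρ) (trans (cong (_* g ρ) (^-+ (ρ nothing) M N)) (ℚP.*-assoc (ρ nothing ^ M) (ρ nothing ^ N) (g ρ))))

  ord-≤ : ∀ {M N f} → M ℕ.≤ N → Ord N f → Ord M f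
  ord-≤ {M} {N} {f} M≤N o = ord-weaken M {N ℕ.∸ M} {f} (subst (λ k → Ord k f) (sym (ℕP.m+[n∸m]≡n M≤N)) o)

  ord-* : ∀ {M N f g} → Ord M f → Ord N g → Ord (M ℕ.+ N) (λ ρ → f ρ * g ρ)
  ord-* {M} {N} (ord f' p e) (ord g' q e') = ord (λ ρ → f' ρ * g' ρ) (poly-* p q) (λ ρ →
    trans (cong₂ _*_ (e ρ) (e' ρ)) (trans (lem (ρ nothing ^ M) (f' ρ) (ρ nothing ^ N) (g' ρ)) (cong (_* (f' ρ * g' ρ)) (sym (^-+ (ρ nothing) M N)))))
    where
    lem : ∀ a b c d → a * b * (c * d) ≡ a * c * (b * d)
    lem = solve 4 (λ a b c d → a :* b :* (c :* d) := a :* c :* (b :* d)) refl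

  ord-+ : ∀ {N f g} → Ord N f → Ord N g → Ord N (λ ρ → f ρ + g ρ)
  ord-+ {N} (ord f' p e) (ord g' q e') = ord (λ ρ → f' ρ + g' ρ) (poly-+ p q) (λ ρ →
    trans (cong₂ _+_ (e ρ) (e' ρ)) (sym (ℚP.*-distribˡ-+ (ρ nothing ^ N) (f' ρ) (g' ρ))))

  ord-zero : ∀ N → Ord N (λ ρ → 0ℚ)
  ord-zero N = ord (λ ρ → 0ℚ) (poly-con 0ℚ) (λ ρ → sym (ℚP.*-zeroʳ (ρ nothing ^ N)))

  ord-sumF : ∀ {n N} {f : Fin n → Env V → ℚ} → (∀ i → Ord N (f i)) → Ord N (λ ρ → sumF (λ i → f i ρ))
  ord-sumF {zero}  {N} o = ord-zero N
  ord-sumF {suc n} {N} {f} o = ord-+ {f = f zero} {g = λ ρ → sumF (λ i → f (suc i) ρ)} (o zero) (ord-sumF {f = λ i → f (suc i)} (λ i → o (suc i)))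

  ord-prodF : ∀ {n} {a : Fin n → ℕ} {f : Fin n → Env V → ℚ} → (∀ i → Ord (a i) (f i)) → Ord (sumℕ a) (λ ρ → prodF (λ i → f i ρ))
  ord-prodF {zero}  o = ord-0 (poly-con 1ℚ)
  ord-prodF {suc n} {a} {f} o = ord-* {f = f zero} {g = λ ρ → prodF (λ i → f (suc i) ρ)} (o zero) (ord-prodF {a = λ i → a (suc i)} {f = λ i → f (suc i)} (λ i → o (suc i)))

  -- Every term of the expansion takes exactly one entry from each row, so orders that depend on the
  -- row alone add up.
  ord-det : ∀ {n} {a : Fin n → ℕ} {f : Fin n → Fin n → Env V → ℚ} → (∀ i j → Ord (a i) (f i j)) → Ord (sumℕ a) (λ ρ → det (λ i j → f i j ρ))
  ord-det {zero}  o = ord-0 (poly-con 1ℚ)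
  ord-det {suc n} {a} {f} o = ord-sumF {f = λ j ρ → sgn (toℕ j) * f zero j ρ * det (λ i k → f (suc i) (punchIn j k) ρ)} λ j →
    ord-* {f = λ ρ → sgn (toℕ j) * f zero j ρ} {g = λ ρ → det (λ i k → f (suc i) (punchIn j k) ρ)}
      (ord-* {f = λ ρ → sgn (toℕ j)} {g = f zero j} (ord-0 (poly-con (sgn (toℕ j)))) (o zero j))
      (ord-det {a = λ i → a (suc i)} {f = λ i k → f (suc i) (punchIn j k)} (λ i k → o (suc i) (punchIn j k)))

  -- The order is exactly N, with one fixed point ρ' at which the leading coefficient is nonzero.
  -- Sharing ρ' makes exactness multiplicative without a further appeal to integrality.
  record Exact (ρ' : Env V) (N : ℕ) (f : Env V → ℚ) : Set where
    constructor exact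
    field
      order   : Ord N f
      nonzero : Ord.cofactor order (at0 ρ') ≢ 0ℚ

  exact-* : ∀ {ρ' M N f g} → Exact ρ' M f → Exact ρ' N g → Exact ρ' (M ℕ.+ N) (λ ρ → f ρ * g ρ)
  exact-* (exact o@(ord _ _ _) nz) (exact o'@(ord _ _ _) nz') = exact (ord-* o o') (*-≢0 nz nz')

  exact-1 : ∀ {ρ'} → Exact ρ' 0 (λ ρ → 1ℚ)
  exact-1 = exact (ord-0 (poly-con 1ℚ)) 1≢0

  exact-prodF : ∀ {ρ' n} {a : Fin n → ℕ} {f : Fin n → Env V → ℚ} → (∀ i → Exact ρ' (a i) (f i)) → Exact ρ' (sumℕ a) (λ ρ → prodF (λ i → f i ρ))
  exact-prodF {n = zero}  o = exact-1
  exact-prodF {n = suc n} {a} {f} o = exact-* {f = f zero} {g = λ ρ → prodF (λ i → f (suc i) ρ)} (o zero) (exact-prodF {a = λ i → a (suc i)} {f = λ i → f (suc i)} (λ i → o (suc i)))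

  exact-prodLt : ∀ {ρ' n} {a : Fin n → Fin n → ℕ} {f : Fin n → Fin n → Env V → ℚ} →
    (∀ i j → i Data.Fin.< j → Exact ρ' (a i j) (f i j)) → Exact ρ' (sumLtℕ a) (λ ρ → prodLt (λ i j → f i j ρ))
  exact-prodLt {n = zero}  o = exact-1
  exact-prodLt {n = suc n} {a} {f} o = exact-* {f = λ ρ → prodF (λ j → f zero (suc j) ρ)} {g = λ ρ → prodLt (λ i j → f (suc i) (suc j) ρ)}
    (exact-prodF {a = λ j → a zero (suc j)} {f = λ j → f zero (suc j)} (λ j → o zero (suc j) (ℕ.s≤s ℕ.z≤n)))
    (exact-prodLt {a = λ i j → a (suc i) (suc j)} {f = λ i j → f (suc i) (suc j)} (λ i j i<j → o (suc i) (suc j) (ℕ.s≤s i<j)))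

  -- The order of a quotient is at least the difference of the orders: s^e is cancelled on the dense
  -- set s ≠ 0, and what is left of D is nonzero at s = 0, so `divide` applies.
  ord-cancel : ∀ {ρ' e M} {D S R : Env V → ℚ} → Exact ρ' e D → IsPoly S → Ord (e ℕ.+ M) R → (∀ ρ → D ρ * S ρ ≡ R ρ) → Ord M S
  ord-cancel {ρ'} {e} {M} {D} {S} {R} (exact (ord D' pD eD) nz) pS (ord R' pR eR) h =
    let (Q , pQ , eQ , _) = divide M pD pS pR reduced ρ' nz in ord Q pQ eQ
    where
    reduced : ∀ ρ → D' ρ * S ρ ≡ ρ nothing ^ M * R' ρ
    reduced = dense-⇒≡ dense-s (poly-* pD pS) (poly-* (poly-^ (poly-var nothing) M) pR) λ ρ s≢0 →
      *-cancelˡ-≢0 (ρ nothing ^ e) (^-≢0 e s≢0) (begin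
        ρ nothing ^ e * (D' ρ * S ρ)                  ≡⟨ sym (ℚP.*-assoc (ρ nothing ^ e) (D' ρ) (S ρ)) ⟩
        ρ nothing ^ e * D' ρ * S ρ                    ≡⟨ cong (_* S ρ) (sym (eD ρ)) ⟩
        D ρ * S ρ                                     ≡⟨ h ρ ⟩
        R ρ                                           ≡⟨ eR ρ ⟩
        ρ nothing ^ (e ℕ.+ M) * R' ρ                  ≡⟨ cong (_* R' ρ) (^-+ (ρ nothing) e M) ⟩
        ρ nothing ^ e * ρ nothing ^ M * R' ρ          ≡⟨ ℚP.*-assoc (ρ nothing ^ e) (ρ nothing ^ M) (R' ρ) ⟩
        ρ nothing ^ e * (ρ nothing ^ M * R' ρ)        ∎)
      where open ≡-Reasoning

-- Substitution of quotients with a common denominator d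
module Clear {X : Set} (𝒫 : (X → ℚ) → Set) (𝒫-con : ∀ c → 𝒫 (λ _ → c))
  (𝒫-+ : ∀ {f g} → 𝒫 f → 𝒫 g → 𝒫 (λ x → f x + g x)) (𝒫-* : ∀ {f g} → 𝒫 f → 𝒫 g → 𝒫 (λ x → f x * g x)) where

  𝒫-^ : ∀ {f} → 𝒫 f → ∀ n → 𝒫 (λ x → f x ^ n)
  𝒫-^ p zero    = 𝒫-con 1ℚ
  𝒫-^ p (suc n) = 𝒫-* p (𝒫-^ p n)

  -- When the arguments are fractions `num v` / d, a polynomial expression becomes a fraction over
  -- d^M, with M bounded by induction on the expression. The values e are constrained only by e d =
  -- num, so the same numerator h serves at every point where d may or may not vanish.
  clear : ∀ {V : Set} (P : MPoly V) {num : V → X → ℚ} {d : X → ℚ} → (∀ v → 𝒫 (num v)) → 𝒫 d →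
    Σ ℕ λ M → Σ (X → ℚ) λ h → 𝒫 h × (∀ x (e : V → ℚ) → (∀ v → e v * d x ≡ num v x) → evalM P e * d x ^ M ≡ h x)
  clear (con c) pn pd = 0 , (λ _ → c) , 𝒫-con c , λ x e eq → ℚP.*-identityʳ c
  clear (var v) {num} {d} pn pd = 1 , num v , pn v , λ x e eq → trans (cong (e v *_) (ℚP.*-identityʳ (d x))) (eq v)
  clear (P ⊕ Q) {num} {d} pn pd =
    let (M , f , pf , ef) = clear P pn pd
        (N , g , pg , eg) = clear Q pn pd
    in M ℕ.+ N , (λ x → f x * d x ^ N + g x * d x ^ M) , 𝒫-+ (𝒫-* pf (𝒫-^ pd N)) (𝒫-* pg (𝒫-^ pd M)) , λ x e eq →
       trans (cong ((evalM P e + evalM Q e) *_) (^-+ (d x) M N))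
         (trans (lem (evalM P e) (evalM Q e) (d x ^ M) (d x ^ N)) (cong₂ (λ v w → v * d x ^ N + w * d x ^ M) (ef x e eq) (eg x e eq)))
    where
    lem : ∀ p q a b → (p + q) * (a * b) ≡ p * a * b + q * b * a
    lem = solve 4 (λ p q a b → (p :+ q) :* (a :* b) := p :* a :* b :+ q :* b :* a) refl
  clear (P ⊗ Q) {num} {d} pn pd =
    let (M , f , pf , ef) = clear P pn pd
        (N , g , pg , eg) = clear Q pn pd
    in M ℕ.+ N , (λ x → f x * g x) , 𝒫-* pf pg , λ x e eq →
       trans (cong (evalM P e * evalM Q e *_) (^-+ (d x) M N))
         (trans (lem (evalM P e) (evalM Q e) (d x ^ M) (d x ^ N)) (cong₂ _*_ (ef x e eq) (eg x e eq)))
    where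
    lem : ∀ p q a b → (p * q) * (a * b) ≡ p * a * (q * b)
    lem = solve 4 (λ p q a b → (p :* q) :* (a :* b) := p :* a :* (q :* b)) refl

-- Polynomial functions of one variable

PolyFun : (ℚ → ℚ) → Set
PolyFun f = Σ Poly λ P → ∀ t → evalP P t ≡ f t

pf-con : ∀ c → PolyFun (λ _ → c)
pf-con c = c ∷ [] , lem c
  where
  lem : ∀ c t → c + t * 0ℚ ≡ c
  lem = solve 2 (λ c t → c :+ t :* :0 := c) refl

pf-id : PolyFun (λ t → t)
pf-id = 0ℚ ∷ 1ℚ ∷ [] , lem
  where
  lem : ∀ t → 0ℚ + t * (1ℚ + t * 0ℚ) ≡ t
  lem = solve 1 (λ t → :0 :+ t :* (:1 :+ t :* :0) := t) refl

pf-+ : ∀ {f g} → PolyFun f → PolyFun g → PolyFun (λ t → f t + g t)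
pf-+ (P , p) (Q , q) = addP P Q , λ t → trans (evalP-addP P Q t) (cong₂ _+_ (p t) (q t))

pf-* : ∀ {f g} → PolyFun f → PolyFun g → PolyFun (λ t → f t * g t)
pf-* (P , p) (Q , q) = mulP P Q , λ t → trans (evalP-mulP P Q t) (cong₂ _*_ (p t) (q t))

pf-neg : ∀ {f} → PolyFun f → PolyFun (λ t → - f t)
pf-neg {f} (P , p) = scaleP (- 1ℚ) P , λ t → trans (evalP-scaleP (- 1ℚ) P t) (trans (cong (- 1ℚ *_) (p t)) (lem (f t)))
  where
  lem : ∀ a → - 1ℚ * a ≡ - a
  lem = solve 1 (λ a → :- :1 :* a := :- a) refl

pf-sub : ∀ {f g} → PolyFun f → PolyFun g → PolyFun (λ t → f t - g t)
pf-sub p q = pf-+ p (pf-neg q)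

open Clear PolyFun pf-con pf-+ pf-* public renaming (𝒫-^ to pf-^; clear to pf-clear)

pf-evalP : ∀ P → PolyFun (evalP P)
pf-evalP P = P , λ t → refl

pf-evalM : ∀ {V} (P : MPoly V) {e : V → ℚ → ℚ} → (∀ v → PolyFun (e v)) → PolyFun (λ t → evalM P (λ v → e v t))
pf-evalM (con c) p = pf-con c
pf-evalM (var v) p = p v
pf-evalM (P ⊕ Q) p = pf-+ (pf-evalM P p) (pf-evalM Q p)
pf-evalM (P ⊗ Q) p = pf-* (pf-evalM P p) (pf-evalM Q p)

pf-comp : ∀ {V} {f : Env V → ℚ} → IsPoly f → {e : V → ℚ → ℚ} → (∀ v → PolyFun (e v)) → PolyFun (λ t → f (λ v → e v t))
pf-comp (P , p) {e} pe = let (R , r) = pf-evalM P pe in R , λ t → trans (r t) (p (λ v → e v t))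

pf-dense : ∀ {f g} → PolyFun f → PolyFun g → ∀ t₀ → g t₀ ≢ 0ℚ → (∀ t → g t ≢ 0ℚ → f t ≡ 0ℚ) → ∀ t → f t ≡ 0ℚ
pf-dense {f} {g} (P , p) (Q , q) t₀ g≢0 h t = go (evalP-domain _ 0 P Q ℕP.≤-refl (λ k → vanish (ι (k ℕ.+ 0))))
  where
  vanish : ∀ s → evalP P s * evalP Q s ≡ 0ℚ
  vanish s = trans (cong₂ _*_ (p s) (q s)) (case (g s ≟ 0ℚ))
    where
    case : Dec (g s ≡ 0ℚ) → f s * g s ≡ 0ℚ
    case (yes g0) = trans (cong (f s *_) g0) (ℚP.*-zeroʳ (f s))
    case (no g≢)  = trans (cong (_* g s) (h s g≢)) (ℚP.*-zeroˡ (g s))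
  go : ZeroFun P ⊎ ZeroFun Q → f t ≡ 0ℚ
  go (inj₁ z) = trans (sym (p t)) (z t)
  go (inj₂ z) = ⊥-elim (g≢0 (trans (sym (q t₀)) (z t₀)))

pf-dense-≡ : ∀ {f f' g} → PolyFun f → PolyFun f' → PolyFun g → ∀ t₀ → g t₀ ≢ 0ℚ → (∀ t → g t ≢ 0ℚ → f t ≡ f' t) → ∀ t → f t ≡ f' t
pf-dense-≡ p p' q t₀ g≢0 h t = -≡0 (pf-dense (pf-sub p p') q t₀ g≢0 (λ s g≢ → ≡-⇒0 (h s g≢)) t)

-- The one-variable counterpart of `divide`, at an arbitrary root c. The cofactor D need only be
-- nonzero at c, so several prime powers can be split off one after another.
pf-divide : ∀ c N {D S R} → PolyFun D → PolyFun S → PolyFun R → (∀ t → D t * S t ≡ (t - c) ^ N * R t) → D c ≢ 0ℚ →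
  Σ (ℚ → ℚ) λ Q → PolyFun Q × (∀ t → S t ≡ (t - c) ^ N * Q t) × (∀ t → D t * Q t ≡ R t)
pf-divide c zero    {D} {S} {R} pD pS pR h D≢0 = S , pS , (λ t → sym (ℚP.*-identityˡ (S t))) , λ t → trans (h t) (ℚP.*-identityˡ (R t))
pf-divide c (suc N) {D} {S} {R} pD (P , p) pR h D≢0 =
  let (Q , pQ , Q₁≡ , DQ) = pf-divide c N pD pQ₁ pR DQ₁ D≢0
  in Q , pQ , (λ t → trans (S≡ t) (trans (cong ((t - c) *_) (Q₁≡ t)) (sym (ℚP.*-assoc (t - c) ((t - c) ^ N) (Q t))))) , DQ
  where
  Q₁ : ℚ → ℚ
  Q₁ = evalP (quotP c P)
  pQ₁ : PolyFun Q₁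
  pQ₁ = pf-evalP (quotP c P)
  Sc : S c ≡ 0ℚ
  Sc = *-zero-split (D c) D≢0 (trans (h c) (trans (cong (λ w → w * (c - c) ^ N * R c) (ℚP.+-inverseʳ c)) (lem ((c - c) ^ N) (R c))))
    where
    lem : ∀ a b → 0ℚ * a * b ≡ 0ℚ
    lem = solve 2 (λ a b → :0 :* a :* b := :0) refl
  S≡ : ∀ t → S t ≡ (t - c) * Q₁ t
  S≡ t = trans (sym (p t)) (trans (quotP-spec c P t) (trans (cong (_+ (t - c) * Q₁ t) (trans (p c) Sc)) (ℚP.+-identityˡ ((t - c) * Q₁ t))))
  lem : ∀ a b c → a * (b * c) ≡ b * (a * c)
  lem = solve 3 (λ a b c → a :* (b :* c) := b :* (a :* c)) refl
  DQ₁ : ∀ t → D t * Q₁ t ≡ (t - c) ^ N * R t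
  DQ₁ = pf-dense-≡ (pf-* pD pQ₁) (pf-* (pf-^ (pf-sub pf-id (pf-con c)) N) pR) (pf-sub pf-id (pf-con c)) (c + 1ℚ) (λ z → 1≢0 (trans (sym (l c)) z)) λ t s≢0 →
    *-cancelˡ-≢0 (t - c) s≢0 (trans (sym (lem (D t) (t - c) (Q₁ t))) (trans (cong (D t *_) (sym (S≡ t))) (trans (h t) (ℚP.*-assoc (t - c) ((t - c) ^ N) (R t)))))
    where
    l : ∀ c → c + 1ℚ - c ≡ 1ℚ
    l = solve 1 (λ c → c :+ :1 :- c := :1) refl

-- R is t^d P(1/t). The exponent d is free, since a coefficient list may be longer than the degree
-- requires.
Reversal : ℕ → Poly → (ℚ → ℚ) → Set
Reversal d P R = ∀ t u → t * u ≡ 1ℚ → R t ≡ t ^ d * evalP P u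

-- The polynomial R produced along with the degree has the leading coefficient of P as its value at
-- 0.
deg-cases : ∀ P → (deg P ≡ nothing × ZeroFun P) ⊎ Σ ℕ λ e → Σ (ℚ → ℚ) λ R → deg P ≡ just e × PolyFun R × Reversal e P R × R 0ℚ ≢ 0ℚ
deg-cases [] = inj₁ (refl , λ t → refl)
deg-cases (c ∷ cs) with deg cs | deg-cases cs
... | just e | inj₂ (.e , R , refl , pR , rev , R≢0) =
  inj₂ (suc e , (λ t → c * t ^ suc e + R t) , refl , pf-+ (pf-* (pf-con c) (pf-^ pf-id (suc e))) pR
       , (λ t u tu → trans (cong (c * t ^ suc e +_) (rev t u tu)) (trans (l₁ c t (t ^ e) (evalP cs u))
                      (trans (cong (λ w → t * t ^ e * c + w * t ^ e * evalP cs u) (sym tu)) (l₂ c t (t ^ e) u (evalP cs u)))))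
       , λ z → R≢0 (trans (l₃ c (0ℚ ^ e) (R 0ℚ)) z))
  where
  l₁ : ∀ c t e p → c * (t * e) + e * p ≡ t * e * c + 1ℚ * e * p
  l₁ = solve 4 (λ c t e p → c :* (t :* e) :+ e :* p := t :* e :* c :+ :1 :* e :* p) refl
  l₂ : ∀ c t e u p → t * e * c + t * u * e * p ≡ t * e * (c + u * p)
  l₂ = solve 5 (λ c t e u p → t :* e :* c :+ t :* u :* e :* p := t :* e :* (c :+ u :* p)) refl
  l₃ : ∀ c a r → r ≡ c * (0ℚ * a) + r
  l₃ = solve 3 (λ c a r → r := c :* (:0 :* a) :+ r) refl
... | nothing | inj₁ (_ , z) with c ≟ 0ℚ
...   | yes refl = inj₁ (refl , λ t → trans (cong (λ w → 0ℚ + t * w) (z t)) (l t))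
  where
  l : ∀ t → 0ℚ + t * 0ℚ ≡ 0ℚ
  l = solve 1 (λ t → :0 :+ t :* :0 := :0) refl
...   | no c≢0 = inj₂ (0 , (λ _ → c) , refl , pf-con c , (λ t u tu → trans (l c u) (cong (λ w → 1ℚ * (c + u * w)) (sym (z u)))) , c≢0)
  where
  l : ∀ c u → c ≡ 1ℚ * (c + u * 0ℚ)
  l = solve 2 (λ c u → c := :1 :* (c :+ u :* :0)) refl

-- Reversals with exponents d and deg P differ by a power of t away from 0. Both are nonzero at 0,
-- so that power is trivial.
deg-reversal : ∀ d P {R} → PolyFun R → Reversal d P R → R 0ℚ ≢ 0ℚ → deg P ≡ just d
deg-reversal d P {R} pR rev R≢0 = go (deg-cases P)
  where
  -- t^e R' = R on t ≠ 0 forces e = 0 when R does not vanish at 0.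
  excess : ∀ e {R R'} → PolyFun R → PolyFun R' → (∀ t → t ≢ 0ℚ → R t ≡ t ^ suc e * R' t) → R 0ℚ ≡ 0ℚ
  excess e {R} {R'} p p' h = trans (pf-dense-≡ p (pf-* (pf-^ pf-id (suc e)) p') pf-id 1ℚ 1≢0 h 0ℚ) (l (0ℚ ^ e) (R' 0ℚ))
    where
    l : ∀ a b → 0ℚ * a * b ≡ 0ℚ
    l = solve 2 (λ a b → :0 :* a :* b := :0) refl
  shift : ∀ a b c {A B : ℚ} {t} → t ≢ 0ℚ → c ≡ b ℕ.+ suc a → A ≡ t ^ c * B → ∀ {A'} → A' ≡ t ^ b * B → A ≡ t ^ suc a * A'
  shift a b .(b ℕ.+ suc a) {A} {B} {t} t≢0 refl e₁ e₂ = trans e₁ (trans (cong (_* B) (^-+ t b (suc a))) (trans (l (t ^ b) (t ^ suc a) B) (cong (t ^ suc a *_) (sym e₂))))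
    where
    l : ∀ x y z → x * y * z ≡ y * (x * z)
    l = solve 3 (λ x y z → x :* y :* z := y :* (x :* z)) refl
  go : _ → deg P ≡ just d
  go (inj₁ (_ , z)) = ⊥-elim (R≢0 (pf-dense pR pf-id 1ℚ 1≢0 (λ t t≢0 → trans (rev t _ (proj₂ (inv t t≢0))) (trans (cong (t ^ d *_) (z (proj₁ (inv t t≢0)))) (ℚP.*-zeroʳ (t ^ d)))) 0ℚ))
  go (inj₂ (e , R' , eq , pR' , rev' , R'≢0)) with ℕP.<-cmp e d
  ... | tri≈ _ refl _ = eq
  ... | tri< e<d _ _ = ⊥-elim (R≢0 (excess (d ℕ.∸ suc e) pR pR' λ t t≢0 →
          shift (d ℕ.∸ suc e) e d t≢0 (sym (trans (ℕP.+-suc e (d ℕ.∸ suc e)) (ℕP.m+[n∸m]≡n e<d))) (rev t _ (proj₂ (inv t t≢0))) (rev' t _ (proj₂ (inv t t≢0)))))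
  ... | tri> _ _ d<e = ⊥-elim (R'≢0 (excess (e ℕ.∸ suc d) pR' pR λ t t≢0 →
          shift (e ℕ.∸ suc d) d e t≢0 (sym (trans (ℕP.+-suc d (e ℕ.∸ suc d)) (ℕP.m+[n∸m]≡n d<e))) (rev' t _ (proj₂ (inv t t≢0))) (rev t _ (proj₂ (inv t t≢0)))))

-- Products with omitted indices, polynomiality of F and G, bordered blocks

prodLt-≢0 : ∀ {n} {f : Fin n → Fin n → ℚ} → (∀ i j → i Data.Fin.< j → f i j ≢ 0ℚ) → prodLt f ≢ 0ℚ
prodLt-≢0 {zero}  nz = 1≢0
prodLt-≢0 {suc n} nz = *-≢0 (prodF-≢0 (λ j → nz zero (suc j) (ℕ.s≤s ℕ.z≤n))) (prodLt-≢0 (λ i j i<j → nz (suc i) (suc j) (ℕ.s≤s i<j)))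

ι-<-≢ : ∀ {a b} → a ℕ.< b → ι b - ι a ≢ 0ℚ
ι-<-≢ {a} {b} a<b = subst (λ c → ι c - ι a ≢ 0ℚ) (trans (sym (ℕP.+-suc (b ℕ.∸ suc a) a)) (ℕP.m∸n+n≡m a<b)) (ι-diff≢0 a (b ℕ.∸ suc a))

vdm-ι≢0 : ∀ n → vdm {n} (λ i → ι (toℕ i)) ≢ 0ℚ
vdm-ι≢0 n = prodLt-≢0 {n} (λ i j i<j → ι-<-≢ i<j)

-- The product over the indices other than j, defined for any size n so that it can be used where n
-- is not displayed as a successor.
skipProd : ∀ {n} → (Fin n → ℚ) → Fin n → ℚ
skipProd {suc n} g j = prodF (λ k → g (punchIn j k))

skipProd-* : ∀ {n} (g : Fin n → ℚ) j → g j * skipProd g j ≡ prodF g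
skipProd-* {suc n} g j = sym (prodF-punchIn g j)

skipProd-cong : ∀ {n} {g g' : Fin n → ℚ} j → (∀ k → g k ≡ g' k) → skipProd g j ≡ skipProd g' j
skipProd-cong {suc n} j eq = prodF-cong (λ k → eq (punchIn j k))

module _ {V : Set} where
  poly-skipProd : ∀ {n} {f : Fin n → Env V → ℚ} → (∀ i → IsPoly (f i)) → ∀ j → IsPoly (λ ρ → skipProd (λ k → f k ρ) j)
  poly-skipProd {suc n} p j = poly-prodF (λ k → p (punchIn j k))

  poly-Fp : ∀ {t x y z : Env V → ℚ} → IsPoly t → IsPoly x → IsPoly y → IsPoly z → IsPoly (λ ρ → Fp (t ρ) (x ρ) (y ρ) (z ρ))
  poly-Fp t x y z = poly-+ (poly-sub (poly-* (poly-* (poly-* (poly-+ t (poly-con two)) x) y) z)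
      (poly-* t (poly-+ (poly-+ (poly-+ (poly-+ (poly-+ (poly-* x y) (poly-* y z)) (poly-* x z)) x) y) z)))
    (poly-* t (poly-+ (poly-* (poly-con two) t) (poly-con 1ℚ)))

  poly-Gp : ∀ {t x y : Env V → ℚ} → IsPoly t → IsPoly x → IsPoly y → IsPoly (λ ρ → Gp (t ρ) (x ρ) (y ρ))
  poly-Gp t x y = poly-+ (poly-sub (poly-sub (poly-* (poly-* (poly-* (poly-+ t (poly-con two)) x) y) (poly-+ x y))
        (poly-* t (poly-+ (poly-* x x) (poly-* y y))))
      (poly-* (poly-* (poly-* (poly-con two) (poly-+ (poly-+ (poly-* t t) (poly-* (poly-con (ℕ→ℚ 3)) t)) (poly-con 1ℚ))) x) y))
    (poly-* (poly-* t (poly-+ (poly-* (poly-con two) t) (poly-con 1ℚ))) (poly-+ x y))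

  poly-vdm : ∀ {n} {x : Fin n → Env V → ℚ} → (∀ i → IsPoly (x i)) → IsPoly (λ ρ → vdm (λ i → x i ρ))
  poly-vdm p = poly-prodLt (λ i j → poly-sub (p j) (p i))

extra : ∀ k → Fin 2 → Fin (suc (suc k))
extra zero    e = e
extra (suc k) e = suc (extra k e)

prodF-keep : ∀ k e (f : Fin (suc (suc k)) → ℚ) → prodF (λ i → f (keep k e i)) ≡ prodF (λ i → f (common k i)) * f (extra k e)
prodF-keep zero    e f = trans (ℚP.*-identityʳ (f e)) (sym (ℚP.*-identityˡ (f e)))
prodF-keep (suc k) e f = trans (cong (f zero *_) (prodF-keep k e (λ i → f (suc i)))) (sym (ℚP.*-assoc (f zero) (prodF (λ i → f (suc (common k i)))) (f (suc (extra k e)))))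

prodF-bordered : ∀ k (f : Fin (suc (suc k)) → ℚ) → prodF f ≡ prodF (λ i → f (common k i)) * (f (extra k zero) * f (extra k (suc zero)))
prodF-bordered zero    f = lem (f zero) (f (suc zero))
  where
  lem : ∀ a b → a * (b * 1ℚ) ≡ 1ℚ * (a * b)
  lem = solve 2 (λ a b → a :* (b :* :1) := :1 :* (a :* b)) refl
prodF-bordered (suc k) f = trans (cong (f zero *_) (prodF-bordered k (λ i → f (suc i)))) (sym (ℚP.*-assoc (f zero) _ _))

gaps : ∀ k → (Fin (suc (suc k)) → ℚ) → Fin 2 → ℚ
gaps k x e = prodF (λ i → x (extra k e) - x (common k i))

vdm-keep : ∀ k e (x : Fin (suc (suc k)) → ℚ) → vdm (λ i → x (keep k e i)) ≡ vdm (λ i → x (common k i)) * gaps k x e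
vdm-keep zero    e x = refl
vdm-keep (suc k) e x = trans (cong₂ _*_ (prodF-keep k e (λ j → x (suc j) - x zero)) (vdm-keep k e (λ i → x (suc i))))
  (lem (prodF (λ i → x (suc (common k i)) - x zero)) (x (suc (extra k e)) - x zero) (vdm (λ i → x (suc (common k i)))) (gaps k (λ i → x (suc i)) e))
  where
  lem : ∀ a b c d → a * b * (c * d) ≡ a * c * (b * d)
  lem = solve 4 (λ a b c d → a :* b :* (c :* d) := a :* c :* (b :* d)) refl

vdm-bordered : ∀ k (x : Fin (suc (suc k)) → ℚ) →
  vdm x ≡ vdm (λ i → x (common k i)) * (gaps k x zero * gaps k x (suc zero)) * (x (extra k (suc zero)) - x (extra k zero))
vdm-bordered zero    x = lem (x zero) (x (suc zero))
  where
  lem : ∀ a b → (b - a) * 1ℚ * (1ℚ * 1ℚ) ≡ 1ℚ * (1ℚ * 1ℚ) * (b - a)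
  lem = solve 2 (λ a b → (b :- a) :* :1 :* (:1 :* :1) := :1 :* (:1 :* :1) :* (b :- a)) refl
vdm-bordered (suc k) x = trans (cong₂ _*_ (prodF-bordered k (λ j → x (suc j) - x zero)) (vdm-bordered k (λ i → x (suc i))))
  (lem (prodF (λ i → x (suc (common k i)) - x zero)) (x (suc (extra k zero)) - x zero) (x (suc (extra k (suc zero))) - x zero)
       (vdm (λ i → x (suc (common k i)))) (gaps k (λ i → x (suc i)) zero) (gaps k (λ i → x (suc i)) (suc zero)) (x (suc (extra k (suc zero))) - x (suc (extra k zero))))
  where
  lem : ∀ a b b' c d d' e → a * (b * b') * (c * (d * d') * e) ≡ a * c * (b * d * (b' * d')) * e
  lem = solve 7 (λ a b b' c d d' e → a :* (b :* b') :* (c :* (d :* d') :* e) := a :* c :* (b :* d :* (b' :* d')) :* e) refl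

snoc : ∀ {n} {A : Set} → (Fin n → A) → A → Fin (suc n) → A
snoc {zero}  X a zero    = a
snoc {suc n} X a zero    = X zero
snoc {suc n} X a (suc i) = snoc (λ k → X (suc k)) a i

-- The environment that is local to `IsS`, made available outside of it.
envS : ∀ {n} → (Fin n → ℚ) → (Fin n → ℚ) → ℚ → ℚ → SVar n → ℚ
envS x y z t (xv i) = x i
envS x y z t (yv j) = y j
envS x y z t zv     = z
envS x y z t ζv     = t

envS-cong : ∀ {n} {x x' y y' : Fin n → ℚ} {z t} → (∀ i → x i ≡ x' i) → (∀ i → y i ≡ y' i) → ∀ v → envS x y z t v ≡ envS x' y' z t v
envS-cong ex ey (xv i) = ex i
envS-cong ex ey (yv j) = ey j
envS-cong ex ey zv     = refl
envS-cong ex ey ζv     = refl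

-- Symmetric functions of vectors

swapAt : ∀ {A : Set} {m} → ℕ → Vec A m → Vec A m
swapAt zero    (a ∷ b ∷ v) = b ∷ a ∷ v
swapAt (suc k) (a ∷ v)     = a ∷ swapAt k v
swapAt zero    []          = []
swapAt zero    (a ∷ [])    = a ∷ []
swapAt (suc k) []          = []

swapIndex : ∀ {m} → ℕ → Fin m → Fin m
swapIndex {suc (suc m)} zero zero          = suc zero
swapIndex {suc (suc m)} zero (suc zero)    = zero
swapIndex {suc (suc m)} zero (suc (suc i)) = suc (suc i)
swapIndex {suc zero}    zero i             = i
swapIndex (suc k) zero    = zero
swapIndex (suc k) (suc i) = suc (swapIndex k i)

lookup-swapAt : ∀ {A : Set} {m} k (v : Vec A m) i → lookup (swapAt k v) i ≡ lookup v (swapIndex k i)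
lookup-swapAt zero (a ∷ b ∷ v) zero          = refl
lookup-swapAt zero (a ∷ b ∷ v) (suc zero)    = refl
lookup-swapAt zero (a ∷ b ∷ v) (suc (suc i)) = refl
lookup-swapAt zero (a ∷ [])    zero          = refl
lookup-swapAt (suc k) (a ∷ v)  zero          = refl
lookup-swapAt (suc k) (a ∷ v)  (suc i)       = lookup-swapAt k v i

data Perm {A : Set} : ∀ {m} → Vec A m → Vec A m → Set where
  prefl  : ∀ {m} {u : Vec A m} → Perm u u
  pswap  : ∀ {m} {a b} {u : Vec A m} → Perm (a ∷ b ∷ u) (b ∷ a ∷ u)
  pcons  : ∀ {m} {a} {u v : Vec A m} → Perm u v → Perm (a ∷ u) (a ∷ v)
  ptrans : ∀ {m} {u v w : Vec A m} → Perm u v → Perm v w → Perm u w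

Symmetric : ∀ {A : Set} {m} → (Vec A m → ℚ) → Set
Symmetric f = ∀ k v → f (swapAt k v) ≡ f v

symmetric-perm : ∀ {A : Set} {m} (f : Vec A m → ℚ) → Symmetric f → ∀ {u v} → Perm u v → f u ≡ f v
symmetric-perm f s prefl = refl
symmetric-perm f s (pswap {a = a} {b} {u}) = sym (s 0 (a ∷ b ∷ u))
symmetric-perm f s (pcons {a = a} p) = symmetric-perm (λ v → f (a ∷ v)) (λ k v → s (suc k) (a ∷ v)) p
symmetric-perm f s (ptrans p q) = trans (symmetric-perm f s p) (symmetric-perm f s q)

-- Twice n, by recursion on pairs, so that vectors of this length plus one are matched two entries
-- at a time.
dbl : ℕ → ℕ
dbl zero    = zero
dbl (suc n) = suc (suc (dbl n))

-- A vector (x_n , y_n , … , x_1 , y_1 , z) lists the arguments of S_n.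
xpos ypos : ∀ n → Fin n → Fin (suc (dbl n))
xpos (suc n) = snoc (λ i → suc (suc (xpos n i))) zero
ypos (suc n) = snoc (λ i → suc (suc (ypos n i))) (suc zero)

zpos : ∀ n → Fin (suc (dbl n))
zpos zero    = zero
zpos (suc n) = suc (suc (zpos n))

snoc-map : ∀ {A B : Set} {n} (f : A → B) (X : Fin n → A) a i → f (snoc X a i) ≡ snoc (λ i → f (X i)) (f a) i
snoc-map {n = zero}  f X a zero    = refl
snoc-map {n = suc n} f X a zero    = refl
snoc-map {n = suc n} f X a (suc i) = snoc-map f (λ i → X (suc i)) a i

snoc-cong : ∀ {A : Set} {n} {X X' : Fin n → A} → (∀ i → X i ≡ X' i) → ∀ {a} i → snoc X a i ≡ snoc X' a i
snoc-cong {n = zero}  eq zero    = refl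
snoc-cong {n = suc n} eq zero    = eq zero
snoc-cong {n = suc n} eq (suc i) = snoc-cong (λ i → eq (suc i)) i

snoc-snoc-common : ∀ {A : Set} k (X : Fin k → A) a b i → snoc (snoc X a) b (common k i) ≡ X i
snoc-snoc-common (suc k) X a b zero    = refl
snoc-snoc-common (suc k) X a b (suc i) = snoc-snoc-common k (λ i → X (suc i)) a b i

snoc-snoc-keep₀ : ∀ {A : Set} k (X : Fin k → A) a b i → snoc (snoc X a) b (keep k zero i) ≡ snoc X a i
snoc-snoc-keep₀ zero    X a b zero    = refl
snoc-snoc-keep₀ (suc k) X a b zero    = refl
snoc-snoc-keep₀ (suc k) X a b (suc i) = snoc-snoc-keep₀ k (λ i → X (suc i)) a b i

snoc-snoc-keep₁ : ∀ {A : Set} k (X : Fin k → A) a b i → snoc (snoc X a) b (keep k (suc zero) i) ≡ snoc X b i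
snoc-snoc-keep₁ zero    X a b zero    = refl
snoc-snoc-keep₁ (suc k) X a b zero    = refl
snoc-snoc-keep₁ (suc k) X a b (suc i) = snoc-snoc-keep₁ k (λ i → X (suc i)) a b i

snoc-snoc-extra₀ : ∀ {A : Set} k (X : Fin k → A) a b → snoc (snoc X a) b (extra k zero) ≡ a
snoc-snoc-extra₀ zero    X a b = refl
snoc-snoc-extra₀ (suc k) X a b = snoc-snoc-extra₀ k (λ i → X (suc i)) a b

snoc-snoc-extra₁ : ∀ {A : Set} k (X : Fin k → A) a b → snoc (snoc X a) b (extra k (suc zero)) ≡ b
snoc-snoc-extra₁ zero    X a b = refl
snoc-snoc-extra₁ (suc k) X a b = snoc-snoc-extra₁ k (λ i → X (suc i)) a b

-- With three entries appended, `adj` at this position exchanges the first two of them.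
mid : ∀ n → Fin (suc (suc n))
mid zero    = zero
mid (suc n) = suc (mid n)

snoc³-adj : ∀ {A : Set} n (X : Fin n → A) p a b i → snoc (snoc (snoc X p) a) b (adj (mid n) i) ≡ snoc (snoc (snoc X a) p) b i
snoc³-adj zero    X p a b zero             = refl
snoc³-adj zero    X p a b (suc zero)       = refl
snoc³-adj zero    X p a b (suc (suc zero)) = refl
snoc³-adj (suc n) X p a b zero             = refl
snoc³-adj (suc n) X p a b (suc i)          = snoc³-adj n (λ i → X (suc i)) p a b i

enc : ∀ {A : Set} n → (Fin n → A) → (Fin n → A) → A → Vec A (suc (dbl n))
enc zero    x y z = z ∷ []
enc (suc n) x y z = x (fromℕ n) ∷ y (fromℕ n) ∷ enc n (λ i → x (inject₁ i)) (λ i → y (inject₁ i)) z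

snoc-last : ∀ {A : Set} n (x : Fin (suc n) → A) i → snoc (λ i → x (inject₁ i)) (x (fromℕ n)) i ≡ x i
snoc-last zero    x zero    = refl
snoc-last (suc n) x zero    = refl
snoc-last (suc n) x (suc i) = snoc-last n (λ i → x (suc i)) i

enc-x : ∀ {A : Set} n (x y : Fin n → A) z i → lookup (enc n x y z) (xpos n i) ≡ x i
enc-x (suc n) x y z i = trans (snoc-map (lookup (enc (suc n) x y z)) (λ i → suc (suc (xpos n i))) zero i)
  (trans (snoc-cong (enc-x n (λ i → x (inject₁ i)) (λ i → y (inject₁ i)) z) i) (snoc-last n x i))

enc-y : ∀ {A : Set} n (x y : Fin n → A) z i → lookup (enc n x y z) (ypos n i) ≡ y i
enc-y (suc n) x y z i = trans (snoc-map (lookup (enc (suc n) x y z)) (λ i → suc (suc (ypos n i))) (suc zero) i)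
  (trans (snoc-cong (enc-y n (λ i → x (inject₁ i)) (λ i → y (inject₁ i)) z) i) (snoc-last n y i))

enc-z : ∀ {A : Set} n (x y : Fin n → A) z → lookup (enc n x y z) (zpos n) ≡ z
enc-z zero    x y z = refl
enc-z (suc n) x y z = enc-z n (λ i → x (inject₁ i)) (λ i → y (inject₁ i)) z

-- Identities satisfied by F and G

Gp-sym : ∀ t x y → Gp t x y ≡ Gp t y x
Gp-sym t x y = lem t x y
  where
  lem : ∀ t x y → (t + two) * x * y * (x + y) - t * (x * x + y * y) - two * (t * t + ℕ→ℚ 3 * t + 1ℚ) * x * y + t * (two * t + 1ℚ) * (x + y)
    ≡ (t + two) * y * x * (y + x) - t * (y * y + x * x) - two * (t * t + ℕ→ℚ 3 * t + 1ℚ) * y * x + t * (two * t + 1ℚ) * (y + x)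
  lem = solve 3 (λ t x y → (t :+ :2) :* x :* y :* (x :+ y) :- t :* (x :* x :+ y :* y) :- :2 :* (t :* t :+ :3 :* t :+ :1) :* x :* y :+ t :* (:2 :* t :+ :1) :* (x :+ y) := (t :+ :2) :* y :* x :* (y :+ x) :- t :* (y :* y :+ x :* x) :- :2 :* (t :* t :+ :3 :* t :+ :1) :* y :* x :+ t :* (:2 :* t :+ :1) :* (y :+ x)) refl

Fp-sym₁₂ : ∀ t x y z → Fp t x y z ≡ Fp t y x z
Fp-sym₁₂ t x y z = lem t x y z
  where
  lem : ∀ t x y z → (t + two) * x * y * z - t * (x * y + y * z + x * z + x + y + z) + t * (two * t + 1ℚ)
    ≡ (t + two) * y * x * z - t * (y * x + x * z + y * z + y + x + z) + t * (two * t + 1ℚ)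
  lem = solve 4 (λ t x y z → (t :+ :2) :* x :* y :* z :- t :* (x :* y :+ y :* z :+ x :* z :+ x :+ y :+ z) :+ t :* (:2 :* t :+ :1) := (t :+ :2) :* y :* x :* z :- t :* (y :* x :+ x :* z :+ y :* z :+ y :+ x :+ z) :+ t :* (:2 :* t :+ :1)) refl

Fp-sym₂₃ : ∀ t x y z → Fp t x y z ≡ Fp t x z y
Fp-sym₂₃ t x y z = lem t x y z
  where
  lem : ∀ t x y z → (t + two) * x * y * z - t * (x * y + y * z + x * z + x + y + z) + t * (two * t + 1ℚ)
    ≡ (t + two) * x * z * y - t * (x * z + z * y + x * y + x + z + y) + t * (two * t + 1ℚ)
  lem = solve 4 (λ t x y z → (t :+ :2) :* x :* y :* z :- t :* (x :* y :+ y :* z :+ x :* z :+ x :+ y :+ z) :+ t :* (:2 :* t :+ :1) := (t :+ :2) :* x :* z :* y :- t :* (x :* z :+ z :* y :+ x :* y :+ x :+ z :+ y) :+ t :* (:2 :* t :+ :1)) refl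

-- Brought to one side, this is a cyclic sum over c, d, z that is alternating and of degree at most
-- two in each, hence a constant times their Vandermonde product. With G(a, c) = α c² + β c + γ and
-- F(a, d, z) = λ d z + μ (d + z) + ν the constant is α ν - β μ + γ λ up to sign. It vanishes
-- because α = λ, β = λ (a - 2t - 1) and γ + ν = μ (a - 2t - 1).
three-term : ∀ t a c d z →
  (d - z) * Gp t a c * Fp t a d z ≡ (c - z) * Gp t a d * Fp t a c z + (d - c) * Gp t a z * Fp t a c d
three-term t a c d z = lem t a c d z
  where
  lem : ∀ t a c d z →
    (d - z) * ((t + two) * a * c * (a + c) - t * (a * a + c * c) - two * (t * t + ℕ→ℚ 3 * t + 1ℚ) * a * c + t * (two * t + 1ℚ) * (a + c)) * ((t + two) * a * d * z - t * (a * d + d * z + a * z + a + d + z) + t * (two * t + 1ℚ))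
    ≡ (c - z) * ((t + two) * a * d * (a + d) - t * (a * a + d * d) - two * (t * t + ℕ→ℚ 3 * t + 1ℚ) * a * d + t * (two * t + 1ℚ) * (a + d)) * ((t + two) * a * c * z - t * (a * c + c * z + a * z + a + c + z) + t * (two * t + 1ℚ))
      + (d - c) * ((t + two) * a * z * (a + z) - t * (a * a + z * z) - two * (t * t + ℕ→ℚ 3 * t + 1ℚ) * a * z + t * (two * t + 1ℚ) * (a + z)) * ((t + two) * a * c * d - t * (a * c + c * d + a * d + a + c + d) + t * (two * t + 1ℚ))
  lem = solve 5 (λ t a c d z → (d :- z) :* ((t :+ :2) :* a :* c :* (a :+ c) :- t :* (a :* a :+ c :* c) :- :2 :* (t :* t :+ :3 :* t :+ :1) :* a :* c :+ t :* (:2 :* t :+ :1) :* (a :+ c)) :* ((t :+ :2) :* a :* d :* z :- t :* (a :* d :+ d :* z :+ a :* z :+ a :+ d :+ z) :+ t :* (:2 :* t :+ :1)) := (c :- z) :* ((t :+ :2) :* a :* d :* (a :+ d) :- t :* (a :* a :+ d :* d) :- :2 :* (t :* t :+ :3 :* t :+ :1) :* a :* d :+ t :* (:2 :* t :+ :1) :* (a :+ d)) :* ((t :+ :2) :* a :* c :* z :- t :* (a :* c :+ c :* z :+ a :* z :+ a :+ c :+ z) :+ t :* (:2 :* t :+ :1)) :+ (d :- c) :* ((t :+ :2) :* a :* z :* (a :+ z) :- t :* (a :* a :+ z :* z) :- :2 :* (t :* t :+ :3 :* t :+ :1) :* a :* z :+ t :* (:2 :* t :+ :1) :* (a :+ z))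 :* ((t :+ :2) :* a :* c :* d :- t :* (a :* c :+ c :* d :+ a :* d :+ a :+ c :+ d) :+ t :* (:2 :* t :+ :1))) refl

prodF-const : ∀ n c → prodF {n} (λ _ → c) ≡ c ^ n
prodF-const zero    c = refl
prodF-const (suc n) c = cong (c *_) (prodF-const n c)

prodF-^ : ∀ {n} (f : Fin n → ℚ) k → prodF (λ i → f i ^ k) ≡ prodF f ^ k
prodF-^ {zero}  f k = sym (1-^ k)
prodF-^ {suc n} f k = trans (cong (f zero ^ k *_) (prodF-^ (λ i → f (suc i)) k)) (sym (*-^ (f zero) (prodF (λ i → f (suc i))) k))

-- Each index lies in n - 1 pairs; the extra factor `prodF x` completes the exponent to n and avoids
-- a subtraction.
prodLt-pairs : ∀ {n} (x : Fin n → ℚ) → prodLt (λ i j → x i * x j) * prodF x ≡ prodF x ^ n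
prodLt-pairs {zero}  x = refl
prodLt-pairs {suc n} x = begin
  prodF (λ j → x zero * x (suc j)) * L * (x zero * P)
    ≡⟨ cong (λ w → w * L * (x zero * P)) (trans (prodF-* (λ _ → x zero) (λ j → x (suc j))) (cong (_* P) (prodF-const n (x zero)))) ⟩
  x zero ^ n * P * L * (x zero * P)
    ≡⟨ l₁ (x zero ^ n) P L (x zero) ⟩
  x zero * x zero ^ n * (P * (L * P))
    ≡⟨ cong (λ w → x zero * x zero ^ n * (P * w)) (prodLt-pairs (λ i → x (suc i))) ⟩
  x zero ^ suc n * P ^ suc n
    ≡⟨ sym (*-^ (x zero) P (suc n)) ⟩
  (x zero * P) ^ suc n ∎
  where
  open ≡-Reasoning
  L P : ℚ
  L = prodLt (λ i j → x (suc i) * x (suc j))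
  P = prodF (λ i → x (suc i))
  l₁ : ∀ a p l x → a * p * l * (x * p) ≡ x * a * (p * (l * p))
  l₁ = solve 4 (λ a p l x → a :* p :* l :* (x :* p) := x :* a :* (p :* (l :* p))) refl

Fp-inv : ∀ t t' x x' y y' z z' → t * t' ≡ 1ℚ → x * x' ≡ 1ℚ → y * y' ≡ 1ℚ → z * z' ≡ 1ℚ →
  t * t * (x * y * z) * Fp t' x' y' z' ≡ Fp t x y z
Fp-inv t t' x x' y y' z z' ht hx hy hz = trans (l₁ t t' x x' y y' z z')
  (trans (cong (λ a → Φ a (x * x') (y * y') (z * z')) ht) (trans (cong (λ b → Φ 1ℚ b (y * y') (z * z')) hx)
    (trans (cong (λ c → Φ 1ℚ 1ℚ c (z * z')) hy) (trans (cong (Φ 1ℚ 1ℚ 1ℚ) hz) (l₂ t x y z)))))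
  where
  -- Φ is the left side written through the products t t', x x', y y', z z', which are replaced by 1
  -- one at a time.
  Φ : ℚ → ℚ → ℚ → ℚ → ℚ
  Φ a b c d = (t * a + two * t * t) * (b * c * d) - t * a * (b * c * z + x * c * d + b * y * d + b * y * z + x * c * z + x * y * d) + (two * a * a + t * a) * (x * y * z)
  l₁ : ∀ t t' x x' y y' z z' → t * t * (x * y * z) * ((t' + two) * x' * y' * z' - t' * (x' * y' + y' * z' + x' * z' + x' + y' + z') + t' * (two * t' + 1ℚ))
    ≡ (t * (t * t') + two * t * t) * ((x * x') * (y * y') * (z * z')) - t * (t * t') * ((x * x') * (y * y') * z + x * (y * y') * (z * z') + (x * x') * y * (z * z') + (x * x') * y * z + x * (y * y') * z + x * y * (z * z'))
      + (two * (t * t') * (t * t') + t * (t * t')) * (x * y * z)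
  l₁ = solve 8 (λ t t' x x' y y' z z' → t :* t :* (x :* y :* z) :* ((t' :+ :2) :* x' :* y' :* z' :- t' :* (x' :* y' :+ y' :* z' :+ x' :* z' :+ x' :+ y' :+ z') :+ t' :* (:2 :* t' :+ :1)) := (t :* (t :* t') :+ :2 :* t :* t) :* ((x :* x') :* (y :* y') :* (z :* z')) :- t :* (t :* t') :* ((x :* x') :* (y :* y') :* z :+ x :* (y :* y') :* (z :* z') :+ (x :* x') :* y :* (z :* z') :+ (x :* x') :* y :* z :+ x :* (y :* y') :* z :+ x :* y :* (z :* z')) :+ (:2 :* (t :* t') :* (t :* t') :+ t :* (t :* t')) :* (x :* y :* z)) refl
  l₂ : ∀ t x y z → (t * 1ℚ + two * t * t) * (1ℚ * 1ℚ * 1ℚ) - t * 1ℚ * (1ℚ * 1ℚ * z + x * 1ℚ * 1ℚ + 1ℚ * y * 1ℚ + 1ℚ * y * z + x * 1ℚ * z + x * y * 1ℚ) + (two * 1ℚ * 1ℚ + t * 1ℚ) * (x * y * z)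
    ≡ (t + two) * x * y * z - t * (x * y + y * z + x * z + x + y + z) + t * (two * t + 1ℚ)
  l₂ = solve 4 (λ t x y z → (t :* :1 :+ :2 :* t :* t) :* (:1 :* :1 :* :1) :- t :* :1 :* (:1 :* :1 :* z :+ x :* :1 :* :1 :+ :1 :* y :* :1 :+ :1 :* y :* z :+ x :* :1 :* z :+ x :* y :* :1) :+ (:2 :* :1 :* :1 :+ t :* :1) :* (x :* y :* z) := (t :+ :2) :* x :* y :* z :- t :* (x :* y :+ y :* z :+ x :* z :+ x :+ y :+ z) :+ t :* (:2 :* t :+ :1)) refl

Gp-inv : ∀ t t' x x' y y' → t * t' ≡ 1ℚ → x * x' ≡ 1ℚ → y * y' ≡ 1ℚ →
  t * t * (x * x) * (y * y) * Gp t' x' y' ≡ Gp t x y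
Gp-inv t t' x x' y y' ht hx hy = trans (l₁ t t' x x' y y') (trans (cong (λ a → Φ a (x * x') (y * y')) ht)
    (trans (cong (λ b → Φ 1ℚ b (y * y')) hx) (trans (cong (Φ 1ℚ 1ℚ) hy) (l₂ t x y))))
  where
  Φ : ℚ → ℚ → ℚ → ℚ
  Φ a b c = (t * a + two * t * t) * (b * c) * (b * y + x * c) - t * a * (b * b * (y * y) + c * c * (x * x)) - two * (a * a + ℕ→ℚ 3 * t * a + t * t) * (b * c) * (x * y) + (two * a * a + t * a) * (b * x * (y * y) + c * (x * x) * y)
  l₁ : ∀ t t' x x' y y' → t * t * (x * x) * (y * y) * ((t' + two) * x' * y' * (x' + y') - t' * (x' * x' + y' * y') - two * (t' * t' + ℕ→ℚ 3 * t' + 1ℚ) * x' * y' + t' * (two * t' + 1ℚ) * (x' + y'))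
    ≡ (t * (t * t') + two * t * t) * ((x * x') * (y * y')) * ((x * x') * y + x * (y * y')) - t * (t * t') * ((x * x') * (x * x') * (y * y) + (y * y') * (y * y') * (x * x))
      - two * ((t * t') * (t * t') + ℕ→ℚ 3 * t * (t * t') + t * t) * ((x * x') * (y * y')) * (x * y) + (two * (t * t') * (t * t') + t * (t * t')) * ((x * x') * x * (y * y) + (y * y') * (x * x) * y)
  l₁ = solve 6 (λ t t' x x' y y' → t :* t :* (x :* x) :* (y :* y) :* ((t' :+ :2) :* x' :* y' :* (x' :+ y') :- t' :* (x' :* x' :+ y' :* y') :- :2 :* (t' :* t' :+ :3 :* t' :+ :1) :* x' :* y' :+ t' :* (:2 :* t' :+ :1) :* (x' :+ y')) := (t :* (t :* t') :+ :2 :* t :* t) :* ((x :* x') :* (y :* y')) :* ((x :* x') :* y :+ x :* (y :* y')) :- t :* (t :* t') :* ((x :* x') :* (x :* x') :* (y :* y) :+ (y :* y') :* (y :* y') :* (x :* x)) :- :2 :* ((t :* t') :* (t :* t') :+ :3 :* t :* (t :* t') :+ t :* t) :* ((x :* x') :* (y :* y')) :* (x :* y) :+ (:2 :* (t :* t') :* (t :* t') :+ t :* (t :* t')) :* ((x :* x') :* x :* (y :* y) :+ (y :* y') :* (x :* x) :* y)) refl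
  l₂ : ∀ t x y → (t * 1ℚ + two * t * t) * (1ℚ * 1ℚ) * (1ℚ * y + x * 1ℚ) - t * 1ℚ * (1ℚ * 1ℚ * (y * y) + 1ℚ * 1ℚ * (x * x)) - two * (1ℚ * 1ℚ + ℕ→ℚ 3 * t * 1ℚ + t * t) * (1ℚ * 1ℚ) * (x * y) + (two * 1ℚ * 1ℚ + t * 1ℚ) * (1ℚ * x * (y * y) + 1ℚ * (x * x) * y)
    ≡ (t + two) * x * y * (x + y) - t * (x * x + y * y) - two * (t * t + ℕ→ℚ 3 * t + 1ℚ) * x * y + t * (two * t + 1ℚ) * (x + y)
  l₂ = solve 3 (λ t x y → (t :* :1 :+ :2 :* t :* t) :* (:1 :* :1) :* (:1 :* y :+ x :* :1) :- t :* :1 :* (:1 :* :1 :* (y :* y) :+ :1 :* :1 :* (x :* x)) :- :2 :* (:1 :* :1 :+ :3 :* t :* :1 :+ t :* t) :* (:1 :* :1) :* (x :* y) :+ (:2 :* :1 :* :1 :+ t :* :1) :* (:1 :* x :* (y :* y) :+ :1 :* (x :* x) :* y) := (t :+ :2) :* x :* y :* (x :+ y) :- t :* (x :* x :+ y :* y) :- :2 :* (t :* t :+ :3 :* t :+ :1) :* x :* y :+ t :* (:2 :* t :+ :1) :* (x :+ y)) refl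

inverse-≢0 : ∀ {a b} → a * b ≡ 1ℚ → a ≢ 0ℚ
inverse-≢0 {b = b} ab refl = 1≢0 (trans (sym ab) (ℚP.*-zeroˡ b))

prodF-inverse : ∀ {n} (f g : Fin n → ℚ) → (∀ i → f i * g i ≡ 1ℚ) → prodF f * prodF g ≡ 1ℚ
prodF-inverse f g fg = trans (sym (prodF-* f g)) (prodF-1 fg)

-- Bookkeeping of exponents

sumℕ-cong : ∀ {n} {a b : Fin n → ℕ} → (∀ i → a i ≡ b i) → sumℕ a ≡ sumℕ b
sumℕ-cong {zero}  eq = refl
sumℕ-cong {suc n} eq = cong₂ ℕ._+_ (eq zero) (sumℕ-cong (λ i → eq (suc i)))

sumℕ-* : ∀ {n} c (a : Fin n → ℕ) → sumℕ (λ i → c ℕ.* a i) ≡ c ℕ.* sumℕ a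
sumℕ-* {zero}  c a = sym (ℕP.*-zeroʳ c)
sumℕ-* {suc n} c a = trans (cong (c ℕ.* a zero ℕ.+_) (sumℕ-* c (λ i → a (suc i)))) (sym (ℕP.*-distribˡ-+ c (a zero) (sumℕ (λ i → a (suc i)))))

sumℕ-0 : ∀ n → sumℕ {n} (λ _ → 0) ≡ 0
sumℕ-0 zero    = refl
sumℕ-0 (suc n) = sumℕ-0 n

sumLtℕ-* : ∀ {n} c (a : Fin n → Fin n → ℕ) → sumLtℕ (λ i j → c ℕ.* a i j) ≡ c ℕ.* sumLtℕ a
sumLtℕ-* {zero}  c a = sym (ℕP.*-zeroʳ c)
sumLtℕ-* {suc n} c a = trans (cong₂ ℕ._+_ (sumℕ-* c (λ j → a zero (suc j))) (sumLtℕ-* c (λ i j → a (suc i) (suc j))))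
  (sym (ℕP.*-distribˡ-+ c (sumℕ (λ j → a zero (suc j))) (sumLtℕ (λ i j → a (suc i) (suc j)))))

bit : Bool → ℕ
bit true  = 1
bit false = 0

-- The binomial n(n - 1)/2, the number of factors of a Vandermonde product in n variables.
tri : ℕ → ℕ
tri zero    = 0
tri (suc n) = n ℕ.+ tri n

sumLtℕ-bit : ∀ {n} (b : Fin n → Bool) → sumLtℕ (λ i j → bit (b i) ℕ.* bit (b j)) ≡ tri (sumℕ (λ i → bit (b i)))
sumLtℕ-bit {zero}  b = refl
sumLtℕ-bit {suc n} b with b zero
... | false = cong₂ ℕ._+_ (sumℕ-0 n) (sumLtℕ-bit (λ i → b (suc i)))
... | true  = cong₂ ℕ._+_ (sumℕ-cong (λ j → ℕP.+-identityʳ (bit (b (suc j))))) (sumLtℕ-bit (λ i → b (suc i)))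

sumLtℕ-1 : ∀ n → sumLtℕ {n} (λ i j → 1) ≡ tri n
sumLtℕ-1 zero    = refl
sumLtℕ-1 (suc n) = cong₂ ℕ._+_ (ones n) (sumLtℕ-1 n)
  where
  ones : ∀ n → sumℕ {n} (λ _ → 1) ≡ n
  ones zero    = refl
  ones (suc n) = cong suc (ones n)

sumℕ-const : ∀ n c → sumℕ {n} (λ _ → c) ≡ n ℕ.* c
sumℕ-const zero    c = refl
sumℕ-const (suc n) c = cong (c ℕ.+_) (sumℕ-const n c)

sumℕ-if : ∀ {n} c (b : Fin n → Bool) → sumℕ (λ i → if b i then c else 0) ≡ sumℕ (λ i → bit (b i)) ℕ.* c
sumℕ-if {zero}  c b = refl
sumℕ-if {suc n} c b with b zero
... | true  = cong (c ℕ.+_) (sumℕ-if c (λ i → b (suc i)))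
... | false = sumℕ-if c (λ i → b (suc i))

skipSum : ∀ {n} → (Fin n → ℕ) → Fin n → ℕ
skipSum {suc n} g j = sumℕ (λ k → g (punchIn j k))

sumℕ-punchIn : ∀ {n} (f : Fin (suc n) → ℕ) j → sumℕ f ≡ f j ℕ.+ sumℕ (λ k → f (punchIn j k))
sumℕ-punchIn f zero = refl
sumℕ-punchIn {suc n} f (suc j) = trans (cong (f zero ℕ.+_) (sumℕ-punchIn (λ k → f (suc k)) j)) (lem (f zero) (f (suc j)) (sumℕ (λ k → f (suc (punchIn j k)))))
  where
  lem : ∀ a b c → a ℕ.+ (b ℕ.+ c) ≡ b ℕ.+ (a ℕ.+ c)
  lem = ℕR.solve-∀

skipSum-+ : ∀ {n} (f : Fin n → ℕ) j → sumℕ f ≡ f j ℕ.+ skipSum f j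
skipSum-+ {suc n} f j = sumℕ-punchIn f j

module _ {W : Set} where
  private
    V : Set
    V = Maybe W

  ord-skipProd : ∀ {n} {a : Fin n → ℕ} {f : Fin n → Env V → ℚ} → (∀ i → Ord (a i) (f i)) → ∀ j → Ord (skipSum a j) (λ ρ → skipProd (λ k → f k ρ) j)
  ord-skipProd {suc n} o j = ord-prodF (λ k → o (punchIn j k))

double-tri : ∀ m → tri m ℕ.+ tri m ℕ.+ m ≡ m ℕ.* m
double-tri zero    = refl
double-tri (suc m) = trans (e m (tri m)) (trans (cong (λ w → w ℕ.+ m ℕ.+ suc m) (double-tri m)) (e' m))
  where
  e : ∀ m r → m ℕ.+ r ℕ.+ (m ℕ.+ r) ℕ.+ suc m ≡ r ℕ.+ r ℕ.+ m ℕ.+ m ℕ.+ suc m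
  e = ℕR.solve-∀
  e' : ∀ m → m ℕ.* m ℕ.+ m ℕ.+ suc m ≡ suc m ℕ.* suc m
  e' = ℕR.solve-∀

^-* : ∀ a m n → (a ^ m) ^ n ≡ a ^ (m ℕ.* n)
^-* a m zero    = cong (a ^_) (sym (ℕP.*-zeroʳ m))
^-* a m (suc n) = trans (cong (a ^ m *_) (^-* a m n)) (trans (sym (^-+ a m (m ℕ.* n))) (cong (a ^_) (sym (ℕP.*-suc m n))))

skipProd-scale : ∀ {n} c (g : Fin n → ℚ) j → skipProd (λ k → c * g k) j ≡ c ^ ℕ.pred n * skipProd g j
skipProd-scale {suc n} c g j = trans (prodF-* (λ _ → c) (λ k → g (punchIn j k))) (cong (_* prodF (λ k → g (punchIn j k))) (prodF-const n c))

prodLt-scale : ∀ {n} c (f : Fin n → Fin n → ℚ) → prodLt (λ i j → c * f i j) ≡ c ^ tri n * prodLt f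
prodLt-scale {zero}  c f = refl
prodLt-scale {suc n} c f = trans (cong₂ _*_ (trans (prodF-* (λ _ → c) (λ j → f zero (suc j))) (cong (_* prodF (λ j → f zero (suc j))) (prodF-const n c))) (prodLt-scale c (λ i j → f (suc i) (suc j))))
  (trans (lem (c ^ n) (prodF (λ j → f zero (suc j))) (c ^ tri n) (prodLt (λ i j → f (suc i) (suc j)))) (cong (_* prodLt f) (sym (^-+ c n (tri n)))))
  where
  lem : ∀ a b c d → a * b * (c * d) ≡ a * c * (b * d)
  lem = solve 4 (λ a b c d → a :* b :* (c :* d) := a :* c :* (b :* d)) refl

poly-ext : ∀ {V : Set} {f : Env V → ℚ} → IsPoly f → ∀ {ρ ρ'} → (∀ v → ρ v ≡ ρ' v) → f ρ ≡ f ρ'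
poly-ext (P , p) {ρ} {ρ'} eq = trans (sym (p ρ)) (trans (evalM-cong P eq) (p ρ'))

-- The central binomials and their log-convexity

-- Multiplication by s + 2 + 1/s of a reciprocal sequence, of which only the half k ≥ 0 is stored: the coefficients of θ_n are the binomials
-- C(2n+1, n−k), and p is the entry at k = −1.
nextH : ℚ → ℚ → List ℚ → ℚ
nextH p c []      = p + two * c
nextH p c (d ∷ r) = p + two * c + d

nextT : ℚ → ℚ → List ℚ → List ℚ
nextT p c []      = c ∷ []
nextT p c (d ∷ r) = nextH c d r ∷ nextT c d r

θH : ℕ → ℚ
θT : ℕ → List ℚ
θH zero    = 1ℚ
θH (suc n) = nextH (θH n) (θH n) (θT n)
θT zero    = []
θT (suc n) = nextT (θH n) (θH n) (θT n)

next-eval : ∀ s p c r → s * evalP (nextH p c r ∷ nextT p c r) s ≡ p * s + (1ℚ + s) * (1ℚ + s) * evalP (c ∷ r) s - c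
next-eval s p c []      = lem s p c
  where
  lem : ∀ s p c → s * (p + two * c + s * (c + s * 0ℚ)) ≡ p * s + (1ℚ + s) * (1ℚ + s) * (c + s * 0ℚ) - c
  lem = solve 3 (λ s p c → s :* (p :+ :2 :* c :+ s :* (c :+ s :* :0)) := p :* s :+ (:1 :+ s) :* (:1 :+ s) :* (c :+ s :* :0) :- c) refl
next-eval s p c (d ∷ r) = trans (cong (λ w → s * (p + two * c + d + w)) (next-eval s c d r)) (lem s p c d (evalP (d ∷ r) s))
  where
  lem : ∀ s p c d l → s * (p + two * c + d + (c * s + (1ℚ + s) * (1ℚ + s) * l - d)) ≡ p * s + (1ℚ + s) * (1ℚ + s) * (c + s * l) - c
  lem = solve 5 (λ s p c d l → s :* (p :+ :2 :* c :+ d :+ (c :* s :+ (:1 :+ s) :* (:1 :+ s) :* l :- d)) := p :* s :+ (:1 :+ s) :* (:1 :+ s) :* (c :+ s :* l) :- c) refl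

-- The quotient of the neighbours C(2N+1, N-k) and C(2N+1, N-k-1), prescribed along the whole list.
-- Past the last entry the neighbour is 0, consistently with the factor N - k.
Ratio : ℚ → ℚ → ℚ → List ℚ → Set
Ratio N k c []      = (N - k) * c ≡ (N + k + two) * 0ℚ
Ratio N k c (d ∷ r) = (N - k) * c ≡ (N + k + two) * d × Ratio N (k + 1ℚ) d r

ratio-head : ∀ {N k c} r → Ratio N k c r → Σ ℚ λ d → (N - k) * c ≡ (N + k + two) * d × (∀ p → nextH p c r ≡ p + two * c + d)
ratio-head {c = c} []  h       = 0ℚ , h , λ p → sym (ℚP.+-identityʳ (p + two * c))
ratio-head (d ∷ r) (h , _)     = d , h , λ p → refl

-- Two steps of Pascal's rule. The hypothesis on p is the ratio with the entry at k - 1, which each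
-- recursive call takes over from the previous head.
ratio-next : ∀ N k p c r → (N - k + 1ℚ) * p ≡ (N + k + 1ℚ) * c → Ratio N k c r → Ratio (N + 1ℚ) k (nextH p c r) (nextT p c r)
ratio-next N k p c [] hp hc = trans (l₁ N k p c) (trans (cong₂ (λ u w → u + two * w + two * c) hp hc) (l₂ N k c)) , trans (l₃ N k c) (trans hc (l₄ N k))
  where
  l₁ : ∀ N k p c → (N + 1ℚ - k) * (p + two * c) ≡ (N - k + 1ℚ) * p + two * ((N - k) * c) + two * c
  l₁ = solve 4 (λ N k p c → (N :+ :1 :- k) :* (p :+ :2 :* c) := (N :- k :+ :1) :* p :+ :2 :* ((N :- k) :* c) :+ :2 :* c) refl
  l₂ : ∀ N k c → (N + k + 1ℚ) * c + two * ((N + k + two) * 0ℚ) + two * c ≡ (N + 1ℚ + k + two) * c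
  l₂ = solve 3 (λ N k c → (N :+ k :+ :1) :* c :+ :2 :* ((N :+ k :+ :2) :* :0) :+ :2 :* c := (N :+ :1 :+ k :+ :2) :* c) refl
  l₃ : ∀ N k c → (N + 1ℚ - (k + 1ℚ)) * c ≡ (N - k) * c
  l₃ = solve 3 (λ N k c → (N :+ :1 :- (k :+ :1)) :* c := (N :- k) :* c) refl
  l₄ : ∀ N k → (N + k + two) * 0ℚ ≡ (N + 1ℚ + (k + 1ℚ) + two) * 0ℚ
  l₄ = solve 2 (λ N k → (N :+ k :+ :2) :* :0 := (N :+ :1 :+ (k :+ :1) :+ :2) :* :0) refl
ratio-next N k p c (d ∷ r) hp (hc , hr) = first , ratio-next N (k + 1ℚ) c d r (trans (l₁ N k c) (trans hc (l₂ N k d))) hr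
  where
  l₁ : ∀ N k c → (N - (k + 1ℚ) + 1ℚ) * c ≡ (N - k) * c
  l₁ = solve 3 (λ N k c → (N :- (k :+ :1) :+ :1) :* c := (N :- k) :* c) refl
  l₂ : ∀ N k d → (N + k + two) * d ≡ (N + (k + 1ℚ) + 1ℚ) * d
  l₂ = solve 3 (λ N k d → (N :+ k :+ :2) :* d := (N :+ (k :+ :1) :+ :1) :* d) refl
  first : (N + 1ℚ - k) * (p + two * c + d) ≡ (N + 1ℚ + k + two) * nextH c d r
  first = go (ratio-head r hr)
    where
    l₃ : ∀ N k p c d → (N + 1ℚ - k) * (p + two * c + d) ≡ (N - k + 1ℚ) * p + two * ((N - k) * c) + two * c + (N + 1ℚ - k) * d
    l₃ = solve 5 (λ N k p c d → (N :+ :1 :- k) :* (p :+ :2 :* c :+ d) := (N :- k :+ :1) :* p :+ :2 :* ((N :- k) :* c) :+ :2 :* c :+ (N :+ :1 :- k) :* d) refl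
    l₄ : ∀ N k c d → (N + k + 1ℚ) * c + two * ((N + k + two) * d) + two * c + (N + 1ℚ - k) * d ≡ (N + 1ℚ + k + two) * (c + two * d) + (N - (k + 1ℚ)) * d
    l₄ = solve 4 (λ N k c d → (N :+ k :+ :1) :* c :+ :2 :* ((N :+ k :+ :2) :* d) :+ :2 :* c :+ (N :+ :1 :- k) :* d := (N :+ :1 :+ k :+ :2) :* (c :+ :2 :* d) :+ (N :- (k :+ :1)) :* d) refl
    l₅ : ∀ N k x e → (N + 1ℚ + k + two) * x + (N + (k + 1ℚ) + two) * e ≡ (N + 1ℚ + k + two) * (x + e)
    l₅ = solve 4 (λ N k x e → (N :+ :1 :+ k :+ :2) :* x :+ (N :+ (k :+ :1) :+ :2) :* e := (N :+ :1 :+ k :+ :2) :* (x :+ e)) refl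
    go : (Σ ℚ λ e → (N - (k + 1ℚ)) * d ≡ (N + (k + 1ℚ) + two) * e × (∀ p → nextH p d r ≡ p + two * d + e)) → (N + 1ℚ - k) * (p + two * c + d) ≡ (N + 1ℚ + k + two) * nextH c d r
    go (e , he , eq) = trans (l₃ N k p c d) (trans (cong₂ (λ u w → u + two * w + two * c + (N + 1ℚ - k) * d) hp hc) (trans (l₄ N k c d)
      (trans (cong ((N + 1ℚ + k + two) * (c + two * d) +_) he) (trans (l₅ N k (c + two * d) e) (cong ((N + 1ℚ + k + two) *_) (sym (eq c)))))))

-- Reciprocity makes the entry at k = -1 equal to the one at k = 0, since C(2n+1, n+1) = C(2n+1, n);
-- so the head serves as its own predecessor.
θ-ratio : ∀ n → Ratio (ι n) 0ℚ (θH n) (θT n)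
θ-ratio zero    = refl
θ-ratio (suc n) = subst (λ N → Ratio N 0ℚ (θH (suc n)) (θT (suc n))) (ℚP.+-comm (ι n) 1ℚ) (ratio-next (ι n) 0ℚ (θH n) (θH n) (θT n) (lem (ι n) (θH n)) (θ-ratio n))
  where
  lem : ∀ N c → (N - 0ℚ + 1ℚ) * c ≡ (N + 0ℚ + 1ℚ) * c
  lem = solve 2 (λ N c → (N :- :0 :+ :1) :* c := (N :+ :0 :+ :1) :* c) refl

-- The new head is three times the old one plus the next entry, and the ratio at k = 0 eliminates
-- that entry.
θH-ratio : ∀ n → (ι n + two) * θH (suc n) ≡ (ℕ→ℚ 4 * ι n + ℕ→ℚ 6) * θH n
θH-ratio n = go (ratio-head (θT n) (θ-ratio n))
  where
  l₁ : ∀ N c d → (N + two) * (c + two * c + d) ≡ (N + two) * (ℕ→ℚ 3 * c) + (N + 0ℚ + two) * d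
  l₁ = solve 3 (λ N c d → (N :+ :2) :* (c :+ :2 :* c :+ d) := (N :+ :2) :* (:3 :* c) :+ (N :+ :0 :+ :2) :* d) refl
  l₂ : ∀ N c → (N + two) * (ℕ→ℚ 3 * c) + (N - 0ℚ) * c ≡ (ℕ→ℚ 4 * N + ℕ→ℚ 6) * c
  l₂ = solve 2 (λ N c → (N :+ :2) :* (:3 :* c) :+ (N :- :0) :* c := (:4 :* N :+ :6) :* c) refl
  go : (Σ ℚ λ d → (ι n - 0ℚ) * θH n ≡ (ι n + 0ℚ + two) * d × (∀ p → nextH p (θH n) (θT n) ≡ p + two * θH n + d)) → (ι n + two) * θH (suc n) ≡ (ℕ→ℚ 4 * ι n + ℕ→ℚ 6) * θH n
  go (d , hd , eq) = trans (cong ((ι n + two) *_) (eq (θH n))) (trans (l₁ (ι n) (θH n) d) (trans (cong ((ι n + two) * (ℕ→ℚ 3 * θH n) +_) (sym hd)) (l₂ (ι n) (θH n))))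

θH≢0 : ∀ n → θH n ≢ 0ℚ
θH≢0 zero    = 1≢0
θH≢0 (suc n) eq = *-≢0 {ℕ→ℚ 4 * ι n + ℕ→ℚ 6} {θH n} coef (θH≢0 n) (trans (sym (θH-ratio n)) (trans (cong ((ι n + two) *_) eq) (ℚP.*-zeroʳ (ι n + two))))
  where
  lem : ∀ N → 1ℚ + (1ℚ + (1ℚ + (1ℚ + (1ℚ + (1ℚ + (N + (N + (N + N)))))))) ≡ ℕ→ℚ 4 * N + ℕ→ℚ 6
  lem = solve 1 (λ N → :1 :+ (:1 :+ (:1 :+ (:1 :+ (:1 :+ (:1 :+ (N :+ (N :+ (N :+ N)))))))) := :4 :* N :+ :6) refl
  coef : ℕ→ℚ 4 * ι n + ℕ→ℚ 6 ≢ 0ℚ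
  coef z = ι-suc≢0 (5 ℕ.+ (n ℕ.+ (n ℕ.+ (n ℕ.+ n)))) (trans (cong (λ w → 1ℚ + (1ℚ + (1ℚ + (1ℚ + (1ℚ + (1ℚ + w))))))
    (trans (ι-+ n _) (cong (ι n +_) (trans (ι-+ n _) (cong (ι n +_) (ι-+ n n)))))) (trans (lem (ι n)) z))

-- Clearing the denominators of the two ratios θ_{n+1}/θ_n, equality would force 2 θ_{n+1}² = 0.
θH-convex : ∀ n → θH n * θH (suc (suc n)) ≢ θH (suc n) * θH (suc n)
θH-convex n eq = *-≢0 {two} {θH (suc n) * θH (suc n)} (λ ()) (*-≢0 (θH≢0 (suc n)) (θH≢0 (suc n))) (begin
  two * (c₁ * c₁)
    ≡⟨ l₁ N c₁ ⟩
  ((N + two) * c₁) * ((ℕ→ℚ 4 * (1ℚ + N) + ℕ→ℚ 6) * c₁) - (ℕ→ℚ 4 * N + ℕ→ℚ 6) * (1ℚ + N + two) * (c₁ * c₁)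
    ≡⟨ cong₂ _-_ (cong₂ _*_ (θH-ratio n) (sym (θH-ratio (suc n)))) (cong ((ℕ→ℚ 4 * N + ℕ→ℚ 6) * (1ℚ + N + two) *_) (sym eq)) ⟩
  ((ℕ→ℚ 4 * N + ℕ→ℚ 6) * c₀) * ((1ℚ + N + two) * c₂) - (ℕ→ℚ 4 * N + ℕ→ℚ 6) * (1ℚ + N + two) * (c₀ * c₂)
    ≡⟨ l₂ (ℕ→ℚ 4 * N + ℕ→ℚ 6) (1ℚ + N + two) c₀ c₂ ⟩
  0ℚ ∎)
  where
  open ≡-Reasoning
  N c₀ c₁ c₂ : ℚ
  N = ι n
  c₀ = θH n
  c₁ = θH (suc n)
  c₂ = θH (suc (suc n))
  l₁ : ∀ N c → two * (c * c) ≡ ((N + two) * c) * ((ℕ→ℚ 4 * (1ℚ + N) + ℕ→ℚ 6) * c) - (ℕ→ℚ 4 * N + ℕ→ℚ 6) * (1ℚ + N + two) * (c * c)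
  l₁ = solve 2 (λ N c → :2 :* (c :* c) := ((N :+ :2) :* c) :* ((:4 :* (:1 :+ N) :+ :6) :* c) :- (:4 :* N :+ :6) :* (:1 :+ N :+ :2) :* (c :* c)) refl
  l₂ : ∀ a b c d → (a * c) * (b * d) - a * b * (c * d) ≡ 0ℚ
  l₂ = solve 4 (λ a b c d → (a :* c) :* (b :* d) :- a :* b :* (c :* d) := :0) refl

-- Appending an argument, and signs

prodF-snoc : ∀ {n} (f : ℚ → ℚ) (B : Fin n → ℚ) d → prodF (λ i → f (snoc B d i)) ≡ prodF (λ i → f (B i)) * f d
prodF-snoc {zero}  f B d = trans (ℚP.*-identityʳ (f d)) (sym (ℚP.*-identityˡ (f d)))
prodF-snoc {suc n} f B d = trans (cong (f (B zero) *_) (prodF-snoc f (λ i → B (suc i)) d)) (sym (ℚP.*-assoc (f (B zero)) _ (f d)))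

prodLt-snoc : ∀ {n} (φ : ℚ → ℚ → ℚ) (B : Fin n → ℚ) d → prodLt (λ i j → φ (snoc B d i) (snoc B d j)) ≡ prodLt (λ i j → φ (B i) (B j)) * prodF (λ i → φ (B i) d)
prodLt-snoc {zero}  φ B d = refl
prodLt-snoc {suc n} φ B d = trans (cong₂ _*_ (prodF-snoc (φ (B zero)) (λ i → B (suc i)) d) (prodLt-snoc φ (λ i → B (suc i)) d))
  (lem (prodF (λ i → φ (B zero) (B (suc i)))) (φ (B zero) d) (prodLt (λ i j → φ (B (suc i)) (B (suc j)))) (prodF (λ i → φ (B (suc i)) d)))
  where
  lem : ∀ a b c d → a * b * (c * d) ≡ a * c * (b * d)
  lem = solve 4 (λ a b c d → a :* b :* (c :* d) := a :* c :* (b :* d)) refl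

snoc-const : ∀ {A : Set} {n} (a : A) i → snoc {n} (λ _ → a) a i ≡ a
snoc-const {n = zero}  a zero    = refl
snoc-const {n = suc n} a zero    = refl
snoc-const {n = suc n} a (suc i) = snoc-const {n = n} a i

perm-enc-end : ∀ {A : Set} n (X Y : Fin n → A) c z → Perm (c ∷ enc n X Y z) (z ∷ enc n X Y c)
perm-enc-end zero    X Y c z = pswap
perm-enc-end (suc n) X Y c z = ptrans pswap (ptrans (pcons pswap)
  (ptrans (pcons (pcons (perm-enc-end n (λ i → X (inject₁ i)) (λ i → Y (inject₁ i)) c z))) (ptrans (pcons pswap) pswap)))

-- The sign (-1)^(n(n+1)/2), in the recursive form that both the definition of p_n and the recursion
-- for τ produce.
signs : ℕ → ℚ
signs zero    = 1ℚ
signs (suc n) = sgn (suc n) * signs n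

-- Arguments taking two values

fill : ∀ m → ℕ → Vec Bool m
fill zero    a       = []
fill (suc m) zero    = false ∷ fill m zero
fill (suc m) (suc a) = true ∷ fill m a

trues : ∀ {m} → Vec Bool m → ℕ
trues []       = 0
trues (b ∷ bs) = bit b ℕ.+ trues bs

trues-≤ : ∀ {m} (bs : Vec Bool m) → trues bs ℕ.≤ m
trues-≤ []           = ℕ.z≤n
trues-≤ (true ∷ bs)  = ℕ.s≤s (trues-≤ bs)
trues-≤ (false ∷ bs) = ℕP.m≤n⇒m≤1+n (trues-≤ bs)

perm-false-fill : ∀ m c → c ℕ.≤ m → Perm (false ∷ fill m c) (fill (suc m) c)
perm-false-fill m       zero    _          = prefl
perm-false-fill (suc m) (suc c) (ℕ.s≤s c≤m) = ptrans pswap (pcons (perm-false-fill m c c≤m))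

perm-fill : ∀ {m} (bs : Vec Bool m) → Perm bs (fill m (trues bs))
perm-fill []           = prefl
perm-fill (true ∷ bs)  = pcons (perm-fill bs)
perm-fill (false ∷ bs) = ptrans (pcons (perm-fill bs)) (perm-false-fill _ (trues bs) (trues-≤ bs))

perm-map : ∀ {A B : Set} (f : A → B) {m} {u v : Vec A m} → Perm u v → Perm (map f u) (map f v)
perm-map f prefl        = prefl
perm-map f pswap        = pswap
perm-map f (pcons p)    = pcons (perm-map f p)
perm-map f (ptrans p q) = ptrans (perm-map f p) (perm-map f q)

map-enc : ∀ {A B : Set} (f : A → B) n (x y : Fin n → A) z → map f (enc n x y z) ≡ enc n (λ i → f (x i)) (λ i → f (y i)) (f z)
map-enc f zero    x y z = refl
map-enc f (suc n) x y z = cong (λ w → f (x (fromℕ n)) ∷ f (y (fromℕ n)) ∷ w) (map-enc f n (λ i → x (inject₁ i)) (λ i → y (inject₁ i)) z)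

sumℕ-last : ∀ n (f : Fin (suc n) → ℕ) → sumℕ f ≡ f (fromℕ n) ℕ.+ sumℕ (λ i → f (inject₁ i))
sumℕ-last zero    f = refl
sumℕ-last (suc n) f = trans (cong (f zero ℕ.+_) (sumℕ-last n (λ i → f (suc i)))) (lem (f zero) (f (suc (fromℕ n))) (sumℕ (λ i → f (suc (inject₁ i)))))
  where
  lem : ∀ a b c → a ℕ.+ (b ℕ.+ c) ≡ b ℕ.+ (a ℕ.+ c)
  lem a b c = trans (sym (ℕP.+-assoc a b c)) (trans (cong (ℕ._+ c) (ℕP.+-comm a b)) (ℕP.+-assoc b a c))

count : ∀ {n} → (Fin n → Bool) → ℕ
count b = sumℕ (λ i → bit (b i))

trues-enc : ∀ n (x y : Fin n → Bool) z → trues (enc n x y z) ≡ count x ℕ.+ count y ℕ.+ bit z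
trues-enc zero    x y z = ℕP.+-identityʳ (bit z)
trues-enc (suc n) x y z = trans (cong (λ w → bit (x (fromℕ n)) ℕ.+ (bit (y (fromℕ n)) ℕ.+ w)) (trues-enc n (λ i → x (inject₁ i)) (λ i → y (inject₁ i)) z))
  (trans (lem (bit (x (fromℕ n))) (bit (y (fromℕ n))) (sumℕ (λ i → bit (x (inject₁ i)))) (sumℕ (λ i → bit (y (inject₁ i)))) (bit z))
    (cong₂ (λ u v → u ℕ.+ v ℕ.+ bit z) (sym (sumℕ-last n (λ i → bit (x i)))) (sym (sumℕ-last n (λ i → bit (y i))))))
  where
  lem : ∀ a b c d e → a ℕ.+ (b ℕ.+ (c ℕ.+ d ℕ.+ e)) ≡ a ℕ.+ c ℕ.+ (b ℕ.+ d) ℕ.+ e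
  lem = ℕR.solve-∀

first : ∀ {n} → ℕ → Fin n → Bool
first zero    i       = false
first (suc h) zero    = true
first (suc h) (suc i) = first h i

count-first : ∀ {n} h → h ℕ.≤ n → count {n} (first h) ≡ h
count-first {n}     zero    _           = sumℕ-0 n
count-first {suc n} (suc h) (ℕ.s≤s h≤n) = cong suc (count-first h h≤n)

count-true : ∀ n → count {n} (λ _ → true) ≡ n
count-true zero    = refl
count-true (suc n) = cong suc (count-true n)

pick : ℚ → ℚ → Bool → ℚ
pick p q true  = p
pick p q false = q

-- The special values ξ₀ and ξ₁

-- Writing G(a, c) as a quadratic in c, its coefficients are λ, λ (a - ξ₀) and -t a (a - ξ₀) with λ
-- = (t + 2)(a - ξ₁). At a = ξ₀ only the square survives and at a = ξ₁ only the constant.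
ξ₀ ξ₁ : ℚ → ℚ
ξ₀ t = two * t + 1ℚ
ξ₁ t = t ÷' (t + two)

ξ₁-spec : ∀ t → t + two ≢ 0ℚ → ξ₁ t * (t + two) ≡ t
ξ₁-spec t nz = ÷'-* t nz

ξ₀-inv : ∀ t t' → t * t' ≡ 1ℚ → t' + two ≢ 0ℚ → ξ₀ t * ξ₁ t' ≡ 1ℚ
ξ₀-inv t t' tt' nz = *-cancelˡ-≢0 t' (inverse-≢0 {t'} {t} (trans (ℚP.*-comm t' t) tt')) (trans (l₁ t t' (ξ₁ t')) (trans (cong (λ w → ξ₁ t' * (t' + two * w)) tt') (trans (l₂ t' (ξ₁ t')) (trans (ξ₁-spec t' nz) (sym (ℚP.*-identityʳ t'))))))
  where
  l₁ : ∀ t t' x → t' * ((two * t + 1ℚ) * x) ≡ x * (t' + two * (t * t'))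
  l₁ = solve 3 (λ t t' x → t' :* ((:2 :* t :+ :1) :* x) := x :* (t' :+ :2 :* (t :* t'))) refl
  l₂ : ∀ t' x → x * (t' + two * 1ℚ) ≡ x * (t' + two)
  l₂ = solve 2 (λ t' x → x :* (t' :+ :2 :* :1) := x :* (t' :+ :2)) refl

ξ₁-inv : ∀ t t' → t * t' ≡ 1ℚ → t + two ≢ 0ℚ → ξ₁ t * ξ₀ t' ≡ 1ℚ
ξ₁-inv t t' tt' nz = trans (ℚP.*-comm (ξ₁ t) (ξ₀ t')) (ξ₀-inv t' t (trans (ℚP.*-comm t' t) tt') nz)

Gp-ξ₀ : ∀ t y → Gp t (ξ₀ t) y ≡ two * (t + 1ℚ) * (t + 1ℚ) * (y * y)
Gp-ξ₀ t y = lem t y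
  where
  lem : ∀ t y → (t + two) * (two * t + 1ℚ) * y * ((two * t + 1ℚ) + y) - t * ((two * t + 1ℚ) * (two * t + 1ℚ) + y * y) - two * (t * t + ℕ→ℚ 3 * t + 1ℚ) * (two * t + 1ℚ) * y + t * (two * t + 1ℚ) * ((two * t + 1ℚ) + y)
    ≡ two * (t + 1ℚ) * (t + 1ℚ) * (y * y)
  lem = solve 2 (λ t y → (t :+ :2) :* (:2 :* t :+ :1) :* y :* ((:2 :* t :+ :1) :+ y) :- t :* ((:2 :* t :+ :1) :* (:2 :* t :+ :1) :+ y :* y) :- :2 :* (t :* t :+ :3 :* t :+ :1) :* (:2 :* t :+ :1) :* y :+ t :* (:2 :* t :+ :1) :* ((:2 :* t :+ :1) :+ y) := :2 :* (t :+ :1) :* (t :+ :1) :* (y :* y)) refl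

Gp-ξ₁ : ∀ t y → t + two ≢ 0ℚ → Gp t (ξ₁ t) y ≡ two * (t + 1ℚ) * (t + 1ℚ) * (ξ₁ t * ξ₁ t)
Gp-ξ₁ t y nz = trans (lem t y x) (trans (cong (λ w → two * (t + 1ℚ) * (t + 1ℚ) * (x * x) + w * (y * y + (x - (two * t + 1ℚ)) * y - (two * t + 1ℚ) * x)) (≡-⇒0 (ξ₁-spec t nz)))
    (drop (two * (t + 1ℚ) * (t + 1ℚ) * (x * x)) (y * y + (x - (two * t + 1ℚ)) * y - (two * t + 1ℚ) * x)))
  where
  x = ξ₁ t
  lem : ∀ t y x → (t + two) * x * y * (x + y) - t * (x * x + y * y) - two * (t * t + ℕ→ℚ 3 * t + 1ℚ) * x * y + t * (two * t + 1ℚ) * (x + y)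
    ≡ two * (t + 1ℚ) * (t + 1ℚ) * (x * x) + (x * (t + two) - t) * (y * y + (x - (two * t + 1ℚ)) * y - (two * t + 1ℚ) * x)
  lem = solve 3 (λ t y x → (t :+ :2) :* x :* y :* (x :+ y) :- t :* (x :* x :+ y :* y) :- :2 :* (t :* t :+ :3 :* t :+ :1) :* x :* y :+ t :* (:2 :* t :+ :1) :* (x :+ y) := :2 :* (t :+ :1) :* (t :+ :1) :* (x :* x) :+ (x :* (t :+ :2) :- t) :* (y :* y :+ (x :- (:2 :* t :+ :1)) :* y :- (:2 :* t :+ :1) :* x)) refl
  drop : ∀ a b → a + 0ℚ * b ≡ a
  drop = solve 2 (λ a b → a :+ :0 :* b := a) refl

-- A curve with common denominator d is substituted into a function of order N. The N-th power of
-- the local parameter appears explicitly, and the cofactor becomes a polynomial in t after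
-- multiplication by a power of d.
ord-path : ∀ {W : Set} {N} {f : Env (Maybe W) → ℚ} → Ord N f → {num : Maybe W → ℚ → ℚ} {d : ℚ → ℚ} → (∀ v → PolyFun (num v)) → PolyFun d →
  Σ ℕ λ M → Σ (ℚ → ℚ) λ h → PolyFun h × (∀ t (e : Maybe W → ℚ) → (∀ v → e v * d t ≡ num v t) → f e * d t ^ M ≡ e nothing ^ N * h t)
ord-path {N = N} {f} (ord g (P , p) eq) {num} {d} pn pd =
  let (M , h , ph , spec) = pf-clear P pn pd
  in M , h , ph , λ t e he → trans (cong (_* d t ^ M) (eq e)) (trans (ℚP.*-assoc (e nothing ^ N) (g e) (d t ^ M)) (cong (e nothing ^ N *_) (trans (cong (_* d t ^ M) (sym (p e))) (spec t e he))))

pf-ξ₀ : PolyFun ξ₀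
pf-ξ₀ = pf-+ (pf-* (pf-con two) pf-id) (pf-con 1ℚ)

pf-t+2 : PolyFun (λ t → t + two)
pf-t+2 = pf-+ pf-id (pf-con two)

-- Parity, the exponents δ, and signs

parity : ∀ m → (Σ ℕ λ k → m ≡ k ℕ.+ k) ⊎ (Σ ℕ λ k → m ≡ suc (k ℕ.+ k))
parity zero    = inj₁ (0 , refl)
parity (suc m) with parity m
... | inj₁ (k , refl) = inj₂ (k , refl)
... | inj₂ (k , refl) = inj₁ (suc k , cong suc (sym (ℕP.+-suc k k)))

δ-even : ∀ k → δ (k ℕ.+ k) ≡ k ℕ.* k
δ-even k = trans (cong (ℕ._/ 4) (lem k)) (m*n/n≡m (k ℕ.* k) 4)
  where
  lem : ∀ k → (k ℕ.+ k) ℕ.* (k ℕ.+ k) ≡ k ℕ.* k ℕ.* 4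
  lem = ℕR.solve-∀

δ-odd : ∀ k → δ (suc (k ℕ.+ k)) ≡ k ℕ.* suc k
δ-odd k = trans (cong (ℕ._/ 4) (lem k)) (trans (+-distrib-/ 1 (k ℕ.* suc k ℕ.* 4) {4} small) (m*n/n≡m (k ℕ.* suc k) 4))
  where
  lem : ∀ k → suc (k ℕ.+ k) ℕ.* suc (k ℕ.+ k) ≡ 1 ℕ.+ k ℕ.* suc k ℕ.* 4
  lem = ℕR.solve-∀
  small : 1 ℕ.% 4 ℕ.+ (k ℕ.* suc k ℕ.* 4) ℕ.% 4 ℕ.< 4
  small = subst (λ w → 1 ℕ.+ w ℕ.< 4) (sym (m*n%n≡0 (k ℕ.* suc k) 4)) (ℕ.s≤s (ℕ.s≤s ℕ.z≤n))

δ-even₂ : ∀ k → δ (suc (suc (k ℕ.+ k))) ≡ suc k ℕ.* suc k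
δ-even₂ k = trans (cong (λ m → δ (suc m)) (sym (ℕP.+-suc k k))) (δ-even (suc k))

δ-odd₂ : ∀ k → δ (suc (suc (suc (k ℕ.+ k)))) ≡ suc k ℕ.* suc (suc k)
δ-odd₂ k = trans (cong (λ m → δ (suc (suc m))) (sym (ℕP.+-suc k k))) (δ-odd (suc k))

χeven-even : ∀ k → χeven (k ℕ.+ k) ≡ 1
χeven-even zero    = refl
χeven-even (suc k) = trans (cong (λ m → χeven (suc m)) (ℕP.+-suc k k)) (χeven-even k)

χeven-odd : ∀ k → χeven (suc (k ℕ.+ k)) ≡ 0
χeven-odd zero    = refl
χeven-odd (suc k) = trans (cong (λ m → χeven (suc (suc m))) (ℕP.+-suc k k)) (χeven-odd k)

χ-sum : ∀ m → χeven m ℕ.+ χodd m ≡ 1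
χ-sum m with parity m
... | inj₁ (k , refl) = cong (λ e → e ℕ.+ (1 ℕ.∸ e)) (χeven-even k)
... | inj₂ (k , refl) = cong (λ e → e ℕ.+ (1 ℕ.∸ e)) (χeven-odd k)

χodd-suc : ∀ m → χodd (suc m) ≡ χeven m
χodd-suc m with parity m
... | inj₁ (k , refl) = trans (cong (1 ℕ.∸_) (χeven-odd k)) (sym (χeven-even k))
... | inj₂ (k , refl) = trans (cong (1 ℕ.∸_) (χeven-even k)) (sym (χeven-odd k))

-- The second difference of ⌊k²/4⌋ alternates between 0 and 1. This is the origin of the
-- parity-dependent exponents in C.
δ-second : ∀ m → δ m ℕ.+ δ (suc (suc m)) ≡ δ (suc m) ℕ.+ δ (suc m) ℕ.+ χodd (suc m)
δ-second m with parity m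
... | inj₁ (k , refl) = trans (cong₂ ℕ._+_ (δ-even k) (δ-even₂ k)) (trans (lem k) (sym (cong₂ ℕ._+_ (cong₂ ℕ._+_ (δ-odd k) (δ-odd k)) (trans (χodd-suc (k ℕ.+ k)) (χeven-even k)))))
  where
  lem : ∀ k → k ℕ.* k ℕ.+ suc k ℕ.* suc k ≡ k ℕ.* suc k ℕ.+ k ℕ.* suc k ℕ.+ 1
  lem = ℕR.solve-∀
... | inj₂ (k , refl) = trans (cong₂ ℕ._+_ (δ-odd k) (δ-odd₂ k)) (trans (lem k) (sym (cong₂ ℕ._+_ (cong₂ ℕ._+_ (δ-even₂ k) (δ-even₂ k)) (trans (χodd-suc (suc (k ℕ.+ k))) (χeven-odd k)))))
  where
  lem : ∀ k → k ℕ.* suc k ℕ.+ suc k ℕ.* suc (suc k) ≡ suc k ℕ.* suc k ℕ.+ suc k ℕ.* suc k ℕ.+ 0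
  lem = ℕR.solve-∀

-- At m = 0 truncated subtraction reads δ at -1 as δ at 0; both are 0, so the formula persists.
δ-second' : ∀ m → δ (m ℕ.∸ 1) ℕ.+ δ (suc m) ≡ δ m ℕ.+ δ m ℕ.+ χeven (suc m)
δ-second' zero    = refl
δ-second' (suc m) = trans (δ-second m) (cong (δ (suc m) ℕ.+ δ (suc m) ℕ.+_) (χodd-suc m))

δ-sum : ∀ m → δ (suc m) ℕ.+ δ m ≡ tri (suc m)
δ-sum m = half-cancel (trans (twice m) (sym (double-tri (suc m))))
  where
  half-cancel : ∀ {a b} → a ℕ.+ a ℕ.+ suc m ≡ b ℕ.+ b ℕ.+ suc m → a ≡ b
  half-cancel {a} {b} eq = ℕP.*-cancelˡ-≡ a b 2 (trans (e a) (trans (ℕP.+-cancelʳ-≡ (suc m) (a ℕ.+ a) (b ℕ.+ b) eq) (sym (e b))))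
    where
    e : ∀ a → 2 ℕ.* a ≡ a ℕ.+ a
    e = ℕR.solve-∀
  twice : ∀ m → δ (suc m) ℕ.+ δ m ℕ.+ (δ (suc m) ℕ.+ δ m) ℕ.+ suc m ≡ suc m ℕ.* suc m
  twice m with parity m
  ... | inj₁ (k , refl) = trans (cong₂ (λ a b → a ℕ.+ b ℕ.+ (a ℕ.+ b) ℕ.+ suc (k ℕ.+ k)) (δ-odd k) (δ-even k)) (lem k)
    where
    lem : ∀ k → k ℕ.* suc k ℕ.+ k ℕ.* k ℕ.+ (k ℕ.* suc k ℕ.+ k ℕ.* k) ℕ.+ suc (k ℕ.+ k) ≡ suc (k ℕ.+ k) ℕ.* suc (k ℕ.+ k)
    lem = ℕR.solve-∀
  ... | inj₂ (k , refl) = trans (cong₂ (λ a b → a ℕ.+ b ℕ.+ (a ℕ.+ b) ℕ.+ suc (suc (k ℕ.+ k))) (δ-even₂ k) (δ-odd k)) (lem k)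
    where
    lem : ∀ k → suc k ℕ.* suc k ℕ.+ k ℕ.* suc k ℕ.+ (suc k ℕ.* suc k ℕ.+ k ℕ.* suc k) ℕ.+ suc (suc (k ℕ.+ k)) ≡ suc (suc (k ℕ.+ k)) ℕ.* suc (suc (k ℕ.+ k))
    lem = ℕR.solve-∀

half-square : ∀ n → (n ℕ.* suc n) ℕ./ 2 ≡ tri (suc n)
half-square n = trans (cong (ℕ._/ 2) (ℕP.+-cancelʳ-≡ (suc n) (n ℕ.* suc n) (tri (suc n) ℕ.* 2) (trans (e₁ n) (trans (sym (double-tri (suc n))) (e₂ (tri (suc n)) (suc n)))))) (m*n/n≡m (tri (suc n)) 2)
  where
  e₁ : ∀ n → n ℕ.* suc n ℕ.+ suc n ≡ suc n ℕ.* suc n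
  e₁ = ℕR.solve-∀
  e₂ : ∀ r m → r ℕ.+ r ℕ.+ m ≡ r ℕ.* 2 ℕ.+ m
  e₂ = ℕR.solve-∀

sgn-binomial : ∀ n → sgn (suc n choose 2) ≡ signs n
sgn-binomial zero    = refl
sgn-binomial (suc n) = trans (cong sgn (sym (nCk+nC[k+1]≡[n+1]C[k+1] (suc n) 1))) (trans (^-+ (- 1ℚ) (suc n choose 1) (suc n choose 2)) (cong₂ _*_ (cong sgn (nC1≡n (suc n))) (sgn-binomial n)))

sgn-square : ∀ n → sgn n * sgn n ≡ 1ℚ
sgn-square n = trans (sym (*-^ (- 1ℚ) (- 1ℚ) n)) (1-^ n)

signs-square : ∀ n → signs n * signs n ≡ 1ℚ
signs-square zero    = refl
signs-square (suc n) = trans (lem (sgn (suc n)) (signs n)) (cong₂ _*_ (sgn-square (suc n)) (signs-square n))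
  where
  lem : ∀ a b → a * b * (a * b) ≡ a * a * (b * b)
  lem = solve 2 (λ a b → a :* b :* (a :* b) := a :* a :* (b :* b)) refl

signs-alternate : ∀ m → signs (suc (suc m)) * signs m ≡ - 1ℚ
signs-alternate m = trans (lem (sgn (suc m)) (signs m)) (cong₂ (λ a b → - (a * b)) (sgn-square (suc m)) (signs-square m))
  where
  lem : ∀ a b → - 1ℚ * a * (a * b) * b ≡ - (a * a * (b * b))
  lem = solve 2 (λ a b → :- :1 :* a :* (a :* b) :* b := :- (a :* a :* (b :* b))) refl

-- Reversed polynomials

reverseP : ∀ P → Σ (ℚ → ℚ) λ R → PolyFun R × Reversal (length P) P R
reverseP []      = (λ _ → 0ℚ) , pf-con 0ℚ , λ t u tu → sym (ℚP.*-zeroʳ 1ℚ)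
reverseP (c ∷ P) =
  let (R , pR , rev) = reverseP P
  in (λ t → c * t ^ suc (length P) + R t) , pf-+ (pf-* (pf-con c) (pf-^ pf-id (suc (length P)))) pR ,
     λ t u tu → trans (cong (c * t ^ suc (length P) +_) (rev t u tu)) (trans (l₁ c t (t ^ length P) (evalP P u))
       (trans (cong (λ w → t * t ^ length P * c + w * t ^ length P * evalP P u) (sym tu)) (l₂ c t (t ^ length P) u (evalP P u))))
  where
  l₁ : ∀ c t e p → c * (t * e) + e * p ≡ t * e * c + 1ℚ * e * p
  l₁ = solve 4 (λ c t e p → c :* (t :* e) :+ e :* p := t :* e :* c :+ :1 :* e :* p) refl
  l₂ : ∀ c t e u p → t * e * c + t * u * e * p ≡ t * e * (c + u * p)
  l₂ = solve 5 (λ c t e u p → t :* e :* c :+ t :* u :* e :* p := t :* e :* (c :+ u :* p)) refl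

-- The reversal with exponent `length P` always exists as a polynomial. To lower the exponent to d
-- it has to be divided by a power of t, which is possible because U is nonzero at 0 and U t^d
-- P(1/t) is known to be the polynomial V. The function g confines the hypothesis to generic points.
reversal : ∀ d P {U V g} → PolyFun U → PolyFun V → PolyFun g → g 1ℚ ≢ 0ℚ → U 0ℚ ≢ 0ℚ →
  (∀ t u → t * u ≡ 1ℚ → g t ≢ 0ℚ → U t * (t ^ d * evalP P u) ≡ V t) →
  Σ (ℚ → ℚ) λ R → PolyFun R × Reversal d P R × (∀ t → U t * R t ≡ V t)
reversal d P {U} {V} {g} pU pV pg g≢0 U≢0 h = R , pR , rev' , UR
  where
  L = length P
  ρ = proj₁ (reverseP P)
  pρ = proj₁ (proj₂ (reverseP P))
  rev = proj₂ (proj₂ (reverseP P))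
  lem : ∀ a b c d → a * (b * c * d) ≡ b * (a * (d * c))
  lem = solve 4 (λ a b c d → a :* (b :* c :* d) := b :* (a :* (d :* c))) refl
  identity : ∀ t → t * g t ≢ 0ℚ → U t * (ρ t * t ^ d) ≡ (t - 0ℚ) ^ L * V t
  identity t nz = trans (cong (λ w → U t * (w * t ^ d)) (rev t u tu)) (trans (lem (U t) (t ^ L) (evalP P u) (t ^ d))
      (cong₂ _*_ (cong (_^ L) (sym (l₀ t))) (h t u tu (*-≢0ʳ {t} {g t} nz))))
    where
    t≢0 : t ≢ 0ℚ
    t≢0 = *-≢0ˡ {t} {g t} nz
    u = proj₁ (inv t t≢0)
    tu = proj₂ (inv t t≢0)
    l₀ : ∀ t → t - 0ℚ ≡ t
    l₀ = solve 1 (λ t → t :- :0 := t) refl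
  all : ∀ t → U t * (ρ t * t ^ d) ≡ (t - 0ℚ) ^ L * V t
  all = pf-dense-≡ (pf-* pU (pf-* pρ (pf-^ pf-id d))) (pf-* (pf-^ (pf-sub pf-id (pf-con 0ℚ)) L) pV) (pf-* pf-id pg) 1ℚ (*-≢0 1≢0 g≢0) identity
  quotient = pf-divide 0ℚ L pU (pf-* pρ (pf-^ pf-id d)) pV all U≢0
  R = proj₁ quotient
  pR = proj₁ (proj₂ quotient)
  UR = proj₂ (proj₂ (proj₂ quotient))
  rev' : Reversal d P R
  rev' t u tu = *-cancelˡ-≢0 (t ^ L) (^-≢0 L (inverse-≢0 {t} {u} tu)) (trans (cong (λ w → w ^ L * R t) (l₀ t)) (trans (sym (proj₁ (proj₂ (proj₂ quotient)) t))
      (trans (cong (_* t ^ d) (rev t u tu)) (l₁ (t ^ L) (evalP P u) (t ^ d)))))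
    where
    l₀ : ∀ t → t ≡ t - 0ℚ
    l₀ = solve 1 (λ t → t := t :- :0) refl
    l₁ : ∀ a b c → a * b * c ≡ a * (c * b)
    l₁ = solve 3 (λ a b c → a :* b :* c := a :* (c :* b)) refl

pow₂₃ : ∀ a i j k l → i ℕ.+ j ≡ k ℕ.+ k ℕ.+ l → a ^ i * a ^ j ≡ a ^ k * a ^ k * a ^ l
pow₂₃ a i j k l eq = trans (sym (^-+ a i j)) (trans (cong (a ^_) eq) (trans (^-+ a (k ℕ.+ k) l) (cong (_* a ^ l) (^-+ a k k))))

pow-inverse : ∀ {a b} n → a * b ≡ 1ℚ → a ^ n * b ^ n ≡ 1ℚ
pow-inverse {a} {b} n ab = trans (sym (*-^ a b n)) (trans (cong (_^ n) ab) (1-^ n))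

δ-sum' : ∀ n → δ n ℕ.+ δ (n ℕ.∸ 1) ≡ tri n
δ-sum' zero    = refl
δ-sum' (suc m) = δ-sum m

-- The degree balance behind the exponent n(n+1)/2 of p̃_n: it is what n² leaves after the two δ
-- powers have been inverted.
square-tri : ∀ n → n ℕ.* n ≡ δ n ℕ.+ δ (n ℕ.∸ 1) ℕ.+ tri (suc n)
square-tri n = trans (sym (double-tri n)) (trans (lem n (tri n)) (cong (ℕ._+ tri (suc n)) (sym (δ-sum' n))))
  where
  lem : ∀ n r → r ℕ.+ r ℕ.+ n ≡ r ℕ.+ (n ℕ.+ r)
  lem = ℕR.solve-∀

-- The polynomials S_n in determinantal form

module Development (S : (m : ℕ) → MPoly (SVar m)) (isS : (m : ℕ) → IsS m (S m)) where

  Sv : ∀ n → (Fin n → ℚ) → (Fin n → ℚ) → ℚ → ℚ → ℚ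
  Sv n x y z t = evalM (S n) (envS x y z t)

  Sv-cong : ∀ n {x x' y y' : Fin n → ℚ} z t → (∀ i → x i ≡ x' i) → (∀ i → y i ≡ y' i) → Sv n x y z t ≡ Sv n x' y' z t
  Sv-cong n z t ex ey = evalM-cong (S n) (envS-cong ex ey)

  poly-Sv : ∀ {V : Set} n {x y : Fin n → Env V → ℚ} {z t : Env V → ℚ} → (∀ i → IsPoly (x i)) → (∀ i → IsPoly (y i)) → IsPoly z → IsPoly t →
    IsPoly (λ ρ → Sv n (λ i → x i ρ) (λ i → y i ρ) (z ρ) (t ρ))
  poly-Sv {V} n {x} {y} {z} {t} px py pz pt = poly-≗ (poly-eval (S n) {e = e} pe) (λ ρ → evalM-cong (S n) (λ { (xv i) → refl ; (yv i) → refl ; zv → refl ; ζv → refl }))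
    where
    e : SVar n → Env V → ℚ
    e (xv i) = x i
    e (yv i) = y i
    e zv     = z
    e ζv     = t
    pe : ∀ v → IsPoly (e v)
    pe (xv i) = px i
    pe (yv i) = py i
    pe zv     = pz
    pe ζv     = pt

  Sv-fraction : ∀ n x y z t → (∀ i j → Gp t (x i) (y j) ≢ 0ℚ) →
    Sv n x y z t * (vdm x * vdm y) ≡ prodF (λ i → prodF (λ j → Gp t (x i) (y j))) * det (λ i j → Fp t (x i) (y j) z ÷' Gp t (x i) (y j))
  Sv-fraction n x y z t nz = trans
    (cong₂ _*_ (evalM-cong (S n) (λ { (xv i) → refl ; (yv i) → refl ; zv → refl ; ζv → refl })) (sym (prodLt-* (λ i j → x j - x i) (λ i j → y j - y i))))
    (isS n x y z t nz)

  -- Row i of (F/G) multiplied by the product of its denominators.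
  entry : ∀ {n} → (Fin n → ℚ) → (Fin n → ℚ) → ℚ → ℚ → Mat n
  entry x y z t i j = Fp t (x i) (y j) z * skipProd (λ k → Gp t (x i) (y k)) j

  poly-entry : ∀ {V : Set} {n} {x y : Fin n → Env V → ℚ} {z t : Env V → ℚ} → (∀ i → IsPoly (x i)) → (∀ i → IsPoly (y i)) → IsPoly z → IsPoly t →
    ∀ i j → IsPoly (λ ρ → entry (λ i → x i ρ) (λ i → y i ρ) (z ρ) (t ρ) i j)
  poly-entry px py pz pt i j = poly-* (poly-Fp pt (px i) (py j) pz) (poly-skipProd (λ k → poly-Gp pt (px i) (py k)) j)

  Sv-det-generic : ∀ n x y z t → (∀ i j → Gp t (x i) (y j) ≢ 0ℚ) → Sv n x y z t * (vdm x * vdm y) ≡ det (entry x y z t)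
  Sv-det-generic n x y z t nz = begin
    Sv n x y z t * (vdm x * vdm y)                   ≡⟨ Sv-fraction n x y z t nz ⟩
    prodF l * det M                                  ≡⟨ cong (_* det M) (sym (trans (cong (prodF l *_) (prodF-1 {n} (λ j → refl))) (ℚP.*-identityʳ (prodF l)))) ⟩
    prodF l * prodF {n} (λ j → 1ℚ) * det M           ≡⟨ sym (det-scale l (λ j → 1ℚ) M) ⟩
    det (λ i j → l i * 1ℚ * M i j)                   ≡⟨ det-cong (λ i j → l i * 1ℚ * M i j) (entry x y z t) cleared ⟩
    det (entry x y z t)                              ∎
    where
    open ≡-Reasoning
    l : Fin n → ℚ
    l i = prodF (λ j → Gp t (x i) (y j))
    M : Mat n
    M i j = Fp t (x i) (y j) z ÷' Gp t (x i) (y j)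
    lem : ∀ g s m → g * s * 1ℚ * m ≡ m * g * s
    lem = solve 3 (λ g s m → g :* s :* :1 :* m := m :* g :* s) refl
    cleared : ∀ i j → l i * 1ℚ * M i j ≡ entry x y z t i j
    cleared i j = trans (cong (λ w → w * 1ℚ * M i j) (sym (skipProd-* (λ k → Gp t (x i) (y k)) j)))
      (trans (lem (Gp t (x i) (y j)) (skipProd (λ k → Gp t (x i) (y k)) j) (M i j))
             (cong (_* skipProd (λ k → Gp t (x i) (y k)) j) (÷'-* (Fp t (x i) (y j) z) (nz i j))))

  module _ {n : ℕ} where
    px : ∀ i → IsPoly {SVar n} (λ ρ → ρ (xv i))
    px i = poly-var (xv i)
    py : ∀ i → IsPoly {SVar n} (λ ρ → ρ (yv i))
    py i = poly-var (yv i)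
    pz : IsPoly {SVar n} (λ ρ → ρ zv)
    pz = poly-var zv
    pζ : IsPoly {SVar n} (λ ρ → ρ ζv)
    pζ = poly-var ζv

    allG : Env (SVar n) → ℚ
    allG ρ = prodF (λ i → prodF (λ j → Gp (ρ ζv) (ρ (xv i)) (ρ (yv j))))

    poly-allG : IsPoly allG
    poly-allG = poly-prodF (λ i → poly-prodF (λ j → poly-Gp pζ (px i) (py j)))

    dense-allG : Dense allG
    -- At ζ = 0 and x = y = 1 the value of G is 2.
    dense-allG = dense poly-allG (envS (λ _ → 1ℚ) (λ _ → 1ℚ) 1ℚ 0ℚ) (prodF-≢0 {n} (λ i → prodF-≢0 {n} (λ j → λ ())))

    allG-≢0 : ∀ ρ → allG ρ ≢ 0ℚ → ∀ i j → Gp (ρ ζv) (ρ (xv i)) (ρ (yv j)) ≢ 0ℚ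
    allG-≢0 ρ nz i j = prodF-≢0⁻ (prodF-≢0⁻ nz i) j

    bothVdm : Env (SVar n) → ℚ
    bothVdm ρ = vdm (λ i → ρ (xv i)) * vdm (λ i → ρ (yv i))

    poly-bothVdm : IsPoly bothVdm
    poly-bothVdm = poly-* (poly-vdm px) (poly-vdm py)

    dense-bothVdm : Dense bothVdm
    dense-bothVdm = dense poly-bothVdm (envS (λ i → ι (toℕ i)) (λ i → ι (toℕ i)) 0ℚ 0ℚ) (*-≢0 (vdm-ι≢0 n) (vdm-ι≢0 n))

  -- Once the denominators are cleared row by row, both sides are polynomial and the restriction G ≠
  -- 0 disappears. All vanishing orders are read off this form.
  Sv-det : ∀ n x y z t → Sv n x y z t * (vdm x * vdm y) ≡ det (entry x y z t)
  Sv-det n x y z t = dense-⇒≡ {f = λ ρ → Sv n (λ i → ρ (xv i)) (λ i → ρ (yv i)) (ρ zv) (ρ ζv) * bothVdm ρ}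
    {f' = λ ρ → det (entry (λ i → ρ (xv i)) (λ i → ρ (yv i)) (ρ zv) (ρ ζv))} dense-allG
    (poly-* (poly-Sv n px py pz pζ) poly-bothVdm) (poly-det (poly-entry px py pz pζ))
    (λ ρ nz → Sv-det-generic n (λ i → ρ (xv i)) (λ i → ρ (yv i)) (ρ zv) (ρ ζv) (allG-≢0 ρ nz)) (envS x y z t)

  -- The determinant and the Vandermonde product both change sign, so their quotient is invariant
  -- wherever the Vandermonde products are nonzero, hence everywhere.
  Sv-adj : ∀ n x y z t p → Sv (suc n) (λ i → x (adj p i)) y z t ≡ Sv (suc n) x y z t
  Sv-adj n x y z t p = dense-⇒≡ {f = λ ρ → Sv (suc n) (λ i → ρ (xv (adj p i))) (λ i → ρ (yv i)) (ρ zv) (ρ ζv)}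
    {f' = λ ρ → Sv (suc n) (λ i → ρ (xv i)) (λ i → ρ (yv i)) (ρ zv) (ρ ζv)} dense-bothVdm
    (poly-Sv (suc n) (λ i → px (adj p i)) py pz pζ) (poly-Sv (suc n) px py pz pζ)
    (λ ρ nz → generic (λ i → ρ (xv i)) (λ i → ρ (yv i)) (ρ zv) (ρ ζv) nz) (envS x y z t)
    where
    neg : ∀ a b c → a * (b * c) ≡ - 1ℚ * (a * ((- b) * c))
    neg = solve 3 (λ a b c → a :* (b :* c) := :- :1 :* (a :* ((:- b) :* c))) refl
    neg' : ∀ a → - 1ℚ * (- a) ≡ a
    neg' = solve 1 (λ a → :- :1 :* (:- a) := a) refl
    generic : ∀ x y z t → vdm x * vdm y ≢ 0ℚ → Sv (suc n) (λ i → x (adj p i)) y z t ≡ Sv (suc n) x y z t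
    generic x y z t nz = *-cancelˡ-≢0 (vdm x * vdm y) nz (trans (ℚP.*-comm (vdm x * vdm y) Sx') (trans (begin
      Sx' * (vdm x * vdm y)                          ≡⟨ neg Sx' (vdm x) (vdm y) ⟩
      - 1ℚ * (Sx' * ((- vdm x) * vdm y))             ≡⟨ cong (λ w → - 1ℚ * (Sx' * (w * vdm y))) (sym (vdm-adj x p)) ⟩
      - 1ℚ * (Sx' * (vdm x' * vdm y))                ≡⟨ cong (- 1ℚ *_) (Sv-det (suc n) x' y z t) ⟩
      - 1ℚ * det (entry x' y z t)                    ≡⟨ cong (- 1ℚ *_) (det-adj (entry x y z t) p) ⟩
      - 1ℚ * (- det (entry x y z t))                 ≡⟨ neg' (det (entry x y z t)) ⟩
      det (entry x y z t)                            ≡⟨ sym (Sv-det (suc n) x y z t) ⟩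
      Sv (suc n) x y z t * (vdm x * vdm y)           ∎) (ℚP.*-comm (Sv (suc n) x y z t) (vdm x * vdm y))))
      where
      open ≡-Reasoning
      x' : Fin (suc n) → ℚ
      x' i = x (adj p i)
      Sx' = Sv (suc n) x' y z t

  -- The bilinear identity

  module _ (k : ℕ) where
    private
      e₀ e₁ : Fin 2
      e₀ = zero
      e₁ = suc zero

    -- The Desnanot-Jacobi identity for F/G with each minor expressed through the corresponding S.
    -- Most products of G and all Vandermonde products occur equally often in the three terms; what
    -- does not cancel is the corner values of G and the differences of the bordering arguments.
    bilinear-generic : ∀ (x y : Fin (suc (suc k)) → ℚ) z t → (∀ i j → Gp t (x i) (y j) ≢ 0ℚ) → vdm x * vdm y ≢ 0ℚ →
      (x (extra k e₁) - x (extra k e₀)) * (y (extra k e₁) - y (extra k e₀)) * Sv (suc (suc k)) x y z t * Sv k (λ i → x (common k i)) (λ i → y (common k i)) z t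
        ≡ Gp t (x (extra k e₀)) (y (extra k e₁)) * Gp t (x (extra k e₁)) (y (extra k e₀))
            * (Sv (suc k) (λ i → x (keep k e₀ i)) (λ i → y (keep k e₀ i)) z t * Sv (suc k) (λ i → x (keep k e₁ i)) (λ i → y (keep k e₁ i)) z t)
          - Gp t (x (extra k e₀)) (y (extra k e₀)) * Gp t (x (extra k e₁)) (y (extra k e₁))
            * (Sv (suc k) (λ i → x (keep k e₀ i)) (λ i → y (keep k e₁ i)) z t * Sv (suc k) (λ i → x (keep k e₁ i)) (λ i → y (keep k e₀ i)) z t)
    bilinear-generic x y z t nz vnz = *-cancelˡ-≢0 K K≢0 (begin
      K * (dx * dy * S₂ * S₀)
        ≡⟨ r₁ V U P₀ P₁ Q₀ Q₁ dx dy S₂ S₀ ⟩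
      (S₂ * (V * (P₀ * P₁) * dx * (U * (Q₀ * Q₁) * dy))) * (S₀ * (V * U))
        ≡⟨ cong₂ _*_ s₂ (Sv-fraction k _ _ z t (λ i j → nz (common k i) (common k j))) ⟩
      (Γ₂ * det M) * (Γ * det (λ i j → M (common k i) (common k j)))
        ≡⟨ r₂ Γ₂ (det M) Γ (det (λ i j → M (common k i) (common k j))) ⟩
      Γ₂ * Γ * (det M * det (λ i j → M (common k i) (common k j)))
        ≡⟨ cong₂ _*_ (cong (_* Γ) γ₂) (dodgson k M) ⟩
      Γ * (γ⁰ * γ¹) * (γ₀ * (g₀₀ * g₀₁) * (γ₁ * (g₁₀ * g₁₁))) * Γ * (D e₀ e₀ * D e₁ e₁ - D e₀ e₁ * D e₁ e₀)
        ≡⟨ r₃ Γ γ⁰ γ¹ γ₀ γ₁ g₀₀ g₀₁ g₁₀ g₁₁ (D e₀ e₀) (D e₁ e₁) (D e₀ e₁) (D e₁ e₀) ⟩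
      g₀₁ * g₁₀ * ((Γ * γ⁰ * (γ₀ * g₀₀) * D e₀ e₀) * (Γ * γ¹ * (γ₁ * g₁₁) * D e₁ e₁)) - g₀₀ * g₁₁ * ((Γ * γ¹ * (γ₀ * g₀₁) * D e₀ e₁) * (Γ * γ⁰ * (γ₁ * g₁₀) * D e₁ e₀))
        ≡⟨ sym (cong₂ _-_ (cong (g₀₁ * g₁₀ *_) (cong₂ _*_ (s₁ e₀ e₀) (s₁ e₁ e₁))) (cong (g₀₀ * g₁₁ *_) (cong₂ _*_ (s₁ e₀ e₁) (s₁ e₁ e₀)))) ⟩
      g₀₁ * g₁₀ * ((S₁ e₀ e₀ * (V * P₀ * (U * Q₀))) * (S₁ e₁ e₁ * (V * P₁ * (U * Q₁)))) - g₀₀ * g₁₁ * ((S₁ e₀ e₁ * (V * P₀ * (U * Q₁))) * (S₁ e₁ e₀ * (V * P₁ * (U * Q₀))))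
        ≡⟨ r₄ V U P₀ P₁ Q₀ Q₁ (g₀₁ * g₁₀) (g₀₀ * g₁₁) (S₁ e₀ e₀) (S₁ e₁ e₁) (S₁ e₀ e₁) (S₁ e₁ e₀) ⟩
      K * (g₀₁ * g₁₀ * (S₁ e₀ e₀ * S₁ e₁ e₁) - g₀₀ * g₁₁ * (S₁ e₀ e₁ * S₁ e₁ e₀)) ∎)
      where
      open ≡-Reasoning
      M : Mat (suc (suc k))
      M i j = Fp t (x i) (y j) z ÷' Gp t (x i) (y j)
      g : Mat (suc (suc k))
      g i j = Gp t (x i) (y j)
      V U P₀ P₁ Q₀ Q₁ dx dy S₂ S₀ Γ Γ₂ γ⁰ γ¹ γ₀ γ₁ g₀₀ g₀₁ g₁₀ g₁₁ K : ℚ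
      V = vdm (λ i → x (common k i))
      U = vdm (λ i → y (common k i))
      P₀ = gaps k x e₀
      P₁ = gaps k x e₁
      Q₀ = gaps k y e₀
      Q₁ = gaps k y e₁
      dx = x (extra k e₁) - x (extra k e₀)
      dy = y (extra k e₁) - y (extra k e₀)
      S₂ = Sv (suc (suc k)) x y z t
      S₀ = Sv k (λ i → x (common k i)) (λ i → y (common k i)) z t
      S₁ D : Fin 2 → Fin 2 → ℚ
      S₁ e f = Sv (suc k) (λ i → x (keep k e i)) (λ i → y (keep k f i)) z t
      D e f = det (λ i j → M (keep k e i) (keep k f j))
      Γ = prodF (λ i → prodF (λ j → g (common k i) (common k j)))
      Γ₂ = prodF (λ i → prodF (λ j → g i j))
      col row : Fin 2 → ℚ
      col f = prodF (λ i → g (common k i) (extra k f))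
      row e = prodF (λ j → g (extra k e) (common k j))
      γ⁰ = col e₀
      γ¹ = col e₁
      γ₀ = row e₀
      γ₁ = row e₁
      g₀₀ = g (extra k e₀) (extra k e₀)
      g₀₁ = g (extra k e₀) (extra k e₁)
      g₁₀ = g (extra k e₁) (extra k e₀)
      g₁₁ = g (extra k e₁) (extra k e₁)
      -- The Vandermonde factors common to all three terms: the common block counted twice, the gaps
      -- from each bordering argument to it once.
      K = V * U * (V * U) * (P₀ * P₁ * (Q₀ * Q₁))
      γ₂ : Γ₂ ≡ Γ * (γ⁰ * γ¹) * (γ₀ * (g₀₀ * g₀₁) * (γ₁ * (g₁₀ * g₁₁)))
      γ₂ = trans (prodF-bordered k (λ i → prodF (λ j → g i j)))
        (cong₂ _*_ (trans (prodF-cong (λ i → prodF-bordered k (g (common k i)))) (trans (prodF-* (λ i → prodF (λ j → g (common k i) (common k j))) (λ i → g (common k i) (extra k e₀) * g (common k i) (extra k e₁)))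
                      (cong (Γ *_) (prodF-* (λ i → g (common k i) (extra k e₀)) (λ i → g (common k i) (extra k e₁))))))
                   (cong₂ _*_ (prodF-bordered k (g (extra k e₀))) (prodF-bordered k (g (extra k e₁)))))
      s₂ : S₂ * (V * (P₀ * P₁) * dx * (U * (Q₀ * Q₁) * dy)) ≡ Γ₂ * det M
      s₂ = trans (cong (S₂ *_) (sym (cong₂ _*_ (vdm-bordered k x) (vdm-bordered k y)))) (Sv-fraction (suc (suc k)) x y z t nz)
      γ₁₁ : ∀ e f → prodF (λ i → prodF (λ j → g (keep k e i) (keep k f j))) ≡ Γ * col f * (row e * g (extra k e) (extra k f))
      γ₁₁ e f = trans (prodF-keep k e (λ i → prodF (λ j → g i (keep k f j))))
        (cong₂ _*_ (trans (prodF-cong (λ i → prodF-keep k f (g (common k i)))) (prodF-* (λ i → prodF (λ j → g (common k i) (common k j))) (λ i → g (common k i) (extra k f))))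
                   (prodF-keep k f (g (extra k e))))
      s₁ : ∀ e f → S₁ e f * (V * gaps k x e * (U * gaps k y f)) ≡ Γ * col f * (row e * g (extra k e) (extra k f)) * D e f
      s₁ e f = trans (cong (S₁ e f *_) (sym (cong₂ _*_ (vdm-keep k e x) (vdm-keep k f y))))
        (trans (Sv-fraction (suc k) _ _ z t (λ i j → nz (keep k e i) (keep k f j))) (cong (_* D e f) (γ₁₁ e f)))
      K≢0 : K ≢ 0ℚ
      K≢0 = *-≢0 {V * U * (V * U)} {P₀ * P₁ * (Q₀ * Q₁)} (*-≢0 VU VU) (*-≢0 Ps Qs)
        where
        vx : V * (P₀ * P₁) ≢ 0ℚ
        vx = *-≢0ˡ {V * (P₀ * P₁)} {dx} (subst (_≢ 0ℚ) (vdm-bordered k x) (*-≢0ˡ {vdm x} {vdm y} vnz))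
        vy : U * (Q₀ * Q₁) ≢ 0ℚ
        vy = *-≢0ˡ {U * (Q₀ * Q₁)} {dy} (subst (_≢ 0ℚ) (vdm-bordered k y) (*-≢0ʳ {vdm x} {vdm y} vnz))
        VU : V * U ≢ 0ℚ
        VU = *-≢0 {V} {U} (*-≢0ˡ {V} {P₀ * P₁} vx) (*-≢0ˡ {U} {Q₀ * Q₁} vy)
        Ps : P₀ * P₁ ≢ 0ℚ
        Ps = *-≢0ʳ {V} {P₀ * P₁} vx
        Qs : Q₀ * Q₁ ≢ 0ℚ
        Qs = *-≢0ʳ {U} {Q₀ * Q₁} vy
      r₁ : ∀ V U P₀ P₁ Q₀ Q₁ dx dy S₂ S₀ → V * U * (V * U) * (P₀ * P₁ * (Q₀ * Q₁)) * (dx * dy * S₂ * S₀)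
        ≡ (S₂ * (V * (P₀ * P₁) * dx * (U * (Q₀ * Q₁) * dy))) * (S₀ * (V * U))
      r₁ = solve 10 (λ V U P₀ P₁ Q₀ Q₁ dx dy S₂ S₀ → V :* U :* (V :* U) :* (P₀ :* P₁ :* (Q₀ :* Q₁)) :* (dx :* dy :* S₂ :* S₀) := (S₂ :* (V :* (P₀ :* P₁) :* dx :* (U :* (Q₀ :* Q₁) :* dy))) :* (S₀ :* (V :* U))) refl
      r₂ : ∀ a b c d → (a * b) * (c * d) ≡ a * c * (b * d)
      r₂ = solve 4 (λ a b c d → (a :* b) :* (c :* d) := a :* c :* (b :* d)) refl
      r₃ : ∀ Γ c₀ c₁ r₀ r₁ g₀₀ g₀₁ g₁₀ g₁₁ d₀₀ d₁₁ d₀₁ d₁₀ →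
        Γ * (c₀ * c₁) * (r₀ * (g₀₀ * g₀₁) * (r₁ * (g₁₀ * g₁₁))) * Γ * (d₀₀ * d₁₁ - d₀₁ * d₁₀)
        ≡ g₀₁ * g₁₀ * ((Γ * c₀ * (r₀ * g₀₀) * d₀₀) * (Γ * c₁ * (r₁ * g₁₁) * d₁₁)) - g₀₀ * g₁₁ * ((Γ * c₁ * (r₀ * g₀₁) * d₀₁) * (Γ * c₀ * (r₁ * g₁₀) * d₁₀))
      r₃ = solve 13 (λ Γ c₀ c₁ r₀ r₁ g₀₀ g₀₁ g₁₀ g₁₁ d₀₀ d₁₁ d₀₁ d₁₀ → Γ :* (c₀ :* c₁) :* (r₀ :* (g₀₀ :* g₀₁) :* (r₁ :* (g₁₀ :* g₁₁))) :* Γ :* (d₀₀ :* d₁₁ :- d₀₁ :* d₁₀) := g₀₁ :* g₁₀ :* ((Γ :* c₀ :* (r₀ :* g₀₀) :* d₀₀) :* (Γ :* c₁ :* (r₁ :* g₁₁) :* d₁₁)) :- g₀₀ :* g₁₁ :* ((Γ :* c₁ :* (r₀ :* g₀₁) :* d₀₁) :* (Γ :* c₀ :* (r₁ :* g₁₀) :* d₁₀))) refl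
      r₄ : ∀ V U P₀ P₁ Q₀ Q₁ a b s₀₀ s₁₁ s₀₁ s₁₀ →
        a * ((s₀₀ * (V * P₀ * (U * Q₀))) * (s₁₁ * (V * P₁ * (U * Q₁)))) - b * ((s₀₁ * (V * P₀ * (U * Q₁))) * (s₁₀ * (V * P₁ * (U * Q₀))))
        ≡ V * U * (V * U) * (P₀ * P₁ * (Q₀ * Q₁)) * (a * (s₀₀ * s₁₁) - b * (s₀₁ * s₁₀))
      r₄ = solve 12 (λ V U P₀ P₁ Q₀ Q₁ a b s₀₀ s₁₁ s₀₁ s₁₀ → a :* ((s₀₀ :* (V :* P₀ :* (U :* Q₀))) :* (s₁₁ :* (V :* P₁ :* (U :* Q₁)))) :- b :* ((s₀₁ :* (V :* P₀ :* (U :* Q₁))) :* (s₁₀ :* (V :* P₁ :* (U :* Q₀)))) := V :* U :* (V :* U) :* (P₀ :* P₁ :* (Q₀ :* Q₁)) :* (a :* (s₀₀ :* s₁₁) :- b :* (s₀₁ :* s₁₀))) refl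

  T : ∀ n → Vec ℚ (suc (dbl n)) → ℚ → ℚ
  T n v t = Sv n (λ i → lookup v (xpos n i)) (λ i → lookup v (ypos n i)) (lookup v (zpos n)) t

  T-enc : ∀ n x y z t → T n (enc n x y z) t ≡ Sv n x y z t
  T-enc n x y z t = trans (Sv-cong n (lookup (enc n x y z) (zpos n)) t (enc-x n x y z) (enc-y n x y z)) (cong (λ w → Sv n x y w t) (enc-z n x y z))

  T-cons : ∀ n a c v t → T (suc n) (a ∷ c ∷ v) t ≡ Sv (suc n) (snoc (λ i → lookup v (xpos n i)) a) (snoc (λ i → lookup v (ypos n i)) c) (lookup v (zpos n)) t
  T-cons n a c v t = Sv-cong (suc n) (lookup v (zpos n)) t
    (λ i → snoc-map (lookup (a ∷ c ∷ v)) (λ i → suc (suc (xpos n i))) zero i)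
    (λ i → snoc-map (lookup (a ∷ c ∷ v)) (λ i → suc (suc (ypos n i))) (suc zero) i)

  T-cons₂ : ∀ n a c b d v t → T (suc (suc n)) (b ∷ d ∷ a ∷ c ∷ v) t
    ≡ Sv (suc (suc n)) (snoc (snoc (λ i → lookup v (xpos n i)) a) b) (snoc (snoc (λ i → lookup v (ypos n i)) c) d) (lookup v (zpos n)) t
  T-cons₂ n a c b d v t = trans (T-cons (suc n) b d (a ∷ c ∷ v) t) (Sv-cong (suc (suc n)) (lookup v (zpos n)) t
    (λ i → snoc-cong (snoc-map (lookup (a ∷ c ∷ v)) (λ i → suc (suc (xpos n i))) zero) i)
    (λ i → snoc-cong (snoc-map (lookup (a ∷ c ∷ v)) (λ i → suc (suc (ypos n i))) (suc zero)) i))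

  T-0 : ∀ z t → T 0 (z ∷ []) t ≡ 1ℚ
  T-0 z t = trans (lem (T 0 (z ∷ []) t)) (Sv-det 0 (λ i → lookup (z ∷ []) (xpos 0 i)) (λ i → lookup (z ∷ []) (ypos 0 i)) z t)
    where
    lem : ∀ a → a ≡ a * (1ℚ * 1ℚ)
    lem = solve 1 (λ a → a := a :* (:1 :* :1)) refl

  T-1 : ∀ a c z t → T 1 (a ∷ c ∷ z ∷ []) t ≡ Fp t a c z
  T-1 a c z t = trans (lem (T 1 (a ∷ c ∷ z ∷ []) t)) (trans (Sv-det 1 (λ i → lookup (a ∷ c ∷ z ∷ []) (xpos 1 i)) (λ i → lookup (a ∷ c ∷ z ∷ []) (ypos 1 i)) z t) (lem' (Fp t a c z)))
    where
    lem : ∀ a → a ≡ a * ((1ℚ * 1ℚ) * (1ℚ * 1ℚ))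
    lem = solve 1 (λ a → a := a :* ((:1 :* :1) :* (:1 :* :1))) refl
    lem' : ∀ a → 1ℚ * (a * 1ℚ) * 1ℚ + 0ℚ ≡ a
    lem' = solve 1 (λ a → :1 :* (a :* :1) :* :1 :+ :0 := a) refl

  module _ (k : ℕ) where
    private
      e₀ e₁ : Fin 2
      e₀ = zero
      e₁ = suc zero

    -- Both sides are polynomial, so the conditions that G be nonzero and the arguments be distinct
    -- drop out. This permits the specialization to repeated arguments.
    bilinear : ∀ (x y : Fin (suc (suc k)) → ℚ) z t →
      (x (extra k e₁) - x (extra k e₀)) * (y (extra k e₁) - y (extra k e₀)) * Sv (suc (suc k)) x y z t * Sv k (λ i → x (common k i)) (λ i → y (common k i)) z t
        ≡ Gp t (x (extra k e₀)) (y (extra k e₁)) * Gp t (x (extra k e₁)) (y (extra k e₀))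
            * (Sv (suc k) (λ i → x (keep k e₀ i)) (λ i → y (keep k e₀ i)) z t * Sv (suc k) (λ i → x (keep k e₁ i)) (λ i → y (keep k e₁ i)) z t)
          - Gp t (x (extra k e₀)) (y (extra k e₀)) * Gp t (x (extra k e₁)) (y (extra k e₁))
            * (Sv (suc k) (λ i → x (keep k e₀ i)) (λ i → y (keep k e₁ i)) z t * Sv (suc k) (λ i → x (keep k e₁ i)) (λ i → y (keep k e₀ i)) z t)
    bilinear x y z t = dense-⇒≡
      (dense-* poly-allG poly-bothVdm dense-allG dense-bothVdm)
      (poly-* (poly-* (poly-* (poly-sub (px (extra k e₁)) (px (extra k e₀))) (poly-sub (py (extra k e₁)) (py (extra k e₀)))) (poly-Sv (suc (suc k)) px py pz pζ))
              (poly-Sv k (λ i → px (common k i)) (λ i → py (common k i)) pz pζ))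
      (poly-sub (poly-* (poly-* (poly-Gp pζ (px (extra k e₀)) (py (extra k e₁))) (poly-Gp pζ (px (extra k e₁)) (py (extra k e₀)))) (poly-* (pS e₀ e₀) (pS e₁ e₁)))
              (poly-* (poly-* (poly-Gp pζ (px (extra k e₀)) (py (extra k e₀))) (poly-Gp pζ (px (extra k e₁)) (py (extra k e₁)))) (poly-* (pS e₀ e₁) (pS e₁ e₀))))
      (λ ρ nz → bilinear-generic k (λ i → ρ (xv i)) (λ i → ρ (yv i)) (ρ zv) (ρ ζv) (allG-≢0 ρ (*-≢0ˡ {allG ρ} {bothVdm ρ} nz)) (*-≢0ʳ {allG ρ} {bothVdm ρ} nz))
      (envS x y z t)
      where
      pS : ∀ e f → IsPoly {SVar (suc (suc k))} (λ ρ → Sv (suc k) (λ i → ρ (xv (keep k e i))) (λ i → ρ (yv (keep k f i))) (ρ zv) (ρ ζv))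
      pS e f = poly-Sv (suc k) (λ i → px (keep k e i)) (λ i → py (keep k f i)) pz pζ

  hirota-rhs : ∀ n (b d a c : ℚ) → Vec ℚ (suc (dbl n)) → ℚ → ℚ
  hirota-rhs n b d a c v t = Gp t a d * Gp t b c * (T (suc n) (a ∷ c ∷ v) t * T (suc n) (b ∷ d ∷ v) t)
    - Gp t a c * Gp t b d * (T (suc n) (a ∷ d ∷ v) t * T (suc n) (b ∷ c ∷ v) t)

  -- The list form: a and b are the bordering x, c and d the bordering y, and v holds the arguments
  -- shared by all terms.
  hirota : ∀ n b d a c v t → (b - a) * (d - c) * T (suc (suc n)) (b ∷ d ∷ a ∷ c ∷ v) t * T n v t ≡ hirota-rhs n b d a c v t
  hirota n b d a c v t = begin
    (b - a) * (d - c) * T (suc (suc n)) (b ∷ d ∷ a ∷ c ∷ v) t * T n v t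
      ≡⟨ cong₂ _*_ (cong₂ _*_ (cong₂ _*_ (cong₂ _-_ (sym xe₁) (sym xe₀)) (cong₂ _-_ (sym ye₁) (sym ye₀))) (T-cons₂ n a c b d v t))
                   (sym (Sv-cong n z t (snoc-snoc-common n X a b) (snoc-snoc-common n Y c d))) ⟩
    (x (extra n zero₁) - x (extra n zero)) * (y (extra n zero₁) - y (extra n zero)) * Sv (suc (suc n)) x y z t * Sv n (λ i → x (common n i)) (λ i → y (common n i)) z t
      ≡⟨ bilinear n x y z t ⟩
    Gp t (x (extra n zero)) (y (extra n zero₁)) * Gp t (x (extra n zero₁)) (y (extra n zero))
        * (Sv (suc n) (λ i → x (keep n zero i)) (λ i → y (keep n zero i)) z t * Sv (suc n) (λ i → x (keep n zero₁ i)) (λ i → y (keep n zero₁ i)) z t)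
      - Gp t (x (extra n zero)) (y (extra n zero)) * Gp t (x (extra n zero₁)) (y (extra n zero₁))
        * (Sv (suc n) (λ i → x (keep n zero i)) (λ i → y (keep n zero₁ i)) z t * Sv (suc n) (λ i → x (keep n zero₁ i)) (λ i → y (keep n zero i)) z t)
      ≡⟨ cong₂ _-_ (cong₂ _*_ (cong₂ _*_ (cong₂ (Gp t) xe₀ ye₁) (cong₂ (Gp t) xe₁ ye₀)) (cong₂ _*_ (s (snoc-snoc-keep₀ n X a b) (snoc-snoc-keep₀ n Y c d)) (s (snoc-snoc-keep₁ n X a b) (snoc-snoc-keep₁ n Y c d))))
                   (cong₂ _*_ (cong₂ _*_ (cong₂ (Gp t) xe₀ ye₀) (cong₂ (Gp t) xe₁ ye₁)) (cong₂ _*_ (s (snoc-snoc-keep₀ n X a b) (snoc-snoc-keep₁ n Y c d)) (s (snoc-snoc-keep₁ n X a b) (snoc-snoc-keep₀ n Y c d)))) ⟩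
    hirota-rhs n b d a c v t ∎
    where
    open ≡-Reasoning
    zero₁ : Fin 2
    zero₁ = suc zero
    X Y : Fin n → ℚ
    X i = lookup v (xpos n i)
    Y i = lookup v (ypos n i)
    z = lookup v (zpos n)
    x y : Fin (suc (suc n)) → ℚ
    x = snoc (snoc X a) b
    y = snoc (snoc Y c) d
    xe₀ = snoc-snoc-extra₀ n X a b
    xe₁ = snoc-snoc-extra₁ n X a b
    ye₀ = snoc-snoc-extra₀ n Y c d
    ye₁ = snoc-snoc-extra₁ n Y c d
    s : ∀ {x' y' : Fin (suc n) → ℚ} {p q} → (∀ i → x' i ≡ snoc X p i) → (∀ i → y' i ≡ snoc Y q i) → Sv (suc n) x' y' z t ≡ T (suc n) (p ∷ q ∷ v) t
    s {p = p} {q} ex ey = trans (Sv-cong (suc n) z t ex ey) (sym (T-cons n p q v t))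

  -- Both exchanged arguments sit in x positions, so antisymmetry of the determinant in its rows
  -- suffices.
  T-row-swap : ∀ n b d a c p q v t → T (suc (suc (suc n))) (b ∷ d ∷ a ∷ c ∷ p ∷ q ∷ v) t ≡ T (suc (suc (suc n))) (b ∷ d ∷ p ∷ c ∷ a ∷ q ∷ v) t
  T-row-swap n b d a c p q v t = trans (cons₃ a p) (trans (sym (Sv-adj (suc (suc n)) (x a p) y z t (mid n)))
      (trans (Sv-cong (suc (suc (suc n))) z t (snoc³-adj n X p a b) (λ i → refl)) (sym (cons₃ p a))))
    where
    X Y : Fin n → ℚ
    X i = lookup v (xpos n i)
    Y i = lookup v (ypos n i)
    z = lookup v (zpos n)
    x : ℚ → ℚ → Fin (suc (suc (suc n))) → ℚ
    x a p = snoc (snoc (snoc X p) a) b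
    y : Fin (suc (suc (suc n))) → ℚ
    y = snoc (snoc (snoc Y q) c) d
    cons₃ : ∀ a p → T (suc (suc (suc n))) (b ∷ d ∷ a ∷ c ∷ p ∷ q ∷ v) t ≡ Sv (suc (suc (suc n))) (x a p) y z t
    cons₃ a p = trans (T-cons₂ (suc n) a c b d (p ∷ q ∷ v) t) (Sv-cong (suc (suc (suc n))) z t
      (λ i → snoc-cong (λ j → snoc-cong (snoc-map (lookup (p ∷ q ∷ v)) (λ i → suc (suc (xpos n i))) zero) j) i)
      (λ i → snoc-cong (λ j → snoc-cong (snoc-map (lookup (p ∷ q ∷ v)) (λ i → suc (suc (ypos n i))) (suc zero)) j) i))

  -- At t = 0 the entries F/G are z/(x + y − 1), so Cauchy's formula applies.
  T-nonzero : ∀ n → Σ (Vec ℚ (suc (dbl n))) λ v → T n v 0ℚ ≢ 0ℚ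
  T-nonzero n = enc n x x 1ℚ , λ T0 → *-≢0 {prodF (λ i → prodF (λ j → Gp 0ℚ (x i) (x j)))} {det M} (prodF-≢0 (λ i → prodF-≢0 (λ j → G≢0 i j))) det≢0
      (trans (sym (Sv-fraction n x x 1ℚ 0ℚ G≢0)) (trans (cong (_* (vdm x * vdm x)) (trans (sym (T-enc n x x 1ℚ 0ℚ)) T0)) (ℚP.*-zeroˡ (vdm x * vdm x))))
    where
    -- With x_i = i + 1 every x_i + x_j - 1 is a positive integer, so no denominator of the Cauchy
    -- matrix vanishes.
    x p : Fin n → ℚ
    x i = ι (suc (toℕ i))
    p i = x i - 1ℚ
    M : Mat n
    M i j = Fp 0ℚ (x i) (x j) 1ℚ ÷' Gp 0ℚ (x i) (x j)
    w≢0 : ∀ i j → p j + 1ℚ * x i ≢ 0ℚ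
    w≢0 i j eq = ι-suc≢0 (toℕ j ℕ.+ toℕ i) (trans (cong (1ℚ +_) (ι-+ (toℕ j) (toℕ i))) (trans (lem (ι (toℕ j)) (ι (toℕ i))) eq))
      where
      lem : ∀ a b → 1ℚ + (a + b) ≡ (1ℚ + a - 1ℚ) + 1ℚ * (1ℚ + b)
      lem = solve 2 (λ a b → :1 :+ (a :+ b) := (:1 :+ a :- :1) :+ :1 :* (:1 :+ b)) refl
    xx≢0 : ∀ i j → two * x i * x j ≢ 0ℚ
    xx≢0 i j = *-≢0 (*-≢0 {two} (λ ()) (ι-suc≢0 (toℕ i))) (ι-suc≢0 (toℕ j))
    G-at-0 : ∀ a b → Gp 0ℚ a b ≡ two * a * b * ((b - 1ℚ) + 1ℚ * a)
    G-at-0 a b = lem a b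
      where
      lem : ∀ a b → (0ℚ + two) * a * b * (a + b) - 0ℚ * (a * a + b * b) - two * (0ℚ * 0ℚ + ℕ→ℚ 3 * 0ℚ + 1ℚ) * a * b + 0ℚ * (two * 0ℚ + 1ℚ) * (a + b) ≡ two * a * b * ((b - 1ℚ) + 1ℚ * a)
      lem = solve 2 (λ a b → (:0 :+ :2) :* a :* b :* (a :+ b) :- :0 :* (a :* a :+ b :* b) :- :2 :* (:0 :* :0 :+ :3 :* :0 :+ :1) :* a :* b :+ :0 :* (:2 :* :0 :+ :1) :* (a :+ b) := :2 :* a :* b :* ((b :- :1) :+ :1 :* a)) refl
    F-at-0 : ∀ a b → Fp 0ℚ a b 1ℚ ≡ two * a * b
    F-at-0 a b = lem a b
      where
      lem : ∀ a b → (0ℚ + two) * a * b * 1ℚ - 0ℚ * (a * b + b * 1ℚ + a * 1ℚ + a + b + 1ℚ) + 0ℚ * (two * 0ℚ + 1ℚ) ≡ two * a * b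
      lem = solve 2 (λ a b → (:0 :+ :2) :* a :* b :* :1 :- :0 :* (a :* b :+ b :* :1 :+ a :* :1 :+ a :+ b :+ :1) :+ :0 :* (:2 :* :0 :+ :1) := :2 :* a :* b) refl
    G≢0 : ∀ i j → Gp 0ℚ (x i) (x j) ≢ 0ℚ
    G≢0 i j eq = *-≢0 (xx≢0 i j) (w≢0 i j) (trans (sym (G-at-0 (x i) (x j))) eq)
    unit : ∀ i j → M i j * (p j + 1ℚ * x i) ≡ 1ℚ
    unit i j = *-cancelˡ-≢0 (two * x i * x j) (xx≢0 i j)
      (trans (lem (two * x i * x j) (M i j) (p j + 1ℚ * x i)) (trans (cong (M i j *_) (sym (G-at-0 (x i) (x j))))
        (trans (÷'-* (Fp 0ℚ (x i) (x j) 1ℚ) (G≢0 i j)) (trans (F-at-0 (x i) (x j)) (sym (ℚP.*-identityʳ (two * x i * x j)))))))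
      where
      lem : ∀ a b c → a * (b * c) ≡ b * (a * c)
      lem = solve 3 (λ a b c → a :* (b :* c) := b :* (a :* c)) refl
    det≢0 : det M ≢ 0ℚ
    det≢0 d0 = *-≢0 {vdm x} {prodLt (λ i j → 1ℚ * p j - p i * 1ℚ)} (prodLt-≢0 {n} (λ i j i<j → ι-<-≢ (ℕ.s≤s i<j)))
      (prodLt-≢0 (λ i j i<j eq → ι-<-≢ (ℕ.s≤s i<j) (trans (lem (x i) (x j)) eq)))
      (trans (sym (cauchy p (λ _ → 1ℚ) x M unit)) (trans (cong (_* prodF (λ i → prodF (λ j → p j + 1ℚ * x i))) d0) (ℚP.*-zeroˡ (prodF (λ i → prodF (λ j → p j + 1ℚ * x i))))))
      where
      lem : ∀ a b → b - a ≡ 1ℚ * (b - 1ℚ) - (a - 1ℚ) * 1ℚ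
      lem = solve 2 (λ a b → b :- a := :1 :* (b :- :1) :- (a :- :1) :* :1) refl

  -- Symmetry of S_n in all its arguments

  vecOf : ∀ {m} → Env (Maybe (Fin m)) → Vec ℚ m
  vecOf ρ = tabulate (λ i → ρ (just i))

  envOf : ∀ {m} → Vec ℚ m → ℚ → Env (Maybe (Fin m))
  envOf v t = maybe (lookup v) t

  IsVecPoly : ∀ {m} → (Vec ℚ m → ℚ → ℚ) → Set
  IsVecPoly f = IsPoly (λ ρ → f (vecOf ρ) (ρ nothing))

  -- F only permutes or selects entries; this is what makes composition with it polynomial.
  Rearrangement : ∀ {m m'} → (Vec ℚ m → Vec ℚ m') → Set
  Rearrangement {m} {m'} F = Σ (Fin m' → Fin m) λ π → ∀ v i → lookup (F v) i ≡ lookup v (π i)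

  vp-T : ∀ {m} n {F : Vec ℚ m → Vec ℚ (suc (dbl n))} → Rearrangement F → IsVecPoly (λ v t → T n (F v) t)
  vp-T n {F} (π , eq) = poly-Sv n (λ i → look (xpos n i)) (λ i → look (ypos n i)) (look (zpos n)) (poly-var nothing)
    where
    look : ∀ i → IsPoly (λ ρ → lookup (F (vecOf ρ)) i)
    look i = poly-≗ (poly-var (just (π i))) (λ ρ → sym (trans (eq (vecOf ρ) i) (lookup∘tabulate (λ i → ρ (just i)) (π i))))

  vec-dense : ∀ {m} {f f' g : Vec ℚ m → ℚ → ℚ} → IsVecPoly f → IsVecPoly f' → Dense (λ ρ → g (vecOf ρ) (ρ nothing)) →
    (∀ v t → g v t ≢ 0ℚ → f v t ≡ f' v t) → ∀ v t → f v t ≡ f' v t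
  vec-dense {f = f} {f'} p p' d h v t = subst (λ w → f w t ≡ f' w t) (tabulate∘lookup v)
    (dense-⇒≡ d p p' (λ ρ nz → h (vecOf ρ) (ρ nothing) nz) (envOf v t))

  vec-dense-witness : ∀ {m} {g : Vec ℚ m → ℚ → ℚ} → IsVecPoly g → ∀ v t → g v t ≢ 0ℚ → Dense (λ ρ → g (vecOf ρ) (ρ nothing))
  vec-dense-witness {g = g} p v t nz = dense p (envOf v t) (subst (λ w → g w t ≢ 0ℚ) (sym (tabulate∘lookup v)) nz)

  SymT : ℕ → Set
  SymT n = ∀ t → Symmetric (λ v → T n v t)

  symT-0 : SymT 0
  symT-0 t zero    (z ∷ []) = refl
  symT-0 t (suc k) (z ∷ []) = cong (λ w → T 0 (z ∷ w) t) (empty k)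
    where
    empty : ∀ k → swapAt k [] ≡ []
    empty zero    = refl
    empty (suc k) = refl

  swapAt-single : ∀ {A : Set} k (z : A) → swapAt k (z ∷ []) ≡ z ∷ []
  swapAt-single zero z = refl
  swapAt-single (suc zero) z = refl
  swapAt-single (suc (suc k)) z = refl

  symT-1 : SymT 1
  symT-1 t zero          (a ∷ c ∷ z ∷ []) = trans (T-1 c a z t) (trans (Fp-sym₁₂ t c a z) (sym (T-1 a c z t)))
  symT-1 t (suc zero)    (a ∷ c ∷ z ∷ []) = trans (T-1 a z c t) (trans (Fp-sym₂₃ t a z c) (sym (T-1 a c z t)))
  symT-1 t (suc (suc k)) (a ∷ c ∷ z ∷ []) = cong (λ w → T 1 (a ∷ c ∷ w) t) (swapAt-single k z)

  module Step (n : ℕ) (sym₁ : SymT (suc n)) (sym₀ : SymT n) where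
    private
      Vec₂ : Set
      Vec₂ = Vec ℚ (suc (dbl (suc (suc n))))

    -- The coefficient of T₂ in the bilinear identity. It is a nonzero polynomial, since `T-nonzero`
    -- exhibits a nonzero value of its last factor, and may therefore be cancelled.
    weight : Vec₂ → ℚ → ℚ
    weight (b ∷ d ∷ a ∷ c ∷ v) t = (b - a) * (d - c) * T n v t

    tail₄ : Vec₂ → Vec ℚ (suc (dbl n))
    tail₄ (b ∷ d ∷ a ∷ c ∷ v) = v

    rearr-tail₄ : Rearrangement tail₄
    rearr-tail₄ = (λ i → suc (suc (suc (suc i)))) , λ { (b ∷ d ∷ a ∷ c ∷ v) i → refl }

    dense-weight : Dense (λ ρ → weight (vecOf ρ) (ρ nothing))
    dense-weight = dense-* (poly-* ba dc) pT (dense-* ba dc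
        (dense ba (λ { (just zero) → 1ℚ ; _ → 0ℚ }) 1≢0)
        (dense dc (λ { (just (suc zero)) → 1ℚ ; _ → 0ℚ }) 1≢0))
        (vec-dense-witness {g = λ v t → T n (tail₄ v) t} pT (0ℚ ∷ 0ℚ ∷ 0ℚ ∷ 0ℚ ∷ proj₁ (T-nonzero n)) 0ℚ (proj₂ (T-nonzero n)))
      where
      ba : IsPoly (λ ρ → ρ (just zero) - ρ (just (suc (suc zero))))
      ba = poly-sub (poly-var (just zero)) (poly-var (just (suc (suc zero))))
      dc : IsPoly (λ ρ → ρ (just (suc zero)) - ρ (just (suc (suc (suc zero)))))
      dc = poly-sub (poly-var (just (suc zero))) (poly-var (just (suc (suc (suc zero)))))
      pT : IsVecPoly (λ v t → T n (tail₄ v) t)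
      pT = vp-T n {F = tail₄} rearr-tail₄

    T₂ : Vec₂ → ℚ → ℚ
    T₂ = T (suc (suc n))

    -- Up to a common sign, F preserves both the weight and the right-hand side of the bilinear identity.
    from-hirota : (F : Vec₂ → Vec₂) → Rearrangement F →
      (∀ v t → weight v t ≢ 0ℚ → weight v t * T₂ (F v) t ≡ weight v t * T₂ v t) → ∀ v t → T₂ (F v) t ≡ T₂ v t
    from-hirota F r h = vec-dense {f = λ v t → T₂ (F v) t} {f' = T₂} {g = weight} (vp-T (suc (suc n)) {F = F} r) (vp-T (suc (suc n)) {F = λ v → v} ((λ i → i) , λ v i → refl)) dense-weight
      (λ v t nz → *-cancelˡ-≢0 (weight v t) nz (h v t nz))

    hirota-weight : ∀ b d a c v t → weight (b ∷ d ∷ a ∷ c ∷ v) t * T₂ (b ∷ d ∷ a ∷ c ∷ v) t ≡ hirota-rhs n b d a c v t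
    hirota-weight b d a c v t = trans (lem (b - a) (d - c) (T n v t) (T₂ (b ∷ d ∷ a ∷ c ∷ v) t)) (hirota n b d a c v t)
      where
      lem : ∀ x y z w → x * y * z * w ≡ x * y * w * z
      lem = solve 4 (λ x y z w → x :* y :* z :* w := x :* y :* w :* z) refl

    swap-ba : ∀ b d a c v t → T₂ (a ∷ d ∷ b ∷ c ∷ v) t ≡ T₂ (b ∷ d ∷ a ∷ c ∷ v) t
    swap-ba b d a c v t = from-hirota F r h (b ∷ d ∷ a ∷ c ∷ v) t
      where
      F : Vec₂ → Vec₂
      F (b ∷ d ∷ a ∷ c ∷ v) = a ∷ d ∷ b ∷ c ∷ v
      r : Rearrangement F
      r = (λ { zero → suc (suc zero) ; (suc zero) → suc zero ; (suc (suc zero)) → zero ; (suc (suc (suc i))) → suc (suc (suc i)) })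
        , λ { (b ∷ d ∷ a ∷ c ∷ v) zero → refl ; (b ∷ d ∷ a ∷ c ∷ v) (suc zero) → refl ; (b ∷ d ∷ a ∷ c ∷ v) (suc (suc zero)) → refl ; (b ∷ d ∷ a ∷ c ∷ v) (suc (suc (suc i))) → refl }
      h : ∀ v t → weight v t ≢ 0ℚ → weight v t * T₂ (F v) t ≡ weight v t * T₂ v t
      h (b ∷ d ∷ a ∷ c ∷ v) t _ = trans (l₁ b a (d - c) (T n v t) (T₂ (a ∷ d ∷ b ∷ c ∷ v) t)) (trans (cong -_ (hirota-weight a d b c v t))
        (trans (l₂ (Gp t b d * Gp t a c) (T (suc n) (b ∷ c ∷ v) t) (T (suc n) (a ∷ d ∷ v) t) (Gp t b c * Gp t a d) (T (suc n) (b ∷ d ∷ v) t) (T (suc n) (a ∷ c ∷ v) t))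
        (trans (cong₂ (λ p q → p * (T (suc n) (a ∷ c ∷ v) t * T (suc n) (b ∷ d ∷ v) t) - q * (T (suc n) (a ∷ d ∷ v) t * T (suc n) (b ∷ c ∷ v) t)) (ℚP.*-comm (Gp t b c) (Gp t a d)) (ℚP.*-comm (Gp t b d) (Gp t a c)))
               (sym (hirota-weight b d a c v t)))))
        where
        l₁ : ∀ b a x y z → (b - a) * x * y * z ≡ - ((a - b) * x * y * z)
        l₁ = solve 5 (λ b a x y z → (b :- a) :* x :* y :* z := :- ((a :- b) :* x :* y :* z)) refl
        l₂ : ∀ g x y g' x' y' → - (g * (x * y) - g' * (x' * y')) ≡ g' * (y' * x') - g * (y * x)
        l₂ = solve 6 (λ g x y g' x' y' → :- (g :* (x :* y) :- g' :* (x' :* y')) := g' :* (y' :* x') :- g :* (y :* x)) refl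

    swap-dc : ∀ b d a c v t → T₂ (b ∷ c ∷ a ∷ d ∷ v) t ≡ T₂ (b ∷ d ∷ a ∷ c ∷ v) t
    swap-dc b d a c v t = from-hirota F r h (b ∷ d ∷ a ∷ c ∷ v) t
      where
      F : Vec₂ → Vec₂
      F (b ∷ d ∷ a ∷ c ∷ v) = b ∷ c ∷ a ∷ d ∷ v
      r : Rearrangement F
      r = (λ { zero → zero ; (suc zero) → suc (suc (suc zero)) ; (suc (suc zero)) → suc (suc zero) ; (suc (suc (suc zero))) → suc zero ; (suc (suc (suc (suc i)))) → suc (suc (suc (suc i))) })
        , λ { (b ∷ d ∷ a ∷ c ∷ v) zero → refl ; (b ∷ d ∷ a ∷ c ∷ v) (suc zero) → refl ; (b ∷ d ∷ a ∷ c ∷ v) (suc (suc zero)) → refl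
            ; (b ∷ d ∷ a ∷ c ∷ v) (suc (suc (suc zero))) → refl ; (b ∷ d ∷ a ∷ c ∷ v) (suc (suc (suc (suc i)))) → refl }
      h : ∀ v t → weight v t ≢ 0ℚ → weight v t * T₂ (F v) t ≡ weight v t * T₂ v t
      h (b ∷ d ∷ a ∷ c ∷ v) t _ = trans (l₁ (b - a) d c (T n v t) (T₂ (b ∷ c ∷ a ∷ d ∷ v) t)) (trans (cong -_ (hirota-weight b c a d v t))
        (trans (l₂ (Gp t a c * Gp t b d) (T (suc n) (a ∷ d ∷ v) t) (T (suc n) (b ∷ c ∷ v) t) (Gp t a d * Gp t b c) (T (suc n) (a ∷ c ∷ v) t) (T (suc n) (b ∷ d ∷ v) t))
               (sym (hirota-weight b d a c v t))))
        where
        l₁ : ∀ x d c y z → x * (d - c) * y * z ≡ - (x * (c - d) * y * z)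
        l₁ = solve 5 (λ x d c y z → x :* (d :- c) :* y :* z := :- (x :* (c :- d) :* y :* z)) refl
        l₂ : ∀ g x y g' x' y' → - (g * (x * y) - g' * (x' * y')) ≡ g' * (x' * y') - g * (x * y)
        l₂ = solve 6 (λ g x y g' x' y' → :- (g :* (x :* y) :- g' :* (x' :* y')) := g' :* (x' :* y') :- g :* (x :* y)) refl

    transpose : ∀ b d a c v t → T₂ (d ∷ b ∷ c ∷ a ∷ v) t ≡ T₂ (b ∷ d ∷ a ∷ c ∷ v) t
    transpose b d a c v t = from-hirota F r h (b ∷ d ∷ a ∷ c ∷ v) t
      where
      F : Vec₂ → Vec₂
      F (b ∷ d ∷ a ∷ c ∷ v) = d ∷ b ∷ c ∷ a ∷ v
      r : Rearrangement F
      r = (λ { zero → suc zero ; (suc zero) → zero ; (suc (suc zero)) → suc (suc (suc zero)) ; (suc (suc (suc zero))) → suc (suc zero) ; (suc (suc (suc (suc i)))) → suc (suc (suc (suc i))) })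
        , λ { (b ∷ d ∷ a ∷ c ∷ v) zero → refl ; (b ∷ d ∷ a ∷ c ∷ v) (suc zero) → refl ; (b ∷ d ∷ a ∷ c ∷ v) (suc (suc zero)) → refl
            ; (b ∷ d ∷ a ∷ c ∷ v) (suc (suc (suc zero))) → refl ; (b ∷ d ∷ a ∷ c ∷ v) (suc (suc (suc (suc i)))) → refl }
      h : ∀ v t → weight v t ≢ 0ℚ → weight v t * T₂ (F v) t ≡ weight v t * T₂ v t
      h (b ∷ d ∷ a ∷ c ∷ v) t _ = trans (l₁ (b - a) (d - c) (T n v t) (T₂ (d ∷ b ∷ c ∷ a ∷ v) t)) (trans (hirota-weight d b c a v t)
        (trans (cong₂ _-_ (cong₂ _*_ (cong₂ _*_ (Gp-sym t c b) (Gp-sym t d a)) (cong₂ _*_ (sym₁ t 0 (a ∷ c ∷ v)) (sym₁ t 0 (b ∷ d ∷ v))))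
                          (cong₂ _*_ (cong₂ _*_ (Gp-sym t c a) (Gp-sym t d b)) (cong₂ _*_ (sym₁ t 0 (b ∷ c ∷ v)) (sym₁ t 0 (a ∷ d ∷ v)))))
        (trans (l₂ (Gp t b c) (Gp t a d) (T (suc n) (a ∷ c ∷ v) t * T (suc n) (b ∷ d ∷ v) t) (Gp t a c * Gp t b d) (T (suc n) (b ∷ c ∷ v) t) (T (suc n) (a ∷ d ∷ v) t))
               (sym (hirota-weight b d a c v t)))))
        where
        l₁ : ∀ x y z w → x * y * z * w ≡ y * x * z * w
        l₁ = solve 4 (λ x y z w → x :* y :* z :* w := y :* x :* z :* w) refl
        l₂ : ∀ g g' x h y z → g * g' * x - h * (y * z) ≡ g' * g * x - h * (z * y)
        l₂ = solve 6 (λ g g' x h y z → g :* g' :* x :- h :* (y :* z) := g' :* g :* x :- h :* (z :* y)) refl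

    swap-tail : ∀ k b d a c v t → T₂ (b ∷ d ∷ a ∷ c ∷ swapAt k v) t ≡ T₂ (b ∷ d ∷ a ∷ c ∷ v) t
    swap-tail k b d a c v t = from-hirota F r h (b ∷ d ∷ a ∷ c ∷ v) t
      where
      F : Vec₂ → Vec₂
      F (b ∷ d ∷ a ∷ c ∷ v) = b ∷ d ∷ a ∷ c ∷ swapAt k v
      r : Rearrangement F
      r = swapIndex (suc (suc (suc (suc k)))) , λ { (b ∷ d ∷ a ∷ c ∷ v) i → lookup-swapAt (suc (suc (suc (suc k)))) (b ∷ d ∷ a ∷ c ∷ v) i }
      h : ∀ v t → weight v t ≢ 0ℚ → weight v t * T₂ (F v) t ≡ weight v t * T₂ v t
      h (b ∷ d ∷ a ∷ c ∷ v) t _ = trans (cong (λ w → (b - a) * (d - c) * w * T₂ (b ∷ d ∷ a ∷ c ∷ swapAt k v) t) (sym (sym₀ t k v)))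
        (trans (hirota-weight b d a c (swapAt k v) t)
        (trans (cong₂ _-_ (cong (Gp t a d * Gp t b c *_) (cong₂ _*_ (s a c) (s b d))) (cong (Gp t a c * Gp t b d *_) (cong₂ _*_ (s a d) (s b c))))
               (sym (hirota-weight b d a c v t))))
        where
        s : ∀ p q → T (suc n) (p ∷ q ∷ swapAt k v) t ≡ T (suc n) (p ∷ q ∷ v) t
        s p q = sym₁ t (suc (suc k)) (p ∷ q ∷ v)

    -- The bilinear identity yields the exchange of b and a, that of d and c, the transposition of
    -- rows and columns, and every permutation inside the tail. None of these mixes c with the head
    -- p of the tail; given that one transposition, all adjacent ones arise by conjugation.
    symmetric : (∀ b d a c p v t → T₂ (b ∷ d ∷ a ∷ p ∷ c ∷ v) t ≡ T₂ (b ∷ d ∷ a ∷ c ∷ p ∷ v) t) → SymT (suc (suc n))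
    symmetric cp t = λ
      { zero (b ∷ d ∷ a ∷ c ∷ p ∷ v) → bd b d a c p v
      ; (suc zero) (b ∷ d ∷ a ∷ c ∷ p ∷ v) → da b d a c p v
      ; (suc (suc zero)) (b ∷ d ∷ a ∷ c ∷ p ∷ v) → ac b d a c p v
      ; (suc (suc (suc zero))) (b ∷ d ∷ a ∷ c ∷ p ∷ v) → cp b d a c p v t
      ; (suc (suc (suc (suc k)))) (b ∷ d ∷ a ∷ c ∷ v) → swap-tail k b d a c v t }
      where
      f : ∀ b d a c p → Vec ℚ (dbl n) → ℚ
      f b d a c p v = T₂ (b ∷ d ∷ a ∷ c ∷ p ∷ v) t
      ap : ∀ b d a c p v → f b d a c p v ≡ f b d p c a v
      ap b d a c p v = trans (sym (transpose b d a c (p ∷ v) t)) (trans (sym (cp d b c a p v t)) (transpose b d p c (a ∷ v) t))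
      ac : ∀ b d a c p v → f b d c a p v ≡ f b d a c p v
      ac b d a c p v = trans (ap b d c a p v) (trans (sym (cp b d p a c v t)) (ap b d p c a v))
      dp : ∀ b d a c p v → f b d a c p v ≡ f b p a c d v
      dp b d a c p v = trans (swap-dc b c a d (p ∷ v) t) (trans (sym (cp b c a d p v t)) (swap-dc b p a c (d ∷ v) t))
      da : ∀ b d a c p v → f b a d c p v ≡ f b d a c p v
      da b d a c p v = trans (ap b a d c p v) (trans (dp b a p c d v) (ap b d p c a v))
      bp : ∀ b d a c p v → f b d a c p v ≡ f p d a c b v
      bp b d a c p v = trans (swap-ba a d b c (p ∷ v) t) (trans (ap a d b c p v) (swap-ba p d a c (b ∷ v) t))
      bd : ∀ b d a c p v → f d b a c p v ≡ f b d a c p v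
      bd b d a c p v = trans (bp d b a c p v) (trans (dp p b a c d v) (bp p d a c b v))

  -- For n = 2 the tail is the single argument z, and exchanging it with c is beyond row and column
  -- symmetries. Here S_1 = F makes the identity explicit, and the three-term relation carries the
  -- exchange.
  symT-2 : SymT 2
  symT-2 = Step.symmetric 0 symT-1 symT-0 (λ { b d a c p [] t → cp b d a c p t })
    where
    open Step 0 symT-1 symT-0 using (rearr-tail₄; hirota-weight; T₂)
    w : Vec ℚ 5 → ℚ → ℚ
    w (b ∷ d ∷ a ∷ c ∷ z ∷ []) t = (b - a) * (d - c) * (d - z)
    pv : (i : Fin 5) → IsPoly {Maybe (Fin 5)} (λ ρ → ρ (just i))
    pv i = poly-var (just i)
    dense-w : Dense (λ ρ → w (vecOf ρ) (ρ nothing))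
    dense-w = dense (poly-* (poly-* (poly-sub (pv zero) (pv (suc (suc zero)))) (poly-sub (pv (suc zero)) (pv (suc (suc (suc zero)))))) (poly-sub (pv (suc zero)) (pv (suc (suc (suc (suc zero)))))))
      (λ { (just zero) → 1ℚ ; (just (suc zero)) → 1ℚ ; _ → 0ℚ }) (λ ())
    F : Vec ℚ 5 → Vec ℚ 5
    F (b ∷ d ∷ a ∷ c ∷ z ∷ []) = b ∷ d ∷ a ∷ z ∷ c ∷ []
    r : Rearrangement F
    r = (λ { zero → zero ; (suc zero) → suc zero ; (suc (suc zero)) → suc (suc zero) ; (suc (suc (suc zero))) → suc (suc (suc (suc zero))) ; (suc (suc (suc (suc zero)))) → suc (suc (suc zero)) })
      , λ { (b ∷ d ∷ a ∷ c ∷ z ∷ []) zero → refl ; (b ∷ d ∷ a ∷ c ∷ z ∷ []) (suc zero) → refl ; (b ∷ d ∷ a ∷ c ∷ z ∷ []) (suc (suc zero)) → refl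
          ; (b ∷ d ∷ a ∷ c ∷ z ∷ []) (suc (suc (suc zero))) → refl ; (b ∷ d ∷ a ∷ c ∷ z ∷ []) (suc (suc (suc (suc zero)))) → refl }
    module _ (b d a c z t : ℚ) where
      explicit : (b - a) * (d - c) * T₂ (b ∷ d ∷ a ∷ c ∷ z ∷ []) t ≡ Gp t a d * Gp t b c * (Fp t a c z * Fp t b d z) - Gp t a c * Gp t b d * (Fp t a d z * Fp t b c z)
      explicit = trans (l ((b - a) * (d - c)) (T₂ (b ∷ d ∷ a ∷ c ∷ z ∷ []) t)) (trans (cong (λ u → (b - a) * (d - c) * u * T₂ (b ∷ d ∷ a ∷ c ∷ z ∷ []) t) (sym (T-0 z t)))
        (trans (hirota-weight b d a c (z ∷ []) t)
          (cong₂ _-_ (cong (Gp t a d * Gp t b c *_) (cong₂ _*_ (T-1 a c z t) (T-1 b d z t))) (cong (Gp t a c * Gp t b d *_) (cong₂ _*_ (T-1 a d z t) (T-1 b c z t))))))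
        where
        l : ∀ x y → x * y ≡ x * 1ℚ * y
        l = solve 2 (λ x y → x :* y := x :* :1 :* y) refl
    exchange : ∀ b d a c z t → (d - z) * (Gp t a d * Gp t b c * (Fp t a c z * Fp t b d z) - Gp t a c * Gp t b d * (Fp t a d z * Fp t b c z))
      ≡ (d - c) * (Gp t a d * Gp t b z * (Fp t a z c * Fp t b d c) - Gp t a z * Gp t b d * (Fp t a d c * Fp t b z c))
    exchange b d a c z t = begin
      (d - z) * (Gp t a d * Gp t b c * (Fp t a c z * Fp t b d z) - Gp t a c * Gp t b d * (Fp t a d z * Fp t b c z))
        ≡⟨ l₁ (d - z) (Gp t a d) (Gp t b c) (Fp t a c z) (Fp t b d z) (Gp t a c) (Gp t b d) (Fp t a d z) (Fp t b c z) ⟩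
      Gp t a d * Fp t a c z * ((d - z) * Gp t b c * Fp t b d z) - Gp t b d * Fp t b c z * ((d - z) * Gp t a c * Fp t a d z)
        ≡⟨ cong₂ (λ u v → Gp t a d * Fp t a c z * u - Gp t b d * Fp t b c z * v) (three-term t b c d z) (three-term t a c d z) ⟩
      -- The terms with the factor c - z coincide in both products and cancel.
      Gp t a d * Fp t a c z * ((c - z) * Gp t b d * Fp t b c z + (d - c) * Gp t b z * Fp t b c d) - Gp t b d * Fp t b c z * ((c - z) * Gp t a d * Fp t a c z + (d - c) * Gp t a z * Fp t a c d)
        ≡⟨ l₂ (Gp t a d) (Fp t a c z) (c - z) (Gp t b d) (Fp t b c z) (d - c) (Gp t b z) (Fp t b c d) (Gp t a z) (Fp t a c d) ⟩
      (d - c) * (Gp t a d * Gp t b z * (Fp t a c z * Fp t b c d) - Gp t a z * Gp t b d * (Fp t a c d * Fp t b c z))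
        ≡⟨ cong ((d - c) *_) (cong₂ _-_ (cong (Gp t a d * Gp t b z *_) (cong₂ _*_ (Fp-sym₂₃ t a c z) (Fp-sym₂₃ t b c d)))
                                         (cong (Gp t a z * Gp t b d *_) (cong₂ _*_ (Fp-sym₂₃ t a c d) (Fp-sym₂₃ t b c z)))) ⟩
      (d - c) * (Gp t a d * Gp t b z * (Fp t a z c * Fp t b d c) - Gp t a z * Gp t b d * (Fp t a d c * Fp t b z c)) ∎
      where
      open ≡-Reasoning
      l₁ : ∀ e g₁ g₂ f₁ f₂ g₃ g₄ f₃ f₄ → e * (g₁ * g₂ * (f₁ * f₂) - g₃ * g₄ * (f₃ * f₄)) ≡ g₁ * f₁ * (e * g₂ * f₂) - g₄ * f₄ * (e * g₃ * f₃)
      l₁ = solve 9 (λ e g₁ g₂ f₁ f₂ g₃ g₄ f₃ f₄ → e :* (g₁ :* g₂ :* (f₁ :* f₂) :- g₃ :* g₄ :* (f₃ :* f₄)) := g₁ :* f₁ :* (e :* g₂ :* f₂) :- g₄ :* f₄ :* (e :* g₃ :* f₃)) refl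
      l₂ : ∀ g f e g' f' e' h k h' k' → g * f * (e * g' * f' + e' * h * k) - g' * f' * (e * g * f + e' * h' * k') ≡ e' * (g * h * (f * k) - h' * g' * (k' * f'))
      l₂ = solve 10 (λ g f e g' f' e' h k h' k' → g :* f :* (e :* g' :* f' :+ e' :* h :* k) :- g' :* f' :* (e :* g :* f :+ e' :* h' :* k') := e' :* (g :* h :* (f :* k) :- h' :* g' :* (k' :* f'))) refl
    generic : ∀ v t → w v t ≢ 0ℚ → T₂ (F v) t ≡ T₂ v t
    generic (b ∷ d ∷ a ∷ c ∷ z ∷ []) t nz = *-cancelˡ-≢0 ((b - a) * (d - c) * (d - z)) nz (trans (l₁ (b - a) (d - c) (d - z) (T₂ (b ∷ d ∷ a ∷ z ∷ c ∷ []) t))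
      (trans (cong ((d - c) *_) (explicit b d a z c t)) (trans (sym (exchange b d a c z t)) (trans (cong ((d - z) *_) (sym (explicit b d a c z t))) (l₂ (b - a) (d - c) (d - z) (T₂ (b ∷ d ∷ a ∷ c ∷ z ∷ []) t))))))
      where
      l₁ : ∀ x y z u → x * y * z * u ≡ y * (x * z * u)
      l₁ = solve 4 (λ x y z u → x :* y :* z :* u := y :* (x :* z :* u)) refl
      l₂ : ∀ x y z u → z * (x * y * u) ≡ x * y * z * u
      l₂ = solve 4 (λ x y z u → z :* (x :* y :* u) := x :* y :* z :* u) refl
    cp : ∀ b d a c z t → T₂ (b ∷ d ∷ a ∷ z ∷ c ∷ []) t ≡ T₂ (b ∷ d ∷ a ∷ c ∷ z ∷ []) t
    cp b d a c z t = vec-dense {f = λ v t → T₂ (F v) t} {f' = T₂} {g = w} (vp-T 2 {F = F} r) (vp-T 2 {F = λ v → v} ((λ i → i) , λ v i → refl)) dense-w generic (b ∷ d ∷ a ∷ c ∷ z ∷ []) t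

  -- For three or more rows the missing exchange of c and p is a row exchange after transposition:
  -- both then occupy x positions.
  symT-pair : ∀ n → SymT (suc n) × SymT (suc (suc n))
  symT-pair zero    = symT-1 , symT-2
  symT-pair (suc n) = let (s₁ , s₂) = symT-pair n in s₂ , Step.symmetric (suc n) s₂ s₁ (λ { b d a c p (q ∷ v) t →
    trans (sym (Step.transpose (suc n) s₂ s₁ b d a p (c ∷ q ∷ v) t)) (trans (T-row-swap n d b p a c q v t) (Step.transpose (suc n) s₂ s₁ b d a c (p ∷ q ∷ v) t)) })

  symT : ∀ n → SymT n
  symT zero    = symT-0
  symT (suc n) = proj₁ (symT-pair n)

  T-perm : ∀ n t {u v} → Perm u v → T n u t ≡ T n v t
  T-perm n t = symmetric-perm (λ v → T n v t) (symT n t)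

  -- Covariance under inversion of all variables

  -- Under inversion F is rescaled by t² x y z, G by t² x² y² and a difference b - a by -a b. The
  -- signs occur in pairs and cancel; the count of the remaining powers leaves t^(2n²) and the n-th
  -- power of the product of all arguments.
  Sv-inv-generic : ∀ n (x x' y y' : Fin n → ℚ) z z' t t' →
    t * t' ≡ 1ℚ → (∀ i → x i * x' i ≡ 1ℚ) → (∀ i → y i * y' i ≡ 1ℚ) → z * z' ≡ 1ℚ →
    (∀ i j → Gp t (x i) (y j) ≢ 0ℚ) → vdm x * vdm y ≢ 0ℚ →
    Sv n x y z t ≡ ((t * t) ^ n) ^ n * (prodF x * prodF y * z) ^ n * Sv n x' y' z' t'
  Sv-inv-generic n x x' y y' z z' t t' ht hx hy hz nz vnz = *-cancelˡ-≢0 (X ^ n * Y ^ n * B') nz' (begin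
    X ^ n * Y ^ n * B' * Sv n x y z t
      ≡⟨ cong₂ (λ u w → u * w * B' * Sv n x y z t) (sym (prodLt-pairs x)) (sym (prodLt-pairs y)) ⟩
    Lx * X * (Ly * Y) * B' * Sv n x y z t
      ≡⟨ l₁ Lx X Ly Y B' (Sv n x y z t) ⟩
    X * Y * (Sv n x y z t * (Lx * Ly * B'))
      ≡⟨ cong (λ w → X * Y * (Sv n x y z t * w)) (sym both) ⟩
    X * Y * (Sv n x y z t * (vdm x * vdm y))
      ≡⟨ cong (X * Y *_) (Sv-fraction n x y z t nz) ⟩
    X * Y * (Γ * det M)
      ≡⟨ cong₂ (λ u w → X * Y * (u * w)) Γ-eq det-eq ⟩
    X * Y * (((t * t) ^ n) ^ n * (X * X) ^ n * (Y * Y) ^ n * Γ' * (X' * z ^ n * Y' * det M'))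
      ≡⟨ l₂ X Y (((t * t) ^ n) ^ n) ((X * X) ^ n) ((Y * Y) ^ n) Γ' X' (z ^ n) Y' (det M') ⟩
    (X * X') * (Y * Y') * (((t * t) ^ n) ^ n * (X * X) ^ n * (Y * Y) ^ n * z ^ n * (Γ' * det M'))
      ≡⟨ cong₂ (λ u w → u * (((t * t) ^ n) ^ n * (X * X) ^ n * (Y * Y) ^ n * z ^ n * w)) (cong₂ _*_ (prodF-inverse x x' hx) (prodF-inverse y y' hy)) (sym (Sv-fraction n x' y' z' t' nz₁)) ⟩
    1ℚ * 1ℚ * (((t * t) ^ n) ^ n * (X * X) ^ n * (Y * Y) ^ n * z ^ n * (Sv n x' y' z' t' * B'))
      ≡⟨ cong₂ (λ u w → 1ℚ * 1ℚ * (((t * t) ^ n) ^ n * u * w * z ^ n * (Sv n x' y' z' t' * B'))) (*-^ X X n) (*-^ Y Y n) ⟩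
    1ℚ * 1ℚ * (((t * t) ^ n) ^ n * (X ^ n * X ^ n) * (Y ^ n * Y ^ n) * z ^ n * (Sv n x' y' z' t' * B'))
      ≡⟨ l₃ (((t * t) ^ n) ^ n) (X ^ n) (Y ^ n) (z ^ n) (Sv n x' y' z' t') B' ⟩
    X ^ n * Y ^ n * B' * (((t * t) ^ n) ^ n * (X ^ n * Y ^ n * z ^ n) * Sv n x' y' z' t')
      ≡⟨ cong (λ w → X ^ n * Y ^ n * B' * (((t * t) ^ n) ^ n * w * Sv n x' y' z' t')) (sym (trans (*-^ (X * Y) z n) (cong (_* z ^ n) (*-^ X Y n)))) ⟩
    X ^ n * Y ^ n * B' * (((t * t) ^ n) ^ n * (X * Y * z) ^ n * Sv n x' y' z' t') ∎)
    where
    open ≡-Reasoning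
    M M' : Mat n
    M i j = Fp t (x i) (y j) z ÷' Gp t (x i) (y j)
    M' i j = Fp t' (x' i) (y' j) z' ÷' Gp t' (x' i) (y' j)
    X Y X' Y' B' Lx Ly Γ Γ' : ℚ
    X = prodF x
    Y = prodF y
    X' = prodF x'
    Y' = prodF y'
    B' = vdm x' * vdm y'
    Lx = prodLt (λ i j → x i * x j)
    Ly = prodLt (λ i j → y i * y j)
    Γ = prodF (λ i → prodF (λ j → Gp t (x i) (y j)))
    Γ' = prodF (λ i → prodF (λ j → Gp t' (x' i) (y' j)))
    G-inv : ∀ i j → t * t * (x i * x i) * (y j * y j) * Gp t' (x' i) (y' j) ≡ Gp t (x i) (y j)
    G-inv i j = Gp-inv t t' (x i) (x' i) (y j) (y' j) ht (hx i) (hy j)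
    nz₁ : ∀ i j → Gp t' (x' i) (y' j) ≢ 0ℚ
    nz₁ i j = *-≢0ʳ {t * t * (x i * x i) * (y j * y j)} (λ z → nz i j (trans (sym (G-inv i j)) z))
    gap : ∀ a a' b b' → a * a' ≡ 1ℚ → b * b' ≡ 1ℚ → b - a ≡ - (a * b) * (b' - a')
    gap a a' b b' ha hb = trans (trans (e₁ a b) (cong₂ (λ u w → b * u - a * w) (sym ha) (sym hb))) (e₂ a a' b b')
      where
      e₁ : ∀ a b → b - a ≡ b * 1ℚ - a * 1ℚ
      e₁ = solve 2 (λ a b → b :- a := b :* :1 :- a :* :1) refl
      e₂ : ∀ a a' b b' → b * (a * a') - a * (b * b') ≡ - (a * b) * (b' - a')
      e₂ = solve 4 (λ a a' b b' → b :* (a :* a') :- a :* (b :* b') := :- (a :* b) :* (b' :- a')) refl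
    both : vdm x * vdm y ≡ Lx * Ly * B'
    both = begin
      vdm x * vdm y
        ≡⟨ sym (prodLt-* (λ i j → x j - x i) (λ i j → y j - y i)) ⟩
      prodLt (λ i j → (x j - x i) * (y j - y i))
        ≡⟨ prodLt-cong (λ i j → trans (cong₂ _*_ (gap (x i) (x' i) (x j) (x' j) (hx i) (hx j)) (gap (y i) (y' i) (y j) (y' j) (hy i) (hy j)))
                                      (e (x i * x j) (x' j - x' i) (y i * y j) (y' j - y' i))) ⟩
      prodLt (λ i j → (x i * x j) * (y i * y j) * ((x' j - x' i) * (y' j - y' i)))
        ≡⟨ prodLt-* (λ i j → (x i * x j) * (y i * y j)) (λ i j → (x' j - x' i) * (y' j - y' i)) ⟩
      prodLt (λ i j → (x i * x j) * (y i * y j)) * prodLt (λ i j → (x' j - x' i) * (y' j - y' i))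
        ≡⟨ cong₂ _*_ (prodLt-* (λ i j → x i * x j) (λ i j → y i * y j)) (prodLt-* (λ i j → x' j - x' i) (λ i j → y' j - y' i)) ⟩
      Lx * Ly * B' ∎
      where
      e : ∀ a b c d → - a * b * (- c * d) ≡ a * c * (b * d)
      e = solve 4 (λ a b c d → :- a :* b :* (:- c :* d) := a :* c :* (b :* d)) refl
    nz' : X ^ n * Y ^ n * B' ≢ 0ℚ
    nz' = *-≢0 {X ^ n * Y ^ n} {B'} (*-≢0 (^-≢0 n (inverse-≢0 (prodF-inverse x x' hx))) (^-≢0 n (inverse-≢0 (prodF-inverse y y' hy))))
      (*-≢0ʳ {Lx * Ly} (λ z → vnz (trans both z)))
    Γ-eq : Γ ≡ ((t * t) ^ n) ^ n * (X * X) ^ n * (Y * Y) ^ n * Γ'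
    Γ-eq = begin
      Γ
        ≡⟨ prodF-cong (λ i → prodF-cong (λ j → sym (G-inv i j))) ⟩
      prodF (λ i → prodF (λ j → t * t * (x i * x i) * (y j * y j) * Gp t' (x' i) (y' j)))
        ≡⟨ prodF-cong (λ i → trans (prodF-* (λ j → t * t * (x i * x i) * (y j * y j)) (λ j → Gp t' (x' i) (y' j)))
             (cong (_* prodF (λ j → Gp t' (x' i) (y' j))) (trans (prodF-* (λ j → t * t * (x i * x i)) (λ j → y j * y j))
               (cong₂ _*_ (trans (prodF-const n (t * t * (x i * x i))) (*-^ (t * t) (x i * x i) n)) (prodF-* y y))))) ⟩
      prodF (λ i → (t * t) ^ n * (x i * x i) ^ n * (Y * Y) * prodF (λ j → Gp t' (x' i) (y' j)))
        ≡⟨ prodF-* (λ i → (t * t) ^ n * (x i * x i) ^ n * (Y * Y)) (λ i → prodF (λ j → Gp t' (x' i) (y' j))) ⟩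
      prodF (λ i → (t * t) ^ n * (x i * x i) ^ n * (Y * Y)) * Γ'
        ≡⟨ cong (_* Γ') (trans (prodF-* (λ i → (t * t) ^ n * (x i * x i) ^ n) (λ i → Y * Y)) (cong₂ _*_
             (trans (prodF-* (λ i → (t * t) ^ n) (λ i → (x i * x i) ^ n)) (cong₂ _*_ (prodF-const n ((t * t) ^ n)) (trans (prodF-^ (λ i → x i * x i) n) (cong (_^ n) (prodF-* x x)))))
             (prodF-const n (Y * Y)))) ⟩
      ((t * t) ^ n) ^ n * (X * X) ^ n * (Y * Y) ^ n * Γ' ∎
    entry-eq : ∀ i j → M i j ≡ x' i * z * y' j * M' i j
    entry-eq i j = *-cancelˡ-≢0 (Gp t (x i) (y j)) (nz i j) (begin
      Gp t (x i) (y j) * M i j                             ≡⟨ ℚP.*-comm (Gp t (x i) (y j)) (M i j) ⟩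
      M i j * Gp t (x i) (y j)                             ≡⟨ ÷'-* (Fp t (x i) (y j) z) (nz i j) ⟩
      Fp t (x i) (y j) z                                   ≡⟨ sym (Fp-inv t t' (x i) (x' i) (y j) (y' j) z z' ht (hx i) (hy j) hz) ⟩
      t * t * (x i * y j * z) * Fp t' (x' i) (y' j) z'     ≡⟨ cong (t * t * (x i * y j * z) *_) (sym (÷'-* (Fp t' (x' i) (y' j) z') (nz₁ i j))) ⟩
      t * t * (x i * y j * z) * (M' i j * Gp t' (x' i) (y' j))
        ≡⟨ e₁ t (x i) (y j) z (M' i j) (Gp t' (x' i) (y' j)) ⟩
      t * t * (1ℚ * x i) * (1ℚ * y j) * Gp t' (x' i) (y' j) * (z * M' i j)
        ≡⟨ cong₂ (λ u w → t * t * (u * x i) * (w * y j) * Gp t' (x' i) (y' j) * (z * M' i j)) (sym (hx i)) (sym (hy j)) ⟩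
      t * t * (x i * x' i * x i) * (y j * y' j * y j) * Gp t' (x' i) (y' j) * (z * M' i j)
        ≡⟨ e₂ t (x i) (x' i) (y j) (y' j) (Gp t' (x' i) (y' j)) z (M' i j) ⟩
      t * t * (x i * x i) * (y j * y j) * Gp t' (x' i) (y' j) * (x' i * z * y' j * M' i j)
        ≡⟨ cong (_* (x' i * z * y' j * M' i j)) (G-inv i j) ⟩
      Gp t (x i) (y j) * (x' i * z * y' j * M' i j)        ∎)
      where
      e₁ : ∀ t x y z m g → t * t * (x * y * z) * (m * g) ≡ t * t * (1ℚ * x) * (1ℚ * y) * g * (z * m)
      e₁ = solve 6 (λ t x y z m g → t :* t :* (x :* y :* z) :* (m :* g) := t :* t :* (:1 :* x) :* (:1 :* y) :* g :* (z :* m)) refl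
      e₂ : ∀ t x x' y y' g z m → t * t * (x * x' * x) * (y * y' * y) * g * (z * m) ≡ t * t * (x * x) * (y * y) * g * (x' * z * y' * m)
      e₂ = solve 8 (λ t x x' y y' g z m → t :* t :* (x :* x' :* x) :* (y :* y' :* y) :* g :* (z :* m) := t :* t :* (x :* x) :* (y :* y) :* g :* (x' :* z :* y' :* m)) refl
    det-eq : det M ≡ X' * z ^ n * Y' * det M'
    det-eq = trans (det-cong M (λ i j → x' i * z * y' j * M' i j) entry-eq) (trans (det-scale (λ i → x' i * z) y' M')
      (cong (λ w → w * Y' * det M') (trans (prodF-* x' (λ _ → z)) (cong (X' *_) (prodF-const n z)))))
    l₁ : ∀ a b c d e f → a * b * (c * d) * e * f ≡ b * d * (f * (a * c * e))
    l₁ = solve 6 (λ a b c d e f → a :* b :* (c :* d) :* e :* f := b :* d :* (f :* (a :* c :* e))) refl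
    l₂ : ∀ X Y a b c g X' z Y' d → X * Y * (a * b * c * g * (X' * z * Y' * d)) ≡ (X * X') * (Y * Y') * (a * b * c * z * (g * d))
    l₂ = solve 10 (λ X Y a b c g X' z Y' d → X :* Y :* (a :* b :* c :* g :* (X' :* z :* Y' :* d)) := (X :* X') :* (Y :* Y') :* (a :* b :* c :* z :* (g :* d))) refl
    l₃ : ∀ a x y z s b → 1ℚ * 1ℚ * (a * (x * x) * (y * y) * z * (s * b)) ≡ x * y * b * (a * (x * y * z) * s)
    l₃ = solve 6 (λ a x y z s b → :1 :* :1 :* (a :* (x :* x) :* (y :* y) :* z :* (s :* b)) := x :* y :* b :* (a :* (x :* y :* z) :* s)) refl

  module ClearPoly {V : Set} = Clear {X = Env V} IsPoly poly-con poly-+ poly-*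

  -- The intended use has repeated arguments, where the generic form says nothing. Since inverses
  -- are not polynomial, S_n at the inverses is multiplied by a power of d, which turns it into a
  -- polynomial h of the original variables, and density applies to the resulting identity.
  Sv-inv : ∀ n (x x' y y' : Fin n → ℚ) z z' t t' →
    t * t' ≡ 1ℚ → (∀ i → x i * x' i ≡ 1ℚ) → (∀ i → y i * y' i ≡ 1ℚ) → z * z' ≡ 1ℚ →
    Sv n x y z t ≡ ((t * t) ^ n) ^ n * (prodF x * prodF y * z) ^ n * Sv n x' y' z' t'
  Sv-inv n x x' y y' z z' t t' ht hx hy hz = go (ClearPoly.clear (S n) {num = num} {d = d} pnum pd)
    where
    V = SVar n
    X Y : Env V → ℚ
    X ρ = prodF (λ i → ρ (xv i))
    Y ρ = prodF (λ i → ρ (yv i))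
    pX : IsPoly X
    pX = poly-prodF px
    pY : IsPoly Y
    pY = poly-prodF py
    d : Env V → ℚ
    d ρ = ρ ζv * ρ zv * (X ρ * Y ρ)
    pd : IsPoly d
    pd = poly-* (poly-* pζ pz) (poly-* pX pY)
    -- `num v` is d with the variable v omitted, so `num v` / d is the inverse of v.
    num : V → Env V → ℚ
    num (xv i) ρ = ρ ζv * ρ zv * (skipProd (λ k → ρ (xv k)) i * Y ρ)
    num (yv i) ρ = ρ ζv * ρ zv * (X ρ * skipProd (λ k → ρ (yv k)) i)
    num zv     ρ = ρ ζv * (X ρ * Y ρ)
    num ζv     ρ = ρ zv * (X ρ * Y ρ)
    pnum : ∀ v → IsPoly (num v)
    pnum (xv i) = poly-* (poly-* pζ pz) (poly-* (poly-skipProd px i) pY)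
    pnum (yv i) = poly-* (poly-* pζ pz) (poly-* pX (poly-skipProd py i))
    pnum zv     = poly-* pζ (poly-* pX pY)
    pnum ζv     = poly-* pz (poly-* pX pY)
    factor : Env V → ℚ
    factor ρ = ((ρ ζv * ρ ζv) ^ n) ^ n * (X ρ * Y ρ * ρ zv) ^ n
    pfactor : IsPoly factor
    pfactor = poly-* (poly-^ (poly-^ (poly-* pζ pζ) n) n) (poly-^ (poly-* (poly-* pX pY) pz) n)
    inverses : ∀ ρ (e : V → ℚ) → (∀ v → ρ v * e v ≡ 1ℚ) → ∀ v → e v * d ρ ≡ num v ρ
    inverses ρ e he (xv i) = trans (cong (λ w → e (xv i) * (ρ ζv * ρ zv * (w * Y ρ))) (sym (skipProd-* (λ k → ρ (xv k)) i)))
        (trans (l (e (xv i)) (ρ ζv * ρ zv) (ρ (xv i)) (skipProd (λ k → ρ (xv k)) i) (Y ρ)) (trans (cong (_* num (xv i) ρ) (he (xv i))) (ℚP.*-identityˡ (num (xv i) ρ))))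
      where
      l : ∀ e a b c d → e * (a * (b * c * d)) ≡ b * e * (a * (c * d))
      l = solve 5 (λ e a b c d → e :* (a :* (b :* c :* d)) := b :* e :* (a :* (c :* d))) refl
    inverses ρ e he (yv i) = trans (cong (λ w → e (yv i) * (ρ ζv * ρ zv * (X ρ * w))) (sym (skipProd-* (λ k → ρ (yv k)) i)))
        (trans (l (e (yv i)) (ρ ζv * ρ zv) (ρ (yv i)) (skipProd (λ k → ρ (yv k)) i) (X ρ)) (trans (cong (_* num (yv i) ρ) (he (yv i))) (ℚP.*-identityˡ (num (yv i) ρ))))
      where
      l : ∀ e a b c d → e * (a * (d * (b * c))) ≡ b * e * (a * (d * c))
      l = solve 5 (λ e a b c d → e :* (a :* (d :* (b :* c))) := b :* e :* (a :* (d :* c))) refl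
    inverses ρ e he zv = trans (l (e zv) (ρ ζv) (ρ zv) (X ρ * Y ρ)) (trans (cong (_* num zv ρ) (he zv)) (ℚP.*-identityˡ (num zv ρ)))
      where
      l : ∀ e a b c → e * (a * b * c) ≡ b * e * (a * c)
      l = solve 4 (λ e a b c → e :* (a :* b :* c) := b :* e :* (a :* c)) refl
    inverses ρ e he ζv = trans (l (e ζv) (ρ ζv) (ρ zv) (X ρ * Y ρ)) (trans (cong (_* num ζv ρ) (he ζv)) (ℚP.*-identityˡ (num ζv ρ)))
      where
      l : ∀ e a b c → e * (a * b * c) ≡ a * e * (b * c)
      l = solve 4 (λ e a b c → e :* (a :* b :* c) := a :* e :* (b :* c)) refl
    go : (Σ ℕ λ M → Σ (Env V → ℚ) λ h → IsPoly h × (∀ ρ (e : V → ℚ) → (∀ v → e v * d ρ ≡ num v ρ) → evalM (S n) e * d ρ ^ M ≡ h ρ)) →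
      Sv n x y z t ≡ ((t * t) ^ n) ^ n * (prodF x * prodF y * z) ^ n * Sv n x' y' z' t'
    go (M , h , ph , spec) = *-cancelˡ-≢0 (d ρ₀ ^ M) (^-≢0 M d≢0) (begin
      d ρ₀ ^ M * Sv n x y z t                         ≡⟨ ℚP.*-comm (d ρ₀ ^ M) (Sv n x y z t) ⟩
      Sv n x y z t * d ρ₀ ^ M                         ≡⟨ identity ρ₀ ⟩
      factor ρ₀ * h ρ₀                                ≡⟨ cong (factor ρ₀ *_) (sym (spec ρ₀ (envS x' y' z' t') (inverses ρ₀ (envS x' y' z' t') inv₀))) ⟩
      factor ρ₀ * (Sv n x' y' z' t' * d ρ₀ ^ M)       ≡⟨ l (factor ρ₀) (Sv n x' y' z' t') (d ρ₀ ^ M) ⟩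
      d ρ₀ ^ M * (factor ρ₀ * Sv n x' y' z' t')       ∎)
      where
      open ≡-Reasoning
      ρ₀ : Env V
      ρ₀ = envS x y z t
      inv₀ : ∀ v → ρ₀ v * envS x' y' z' t' v ≡ 1ℚ
      inv₀ (xv i) = hx i
      inv₀ (yv i) = hy i
      inv₀ zv     = hz
      inv₀ ζv     = ht
      d≢0 : d ρ₀ ≢ 0ℚ
      d≢0 = *-≢0 {t * z} {prodF x * prodF y} (*-≢0 (inverse-≢0 {t} {t'} ht) (inverse-≢0 {z} {z'} hz))
        (*-≢0 (prodF-≢0 {f = x} (λ i → inverse-≢0 {x i} {x' i} (hx i))) (prodF-≢0 {f = y} (λ i → inverse-≢0 {y i} {y' i} (hy i))))
      l : ∀ a b c → a * (b * c) ≡ c * (a * b)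
      l = solve 3 (λ a b c → a :* (b :* c) := c :* (a :* b)) refl
      S₀ : Env V → ℚ
      S₀ ρ = Sv n (λ i → ρ (xv i)) (λ i → ρ (yv i)) (ρ zv) (ρ ζv)
      identity : ∀ ρ → S₀ ρ * d ρ ^ M ≡ factor ρ * h ρ
      identity = dense-⇒≡ (dense-* pd (poly-* poly-allG poly-bothVdm)
            (dense pd (λ _ → 1ℚ) (*-≢0 {1ℚ * 1ℚ} (λ ()) (*-≢0 (prodF-≢0 {n} (λ i → 1≢0)) (prodF-≢0 {n} (λ i → 1≢0)))))
            (dense-* poly-allG poly-bothVdm dense-allG dense-bothVdm))
          (poly-* (poly-Sv n px py pz pζ) (poly-^ pd M)) (poly-* pfactor ph) generic
        where
        generic : ∀ ρ → d ρ * (allG ρ * bothVdm ρ) ≢ 0ℚ → S₀ ρ * d ρ ^ M ≡ factor ρ * h ρ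
        generic ρ nz = begin
          S₀ ρ * d ρ ^ M
            ≡⟨ cong (_* d ρ ^ M) (Sv-inv-generic n (λ i → ρ (xv i)) (λ i → e (xv i)) (λ i → ρ (yv i)) (λ i → e (yv i)) (ρ zv) (e zv) (ρ ζv) (e ζv)
                 (he ζv) (λ i → he (xv i)) (λ i → he (yv i)) (he zv) (allG-≢0 ρ (*-≢0ˡ {allG ρ} {bothVdm ρ} gb)) (*-≢0ʳ {allG ρ} {bothVdm ρ} gb)) ⟩
          factor ρ * Sv n (λ i → e (xv i)) (λ i → e (yv i)) (e zv) (e ζv) * d ρ ^ M
            ≡⟨ ℚP.*-assoc (factor ρ) (Sv n (λ i → e (xv i)) (λ i → e (yv i)) (e zv) (e ζv)) (d ρ ^ M) ⟩
          factor ρ * (Sv n (λ i → e (xv i)) (λ i → e (yv i)) (e zv) (e ζv) * d ρ ^ M)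
            ≡⟨ cong (factor ρ *_) (trans (cong (_* d ρ ^ M) (evalM-cong (S n) (λ { (xv i) → refl ; (yv i) → refl ; zv → refl ; ζv → refl }))) (spec ρ e (inverses ρ e he))) ⟩
          factor ρ * h ρ ∎
          where
          gb : allG ρ * bothVdm ρ ≢ 0ℚ
          gb = *-≢0ʳ {d ρ} {allG ρ * bothVdm ρ} nz
          dn : d ρ ≢ 0ℚ
          dn = *-≢0ˡ {d ρ} {allG ρ * bothVdm ρ} nz
          nonzero : ∀ v → ρ v ≢ 0ℚ
          nonzero (xv i) = prodF-≢0⁻ (*-≢0ˡ {X ρ} {Y ρ} (*-≢0ʳ {ρ ζv * ρ zv} {X ρ * Y ρ} dn)) i
          nonzero (yv i) = prodF-≢0⁻ (*-≢0ʳ {X ρ} {Y ρ} (*-≢0ʳ {ρ ζv * ρ zv} {X ρ * Y ρ} dn)) i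
          nonzero zv     = *-≢0ʳ {ρ ζv} {ρ zv} (*-≢0ˡ {ρ ζv * ρ zv} {X ρ * Y ρ} dn)
          nonzero ζv     = *-≢0ˡ {ρ ζv} {ρ zv} (*-≢0ˡ {ρ ζv * ρ zv} {X ρ * Y ρ} dn)
          e : V → ℚ
          e v = proj₁ (inv (ρ v) (nonzero v))
          he : ∀ v → ρ v * e v ≡ 1ℚ
          he v = proj₂ (inv (ρ v) (nonzero v))

  -- Vanishing orders of S_n near ζ = 0, -1 and -1/2

  -- The order of S_n along a family is at least the sum of the row orders minus the orders of the
  -- two Vandermonde products. The latter are divided out, so they must be exact.
  scale : ∀ {W : Set} n {x y : Fin n → Env (Maybe W) → ℚ} {z t : Env (Maybe W) → ℚ} →
    (∀ i → IsPoly (x i)) → (∀ i → IsPoly (y i)) → IsPoly z → IsPoly t →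
    ∀ {ρ' e₁ e₂ a M} → Exact ρ' e₁ (λ ρ → vdm (λ i → x i ρ)) → Exact ρ' e₂ (λ ρ → vdm (λ i → y i ρ)) →
    (∀ i j → Ord (a i) (λ ρ → entry (λ i → x i ρ) (λ i → y i ρ) (z ρ) (t ρ) i j)) → e₁ ℕ.+ e₂ ℕ.+ M ≡ sumℕ a →
    Ord M (λ ρ → Sv n (λ i → x i ρ) (λ i → y i ρ) (z ρ) (t ρ))
  scale n {x} {y} {z} {t} px py pz pt {M = M} ex ey o eq =
    ord-cancel (exact-* ex ey) (poly-Sv n px py pz pt) (subst (λ N → Ord N _) (sym eq) (ord-det o))
      (λ ρ → trans (ℚP.*-comm (vdm (λ i → x i ρ) * vdm (λ i → y i ρ)) (Sv n (λ i → x i ρ) (λ i → y i ρ) (z ρ) (t ρ))) (Sv-det n (λ i → x i ρ) (λ i → y i ρ) (z ρ) (t ρ)))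

  module _ {n : ℕ} where
    V : Set
    V = Maybe (SVar n)

    loc : Env V → ℚ
    loc ρ = ρ nothing

    p-loc : IsPoly loc
    p-loc = poly-var nothing

    pvar : ∀ v → IsPoly {V} (λ ρ → ρ (just v))
    pvar v = poly-var (just v)

    -- The free parameters of the x, and likewise those of the y, are distinct nonzero integers:
    -- differences of parameters are nonzero, and so is the distance of a free argument from the
    -- limit 0 of a special one.
    generic-point : Env V
    generic-point nothing         = 0ℚ
    generic-point (just (xv i))   = ι (suc (toℕ i))
    generic-point (just (yv i))   = ι (suc (toℕ i))
    generic-point (just zv)       = 0ℚ
    generic-point (just ζv)       = 0ℚ

    -- A special argument approaches A within distance of order k, with the variable as coefficient;
    -- an ordinary argument is the variable itself.
    arg : Bool → (Env V → ℚ) → ℕ → SVar n → Env V → ℚ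
    arg true  A k v ρ = A ρ + loc ρ ^ k * ρ (just v)
    arg false A k v ρ = ρ (just v)

    poly-arg : ∀ b {A} k v → IsPoly A → IsPoly (arg b A k v)
    poly-arg true  k v pA = poly-+ pA (poly-* (poly-^ p-loc k) (pvar v))
    poly-arg false k v pA = pvar v

    -- Only two special arguments approach each other, and then by the full order of the local
    -- power. A special and an ordinary one stay apart because A vanishes at the generic point while
    -- the parameters do not.
    exact-gap : ∀ (sv : Fin n → SVar n) (b : Fin n → Bool) {A} k → IsPoly A → A (at0 generic-point) ≡ 0ℚ → (∀ i → generic-point (just (sv i)) ≡ ι (suc (toℕ i))) →
      ∀ i j → i Data.Fin.< j → Exact generic-point (suc k ℕ.* (bit (b i) ℕ.* bit (b j))) (λ ρ → arg (b j) A (suc k) (sv j) ρ - arg (b i) A (suc k) (sv i) ρ)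
    exact-gap sv b {A} k pA A0 hv i j i<j with b i | b j
    ... | true | true = exact (ord (λ ρ → ρ (just (sv j)) - ρ (just (sv i))) (poly-sub (pvar (sv j)) (pvar (sv i)))
            (λ ρ → trans (lem (A ρ) (loc ρ ^ suc k) (ρ (just (sv j))) (ρ (just (sv i)))) (cong (λ m → loc ρ ^ m * (ρ (just (sv j)) - ρ (just (sv i)))) (sym (ℕP.*-identityʳ (suc k))))))
          (λ z → ι-<-≢ (ℕ.s≤s i<j) (trans (cong₂ _-_ (sym (hv j)) (sym (hv i))) z))
      where
      lem : ∀ a s u v → a + s * u - (a + s * v) ≡ s * (u - v)
      lem = solve 4 (λ a s u v → a :+ s :* u :- (a :+ s :* v) := s :* (u :- v)) refl
    ... | true | false = subst (λ N → Exact generic-point N (λ ρ → ρ (just (sv j)) - (A ρ + loc ρ ^ suc k * ρ (just (sv i))))) (sym (ℕP.*-zeroʳ (suc k)))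
          (exact (ord-0 (poly-sub (pvar (sv j)) (poly-arg true (suc k) (sv i) pA)))
            (λ z → ι-suc≢0 (toℕ j) (trans (sym (hv j)) (trans (lem (generic-point (just (sv j))) (0ℚ ^ k) (generic-point (just (sv i)))) (trans (cong (λ w → generic-point (just (sv j)) - (w + 0ℚ * 0ℚ ^ k * generic-point (just (sv i)))) (sym A0)) z)))))
      where
      lem : ∀ a s u → a ≡ a - (0ℚ + 0ℚ * s * u)
      lem = solve 3 (λ a s u → a := a :- (:0 :+ :0 :* s :* u)) refl
    ... | false | true = subst (λ N → Exact generic-point N (λ ρ → (A ρ + loc ρ ^ suc k * ρ (just (sv j))) - ρ (just (sv i)))) (sym (ℕP.*-zeroʳ (suc k)))
          (exact (ord-0 (poly-sub (poly-arg true (suc k) (sv j) pA) (pvar (sv i))))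
            (λ z → ι-suc≢0 (toℕ i) (trans (sym (hv i)) (trans (lem (generic-point (just (sv i))) (0ℚ ^ k) (generic-point (just (sv j)))) (trans (cong (λ w → - ((w + 0ℚ * 0ℚ ^ k * generic-point (just (sv j))) - generic-point (just (sv i)))) (sym A0)) (cong -_ z))))))
      where
      lem : ∀ a s u → a ≡ - ((0ℚ + 0ℚ * s * u) - a)
      lem = solve 3 (λ a s u → a := :- ((:0 :+ :0 :* s :* u) :- a)) refl
    ... | false | false = subst (λ N → Exact generic-point N (λ ρ → ρ (just (sv j)) - ρ (just (sv i)))) (sym (ℕP.*-zeroʳ (suc k)))
          (exact (ord-0 (poly-sub (pvar (sv j)) (pvar (sv i)))) (λ z → ι-<-≢ (ℕ.s≤s i<j) (trans (cong₂ _-_ (sym (hv j)) (sym (hv i))) z)))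

    exact-vdm : ∀ (sv : Fin n → SVar n) (b : Fin n → Bool) {A} k → IsPoly A → A (at0 generic-point) ≡ 0ℚ → (∀ i → generic-point (just (sv i)) ≡ ι (suc (toℕ i))) →
      Exact generic-point (suc k ℕ.* tri (sumℕ (λ i → bit (b i)))) (λ ρ → vdm (λ i → arg (b i) A (suc k) (sv i) ρ))
    exact-vdm sv b {A} k pA A0 hv = subst (λ N → Exact generic-point N (λ ρ → vdm (λ i → arg (b i) A (suc k) (sv i) ρ)))
      (trans (sumLtℕ-* (suc k) (λ i j → bit (b i) ℕ.* bit (b j))) (cong (suc k ℕ.*_) (sumLtℕ-bit b)))
      (exact-prodLt (exact-gap sv b k pA A0 hv))

  -- Near t = 0, with the special arguments t/2 + t² b among the x.
  module AtZero (m : ℕ) (b : Fin (suc m) → Bool) (count : sumℕ (λ i → bit (b i)) ≡ m) where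
    private
      n = suc m
    A : Env (V {n}) → ℚ
    A ρ = half * loc ρ
    pA : IsPoly A
    pA = poly-* (poly-con half) p-loc
    x y : Fin n → Env (V {n}) → ℚ
    x i = arg (b i) A 2 (xv i)
    y i = arg false A 2 (yv i)

    special-F : ∀ v y z → Ord 1 (λ ρ → Fp (loc ρ) (arg true A 2 v ρ) (ρ (just y)) (ρ (just z)))
    special-F v y z = ord F̂ pF̂ (λ ρ → lem (loc ρ) (ρ (just v)) (ρ (just y)) (ρ (just z)))
      where
      h : Env (V {n}) → ℚ
      h ρ = half + loc ρ * ρ (just v)
      ph : IsPoly h
      ph = poly-+ (poly-con half) (poly-* p-loc (pvar v))
      F̂ : Env (V {n}) → ℚ
      F̂ ρ = (loc ρ + two) * h ρ * ρ (just y) * ρ (just z) - (loc ρ * h ρ * ρ (just y) + ρ (just y) * ρ (just z) + loc ρ * h ρ * ρ (just z) + loc ρ * h ρ + ρ (just y) + ρ (just z)) + (two * loc ρ + 1ℚ)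
      pF̂ : IsPoly F̂
      pF̂ = poly-+ (poly-sub (poly-* (poly-* (poly-* (poly-+ p-loc (poly-con two)) ph) (pvar y)) (pvar z))
             (poly-+ (poly-+ (poly-+ (poly-+ (poly-+ (poly-* (poly-* p-loc ph) (pvar y)) (poly-* (pvar y) (pvar z))) (poly-* (poly-* p-loc ph) (pvar z))) (poly-* p-loc ph)) (pvar y)) (pvar z)))
             (poly-+ (poly-* (poly-con two) p-loc) (poly-con 1ℚ))
      lem : ∀ s b y z → (s + two) * (half * s + s * (s * 1ℚ) * b) * y * z - s * ((half * s + s * (s * 1ℚ) * b) * y + y * z + (half * s + s * (s * 1ℚ) * b) * z + (half * s + s * (s * 1ℚ) * b) + y + z) + s * (two * s + 1ℚ)
        ≡ s * 1ℚ * ((s + two) * (half + s * b) * y * z - (s * (half + s * b) * y + y * z + s * (half + s * b) * z + s * (half + s * b) + y + z) + (two * s + 1ℚ))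
      lem = solve 4 (λ s b y z → (s :+ :2) :* (:½ :* s :+ s :* (s :* :1) :* b) :* y :* z :- s :* ((:½ :* s :+ s :* (s :* :1) :* b) :* y :+ y :* z :+ (:½ :* s :+ s :* (s :* :1) :* b) :* z :+ (:½ :* s :+ s :* (s :* :1) :* b) :+ y :+ z) :+ s :* (:2 :* s :+ :1) := s :* :1 :* ((s :+ :2) :* (:½ :+ s :* b) :* y :* z :- (s :* (:½ :+ s :* b) :* y :+ y :* z :+ s :* (:½ :+ s :* b) :* z :+ s :* (:½ :+ s :* b) :+ y :+ z) :+ (:2 :* s :+ :1))) refl

    -- The constant 1/2 in x = t/2 + t² b is forced: at first order in t, G has the terms t y² - t
    -- y² and -t y + t y, which cancel for this choice only.
    special-G : ∀ v y → Ord 2 (λ ρ → Gp (loc ρ) (arg true A 2 v ρ) (ρ (just y)))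
    special-G v y = ord Ĝ pĜ (λ ρ → lem (loc ρ) (ρ (just v)) (ρ (just y)))
      where
      h : Env (V {n}) → ℚ
      h ρ = half + loc ρ * ρ (just v)
      ph : IsPoly h
      ph = poly-+ (poly-con half) (poly-* p-loc (pvar v))
      Ĝ : Env (V {n}) → ℚ
      Ĝ ρ = ρ (just y) * ρ (just y) * (half + (loc ρ + two) * ρ (just v)) + (loc ρ + two) * h ρ * h ρ * ρ (just y) - loc ρ * h ρ * h ρ
            - two * (loc ρ + ℕ→ℚ 3) * h ρ * ρ (just y) - two * ρ (just v) * ρ (just y) + two * ρ (just y) + (two * loc ρ + 1ℚ) * h ρ
      pĜ : IsPoly Ĝ
      pĜ = poly-+ (poly-+ (poly-sub (poly-sub (poly-sub (poly-+ (poly-* (poly-* (pvar y) (pvar y)) (poly-+ (poly-con half) (poly-* (poly-+ p-loc (poly-con two)) (pvar v))))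
             (poly-* (poly-* (poly-* (poly-+ p-loc (poly-con two)) ph) ph) (pvar y))) (poly-* (poly-* p-loc ph) ph))
             (poly-* (poly-* (poly-* (poly-con two) (poly-+ p-loc (poly-con (ℕ→ℚ 3)))) ph) (pvar y))) (poly-* (poly-* (poly-con two) (pvar v)) (pvar y))) (poly-* (poly-con two) (pvar y)))
             (poly-* (poly-+ (poly-* (poly-con two) p-loc) (poly-con 1ℚ)) ph)
      lem : ∀ s b y → (s + two) * (half * s + s * (s * 1ℚ) * b) * y * ((half * s + s * (s * 1ℚ) * b) + y) - s * ((half * s + s * (s * 1ℚ) * b) * (half * s + s * (s * 1ℚ) * b) + y * y)
          - two * (s * s + ℕ→ℚ 3 * s + 1ℚ) * (half * s + s * (s * 1ℚ) * b) * y + s * (two * s + 1ℚ) * ((half * s + s * (s * 1ℚ) * b) + y)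
        ≡ s * (s * 1ℚ) * (y * y * (half + (s + two) * b) + (s + two) * (half + s * b) * (half + s * b) * y - s * (half + s * b) * (half + s * b) - two * (s + ℕ→ℚ 3) * (half + s * b) * y - two * b * y + two * y + (two * s + 1ℚ) * (half + s * b))
      lem = solve 3 (λ s b y → (s :+ :2) :* (:½ :* s :+ s :* (s :* :1) :* b) :* y :* ((:½ :* s :+ s :* (s :* :1) :* b) :+ y) :- s :* ((:½ :* s :+ s :* (s :* :1) :* b) :* (:½ :* s :+ s :* (s :* :1) :* b) :+ y :* y) :- :2 :* (s :* s :+ :3 :* s :+ :1) :* (:½ :* s :+ s :* (s :* :1) :* b) :* y :+ s :* (:2 :* s :+ :1) :* ((:½ :* s :+ s :* (s :* :1) :* b) :+ y) := s :* (s :* :1) :* (y :* y :* (:½ :+ (s :+ :2) :* b) :+ (s :+ :2) :* (:½ :+ s :* b) :* (:½ :+ s :* b) :* y :- s :* (:½ :+ s :* b) :* (:½ :+ s :* b) :- :2 :* (s :+ :3) :* (:½ :+ s :* b) :* y :- :2 :* b :* y :+ :2 :* y :+ (:2 :* s :+ :1) :* (:½ :+ s :* b))) refl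

    entries : ∀ i j → Ord (if b i then suc (m ℕ.* 2) else 0) (λ ρ → entry (λ i → x i ρ) (λ i → y i ρ) (ρ (just zv)) (loc ρ) i j)
    entries i j with b i
    ... | true  = ord-* {M = 1} {N = m ℕ.* 2} (special-F (xv i) (yv j) zv) (subst (λ N → Ord N (λ ρ → skipProd (λ k → Gp (loc ρ) (arg true A 2 (xv i) ρ) (ρ (just (yv k)))) j)) (sumℕ-const m 2)
                    (ord-skipProd {f = λ k ρ → Gp (loc ρ) (arg true A 2 (xv i) ρ) (ρ (just (yv k)))} (λ k → special-G (xv i) (yv k)) j))
    ... | false = ord-0 (poly-* (poly-Fp p-loc (pvar (xv i)) (pvar (yv j)) (pvar zv)) (poly-skipProd (λ k → poly-Gp p-loc (pvar (xv i)) (pvar (yv k))) j))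

    -- Each of the m special rows has order 1 + 2m, one from F and two from each of the m remaining
    -- G. The gaps of the special x have order two, so m(m - 1) is lost and m(2m + 1) - m(m - 1) =
    -- m(m + 2) remains.
    order : Ord (m ℕ.* suc (suc m)) (λ ρ → Sv n (λ i → x i ρ) (λ i → y i ρ) (ρ (just zv)) (loc ρ))
    order = scale n (λ i → poly-arg (b i) 2 (xv i) pA) (λ i → pvar (yv i)) (pvar zv) p-loc
      (exact-vdm xv b 1 pA refl (λ i → refl)) (exact-vdm yv (λ _ → false) 1 pA refl (λ i → refl)) entries
      (trans (cong₂ (λ u w → 2 ℕ.* tri u ℕ.+ 2 ℕ.* tri w ℕ.+ m ℕ.* suc (suc m)) count (sumℕ-0 n))
        (trans (arith m) (sym (trans (sumℕ-if (suc (m ℕ.* 2)) b) (cong (ℕ._* suc (m ℕ.* 2)) count)))))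
      where
      arith : ∀ m → 2 ℕ.* tri m ℕ.+ 2 ℕ.* 0 ℕ.+ m ℕ.* suc (suc m) ≡ m ℕ.* suc (m ℕ.* 2)
      arith m = trans (e m (tri m)) (trans (cong (λ w → w ℕ.+ m ℕ.* suc m) (double-tri m)) (e' m))
        where
        e : ∀ m r → 2 ℕ.* r ℕ.+ 2 ℕ.* 0 ℕ.+ m ℕ.* suc (suc m) ≡ r ℕ.+ r ℕ.+ m ℕ.+ m ℕ.* suc m
        e = ℕR.solve-∀
        e' : ∀ m → m ℕ.* m ℕ.+ m ℕ.* suc m ≡ m ℕ.* suc (m ℕ.* 2)
        e' = ℕR.solve-∀

  -- Near t = −1 all arguments approach −1.
  module AtMinusOne (m : ℕ) where
    private
      n = suc m
    point : SVar n → Env (V {n}) → ℚ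
    point v ρ = - 1ℚ + loc ρ * ρ (just v)
    p-point : ∀ v → IsPoly (point v)
    p-point v = poly-+ (poly-con (- 1ℚ)) (poly-* p-loc (pvar v))
    zeta : Env (V {n}) → ℚ
    zeta ρ = - 1ℚ + loc ρ
    p-zeta : IsPoly zeta
    p-zeta = poly-+ (poly-con (- 1ℚ)) p-loc

    gap : ∀ (sv : Fin n → SVar n) → (∀ i → generic-point (just (sv i)) ≡ ι (suc (toℕ i))) → Exact generic-point (tri n) (λ ρ → vdm (λ i → point (sv i) ρ))
    gap sv hv = subst (λ N → Exact generic-point N (λ ρ → vdm (λ i → point (sv i) ρ))) (sumLtℕ-1 n) (exact-prodLt {a = λ _ _ → 1} (λ i j i<j →
      exact (ord (λ ρ → ρ (just (sv j)) - ρ (just (sv i))) (poly-sub (pvar (sv j)) (pvar (sv i))) (λ ρ → lem (loc ρ) (ρ (just (sv j))) (ρ (just (sv i)))))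
            (λ z → ι-<-≢ (ℕ.s≤s i<j) (trans (cong₂ _-_ (sym (hv j)) (sym (hv i))) z))))
      where
      lem : ∀ s u v → (- 1ℚ + s * u) - (- 1ℚ + s * v) ≡ s * 1ℚ * (u - v)
      lem = solve 3 (λ s u v → (:- :1 :+ s :* u) :- (:- :1 :+ s :* v) := s :* :1 :* (u :- v)) refl

    F-order : ∀ x y z → Ord 1 (λ ρ → Fp (zeta ρ) (point x ρ) (point y ρ) (point z ρ))
    F-order x y z = ord F̂ pF̂ (λ ρ → lem (loc ρ) (ρ (just x)) (ρ (just y)) (ρ (just z)))
      where
      e₁ e₂ e₃ F̂ : Env (V {n}) → ℚ
      e₁ ρ = ρ (just x) + ρ (just y) + ρ (just z)
      e₂ ρ = ρ (just x) * ρ (just y) + ρ (just y) * ρ (just z) + ρ (just x) * ρ (just z)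
      e₃ ρ = ρ (just x) * ρ (just y) * ρ (just z)
      F̂ ρ = loc ρ * loc ρ * e₃ ρ + loc ρ * loc ρ * loc ρ * e₃ ρ - two * loc ρ * loc ρ * e₂ ρ + two * loc ρ * e₁ ρ - ℕ→ℚ 4 + two * loc ρ
      p₁ : IsPoly e₁
      p₁ = poly-+ (poly-+ (pvar x) (pvar y)) (pvar z)
      p₂ : IsPoly e₂
      p₂ = poly-+ (poly-+ (poly-* (pvar x) (pvar y)) (poly-* (pvar y) (pvar z))) (poly-* (pvar x) (pvar z))
      p₃ : IsPoly e₃
      p₃ = poly-* (poly-* (pvar x) (pvar y)) (pvar z)
      pF̂ : IsPoly F̂
      pF̂ = poly-+ (poly-sub (poly-+ (poly-sub (poly-+ (poly-* (poly-* p-loc p-loc) p₃) (poly-* (poly-* (poly-* p-loc p-loc) p-loc) p₃)) (poly-* (poly-* (poly-* (poly-con two) p-loc) p-loc) p₂))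
             (poly-* (poly-* (poly-con two) p-loc) p₁)) (poly-con (ℕ→ℚ 4))) (poly-* (poly-con two) p-loc)
      lem : ∀ s u v w → ((- 1ℚ + s) + two) * (- 1ℚ + s * u) * (- 1ℚ + s * v) * (- 1ℚ + s * w)
          - (- 1ℚ + s) * ((- 1ℚ + s * u) * (- 1ℚ + s * v) + (- 1ℚ + s * v) * (- 1ℚ + s * w) + (- 1ℚ + s * u) * (- 1ℚ + s * w) + (- 1ℚ + s * u) + (- 1ℚ + s * v) + (- 1ℚ + s * w))
          + (- 1ℚ + s) * (two * (- 1ℚ + s) + 1ℚ)
        ≡ s * 1ℚ * (s * s * (u * v * w) + s * s * s * (u * v * w) - two * s * s * (u * v + v * w + u * w) + two * s * (u + v + w) - ℕ→ℚ 4 + two * s)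
      lem = solve 4 (λ s u v w → ((:- :1 :+ s) :+ :2) :* (:- :1 :+ s :* u) :* (:- :1 :+ s :* v) :* (:- :1 :+ s :* w) :- (:- :1 :+ s) :* ((:- :1 :+ s :* u) :* (:- :1 :+ s :* v) :+ (:- :1 :+ s :* v) :* (:- :1 :+ s :* w) :+ (:- :1 :+ s :* u) :* (:- :1 :+ s :* w) :+ (:- :1 :+ s :* u) :+ (:- :1 :+ s :* v) :+ (:- :1 :+ s :* w)) :+ (:- :1 :+ s) :* (:2 :* (:- :1 :+ s) :+ :1) := s :* :1 :* (s :* s :* (u :* v :* w) :+ s :* s :* s :* (u :* v :* w) :- :2 :* s :* s :* (u :* v :+ v :* w :+ u :* w) :+ :2 :* s :* (u :+ v :+ w) :- :4 :+ :2 :* s)) refl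

    G-order : ∀ x y → Ord 2 (λ ρ → Gp (zeta ρ) (point x ρ) (point y ρ))
    G-order x y = ord Ĝ pĜ (λ ρ → lem (loc ρ) (ρ (just x)) (ρ (just y)))
      where
      P Q Ĝ : Env (V {n}) → ℚ
      P ρ = ρ (just x) + ρ (just y)
      Q ρ = ρ (just x) * ρ (just y)
      Ĝ ρ = loc ρ * P ρ * Q ρ - two * Q ρ + loc ρ * loc ρ * P ρ * Q ρ - two * loc ρ * Q ρ - two * loc ρ * P ρ * P ρ + ℕ→ℚ 4 * P ρ - two * loc ρ * loc ρ * Q ρ + ℕ→ℚ 4 * loc ρ * P ρ - ℕ→ℚ 6
      pP : IsPoly P
      pP = poly-+ (pvar x) (pvar y)
      pQ : IsPoly Q
      pQ = poly-* (pvar x) (pvar y)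
      pĜ : IsPoly Ĝ
      pĜ = poly-sub (poly-+ (poly-sub (poly-+ (poly-sub (poly-sub (poly-+ (poly-sub (poly-* (poly-* p-loc pP) pQ) (poly-* (poly-con two) pQ)) (poly-* (poly-* (poly-* p-loc p-loc) pP) pQ))
             (poly-* (poly-* (poly-con two) p-loc) pQ)) (poly-* (poly-* (poly-* (poly-con two) p-loc) pP) pP)) (poly-* (poly-con (ℕ→ℚ 4)) pP))
             (poly-* (poly-* (poly-* (poly-con two) p-loc) p-loc) pQ)) (poly-* (poly-* (poly-con (ℕ→ℚ 4)) p-loc) pP)) (poly-con (ℕ→ℚ 6))
      lem : ∀ s u v → ((- 1ℚ + s) + two) * (- 1ℚ + s * u) * (- 1ℚ + s * v) * ((- 1ℚ + s * u) + (- 1ℚ + s * v))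
          - (- 1ℚ + s) * ((- 1ℚ + s * u) * (- 1ℚ + s * u) + (- 1ℚ + s * v) * (- 1ℚ + s * v))
          - two * ((- 1ℚ + s) * (- 1ℚ + s) + ℕ→ℚ 3 * (- 1ℚ + s) + 1ℚ) * (- 1ℚ + s * u) * (- 1ℚ + s * v)
          + (- 1ℚ + s) * (two * (- 1ℚ + s) + 1ℚ) * ((- 1ℚ + s * u) + (- 1ℚ + s * v))
        ≡ s * (s * 1ℚ) * (s * (u + v) * (u * v) - two * (u * v) + s * s * (u + v) * (u * v) - two * s * (u * v) - two * s * (u + v) * (u + v) + ℕ→ℚ 4 * (u + v) - two * s * s * (u * v) + ℕ→ℚ 4 * s * (u + v) - ℕ→ℚ 6)
      lem = solve 3 (λ s u v → ((:- :1 :+ s) :+ :2) :* (:- :1 :+ s :* u) :* (:- :1 :+ s :* v) :* ((:- :1 :+ s :* u) :+ (:- :1 :+ s :* v)) :- (:- :1 :+ s) :* ((:- :1 :+ s :* u) :* (:- :1 :+ s :* u) :+ (:- :1 :+ s :* v) :* (:- :1 :+ s :* v)) :- :2 :* ((:- :1 :+ s) :* (:- :1 :+ s) :+ :3 :* (:- :1 :+ s) :+ :1) :* (:- :1 :+ s :* u) :* (:- :1 :+ s :* v) :+ (:- :1 :+ s) :* (:2 :* (:- :1 :+ s) :+ :1) :* ((:- :1 :+ s :* u) :+ (:- :1 :+ s :* v)) := s :* (s :* :1) :* (s :* (u :+ v) :* (u :* v) :- :2 :* (u :* v) :+ s :* s :* (u :+ v) :* (u :* v) :- :2 :* s :* (u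 :* v) :- :2 :* s :* (u :+ v) :* (u :+ v) :+ :4 :* (u :+ v) :- :2 :* s :* s :* (u :* v) :+ :4 :* s :* (u :+ v) :- :6)) refl

    -- All arguments are special here since ξ₀ and ξ₁ both equal -1 at t = -1. Every row has order 1
    -- + 2m, and the two Vandermonde products together take n(n - 1) away from n(2m + 1).
    order : Ord (n ℕ.* n) (λ ρ → Sv n (λ i → point (xv i) ρ) (λ i → point (yv i) ρ) (point zv ρ) (zeta ρ))
    order = scale n (λ i → p-point (xv i)) (λ i → p-point (yv i)) (p-point zv) p-zeta (gap xv (λ i → refl)) (gap yv (λ i → refl))
      (λ i j → ord-* {M = 1} {N = m ℕ.* 2} (F-order (xv i) (yv j) zv) (subst (λ N → Ord N (λ ρ → skipProd (λ k → Gp (zeta ρ) (point (xv i) ρ) (point (yv k) ρ)) j)) (sumℕ-const m 2)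
          (ord-skipProd {f = λ k ρ → Gp (zeta ρ) (point (xv i) ρ) (point (yv k) ρ)} (λ k → G-order (xv i) (yv k)) j)))
      (trans (arith m) (sym (sumℕ-const n (suc (m ℕ.* 2)))))
      where
      arith : ∀ m → tri (suc m) ℕ.+ tri (suc m) ℕ.+ suc m ℕ.* suc m ≡ suc m ℕ.* suc (m ℕ.* 2)
      arith m = trans (e m (tri (suc m))) (trans (cong (ℕ._+ suc m ℕ.* m) (double-tri (suc m))) (e' m))
        where
        e : ∀ m r → r ℕ.+ r ℕ.+ suc m ℕ.* suc m ≡ r ℕ.+ r ℕ.+ suc m ℕ.+ suc m ℕ.* m
        e = ℕR.solve-∀
        e' : ∀ m → suc m ℕ.* suc m ℕ.+ suc m ℕ.* m ≡ suc m ℕ.* suc (m ℕ.* 2)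
        e' = ℕR.solve-∀

  -- Near t = −1/2 with s = 1 + 2t, as many special arguments s u among the x as among the y.
  module AtMinusHalf (n : ℕ) (bx by : Fin n → Bool) (bz : Bool) where
    A : Env (V {n}) → ℚ
    A ρ = 0ℚ
    pA : IsPoly A
    pA = poly-con 0ℚ
    zeta : Env (V {n}) → ℚ
    zeta ρ = half * (loc ρ - 1ℚ)
    p-zeta : IsPoly zeta
    p-zeta = poly-* (poly-con half) (poly-sub p-loc (poly-con 1ℚ))
    x y : Fin n → Env (V {n}) → ℚ
    x i = arg (bx i) A 1 (xv i)
    y i = arg (by i) A 1 (yv i)
    z : Env (V {n}) → ℚ
    z = arg bz A 1 zv
    px' : ∀ i → IsPoly (x i)
    px' i = poly-arg (bx i) 1 (xv i) pA
    py' : ∀ i → IsPoly (y i)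
    py' i = poly-arg (by i) 1 (yv i) pA
    pz' : IsPoly z
    pz' = poly-arg bz 1 zv pA

    -- G has no constant term and its linear terms carry the factor 2t + 1 = s; so two arguments of
    -- order s give order two.
    G-order : ∀ v b w → Ord (2 ℕ.* bit b) (λ ρ → Gp (zeta ρ) (arg true A 1 v ρ) (arg b A 1 w ρ))
    G-order v false w = ord-0 (poly-Gp p-zeta (poly-arg true 1 v pA) (pvar w))
    G-order v true  w = ord Ĝ pĜ (λ ρ → lem (loc ρ) (ρ (just v)) (ρ (just w)))
      where
      Ĝ : Env (V {n}) → ℚ
      Ĝ ρ = (zeta ρ + two) * loc ρ * ρ (just v) * ρ (just w) * (ρ (just v) + ρ (just w)) - zeta ρ * (ρ (just v) * ρ (just v) + ρ (just w) * ρ (just w))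
        - two * (zeta ρ * zeta ρ + ℕ→ℚ 3 * zeta ρ + 1ℚ) * ρ (just v) * ρ (just w) + zeta ρ * (ρ (just v) + ρ (just w))
      pĜ : IsPoly Ĝ
      pĜ = poly-+ (poly-sub (poly-sub (poly-* (poly-* (poly-* (poly-* (poly-+ p-zeta (poly-con two)) p-loc) (pvar v)) (pvar w)) (poly-+ (pvar v) (pvar w)))
               (poly-* p-zeta (poly-+ (poly-* (pvar v) (pvar v)) (poly-* (pvar w) (pvar w)))))
             (poly-* (poly-* (poly-* (poly-con two) (poly-+ (poly-+ (poly-* p-zeta p-zeta) (poly-* (poly-con (ℕ→ℚ 3)) p-zeta)) (poly-con 1ℚ))) (pvar v)) (pvar w)))
             (poly-* p-zeta (poly-+ (pvar v) (pvar w)))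
      lem : ∀ s u v → (half * (s - 1ℚ) + two) * (0ℚ + s * 1ℚ * u) * (0ℚ + s * 1ℚ * v) * ((0ℚ + s * 1ℚ * u) + (0ℚ + s * 1ℚ * v)) - half * (s - 1ℚ) * ((0ℚ + s * 1ℚ * u) * (0ℚ + s * 1ℚ * u) + (0ℚ + s * 1ℚ * v) * (0ℚ + s * 1ℚ * v))
          - two * (half * (s - 1ℚ) * (half * (s - 1ℚ)) + ℕ→ℚ 3 * (half * (s - 1ℚ)) + 1ℚ) * (0ℚ + s * 1ℚ * u) * (0ℚ + s * 1ℚ * v) + half * (s - 1ℚ) * (two * (half * (s - 1ℚ)) + 1ℚ) * ((0ℚ + s * 1ℚ * u) + (0ℚ + s * 1ℚ * v))
        ≡ s * (s * 1ℚ) * ((half * (s - 1ℚ) + two) * s * u * v * (u + v) - half * (s - 1ℚ) * (u * u + v * v) - two * (half * (s - 1ℚ) * (half * (s - 1ℚ)) + ℕ→ℚ 3 * (half * (s - 1ℚ)) + 1ℚ) * u * v + half * (s - 1ℚ) * (u + v))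
      lem = solve 3 (λ s u v → (:½ :* (s :- :1) :+ :2) :* (:0 :+ s :* :1 :* u) :* (:0 :+ s :* :1 :* v) :* ((:0 :+ s :* :1 :* u) :+ (:0 :+ s :* :1 :* v)) :- :½ :* (s :- :1) :* ((:0 :+ s :* :1 :* u) :* (:0 :+ s :* :1 :* u) :+ (:0 :+ s :* :1 :* v) :* (:0 :+ s :* :1 :* v)) :- :2 :* (:½ :* (s :- :1) :* (:½ :* (s :- :1)) :+ :3 :* (:½ :* (s :- :1)) :+ :1) :* (:0 :+ s :* :1 :* u) :* (:0 :+ s :* :1 :* v) :+ :½ :* (s :- :1) :* (:2 :* (:½ :* (s :- :1)) :+ :1) :* ((:0 :+ s :* :1 :* u) :+ (:0 :+ s :* :1 :* v)) := s :* (s :* :1) :* ((:½ :* (s :- :1) :+ :2) :* s :* u :* v :* (u :+ v) :- :½ :* (s :- :1) :* (u :* u :+ v :* v) :- :2 :* (:½ :* (s :- :1) :* (:½ :* (s :- :1)) :+ :3 :* (:½ :* (s :- :1)) :+ :1) :* u :* v :+ :½ :* (s :- :1) :* (u :+ v))) refl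

    F-order : ∀ v b w b' w' → Ord (bit b' ℕ.* bit b) (λ ρ → Fp (zeta ρ) (arg true A 1 v ρ) (arg b A 1 w ρ) (arg b' A 1 w' ρ))
    F-order v b     w false w' = ord-0 (poly-Fp p-zeta (poly-arg true 1 v pA) (poly-arg b 1 w pA) (pvar w'))
    F-order v false w true  w' = ord-0 (poly-Fp p-zeta (poly-arg true 1 v pA) (pvar w) (poly-arg true 1 w' pA))
    F-order v true  w true  w' = ord F̂ pF̂ (λ ρ → lem (loc ρ) (ρ (just v)) (ρ (just w)) (ρ (just w')))
      where
      F̂ : Env (V {n}) → ℚ
      F̂ ρ = (zeta ρ + two) * loc ρ * loc ρ * ρ (just v) * ρ (just w) * ρ (just w')
        - zeta ρ * (loc ρ * (ρ (just v) * ρ (just w) + ρ (just w) * ρ (just w') + ρ (just v) * ρ (just w')) + ρ (just v) + ρ (just w) + ρ (just w')) + zeta ρ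
      pF̂ : IsPoly F̂
      pF̂ = poly-+ (poly-sub (poly-* (poly-* (poly-* (poly-* (poly-* (poly-+ p-zeta (poly-con two)) p-loc) p-loc) (pvar v)) (pvar w)) (pvar w'))
             (poly-* p-zeta (poly-+ (poly-+ (poly-+ (poly-* p-loc (poly-+ (poly-+ (poly-* (pvar v) (pvar w)) (poly-* (pvar w) (pvar w'))) (poly-* (pvar v) (pvar w')))) (pvar v)) (pvar w)) (pvar w')))) p-zeta
      lem : ∀ s u v w → (half * (s - 1ℚ) + two) * (0ℚ + s * 1ℚ * u) * (0ℚ + s * 1ℚ * v) * (0ℚ + s * 1ℚ * w)
          - half * (s - 1ℚ) * ((0ℚ + s * 1ℚ * u) * (0ℚ + s * 1ℚ * v) + (0ℚ + s * 1ℚ * v) * (0ℚ + s * 1ℚ * w) + (0ℚ + s * 1ℚ * u) * (0ℚ + s * 1ℚ * w) + (0ℚ + s * 1ℚ * u) + (0ℚ + s * 1ℚ * v) + (0ℚ + s * 1ℚ * w))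
          + half * (s - 1ℚ) * (two * (half * (s - 1ℚ)) + 1ℚ)
        ≡ s * 1ℚ * ((half * (s - 1ℚ) + two) * s * s * u * v * w - half * (s - 1ℚ) * (s * (u * v + v * w + u * w) + u + v + w) + half * (s - 1ℚ))
      lem = solve 4 (λ s u v w → (:½ :* (s :- :1) :+ :2) :* (:0 :+ s :* :1 :* u) :* (:0 :+ s :* :1 :* v) :* (:0 :+ s :* :1 :* w) :- :½ :* (s :- :1) :* ((:0 :+ s :* :1 :* u) :* (:0 :+ s :* :1 :* v) :+ (:0 :+ s :* :1 :* v) :* (:0 :+ s :* :1 :* w) :+ (:0 :+ s :* :1 :* u) :* (:0 :+ s :* :1 :* w) :+ (:0 :+ s :* :1 :* u) :+ (:0 :+ s :* :1 :* v) :+ (:0 :+ s :* :1 :* w)) :+ :½ :* (s :- :1) :* (:2 :* (:½ :* (s :- :1)) :+ :1) := s :* :1 :* ((:½ :* (s :- :1) :+ :2) :* s :* s :* u :* v :* w :- :½ :* (s :- :1) :* (s :* (u :* v :+ v :* w :+ u :* w) :+ u :+ v :+ w) :+ :½ :* (s :- :1))) refl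

    -- A special row has order at least 2(h - 1) + `bit bz`, and the Vandermonde products of the h
    -- special x and the h special y lose h(h - 1) together.
    order : ∀ h → sumℕ (λ i → bit (bx i)) ≡ h → sumℕ (λ i → bit (by i)) ≡ h →
      Ord (h ℕ.* (ℕ.pred h ℕ.+ bit bz)) (λ ρ → Sv n (λ i → x i ρ) (λ i → y i ρ) (z ρ) (zeta ρ))
    order zero     _  _  = ord-0 (poly-Sv n px' py' pz' p-zeta)
    order (suc h') cx cy = scale n px' py' pz' p-zeta (exact-vdm xv bx 0 pA refl (λ i → refl)) (exact-vdm yv by 0 pA refl (λ i → refl)) entries
      (trans (cong₂ (λ u w → 1 ℕ.* tri u ℕ.+ 1 ℕ.* tri w ℕ.+ suc h' ℕ.* (h' ℕ.+ bit bz)) cx cy)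
        (trans (arith h' (bit bz)) (sym (trans (sumℕ-if (2 ℕ.* h' ℕ.+ bit bz) bx) (cong (ℕ._* (2 ℕ.* h' ℕ.+ bit bz)) cx)))))
      where
      arith : ∀ h f → 1 ℕ.* tri (suc h) ℕ.+ 1 ℕ.* tri (suc h) ℕ.+ suc h ℕ.* (h ℕ.+ f) ≡ suc h ℕ.* (2 ℕ.* h ℕ.+ f)
      arith h f = ℕP.+-cancelʳ-≡ (suc h) _ _ (trans (e h f (tri (suc h))) (trans (cong (ℕ._+ suc h ℕ.* (h ℕ.+ f)) (double-tri (suc h))) (e' h f)))
        where
        e : ∀ h f r → 1 ℕ.* r ℕ.+ 1 ℕ.* r ℕ.+ suc h ℕ.* (h ℕ.+ f) ℕ.+ suc h ≡ r ℕ.+ r ℕ.+ suc h ℕ.+ suc h ℕ.* (h ℕ.+ f)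
        e = ℕR.solve-∀
        e' : ∀ h f → suc h ℕ.* suc h ℕ.+ suc h ℕ.* (h ℕ.+ f) ≡ suc h ℕ.* (2 ℕ.* h ℕ.+ f) ℕ.+ suc h
        e' = ℕR.solve-∀
      -- If column j is special, one special G is omitted but F contributes `bit bz`. Otherwise all
      -- special G remain, and their order 2h exceeds the bound.
      bound : ∀ b b' k r → bit b ℕ.+ k ≡ suc r → 2 ℕ.* r ℕ.+ bit b' ℕ.≤ bit b' ℕ.* bit b ℕ.+ 2 ℕ.* k
      bound true  b'    k r eq = ℕP.≤-reflexive (trans (cong (λ w → 2 ℕ.* w ℕ.+ bit b') (sym (ℕP.suc-injective eq))) (e (bit b') k))
        where
        e : ∀ b k → 2 ℕ.* k ℕ.+ b ≡ b ℕ.* 1 ℕ.+ 2 ℕ.* k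
        e = ℕR.solve-∀
      bound false b'    k r refl = ℕP.≤-trans (ℕP.+-monoʳ-≤ (2 ℕ.* r) (le b')) (ℕP.≤-reflexive (e (bit b') r))
        where
        le : ∀ b → bit b ℕ.≤ 2
        le true  = ℕ.s≤s ℕ.z≤n
        le false = ℕ.z≤n
        e : ∀ b r → 2 ℕ.* r ℕ.+ 2 ≡ b ℕ.* 0 ℕ.+ 2 ℕ.* suc r
        e = ℕR.solve-∀
      skip-double : ∀ {n} (a : Fin n → ℕ) j → skipSum (λ k → 2 ℕ.* a k) j ≡ 2 ℕ.* skipSum a j
      skip-double {suc n} a j = sumℕ-* 2 (λ k → a (punchIn j k))
      entries : ∀ i j → Ord (if bx i then 2 ℕ.* h' ℕ.+ bit bz else 0) (λ ρ → entry (λ i → x i ρ) (λ i → y i ρ) (z ρ) (zeta ρ) i j)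
      entries i j with bx i
      ... | false = ord-0 (poly-* (poly-Fp p-zeta (pvar (xv i)) (py' j) pz') (poly-skipProd (λ k → poly-Gp p-zeta (pvar (xv i)) (py' k)) j))
      ... | true  = ord-≤ (bound (by j) bz (skipSum (λ k → bit (by k)) j) h' (trans (sym (skipSum-+ (λ k → bit (by k)) j)) cy))
          (subst (λ N → Ord (bit bz ℕ.* bit (by j) ℕ.+ N) (λ ρ → Fp (zeta ρ) (arg true A 1 (xv i) ρ) (y j ρ) (z ρ) * skipProd (λ k → Gp (zeta ρ) (arg true A 1 (xv i) ρ) (y k ρ)) j)) (skip-double (λ k → bit (by k)) j)
            (ord-* (F-order (xv i) (by j) (yv j) bz zv) (ord-skipProd {f = λ k ρ → Gp (zeta ρ) (arg true A 1 (xv i) ρ) (y k ρ)} (λ k → G-order (xv i) (by k) (yv k)) j)))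

  -- Leading behaviour of S_n near ζ = 0

  module Leading where

    -- Near t = 0 with x = 1 + t u and y = t (1/2 + β).
    module _ (n : ℕ) where
      private
        W = Env (V {n})
      U B : Fin n → W → ℚ
      U i ρ = ρ (just (xv i))
      B i ρ = ρ (just (yv i))
      X Y : Fin n → W → ℚ
      X i ρ = 1ℚ + loc ρ * U i ρ
      Y i ρ = loc ρ * (half + B i ρ)
      pU : ∀ i → IsPoly (U i)
      pU i = pvar (xv i)
      pB : ∀ i → IsPoly (B i)
      pB i = pvar (yv i)
      pX : ∀ i → IsPoly (X i)
      pX i = poly-+ (poly-con 1ℚ) (poly-* p-loc (pU i))
      pY : ∀ i → IsPoly (Y i)
      pY i = poly-* p-loc (poly-+ (poly-con half) (pB i))

      -- The quotient of G by s² in the scaled coordinates. At first order G reads 2y - s - 2y + s,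
      -- so order two holds for every β; the shift by 1/2 places ξ₁ at β = 0 in the limit.
      ĝ : ℚ → ℚ → ℚ → ℚ
      ĝ s u β = (half + β) + (s + two) * (half + β) * (two * u + s * u * u + (half + β) + s * u * (half + β)) - two * u - s * u * u - s * (half + β) * (half + β)
        - two * (s + ℕ→ℚ 3) * (half + β) - two * (s * s + ℕ→ℚ 3 * s + 1ℚ) * u * (half + β) + two + (two * s + 1ℚ) * (u + (half + β))

      poly-ĝ : ∀ {s u β : W → ℚ} → IsPoly s → IsPoly u → IsPoly β → IsPoly (λ ρ → ĝ (s ρ) (u ρ) (β ρ))
      poly-ĝ s u β = poly-+ (poly-+ (poly-sub (poly-sub (poly-sub (poly-sub (poly-sub (poly-+ k (poly-* (poly-* (poly-+ s (poly-con two)) k) (poly-+ (poly-+ (poly-+ (poly-* (poly-con two) u) (poly-* (poly-* s u) u)) k) (poly-* (poly-* s u) k))))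
          (poly-* (poly-con two) u)) (poly-* (poly-* s u) u)) (poly-* (poly-* s k) k)) (poly-* (poly-* (poly-con two) (poly-+ s (poly-con (ℕ→ℚ 3)))) k))
          (poly-* (poly-* (poly-* (poly-con two) (poly-+ (poly-+ (poly-* s s) (poly-* (poly-con (ℕ→ℚ 3)) s)) (poly-con 1ℚ))) u) k)) (poly-con two))
          (poly-* (poly-+ (poly-* (poly-con two) s) (poly-con 1ℚ)) (poly-+ u k))
        where
        k = poly-+ (poly-con half) β

      Gp-near-0 : ∀ s u β → Gp s (1ℚ + s * u) (s * (half + β)) ≡ s ^ 2 * ĝ s u β
      Gp-near-0 s u β = lem s u β
        where
        lem : ∀ s u β → (s + two) * (1ℚ + s * u) * (s * (half + β)) * ((1ℚ + s * u) + s * (half + β)) - s * ((1ℚ + s * u) * (1ℚ + s * u) + s * (half + β) * (s * (half + β)))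
            - two * (s * s + ℕ→ℚ 3 * s + 1ℚ) * (1ℚ + s * u) * (s * (half + β)) + s * (two * s + 1ℚ) * ((1ℚ + s * u) + s * (half + β))
          ≡ s * (s * 1ℚ) * ((half + β) + (s + two) * (half + β) * (two * u + s * u * u + (half + β) + s * u * (half + β)) - two * u - s * u * u - s * (half + β) * (half + β)
            - two * (s + ℕ→ℚ 3) * (half + β) - two * (s * s + ℕ→ℚ 3 * s + 1ℚ) * u * (half + β) + two + (two * s + 1ℚ) * (u + (half + β)))
        lem = solve 3 (λ s u β → (s :+ :2) :* (:1 :+ s :* u) :* (s :* (:½ :+ β)) :* ((:1 :+ s :* u) :+ s :* (:½ :+ β)) :- s :* ((:1 :+ s :* u) :* (:1 :+ s :* u) :+ s :* (:½ :+ β) :* (s :* (:½ :+ β))) :- :2 :* (s :* s :+ :3 :* s :+ :1) :* (:1 :+ s :* u) :* (s :* (:½ :+ β)) :+ s :* (:2 :* s :+ :1) :* ((:1 :+ s :* u) :+ s :* (:½ :+ β)) := s :* (s :* :1) :* ((:½ :+ β) :+ (s :+ :2) :* (:½ :+ β) :* (:2 :* u :+ s :* u :* u :+ (:½ :+ β) :+ s :* u :* (:½ :+ β)) :- :2 :* u :- s :* u :* u :- s :* (:½ :+ β) :* (:½ :+ β) :- :2 :* (s :+ :3) :* (:½ :+ β) :- :2 :* (s :* s :+ :3 :* s :+ :1) :* u :* (:½ :+ β) :+ :2 :+ (:2 :* s :+ :1) :* (u :+ (:½ :+ β)))) refl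

      ĝ-0 : ∀ u β → ĝ 0ℚ u β ≡ two * (β - half) * (β - half) + two * β * u
      ĝ-0 u β = lem u β
        where
        lem : ∀ u β → (half + β) + (0ℚ + two) * (half + β) * (two * u + 0ℚ * u * u + (half + β) + 0ℚ * u * (half + β)) - two * u - 0ℚ * u * u - 0ℚ * (half + β) * (half + β)
            - two * (0ℚ + ℕ→ℚ 3) * (half + β) - two * (0ℚ * 0ℚ + ℕ→ℚ 3 * 0ℚ + 1ℚ) * u * (half + β) + two + (two * 0ℚ + 1ℚ) * (u + (half + β))
          ≡ two * (β - half) * (β - half) + two * β * u
        lem = solve 2 (λ u β → (:½ :+ β) :+ (:0 :+ :2) :* (:½ :+ β) :* (:2 :* u :+ :0 :* u :* u :+ (:½ :+ β) :+ :0 :* u :* (:½ :+ β)) :- :2 :* u :- :0 :* u :* u :- :0 :* (:½ :+ β) :* (:½ :+ β) :- :2 :* (:0 :+ :3) :* (:½ :+ β) :- :2 :* (:0 :* :0 :+ :3 :* :0 :+ :1) :* u :* (:½ :+ β) :+ :2 :+ (:2 :* :0 :+ :1) :* (u :+ (:½ :+ β)) := :2 :* (β :- :½) :* (β :- :½) :+ :2 :* β :* u) refl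

      Ĝ : Fin n → Fin n → W → ℚ
      Ĝ i j ρ = ĝ (loc ρ) (U i ρ) (B j ρ)
      pĜ : ∀ i j → IsPoly (Ĝ i j)
      pĜ i j = poly-ĝ p-loc (pU i) (pB j)

      module Expansion (f : ℕ) {z : W → ℚ} (pz : IsPoly z) {F̂ : Fin n → Fin n → W → ℚ} (pF̂ : ∀ i j → IsPoly (F̂ i j))
        (hF : ∀ i j ρ → Fp (loc ρ) (X i ρ) (Y j ρ) (z ρ) ≡ loc ρ ^ f * F̂ i j ρ) where

        Ê : Fin n → Fin n → W → ℚ
        Ê i j ρ = F̂ i j ρ * skipProd (λ k → Ĝ i k ρ) j
        pÊ : ∀ i j → IsPoly (Ê i j)
        pÊ i j = poly-* (pF̂ i j) (poly-skipProd (λ k → pĜ i k) j)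
        Sρ D : W → ℚ
        Sρ ρ = Sv n (λ i → X i ρ) (λ i → Y i ρ) (z ρ) (loc ρ)
        D ρ = vdm (λ i → U i ρ) * vdm (λ i → B i ρ)
        pS : IsPoly Sρ
        pS = poly-Sv n pX pY pz p-loc
        pD : IsPoly D
        pD = poly-* (poly-vdm pU) (poly-vdm pB)

        module _ (ρ : W) where
          private
            s = loc ρ
          vdm-X : vdm (λ i → X i ρ) ≡ s ^ tri n * vdm (λ i → U i ρ)
          vdm-X = trans (prodLt-cong (λ i j → lem s (U j ρ) (U i ρ))) (prodLt-scale s (λ i j → U j ρ - U i ρ))
            where
            lem : ∀ s u v → 1ℚ + s * u - (1ℚ + s * v) ≡ s * (u - v)
            lem = solve 3 (λ s u v → :1 :+ s :* u :- (:1 :+ s :* v) := s :* (u :- v)) refl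
          vdm-Y : vdm (λ i → Y i ρ) ≡ s ^ tri n * vdm (λ i → B i ρ)
          vdm-Y = trans (prodLt-cong (λ i j → lem s half (B j ρ) (B i ρ))) (prodLt-scale s (λ i j → B j ρ - B i ρ))
            where
            lem : ∀ s h u v → s * (h + u) - s * (h + v) ≡ s * (u - v)
            lem = solve 4 (λ s h u v → s :* (h :+ u) :- s :* (h :+ v) := s :* (u :- v)) refl
          entry-X : ∀ i j → entry (λ i → X i ρ) (λ i → Y i ρ) (z ρ) s i j ≡ s ^ (f ℕ.+ 2 ℕ.* ℕ.pred n) * 1ℚ * Ê i j ρ
          entry-X i j = begin
            Fp s (X i ρ) (Y j ρ) (z ρ) * skipProd (λ k → Gp s (X i ρ) (Y k ρ)) j
              ≡⟨ cong₂ _*_ (hF i j ρ) (trans (skipProd-cong j (λ k → Gp-near-0 s (U i ρ) (B k ρ))) (trans (skipProd-scale (s ^ 2) (λ k → Ĝ i k ρ) j) (cong (_* skipProd (λ k → Ĝ i k ρ) j) (^-* s 2 (ℕ.pred n))))) ⟩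
            s ^ f * F̂ i j ρ * (s ^ (2 ℕ.* ℕ.pred n) * skipProd (λ k → Ĝ i k ρ) j)
              ≡⟨ lem (s ^ f) (F̂ i j ρ) (s ^ (2 ℕ.* ℕ.pred n)) (skipProd (λ k → Ĝ i k ρ) j) ⟩
            s ^ f * s ^ (2 ℕ.* ℕ.pred n) * 1ℚ * Ê i j ρ
              ≡⟨ cong (λ w → w * 1ℚ * Ê i j ρ) (sym (^-+ s f (2 ℕ.* ℕ.pred n))) ⟩
            s ^ (f ℕ.+ 2 ℕ.* ℕ.pred n) * 1ℚ * Ê i j ρ ∎
            where
            open ≡-Reasoning
            lem : ∀ a b c d → a * b * (c * d) ≡ a * c * 1ℚ * (b * d)
            lem = solve 4 (λ a b c d → a :* b :* (c :* d) := a :* c :* :1 :* (b :* d)) refl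
          det-X : det (entry (λ i → X i ρ) (λ i → Y i ρ) (z ρ) s) ≡ s ^ ((f ℕ.+ 2 ℕ.* ℕ.pred n) ℕ.* n) * det (λ i j → Ê i j ρ)
          det-X = trans (det-cong (entry (λ i → X i ρ) (λ i → Y i ρ) (z ρ) s) (λ i j → s ^ (f ℕ.+ 2 ℕ.* ℕ.pred n) * 1ℚ * Ê i j ρ) entry-X)
            (trans (det-scale (λ _ → s ^ (f ℕ.+ 2 ℕ.* ℕ.pred n)) (λ _ → 1ℚ) (λ i j → Ê i j ρ))
              (cong (_* det (λ i j → Ê i j ρ)) (trans (cong₂ _*_ (prodF-const n (s ^ (f ℕ.+ 2 ℕ.* ℕ.pred n))) (prodF-1 {n} (λ _ → refl)))
                (trans (ℚP.*-identityʳ ((s ^ (f ℕ.+ 2 ℕ.* ℕ.pred n)) ^ n)) (^-* s (f ℕ.+ 2 ℕ.* ℕ.pred n) n)))))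

        exponents : tri n ℕ.+ tri n ℕ.+ n ℕ.* (f ℕ.+ ℕ.pred n) ≡ (f ℕ.+ 2 ℕ.* ℕ.pred n) ℕ.* n
        exponents = arith n
          where
          arith : ∀ n → tri n ℕ.+ tri n ℕ.+ n ℕ.* (f ℕ.+ ℕ.pred n) ≡ (f ℕ.+ 2 ℕ.* ℕ.pred n) ℕ.* n
          arith zero    = sym (ℕP.*-zeroʳ (f ℕ.+ 0))
          arith (suc m) = ℕP.+-cancelʳ-≡ (suc m) _ _ (trans (e m f (tri (suc m))) (trans (cong (ℕ._+ suc m ℕ.* (f ℕ.+ m)) (double-tri (suc m))) (e' m f)))
            where
            e : ∀ m f r → r ℕ.+ r ℕ.+ suc m ℕ.* (f ℕ.+ m) ℕ.+ suc m ≡ r ℕ.+ r ℕ.+ suc m ℕ.+ suc m ℕ.* (f ℕ.+ m)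
            e = ℕR.solve-∀
            e' : ∀ m f → suc m ℕ.* suc m ℕ.+ suc m ℕ.* (f ℕ.+ m) ≡ (f ℕ.+ 2 ℕ.* m) ℕ.* suc m ℕ.+ suc m
            e' = ℕR.solve-∀

        -- Rows have order f + 2(n - 1), with f the order of F, and the Vandermonde products
        -- together n(n - 1).
        N : ℕ
        N = n ℕ.* (f ℕ.+ ℕ.pred n)

        reduced : ∀ ρ → D ρ * Sρ ρ ≡ loc ρ ^ N * det (λ i j → Ê i j ρ)
        reduced = dense-⇒≡ dense-s (poly-* pD pS) (poly-* (poly-^ p-loc N) (poly-det pÊ)) λ ρ s≢0 →
          *-cancelˡ-≢0 (loc ρ ^ (tri n ℕ.+ tri n)) (^-≢0 (tri n ℕ.+ tri n) s≢0) (begin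
            loc ρ ^ (tri n ℕ.+ tri n) * (D ρ * Sρ ρ)
              ≡⟨ cong (_* (D ρ * Sρ ρ)) (^-+ (loc ρ) (tri n) (tri n)) ⟩
            loc ρ ^ tri n * loc ρ ^ tri n * (D ρ * Sρ ρ)
              ≡⟨ lem (loc ρ ^ tri n) (vdm (λ i → U i ρ)) (vdm (λ i → B i ρ)) (Sρ ρ) ⟩
            Sρ ρ * (loc ρ ^ tri n * vdm (λ i → U i ρ) * (loc ρ ^ tri n * vdm (λ i → B i ρ)))
              ≡⟨ cong (Sρ ρ *_) (sym (cong₂ _*_ (vdm-X ρ) (vdm-Y ρ))) ⟩
            Sρ ρ * (vdm (λ i → X i ρ) * vdm (λ i → Y i ρ))
              ≡⟨ Sv-det n (λ i → X i ρ) (λ i → Y i ρ) (z ρ) (loc ρ) ⟩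
            det (entry (λ i → X i ρ) (λ i → Y i ρ) (z ρ) (loc ρ))
              ≡⟨ det-X ρ ⟩
            loc ρ ^ ((f ℕ.+ 2 ℕ.* ℕ.pred n) ℕ.* n) * det (λ i j → Ê i j ρ)
              ≡⟨ cong (λ k → loc ρ ^ k * det (λ i j → Ê i j ρ)) (sym exponents) ⟩
            loc ρ ^ (tri n ℕ.+ tri n ℕ.+ N) * det (λ i j → Ê i j ρ)
              ≡⟨ cong (_* det (λ i j → Ê i j ρ)) (^-+ (loc ρ) (tri n ℕ.+ tri n) N) ⟩
            loc ρ ^ (tri n ℕ.+ tri n) * loc ρ ^ N * det (λ i j → Ê i j ρ)
              ≡⟨ ℚP.*-assoc (loc ρ ^ (tri n ℕ.+ tri n)) (loc ρ ^ N) (det (λ i j → Ê i j ρ)) ⟩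
            loc ρ ^ (tri n ℕ.+ tri n) * (loc ρ ^ N * det (λ i j → Ê i j ρ)) ∎)
          where
          open ≡-Reasoning
          lem : ∀ s u b t → s * s * (u * b * t) ≡ t * (s * u * (s * b))
          lem = solve 4 (λ s u b t → s :* s :* (u :* b :* t) := t :* (s :* u :* (s :* b))) refl

        D≢0 : D (at0 generic-point) ≢ 0ℚ
        D≢0 = *-≢0 {vdm {n} (λ i → ι (suc (toℕ i)))} {vdm {n} (λ i → ι (suc (toℕ i)))} (prodLt-≢0 {n} (λ i j i<j → ι-<-≢ (ℕ.s≤s i<j))) (prodLt-≢0 {n} (λ i j i<j → ι-<-≢ (ℕ.s≤s i<j)))

        result : Σ (W → ℚ) λ Q → IsPoly Q × (∀ ρ → Sρ ρ ≡ loc ρ ^ N * Q ρ) × (∀ ρ → D ρ * Q ρ ≡ det (λ i j → Ê i j ρ))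
        result = divide N pD pS (poly-det pÊ) reduced generic-point D≢0

      -- The last argument is placed near 1, the limit of ξ₀, or near s/2, on the scale of ξ₁. F has
      -- order one in the former case and two in the latter.
      zR zH : W → ℚ
      zR ρ = 1ℚ + loc ρ * ρ (just zv)
      zH ρ = loc ρ * (half + ρ (just zv))

      f̂R f̂H : ℚ → ℚ → ℚ → ℚ → ℚ
      f̂R s u β w = (s + two) * (half + β) * (1ℚ + s * u) * (1ℚ + s * w) - s * (half + β) * (1ℚ + s * u) - s * (half + β) * (1ℚ + s * w) - (1ℚ + s * u) * (1ℚ + s * w) - two - s * u - s * w - s * (half + β) + two * s + 1ℚ
      f̂H s u β w = (s + two) * (1ℚ + s * u) * (half + β) * (half + w) - (1ℚ + s * u) * ((half + β) + (half + w)) - s * (half + β) * (half + w) - u - (half + β) - (half + w) + two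

      Fp-R : ∀ s u β w → Fp s (1ℚ + s * u) (s * (half + β)) (1ℚ + s * w) ≡ s ^ 1 * f̂R s u β w
      Fp-R s u β w = lem s u β w
        where
        lem : ∀ s u β w → (s + two) * (1ℚ + s * u) * (s * (half + β)) * (1ℚ + s * w) - s * ((1ℚ + s * u) * (s * (half + β)) + s * (half + β) * (1ℚ + s * w) + (1ℚ + s * u) * (1ℚ + s * w) + (1ℚ + s * u) + s * (half + β) + (1ℚ + s * w)) + s * (two * s + 1ℚ)
          ≡ s * 1ℚ * ((s + two) * (half + β) * (1ℚ + s * u) * (1ℚ + s * w) - s * (half + β) * (1ℚ + s * u) - s * (half + β) * (1ℚ + s * w) - (1ℚ + s * u) * (1ℚ + s * w) - two - s * u - s * w - s * (half + β) + two * s + 1ℚ)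
        lem = solve 4 (λ s u β w → (s :+ :2) :* (:1 :+ s :* u) :* (s :* (:½ :+ β)) :* (:1 :+ s :* w) :- s :* ((:1 :+ s :* u) :* (s :* (:½ :+ β)) :+ s :* (:½ :+ β) :* (:1 :+ s :* w) :+ (:1 :+ s :* u) :* (:1 :+ s :* w) :+ (:1 :+ s :* u) :+ s :* (:½ :+ β) :+ (:1 :+ s :* w)) :+ s :* (:2 :* s :+ :1) := s :* :1 :* ((s :+ :2) :* (:½ :+ β) :* (:1 :+ s :* u) :* (:1 :+ s :* w) :- s :* (:½ :+ β) :* (:1 :+ s :* u) :- s :* (:½ :+ β) :* (:1 :+ s :* w) :- (:1 :+ s :* u) :* (:1 :+ s :* w) :- :2 :- s :* u :- s :* w :- s :* (:½ :+ β) :+ :2 :* s :+ :1)) refl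

      Fp-H : ∀ s u β w → Fp s (1ℚ + s * u) (s * (half + β)) (s * (half + w)) ≡ s ^ 2 * f̂H s u β w
      Fp-H s u β w = lem s u β w
        where
        lem : ∀ s u β w → (s + two) * (1ℚ + s * u) * (s * (half + β)) * (s * (half + w)) - s * ((1ℚ + s * u) * (s * (half + β)) + s * (half + β) * (s * (half + w)) + (1ℚ + s * u) * (s * (half + w)) + (1ℚ + s * u) + s * (half + β) + s * (half + w)) + s * (two * s + 1ℚ)
          ≡ s * (s * 1ℚ) * ((s + two) * (1ℚ + s * u) * (half + β) * (half + w) - (1ℚ + s * u) * ((half + β) + (half + w)) - s * (half + β) * (half + w) - u - (half + β) - (half + w) + two)
        lem = solve 4 (λ s u β w → (s :+ :2) :* (:1 :+ s :* u) :* (s :* (:½ :+ β)) :* (s :* (:½ :+ w)) :- s :* ((:1 :+ s :* u) :* (s :* (:½ :+ β)) :+ s :* (:½ :+ β) :* (s :* (:½ :+ w)) :+ (:1 :+ s :* u) :* (s :* (:½ :+ w)) :+ (:1 :+ s :* u) :+ s :* (:½ :+ β) :+ s :* (:½ :+ w)) :+ s :* (:2 :* s :+ :1) := s :* (s :* :1) :* ((s :+ :2) :* (:1 :+ s :* u) :* (:½ :+ β) :* (:½ :+ w) :- (:1 :+ s :* u) :* ((:½ :+ β) :+ (:½ :+ w)) :- s :* (:½ :+ β) :* (:½ :+ w) :- u :- (:½ :+ β) :- (:½ :+ w) :+ :2)) refl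

      p-f̂R : ∀ i j → IsPoly {V {n}} (λ ρ → f̂R (loc ρ) (U i ρ) (B j ρ) (ρ (just zv)))
      p-f̂R i j = poly-+ (poly-+ (poly-sub (poly-sub (poly-sub (poly-sub (poly-sub (poly-sub (poly-sub (poly-* (poly-* (poly-* (poly-+ p-loc (poly-con two)) k) a) b) (poly-* (poly-* p-loc k) a)) (poly-* (poly-* p-loc k) b)) (poly-* a b)) (poly-con two))
          (poly-* p-loc (pU i))) (poly-* p-loc (pvar zv))) (poly-* p-loc k)) (poly-* (poly-con two) p-loc)) (poly-con 1ℚ)
        where
        k = poly-+ (poly-con half) (pB j)
        a = poly-+ (poly-con 1ℚ) (poly-* p-loc (pU i))
        b = poly-+ (poly-con 1ℚ) (poly-* p-loc (pvar zv))

      module R = Expansion 1 {zR} (poly-+ (poly-con 1ℚ) (poly-* p-loc (pvar zv))) {λ i j ρ → f̂R (loc ρ) (U i ρ) (B j ρ) (ρ (just zv))} p-f̂R (λ i j ρ → Fp-R (loc ρ) (U i ρ) (B j ρ) (ρ (just zv)))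

      p-f̂H : ∀ i j → IsPoly {V {n}} (λ ρ → f̂H (loc ρ) (U i ρ) (B j ρ) (ρ (just zv)))
      p-f̂H i j = poly-+ (poly-sub (poly-sub (poly-sub (poly-sub (poly-sub (poly-* (poly-* (poly-* (poly-+ p-loc (poly-con two)) a) k) l) (poly-* a (poly-+ k l))) (poly-* (poly-* p-loc k) l)) (pU i)) k) l) (poly-con two)
        where
        k = poly-+ (poly-con half) (pB j)
        l = poly-+ (poly-con half) (pvar zv)
        a = poly-+ (poly-con 1ℚ) (poly-* p-loc (pU i))

      module H = Expansion 2 {zH} (poly-* p-loc (poly-+ (poly-con half) (pvar zv))) {λ i j ρ → f̂H (loc ρ) (U i ρ) (B j ρ) (ρ (just zv))} p-f̂H (λ i j ρ → Fp-H (loc ρ) (U i ρ) (B j ρ) (ρ (just zv)))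

      envM : ℚ → (Fin n → ℚ) → (Fin n → ℚ) → ℚ → W
      envM s u β w nothing  = s
      envM s u β w (just v) = envS u β w 0ℚ v

      R̂ Ĥ : ℚ → (Fin n → ℚ) → (Fin n → ℚ) → ℚ → ℚ
      R̂ s u β w = proj₁ R.result (envM s u β w)
      Ĥ s u β w = proj₁ H.result (envM s u β w)

      R̂-spec : ∀ s u β w → Sv n (λ i → 1ℚ + s * u i) (λ i → s * (half + β i)) (1ℚ + s * w) s ≡ s ^ (n ℕ.* (1 ℕ.+ ℕ.pred n)) * R̂ s u β w
      R̂-spec s u β w = proj₁ (proj₂ (proj₂ R.result)) (envM s u β w)

      Ĥ-spec : ∀ s u β w → Sv n (λ i → 1ℚ + s * u i) (λ i → s * (half + β i)) (s * (half + w)) s ≡ s ^ (n ℕ.* (2 ℕ.+ ℕ.pred n)) * Ĥ s u β w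
      Ĥ-spec s u β w = proj₁ (proj₂ (proj₂ H.result)) (envM s u β w)

      envM-cong : ∀ {s u u' β β' w} → (∀ i → u i ≡ u' i) → (∀ i → β i ≡ β' i) → ∀ v → envM s u β w v ≡ envM s u' β' w v
      envM-cong eu eβ nothing       = refl
      envM-cong eu eβ (just v)      = envS-cong eu eβ v

      Ĥ-cong : ∀ {s u u' β β' w} → (∀ i → u i ≡ u' i) → (∀ i → β i ≡ β' i) → Ĥ s u β w ≡ Ĥ s u' β' w
      Ĥ-cong eu eβ = poly-ext (proj₁ (proj₂ H.result)) (envM-cong eu eβ)

      pf-envM : ∀ {s w : ℚ → ℚ} {u β : Fin n → ℚ → ℚ} → PolyFun s → (∀ i → PolyFun (u i)) → (∀ i → PolyFun (β i)) → PolyFun w → ∀ v → PolyFun (λ q → envM (s q) (λ i → u i q) (λ i → β i q) (w q) v)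
      pf-envM ps pu pβ pw nothing       = ps
      pf-envM ps pu pβ pw (just (xv i)) = pu i
      pf-envM ps pu pβ pw (just (yv i)) = pβ i
      pf-envM ps pu pβ pw (just zv)     = pw
      pf-envM ps pu pβ pw (just ζv)     = pf-con 0ℚ

      pf-R̂ : ∀ {s w : ℚ → ℚ} {u β : Fin n → ℚ → ℚ} → PolyFun s → (∀ i → PolyFun (u i)) → (∀ i → PolyFun (β i)) → PolyFun w → PolyFun (λ q → R̂ (s q) (λ i → u i q) (λ i → β i q) (w q))
      pf-R̂ {s} {w} {u} {β} ps pu pβ pw = pf-comp (proj₁ (proj₂ R.result)) {e = λ v q → envM (s q) (λ i → u i q) (λ i → β i q) (w q) v} (pf-envM ps pu pβ pw)

      pf-Ĥ : ∀ {s w : ℚ → ℚ} {u β : Fin n → ℚ → ℚ} → PolyFun s → (∀ i → PolyFun (u i)) → (∀ i → PolyFun (β i)) → PolyFun w → PolyFun (λ q → Ĥ (s q) (λ i → u i q) (λ i → β i q) (w q))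
      pf-Ĥ {s} {w} {u} {β} ps pu pβ pw = pf-comp (proj₁ (proj₂ H.result)) {e = λ v q → envM (s q) (λ i → u i q) (λ i → β i q) (w q) v} (pf-envM ps pu pβ pw)

      -- The factors 4 β_i β_j - 1 are what q_i p_j - p_i q_j leaves after division by β_j - β_i.
      -- Independence of u and of the last argument is essential later: it lets this value be pulled
      -- out of both terms of the bilinear identity.
      closedR : (Fin n → ℚ) → ℚ
      closedR β = prodF (λ j → two * β j - 1ℚ) * prodLt (λ i j → ℕ→ℚ 4 * β i * β j - 1ℚ)

      -- At s = 0 the entry is (2β − 1)/(p + q u) with p = 2(β − 1/2)² and q = 2β: a Cauchy determinant.
      R̂-0 : ∀ u β w → R̂ 0ℚ u β w ≡ closedR β
      R̂-0 u β w = trans (poly-ext pQ (λ { nothing → refl ; (just v) → refl })) (dense-⇒≡ {g = λ ρ → D₀ ρ * Γ ρ} dns (poly-at0 pQ) pC generic (envM 0ℚ u β w))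
        where
        Q = proj₁ R.result
        pQ = proj₁ (proj₂ R.result)
        D₀ Γ C : W → ℚ
        D₀ ρ = R.D (at0 ρ)
        Γ ρ = prodF (λ i → prodF (λ j → Ĝ i j (at0 ρ)))
        C ρ = closedR (λ j → B j ρ)
        pΓ : IsPoly Γ
        pΓ = poly-at0 (poly-prodF (λ i → poly-prodF (λ j → pĜ i j)))
        pC : IsPoly C
        pC = poly-* (poly-prodF (λ j → poly-sub (poly-* (poly-con two) (pB j)) (poly-con 1ℚ))) (poly-prodLt (λ i j → poly-sub (poly-* (poly-* (poly-con (ℕ→ℚ 4)) (pB i)) (pB j)) (poly-con 1ℚ)))
        dns : Dense (λ ρ → D₀ ρ * Γ ρ)
        dns = dense-* (poly-at0 R.pD) pΓ (dense (poly-at0 R.pD) generic-point R.D≢0) (dense pΓ (λ _ → 0ℚ) (prodF-≢0 {n} (λ i → prodF-≢0 {n} (λ j → λ ()))))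
        generic : ∀ ρ → D₀ ρ * Γ ρ ≢ 0ℚ → Q (at0 ρ) ≡ C ρ
        generic ρ nz = *-cancelˡ-≢0 (D₀ ρ) (*-≢0ˡ {D₀ ρ} {Γ ρ} nz) (begin
          D₀ ρ * Q (at0 ρ)
            ≡⟨ proj₂ (proj₂ (proj₂ R.result)) (at0 ρ) ⟩
          det (λ i j → R.Ê i j (at0 ρ))
            ≡⟨ det-cong (λ i j → R.Ê i j (at0 ρ)) (λ i j → l i * r j * c i j) entryR ⟩
          det (λ i j → l i * r j * c i j)
            ≡⟨ det-scale l r c ⟩
          prodF l * prodF r * det c
            ≡⟨ e₁ (prodF l) (prodF r) (det c) ⟩
          prodF r * (det c * prodF l)
            ≡⟨ cong (λ w → prodF r * (det c * w)) (prodF-cong (λ i → prodF-cong (λ j → ĝ-0 (U i ρ) (B j ρ)))) ⟩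
          prodF r * (det c * prodF (λ i → prodF (λ j → p j + q j * U i ρ)))
            ≡⟨ cong (prodF r *_) (cauchy p q (λ i → U i ρ) c hc) ⟩
          prodF r * (vdm (λ i → U i ρ) * prodLt (λ i j → q i * p j - p i * q j))
            ≡⟨ cong (λ w → prodF r * (vdm (λ i → U i ρ) * w)) (trans (prodLt-cong (λ i j → e₂ (B i ρ) (B j ρ))) (prodLt-* (λ i j → B j ρ - B i ρ) (λ i j → ℕ→ℚ 4 * B i ρ * B j ρ - 1ℚ))) ⟩
          prodF r * (vdm (λ i → U i ρ) * (vdm (λ i → B i ρ) * prodLt (λ i j → ℕ→ℚ 4 * B i ρ * B j ρ - 1ℚ)))
            ≡⟨ e₃ (prodF r) (vdm (λ i → U i ρ)) (vdm (λ i → B i ρ)) (prodLt (λ i j → ℕ→ℚ 4 * B i ρ * B j ρ - 1ℚ)) ⟩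
          D₀ ρ * C ρ ∎)
          where
          open ≡-Reasoning
          g₀ : Fin n → Fin n → ℚ
          g₀ i j = Ĝ i j (at0 ρ)
          g₀≢0 : ∀ i j → g₀ i j ≢ 0ℚ
          g₀≢0 i j = prodF-≢0⁻ {f = λ j → g₀ i j} (prodF-≢0⁻ {f = λ i → prodF (λ j → g₀ i j)} (*-≢0ʳ {D₀ ρ} {Γ ρ} nz) i) j
          l r p q : Fin n → ℚ
          l i = prodF (λ j → g₀ i j)
          r j = two * B j ρ - 1ℚ
          p j = two * (B j ρ - half) * (B j ρ - half)
          q j = two * B j ρ
          c : Mat n
          c i j = proj₁ (inv (g₀ i j) (g₀≢0 i j))
          hc : ∀ i j → c i j * (p j + q j * U i ρ) ≡ 1ℚ
          hc i j = trans (ℚP.*-comm (c i j) (p j + q j * U i ρ)) (trans (cong (_* c i j) (sym (ĝ-0 (U i ρ) (B j ρ)))) (proj₂ (inv (g₀ i j) (g₀≢0 i j))))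
          f₀ : ∀ u β w → f̂R 0ℚ u β w ≡ two * β - 1ℚ
          f₀ u β w = lem u β w
            where
            lem : ∀ u β w → (0ℚ + two) * (half + β) * (1ℚ + 0ℚ * u) * (1ℚ + 0ℚ * w) - 0ℚ * (half + β) * (1ℚ + 0ℚ * u) - 0ℚ * (half + β) * (1ℚ + 0ℚ * w) - (1ℚ + 0ℚ * u) * (1ℚ + 0ℚ * w) - two - 0ℚ * u - 0ℚ * w - 0ℚ * (half + β) + two * 0ℚ + 1ℚ ≡ two * β - 1ℚ
            lem = solve 3 (λ u β w → (:0 :+ :2) :* (:½ :+ β) :* (:1 :+ :0 :* u) :* (:1 :+ :0 :* w) :- :0 :* (:½ :+ β) :* (:1 :+ :0 :* u) :- :0 :* (:½ :+ β) :* (:1 :+ :0 :* w) :- (:1 :+ :0 :* u) :* (:1 :+ :0 :* w) :- :2 :- :0 :* u :- :0 :* w :- :0 :* (:½ :+ β) :+ :2 :* :0 :+ :1 := :2 :* β :- :1) refl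
          entryR : ∀ i j → R.Ê i j (at0 ρ) ≡ l i * r j * c i j
          entryR i j = begin
            f̂R 0ℚ (U i ρ) (B j ρ) (ρ (just zv)) * skipProd (g₀ i) j         ≡⟨ cong (_* skipProd (g₀ i) j) (f₀ (U i ρ) (B j ρ) (ρ (just zv))) ⟩
            r j * skipProd (g₀ i) j                                           ≡⟨ a₁ (r j) (skipProd (g₀ i) j) ⟩
            1ℚ * (r j * skipProd (g₀ i) j)                                    ≡⟨ cong (_* (r j * skipProd (g₀ i) j)) (sym (proj₂ (inv (g₀ i j) (g₀≢0 i j)))) ⟩
            g₀ i j * c i j * (r j * skipProd (g₀ i) j)                        ≡⟨ a₂ (g₀ i j) (c i j) (r j) (skipProd (g₀ i) j) ⟩
            g₀ i j * skipProd (g₀ i) j * r j * c i j                          ≡⟨ cong (λ w → w * r j * c i j) (skipProd-* (g₀ i) j) ⟩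
            l i * r j * c i j                                                 ∎
            where
            a₁ : ∀ a b → a * b ≡ 1ℚ * (a * b)
            a₁ = solve 2 (λ a b → a :* b := :1 :* (a :* b)) refl
            a₂ : ∀ a b c d → a * b * (c * d) ≡ a * d * c * b
            a₂ = solve 4 (λ a b c d → a :* b :* (c :* d) := a :* d :* c :* b) refl
          e₁ : ∀ a b c → a * b * c ≡ b * (c * a)
          e₁ = solve 3 (λ a b c → a :* b :* c := b :* (c :* a)) refl
          e₂ : ∀ a b → two * a * (two * (b - half) * (b - half)) - two * (a - half) * (a - half) * (two * b) ≡ (b - a) * (ℕ→ℚ 4 * a * b - 1ℚ)
          e₂ = solve 2 (λ a b → :2 :* a :* (:2 :* (b :- :½) :* (b :- :½)) :- :2 :* (a :- :½) :* (a :- :½) :* (:2 :* b) := (b :- a) :* (:4 :* a :* b :- :1)) refl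
          e₃ : ∀ a b c d → a * (b * (c * d)) ≡ b * c * (a * d)
          e₃ = solve 4 (λ a b c d → a :* (b :* (c :* d)) := b :* c :* (a :* d)) refl

  open Leading using (R̂; Ĥ; R̂-spec; Ĥ-spec; Ĥ-cong; pf-R̂; pf-Ĥ; closedR; R̂-0; ĝ; ĝ-0; poly-ĝ; Gp-near-0; envM)

  -- The scaling limit of the bilinear identity

  T-snoc : ∀ n a c X Y z t → T (suc n) (a ∷ c ∷ enc n X Y z) t ≡ Sv (suc n) (snoc X a) (snoc Y c) z t
  T-snoc n a c X Y z t = trans (T-cons n a c (enc n X Y z) t) (trans (Sv-cong (suc n) _ t (snoc-cong (enc-x n X Y z)) (snoc-cong (enc-y n X Y z)))
    (cong (λ w → Sv (suc n) (snoc X a) (snoc Y c) w t) (enc-z n X Y z)))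

  T-snoc₂ : ∀ n a c b d X Y z t → T (suc (suc n)) (b ∷ d ∷ a ∷ c ∷ enc n X Y z) t ≡ Sv (suc (suc n)) (snoc (snoc X a) b) (snoc (snoc Y c) d) z t
  T-snoc₂ n a c b d X Y z t = trans (T-cons₂ n a c b d (enc n X Y z) t) (trans (Sv-cong (suc (suc n)) _ t (snoc-cong (snoc-cong (enc-x n X Y z))) (snoc-cong (snoc-cong (enc-y n X Y z))))
    (cong (λ w → Sv (suc (suc n)) (snoc (snoc X a) b) (snoc (snoc Y c) d) w t) (enc-z n X Y z)))

  -- The value of `ĝ` at s = 0.
  g₀ : ℚ → ℚ → ℚ
  g₀ u β = two * (β - half) * (β - half) + two * β * u

  module _ (N : ℕ) (U B : Fin N → ℚ) (ζ d ua ub : ℚ) where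
    private
      module At (s : ℚ) where
        xu : ℚ → ℚ
        xu u = 1ℚ + s * u
        yb : ℚ → ℚ
        yb β = s * (half + β)
        X Y : Fin N → ℚ
        X i = xu (U i)
        Y i = yb (B i)
        v = enc N X Y (yb ζ)
        R₂ R₁a R₁b Ha Hb H₀ : ℚ
        R₂ = R̂ (suc (suc N)) s (snoc (snoc U ua) ub) (snoc (snoc B ζ) d) 0ℚ
        R₁a = R̂ (suc N) s (snoc U ua) (snoc B ζ) 0ℚ
        R₁b = R̂ (suc N) s (snoc U ub) (snoc B ζ) 0ℚ
        Ha = Ĥ (suc N) s (snoc U ua) (snoc B d) ζ
        Hb = Ĥ (suc N) s (snoc U ub) (snoc B d) ζ
        H₀ = Ĥ N s U B ζ
        -- The argument 1 stands in a y position. Symmetry exchanges it with the small last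
        -- argument, after which all y are small and the expansion of type R applies.
        T₂-eq : T (suc (suc N)) (xu ub ∷ yb d ∷ xu ua ∷ xu 0ℚ ∷ v) s ≡ s ^ (suc (suc N) ℕ.* suc (suc N)) * R₂
        T₂-eq = trans (T-perm (suc (suc N)) s (pcons (pcons (pcons (perm-enc-end N X Y (xu 0ℚ) (yb ζ))))))
          (trans (T-snoc₂ N (xu ua) (yb ζ) (xu ub) (yb d) X Y (xu 0ℚ) s)
          (trans (Sv-cong (suc (suc N)) (xu 0ℚ) s
             (λ i → trans (snoc-cong (λ j → sym (snoc-map xu U ua j)) i) (sym (snoc-map xu (snoc U ua) ub i)))
             (λ i → trans (snoc-cong (λ j → sym (snoc-map yb B ζ j)) i) (sym (snoc-map yb (snoc B ζ) d i))))
             (R̂-spec (suc (suc N)) s (snoc (snoc U ua) ub) (snoc (snoc B ζ) d) 0ℚ)))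
        TR : ∀ u → T (suc N) (xu u ∷ xu 0ℚ ∷ v) s ≡ s ^ (suc N ℕ.* suc N) * R̂ (suc N) s (snoc U u) (snoc B ζ) 0ℚ
        TR u = trans (T-perm (suc N) s (pcons (perm-enc-end N X Y (xu 0ℚ) (yb ζ)))) (trans (T-snoc N (xu u) (yb ζ) X Y (xu 0ℚ) s)
          (trans (Sv-cong (suc N) (xu 0ℚ) s (λ i → sym (snoc-map xu U u i)) (λ i → sym (snoc-map yb B ζ i))) (R̂-spec (suc N) s (snoc U u) (snoc B ζ) 0ℚ)))
        TH : ∀ u → T (suc N) (xu u ∷ yb d ∷ v) s ≡ s ^ (suc N ℕ.* suc (suc N)) * Ĥ (suc N) s (snoc U u) (snoc B d) ζ
        TH u = trans (T-snoc N (xu u) (yb d) X Y (yb ζ) s)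
          (trans (Sv-cong (suc N) (yb ζ) s (λ i → sym (snoc-map xu U u i)) (λ i → sym (snoc-map yb B d i))) (Ĥ-spec (suc N) s (snoc U u) (snoc B d) ζ))
        T₀-eq : T N v s ≡ s ^ (N ℕ.* (2 ℕ.+ ℕ.pred N)) * H₀
        T₀-eq = trans (T-enc N X Y (yb ζ) s) (Ĥ-spec N s U B ζ)
        G : ℚ → ℚ
        G u = Gp s (xu u) (xu 0ℚ)
        gd : ℚ → ℚ
        gd u = ĝ N s u d
        lhs rhs : ℚ
        lhs = (ub - ua) * (yb d - xu 0ℚ) * R₂ * H₀
        rhs = gd ua * G ub * (R₁a * Hb) - G ua * gd ub * (Ha * R₁b)
        K : ℕ
        K = 1 ℕ.+ suc (suc N) ℕ.* suc (suc N) ℕ.+ N ℕ.* (2 ℕ.+ ℕ.pred N)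
        K' : K ≡ 2 ℕ.+ suc N ℕ.* suc N ℕ.+ suc N ℕ.* suc (suc N)
        K' = arith N
          where
          arith : ∀ N → 1 ℕ.+ suc (suc N) ℕ.* suc (suc N) ℕ.+ N ℕ.* (2 ℕ.+ ℕ.pred N) ≡ 2 ℕ.+ suc N ℕ.* suc N ℕ.+ suc N ℕ.* suc (suc N)
          arith zero    = refl
          arith (suc m) = e m
            where
            e : ∀ m → 1 ℕ.+ suc (suc (suc m)) ℕ.* suc (suc (suc m)) ℕ.+ suc m ℕ.* (2 ℕ.+ m) ≡ 2 ℕ.+ suc (suc m) ℕ.* suc (suc m) ℕ.+ suc (suc m) ℕ.* suc (suc (suc m))
            e = ℕR.solve-∀
        scaled : s ^ K * lhs ≡ s ^ K * rhs
        scaled = begin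
          s ^ K * lhs
            ≡⟨ cong (_* lhs) (trans (^-+ s (1 ℕ.+ E₂) E₀) (cong (_* s ^ E₀) (^-+ s 1 E₂))) ⟩
          s ^ 1 * s ^ E₂ * s ^ E₀ * lhs
            ≡⟨ l₁ s (s ^ E₂) (s ^ E₀) ub ua (yb d - xu 0ℚ) R₂ H₀ ⟩
          (xu ub - xu ua) * (yb d - xu 0ℚ) * (s ^ E₂ * R₂) * (s ^ E₀ * H₀)
            ≡⟨ cong₂ (λ p q → (xu ub - xu ua) * (yb d - xu 0ℚ) * p * q) (sym T₂-eq) (sym T₀-eq) ⟩
          (xu ub - xu ua) * (yb d - xu 0ℚ) * T (suc (suc N)) (xu ub ∷ yb d ∷ xu ua ∷ xu 0ℚ ∷ v) s * T N v s
            ≡⟨ hirota N (xu ub) (yb d) (xu ua) (xu 0ℚ) v s ⟩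
          Gp s (xu ua) (yb d) * G ub * (T (suc N) (xu ua ∷ xu 0ℚ ∷ v) s * T (suc N) (xu ub ∷ yb d ∷ v) s)
            - G ua * Gp s (xu ub) (yb d) * (T (suc N) (xu ua ∷ yb d ∷ v) s * T (suc N) (xu ub ∷ xu 0ℚ ∷ v) s)
            ≡⟨ cong₂ _-_ (cong₂ _*_ (cong (_* G ub) (Gp-near-0 N s ua d)) (cong₂ _*_ (TR ua) (TH ub))) (cong₂ _*_ (cong (G ua *_) (Gp-near-0 N s ub d)) (cong₂ _*_ (TH ua) (TR ub))) ⟩
          s ^ 2 * gd ua * G ub * (s ^ E₁ * R₁a * (s ^ E₃ * Hb)) - G ua * (s ^ 2 * gd ub) * (s ^ E₃ * Ha * (s ^ E₁ * R₁b))
            ≡⟨ l₂ (s ^ 2) (gd ua) (G ub) (s ^ E₁) R₁a (s ^ E₃) Hb (G ua) (gd ub) Ha R₁b ⟩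
          s ^ 2 * s ^ E₁ * s ^ E₃ * rhs
            ≡⟨ cong (_* rhs) (trans (cong (_* s ^ E₃) (sym (^-+ s 2 E₁))) (trans (sym (^-+ s (2 ℕ.+ E₁) E₃)) (cong (s ^_) (sym K')))) ⟩
          s ^ K * rhs ∎
          where
          open ≡-Reasoning
          E₀ = N ℕ.* (2 ℕ.+ ℕ.pred N)
          E₁ = suc N ℕ.* suc N
          E₂ = suc (suc N) ℕ.* suc (suc N)
          E₃ = suc N ℕ.* suc (suc N)
          l₁ : ∀ s e₂ e₀ ub ua f r h → s * 1ℚ * e₂ * e₀ * ((ub - ua) * f * r * h) ≡ (1ℚ + s * ub - (1ℚ + s * ua)) * f * (e₂ * r) * (e₀ * h)
          l₁ = solve 8 (λ s e₂ e₀ ub ua f r h → s :* :1 :* e₂ :* e₀ :* ((ub :- ua) :* f :* r :* h) := (:1 :+ s :* ub :- (:1 :+ s :* ua)) :* f :* (e₂ :* r) :* (e₀ :* h)) refl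
          l₂ : ∀ q ga Gb e₁ ra e₃ hb Ga gb ha rb → q * ga * Gb * (e₁ * ra * (e₃ * hb)) - Ga * (q * gb) * (e₃ * ha * (e₁ * rb)) ≡ q * e₁ * e₃ * (ga * Gb * (ra * hb) - Ga * gb * (ha * rb))
          l₂ = solve 11 (λ q ga Gb e₁ ra e₃ hb Ga gb ha rb → q :* ga :* Gb :* (e₁ :* ra :* (e₃ :* hb)) :- Ga :* (q :* gb) :* (e₃ :* ha :* (e₁ :* rb)) := q :* e₁ :* e₃ :* (ga :* Gb :* (ra :* hb) :- Ga :* gb :* (ha :* rb))) refl

    private
      pxu : ∀ u → PolyFun (λ s → At.xu s u)
      pxu u = pf-+ (pf-con 1ℚ) (pf-* pf-id (pf-con u))
      pG : ∀ u → PolyFun (λ s → At.G s u)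
      pG u = pf-comp {V = ⊤} (poly-Gp (poly-var tt) (poly-+ (poly-con 1ℚ) (poly-* (poly-var tt) (poly-con u))) (poly-+ (poly-con 1ℚ) (poly-* (poly-var tt) (poly-con 0ℚ)))) {e = λ _ s → s} (λ _ → pf-id)
      pg : ∀ u → PolyFun (λ s → At.gd s u)
      pg u = pf-comp (poly-ĝ N (poly-var nothing) (poly-con u) (poly-con d)) {e = λ _ s → s} (λ _ → pf-id)
      plhs : PolyFun At.lhs
      plhs = pf-* (pf-* (pf-* (pf-con (ub - ua)) (pf-sub (pf-* pf-id (pf-con (half + d))) (pxu 0ℚ)))
        (pf-R̂ (suc (suc N)) pf-id (λ i → pf-con (snoc (snoc U ua) ub i)) (λ i → pf-con (snoc (snoc B ζ) d i)) (pf-con 0ℚ))) (pf-Ĥ N pf-id (λ i → pf-con (U i)) (λ i → pf-con (B i)) (pf-con ζ))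
      pR : ∀ u → PolyFun (λ s → R̂ (suc N) s (snoc U u) (snoc B ζ) 0ℚ)
      pR u = pf-R̂ (suc N) pf-id (λ i → pf-con (snoc U u i)) (λ i → pf-con (snoc B ζ i)) (pf-con 0ℚ)
      pH : ∀ u → PolyFun (λ s → Ĥ (suc N) s (snoc U u) (snoc B d) ζ)
      pH u = pf-Ĥ (suc N) pf-id (λ i → pf-con (snoc U u i)) (λ i → pf-con (snoc B d i)) (pf-con ζ)
      prhs : PolyFun At.rhs
      prhs = pf-sub (pf-* (pf-* (pg ua) (pG ub)) (pf-* (pR ua) (pH ub))) (pf-* (pf-* (pG ua) (pg ub)) (pf-* (pH ua) (pR ub)))

    -- The bilinear identity at x = 1 + s ua, 1 + s ub and y = 1, s(1/2 + d), divided by the common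
    -- power of s and taken at s = 0. There G between the large arguments tends to 2, the difference
    -- of the two y tends to -1, and all R values are Cauchy determinants; it thereby becomes a
    -- linear relation between Ĥ at size N and at size N + 1.
    hirota-limit : (ub - ua) * (closedR (suc (suc N)) (snoc (snoc B ζ) d) * Ĥ N 0ℚ U B ζ)
      ≡ two * closedR (suc N) (snoc B ζ) * (g₀ ub d * Ĥ (suc N) 0ℚ (snoc U ua) (snoc B d) ζ - g₀ ua d * Ĥ (suc N) 0ℚ (snoc U ub) (snoc B d) ζ)
    hirota-limit = begin
      (ub - ua) * (closedR (suc (suc N)) (snoc (snoc B ζ) d) * H₀)
        ≡⟨ cong (λ w → (ub - ua) * (w * H₀)) (sym (R̂-0 (suc (suc N)) (snoc (snoc U ua) ub) (snoc (snoc B ζ) d) 0ℚ)) ⟩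
      (ub - ua) * (R₂ * H₀)
        ≡⟨ l₁ ub ua (half + d) R₂ H₀ ⟩
      - lhs
        ≡⟨ cong -_ (pf-dense-≡ plhs prhs pf-id 1ℚ 1≢0 (λ s s≢0 → *-cancelˡ-≢0 (s ^ At.K s) (^-≢0 (At.K s) s≢0) (At.scaled s)) 0ℚ) ⟩
      - rhs
        ≡⟨ cong -_ (cong₂ _-_ (cong₂ _*_ (cong₂ _*_ (ĝ-0 N ua d) (G0 ub)) (cong (_* Hb) (R̂-0 (suc N) (snoc U ua) (snoc B ζ) 0ℚ)))
                              (cong₂ _*_ (cong₂ _*_ (G0 ua) (ĝ-0 N ub d)) (cong (Ha *_) (R̂-0 (suc N) (snoc U ub) (snoc B ζ) 0ℚ)))) ⟩
      - (g₀ ua d * two * (closedR (suc N) (snoc B ζ) * Hb) - two * g₀ ub d * (Ha * closedR (suc N) (snoc B ζ)))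
        ≡⟨ l₂ (g₀ ua d) (closedR (suc N) (snoc B ζ)) Hb (g₀ ub d) Ha ⟩
      two * closedR (suc N) (snoc B ζ) * (g₀ ub d * Ha - g₀ ua d * Hb) ∎
      where
      open ≡-Reasoning
      open At 0ℚ
      G0 : ∀ u → Gp 0ℚ (1ℚ + 0ℚ * u) (1ℚ + 0ℚ * 0ℚ) ≡ two
      G0 u = lem u
        where
        lem : ∀ u → (0ℚ + two) * (1ℚ + 0ℚ * u) * (1ℚ + 0ℚ * 0ℚ) * ((1ℚ + 0ℚ * u) + (1ℚ + 0ℚ * 0ℚ)) - 0ℚ * ((1ℚ + 0ℚ * u) * (1ℚ + 0ℚ * u) + (1ℚ + 0ℚ * 0ℚ) * (1ℚ + 0ℚ * 0ℚ))
          - two * (0ℚ * 0ℚ + ℕ→ℚ 3 * 0ℚ + 1ℚ) * (1ℚ + 0ℚ * u) * (1ℚ + 0ℚ * 0ℚ) + 0ℚ * (two * 0ℚ + 1ℚ) * ((1ℚ + 0ℚ * u) + (1ℚ + 0ℚ * 0ℚ)) ≡ two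
        lem = solve 1 (λ u → (:0 :+ :2) :* (:1 :+ :0 :* u) :* (:1 :+ :0 :* :0) :* ((:1 :+ :0 :* u) :+ (:1 :+ :0 :* :0)) :- :0 :* ((:1 :+ :0 :* u) :* (:1 :+ :0 :* u) :+ (:1 :+ :0 :* :0) :* (:1 :+ :0 :* :0)) :- :2 :* (:0 :* :0 :+ :3 :* :0 :+ :1) :* (:1 :+ :0 :* u) :* (:1 :+ :0 :* :0) :+ :0 :* (:2 :* :0 :+ :1) :* ((:1 :+ :0 :* u) :+ (:1 :+ :0 :* :0)) := :2) refl
      l₁ : ∀ a b k r h → (a - b) * (r * h) ≡ - ((a - b) * (0ℚ * k - (1ℚ + 0ℚ * 0ℚ)) * r * h)
      l₁ = solve 5 (λ a b k r h → (a :- b) :* (r :* h) := :- ((a :- b) :* (:0 :* k :- (:1 :+ :0 :* :0)) :* r :* h)) refl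
      l₂ : ∀ ga c hb gb ha → - (ga * two * (c * hb) - two * gb * (ha * c)) ≡ two * c * (gb * ha - ga * hb)
      l₂ = solve 5 (λ ga c hb gb ha → :- (ga :* :2 :* (c :* hb) :- :2 :* gb :* (ha :* c)) := :2 :* c :* (gb :* ha :- ga :* hb)) refl

  -- The symmetry between the last y and z in S is divided by its power of s and extended to s = 0
  -- by density.
  Ĥ-swap : ∀ N U B u d ζ → Ĥ (suc N) 0ℚ (snoc U u) (snoc B d) ζ ≡ Ĥ (suc N) 0ℚ (snoc U u) (snoc B ζ) d
  Ĥ-swap N U B u d ζ = pf-dense-≡ (pH d ζ) (pH ζ d) pf-id 1ℚ 1≢0 (λ s s≢0 → *-cancelˡ-≢0 (s ^ E) (^-≢0 E s≢0) (swapped s)) 0ℚ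
    where
    E = suc N ℕ.* suc (suc N)
    pH : ∀ d ζ → PolyFun (λ s → Ĥ (suc N) s (snoc U u) (snoc B d) ζ)
    pH d ζ = pf-Ĥ (suc N) pf-id (λ i → pf-con (snoc U u i)) (λ i → pf-con (snoc B d i)) (pf-con ζ)
    module _ (s : ℚ) where
      xu yb : ℚ → ℚ
      xu u = 1ℚ + s * u
      yb β = s * (half + β)
      TH : ∀ d ζ → T (suc N) (xu u ∷ yb d ∷ enc N (λ i → xu (U i)) (λ i → yb (B i)) (yb ζ)) s ≡ s ^ E * Ĥ (suc N) s (snoc U u) (snoc B d) ζ
      TH d ζ = trans (T-snoc N (xu u) (yb d) (λ i → xu (U i)) (λ i → yb (B i)) (yb ζ) s)
        (trans (Sv-cong (suc N) (yb ζ) s (λ i → sym (snoc-map xu U u i)) (λ i → sym (snoc-map yb B d i))) (Ĥ-spec (suc N) s (snoc U u) (snoc B d) ζ))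
      swapped : s ^ E * Ĥ (suc N) s (snoc U u) (snoc B d) ζ ≡ s ^ E * Ĥ (suc N) s (snoc U u) (snoc B ζ) d
      swapped = trans (sym (TH d ζ)) (trans (T-perm (suc N) s (pcons (perm-enc-end N (λ i → xu (U i)) (λ i → yb (B i)) (yb d) (yb ζ)))) (TH ζ d))

  closedR-snoc : ∀ N B d → closedR (suc N) (snoc B d) ≡ closedR N B * ((two * d - 1ℚ) * prodF (λ i → ℕ→ℚ 4 * B i * d - 1ℚ))
  closedR-snoc N B d = trans (cong₂ _*_ (prodF-snoc (λ b → two * b - 1ℚ) B d) (prodLt-snoc (λ a b → ℕ→ℚ 4 * a * b - 1ℚ) B d))
    (lem (prodF (λ i → two * B i - 1ℚ)) (two * d - 1ℚ) (prodLt (λ i j → ℕ→ℚ 4 * B i * B j - 1ℚ)) (prodF (λ i → ℕ→ℚ 4 * B i * d - 1ℚ)))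
    where
    lem : ∀ a b c d → a * b * (c * d) ≡ a * c * (b * d)
    lem = solve 4 (λ a b c d → a :* b :* (c :* d) := a :* c :* (b :* d)) refl

  -- The leading coefficients as binomials

  -- In the limit u = 2 and β = 0 are the scaled coordinates of the special values: ξ₀ = 1 + 2t and
  -- ξ₁ = t/2 up to second order.
  zeros twos : ∀ {n} → Fin n → ℚ
  zeros _ = 0ℚ
  twos _ = two

  closedR-zeros≢0 : ∀ n → closedR n zeros ≢ 0ℚ
  closedR-zeros≢0 n = *-≢0 {prodF {n} (λ j → two * 0ℚ - 1ℚ)} {prodLt {n} (λ i j → ℕ→ℚ 4 * 0ℚ * 0ℚ - 1ℚ)} (prodF-≢0 {n} (λ i → λ ())) (prodLt-≢0 {n} (λ i j _ → λ ()))

  -- One argument β is kept free. The value at 0 alone satisfies no closed recursion here, whereas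
  -- the function of β does.
  τ : ℕ → ℚ → ℚ
  τ n β = Ĥ n 0ℚ twos zeros β

  pf-τ : ∀ n → PolyFun (τ n)
  pf-τ n = pf-Ĥ n (pf-con 0ℚ) (λ i → pf-con two) (λ i → pf-con 0ℚ) pf-id

  module _ (N : ℕ) where
    private
      ε = sgn (suc N)
      ha : ℚ → ℚ
      ha β = Ĥ (suc N) 0ℚ (snoc twos 0ℚ) (snoc zeros 0ℚ) β
      ones : ∀ {n} {f : Fin n → ℚ} → (∀ i → f i ≡ - 1ℚ) → prodF f ≡ sgn n
      ones {n} eq = trans (prodF-cong eq) (prodF-const n (- 1ℚ))
      τ-snoc : ∀ β → Ĥ (suc N) 0ℚ (snoc twos two) (snoc zeros 0ℚ) β ≡ τ (suc N) β
      τ-snoc β = Ĥ-cong (suc N) (snoc-const {n = N} two) (snoc-const {n = N} 0ℚ)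
      R≢0 : ∀ β → two * β - 1ℚ ≢ 0ℚ → closedR (suc N) (snoc zeros β) ≢ 0ℚ
      R≢0 β nz z = *-≢0 (closedR-zeros≢0 N) (*-≢0 nz (prodF-≢0 {N} (λ i eq → m1 (trans (sym (lem β)) eq)))) (trans (sym (closedR-snoc N zeros β)) z)
        where
        lem : ∀ β → ℕ→ℚ 4 * 0ℚ * β - 1ℚ ≡ - 1ℚ
        lem = solve 1 (λ β → :4 :* :0 :* β :- :1 := :- :1) refl
        m1 : - 1ℚ ≢ 0ℚ
        m1 ()

    -- The limit at ua = 0, ub = 2 with β as last argument. It brings in the auxiliary value `ha`,
    -- where one u is 0.
    eq₁ : ∀ β → two * β - 1ℚ ≢ 0ℚ → - 1ℚ * ε * τ N β ≡ half * ha β - half * τ (suc N) β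
    eq₁ β nz = *-cancelˡ-≢0 (two * R₁) (*-≢0 {two} {R₁} (λ ()) (R≢0 β nz)) (begin
      two * R₁ * (- 1ℚ * ε * τ N β)
        ≡⟨ l₁ R₁ ε (τ N β) ⟩
      (two - 0ℚ) * (R₁ * ((two * 0ℚ - 1ℚ) * ε) * τ N β)
        ≡⟨ cong (λ w → (two - 0ℚ) * (R₁ * ((two * 0ℚ - 1ℚ) * w) * τ N β)) (sym (ones {suc N} (λ i → l₀ (snoc zeros β i)))) ⟩
      (two - 0ℚ) * (R₁ * ((two * 0ℚ - 1ℚ) * prodF (λ i → ℕ→ℚ 4 * snoc {N} zeros β i * 0ℚ - 1ℚ)) * τ N β)
        ≡⟨ cong (λ w → (two - 0ℚ) * (w * τ N β)) (sym (closedR-snoc (suc N) (snoc zeros β) 0ℚ)) ⟩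
      (two - 0ℚ) * (closedR (suc (suc N)) (snoc (snoc zeros β) 0ℚ) * τ N β)
        ≡⟨ hirota-limit N twos zeros β 0ℚ 0ℚ two ⟩
      two * R₁ * (g₀ two 0ℚ * ha β - g₀ 0ℚ 0ℚ * Ĥ (suc N) 0ℚ (snoc twos two) (snoc zeros 0ℚ) β)
        ≡⟨ cong (λ w → two * R₁ * (half * ha β - half * w)) (τ-snoc β) ⟩
      two * R₁ * (half * ha β - half * τ (suc N) β) ∎)
      where
      open ≡-Reasoning
      R₁ = closedR (suc N) (snoc zeros β)
      l₀ : ∀ b → ℕ→ℚ 4 * b * 0ℚ - 1ℚ ≡ - 1ℚ
      l₀ = solve 1 (λ b → :4 :* b :* :0 :- :1 := :- :1) refl
      l₁ : ∀ r e t → two * r * (- 1ℚ * e * t) ≡ (two - 0ℚ) * (r * ((two * 0ℚ - 1ℚ) * e) * t)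
      l₁ = solve 3 (λ r e t → :2 :* r :* (:- :1 :* e :* t) := (:2 :- :0) :* (r :* ((:2 :* :0 :- :1) :* e) :* t)) refl

    -- The same limit with the roles of β and 0 exchanged; `Ĥ-swap` brings back the same two
    -- unknowns, so that `ha` can be eliminated.
    eq₂ : ∀ β → (two * β - 1ℚ) * ε * τ N 0ℚ ≡ g₀ two β * ha β - g₀ 0ℚ β * τ (suc N) β
    eq₂ β = *-cancelˡ-≢0 (two * R₁) (*-≢0 {two} {R₁} (λ ()) (R≢0 0ℚ (λ ()))) (begin
      two * R₁ * ((two * β - 1ℚ) * ε * τ N 0ℚ)
        ≡⟨ l₁ R₁ (two * β - 1ℚ) ε (τ N 0ℚ) ⟩
      (two - 0ℚ) * (R₁ * ((two * β - 1ℚ) * ε) * τ N 0ℚ)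
        ≡⟨ cong (λ w → (two - 0ℚ) * (R₁ * ((two * β - 1ℚ) * w) * τ N 0ℚ)) (sym (ones {suc N} (λ i → trans (cong (λ w → ℕ→ℚ 4 * w * β - 1ℚ) (snoc-const {n = N} 0ℚ i)) (l₀ β)))) ⟩
      (two - 0ℚ) * (R₁ * ((two * β - 1ℚ) * prodF (λ i → ℕ→ℚ 4 * snoc {N} zeros 0ℚ i * β - 1ℚ)) * τ N 0ℚ)
        ≡⟨ cong (λ w → (two - 0ℚ) * (w * τ N 0ℚ)) (sym (closedR-snoc (suc N) (snoc zeros 0ℚ) β)) ⟩
      (two - 0ℚ) * (closedR (suc (suc N)) (snoc (snoc zeros 0ℚ) β) * τ N 0ℚ)
        ≡⟨ hirota-limit N twos zeros 0ℚ β 0ℚ two ⟩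
      two * R₁ * (g₀ two β * Ĥ (suc N) 0ℚ (snoc twos 0ℚ) (snoc zeros β) 0ℚ - g₀ 0ℚ β * Ĥ (suc N) 0ℚ (snoc twos two) (snoc zeros β) 0ℚ)
        ≡⟨ cong₂ (λ v w → two * R₁ * (g₀ two β * v - g₀ 0ℚ β * w)) (Ĥ-swap N twos zeros 0ℚ β 0ℚ) (trans (Ĥ-swap N twos zeros two β 0ℚ) (τ-snoc β)) ⟩
      two * R₁ * (g₀ two β * ha β - g₀ 0ℚ β * τ (suc N) β) ∎)
      where
      open ≡-Reasoning
      R₁ = closedR (suc N) (snoc zeros 0ℚ)
      l₀ : ∀ b → ℕ→ℚ 4 * 0ℚ * b - 1ℚ ≡ - 1ℚ
      l₀ = solve 1 (λ b → :4 :* :0 :* b :- :1 := :- :1) refl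
      l₁ : ∀ r b e t → two * r * (b * e * t) ≡ (two - 0ℚ) * (r * (b * e) * t)
      l₁ = solve 4 (λ r b e t → :2 :* r :* (b :* e :* t) := (:2 :- :0) :* (r :* (b :* e) :* t)) refl

    -- Elimination of `ha` from `eq₁` and `eq₂`: the coefficients g₀ at u = 2 and u = 0 are (1 +
    -- 2β)²/2 + 2β - 2β... up to their difference 4β, and twice the former is (1 + 2β)².
    τ-rec : ∀ β → ℕ→ℚ 4 * β * τ (suc N) β ≡ ε * ((1ℚ + two * β) * (1ℚ + two * β) * τ N β + (two * β - 1ℚ) * τ N 0ℚ)
    τ-rec = pf-dense-≡ (pf-* (pf-* (pf-con (ℕ→ℚ 4)) pf-id) (pf-τ (suc N)))
      (pf-* (pf-con ε) (pf-+ (pf-* (pf-* p1 p1) (pf-τ N)) (pf-* p2 (pf-con (τ N 0ℚ))))) p2 0ℚ (λ ()) generic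
      where
      p1 : PolyFun (λ β → 1ℚ + two * β)
      p1 = pf-+ (pf-con 1ℚ) (pf-* (pf-con two) pf-id)
      p2 : PolyFun (λ β → two * β - 1ℚ)
      p2 = pf-sub (pf-* (pf-con two) pf-id) (pf-con 1ℚ)
      generic : ∀ β → two * β - 1ℚ ≢ 0ℚ → ℕ→ℚ 4 * β * τ (suc N) β ≡ ε * ((1ℚ + two * β) * (1ℚ + two * β) * τ N β + (two * β - 1ℚ) * τ N 0ℚ)
      generic β nz = begin
        ℕ→ℚ 4 * β * τ (suc N) β
          ≡⟨ l₁ β (τ (suc N) β) (ha β) ⟩
        (g₀ two β * ha β - g₀ 0ℚ β * τ (suc N) β) - two * g₀ two β * (half * ha β - half * τ (suc N) β)
          ≡⟨ cong₂ (λ v w → v - two * g₀ two β * w) (sym (eq₂ β)) (sym (eq₁ β nz)) ⟩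
        (two * β - 1ℚ) * ε * τ N 0ℚ - two * g₀ two β * (- 1ℚ * ε * τ N β)
          ≡⟨ l₂ β ε (τ N 0ℚ) (τ N β) ⟩
        ε * ((1ℚ + two * β) * (1ℚ + two * β) * τ N β + (two * β - 1ℚ) * τ N 0ℚ) ∎
        where
        open ≡-Reasoning
        l₁ : ∀ β t h → ℕ→ℚ 4 * β * t ≡ ((two * (β - half) * (β - half) + two * β * two) * h - (two * (β - half) * (β - half) + two * β * 0ℚ) * t)
          - two * (two * (β - half) * (β - half) + two * β * two) * (half * h - half * t)
        l₁ = solve 3 (λ β t h → :4 :* β :* t := ((:2 :* (β :- :½) :* (β :- :½) :+ :2 :* β :* :2) :* h :- (:2 :* (β :- :½) :* (β :- :½) :+ :2 :* β :* :0) :* t) :- :2 :* (:2 :* (β :- :½) :* (β :- :½) :+ :2 :* β :* :2) :* (:½ :* h :- :½ :* t)) refl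
        l₂ : ∀ β e t₀ t → (two * β - 1ℚ) * e * t₀ - two * (two * (β - half) * (β - half) + two * β * two) * (- 1ℚ * e * t) ≡ e * ((1ℚ + two * β) * (1ℚ + two * β) * t + (two * β - 1ℚ) * t₀)
        l₂ = solve 4 (λ β e t₀ t → (:2 :* β :- :1) :* e :* t₀ :- :2 :* (:2 :* (β :- :½) :* (β :- :½) :+ :2 :* β :* :2) :* (:- :1 :* e :* t) := e :* ((:1 :+ :2 :* β) :* (:1 :+ :2 :* β) :* t :+ (:2 :* β :- :1) :* t₀)) refl

  -- With s = 2β the recursion multiplies by s + 2 + 1/s, up to sign and a factor 1/2, and keeps the
  -- nonnegative powers. Its term with τ at 0 adds what comes in from the entry at s^(-1), equal to
  -- the head by reciprocity, and removes the head that leaves to s^(-1).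
  τ-closed : ∀ n β → τ n β ≡ signs n * half ^ n * evalP (θH n ∷ θT n) (two * β)
  τ-closed zero β = trans (trans (sym (trans (Ĥ-spec 0 0ℚ twos zeros β) (ℚP.*-identityˡ (τ 0 β)))) (trans (Sv-cong 0 (0ℚ * (half + β)) 0ℚ (λ ()) (λ ())) (T-0 (0ℚ * (half + β)) 0ℚ))) (lem β)
    where
    lem : ∀ β → 1ℚ ≡ 1ℚ * 1ℚ * (1ℚ + two * β * 0ℚ)
    lem = solve 1 (λ β → :1 := :1 :* :1 :* (:1 :+ :2 :* β :* :0)) refl
  τ-closed (suc n) = pf-dense-≡ (pf-τ (suc n)) (pf-* (pf-con (signs (suc n) * half ^ suc n)) (pf-+ (pf-con (θH (suc n))) (pf-* p (pf-evalP∘ (θT (suc n)))))) pf-id 1ℚ 1≢0 λ β β≢0 →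
    *-cancelˡ-≢0 (ℕ→ℚ 4 * β) (*-≢0 {ℕ→ℚ 4} (λ ()) β≢0) (begin
      ℕ→ℚ 4 * β * τ (suc n) β
        ≡⟨ τ-rec n β ⟩
      ε * ((1ℚ + two * β) * (1ℚ + two * β) * τ n β + (two * β - 1ℚ) * τ n 0ℚ)
        ≡⟨ cong₂ (λ v w → ε * ((1ℚ + two * β) * (1ℚ + two * β) * v + (two * β - 1ℚ) * w)) (τ-closed n β) (trans (τ-closed n 0ℚ) (l₀ k (θH n) (evalP (θT n) (two * 0ℚ)))) ⟩
      ε * ((1ℚ + two * β) * (1ℚ + two * β) * (k * ev β) + (two * β - 1ℚ) * (k * θH n))
        ≡⟨ l₁ ε β k (ev β) (θH n) ⟩
      ε * k * (θH n * (two * β) + (1ℚ + two * β) * (1ℚ + two * β) * ev β - θH n)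
        ≡⟨ cong (ε * k *_) (sym (next-eval (two * β) (θH n) (θH n) (θT n))) ⟩
      ε * k * (two * β * ev' β)
        ≡⟨ l₂ ε (signs n) (half ^ n) β (ev' β) ⟩
      ℕ→ℚ 4 * β * (signs (suc n) * half ^ suc n * ev' β) ∎)
    where
    open ≡-Reasoning
    ε = sgn (suc n)
    k = signs n * half ^ n
    ev ev' : ℚ → ℚ
    ev β = evalP (θH n ∷ θT n) (two * β)
    ev' β = evalP (θH (suc n) ∷ θT (suc n)) (two * β)
    p : PolyFun (λ β → two * β)
    p = pf-* (pf-con two) pf-id
    pf-evalP∘ : ∀ P → PolyFun (λ β → evalP P (two * β))
    pf-evalP∘ []      = pf-con 0ℚ
    pf-evalP∘ (c ∷ P) = pf-+ (pf-con c) (pf-* p (pf-evalP∘ P))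
    l₀ : ∀ k c r → k * (c + two * 0ℚ * r) ≡ k * c
    l₀ = solve 3 (λ k c r → k :* (c :+ :2 :* :0 :* r) := k :* c) refl
    l₁ : ∀ e b k v c → e * ((1ℚ + two * b) * (1ℚ + two * b) * (k * v) + (two * b - 1ℚ) * (k * c)) ≡ e * k * (c * (two * b) + (1ℚ + two * b) * (1ℚ + two * b) * v - c)
    l₁ = solve 5 (λ e b k v c → e :* ((:1 :+ :2 :* b) :* (:1 :+ :2 :* b) :* (k :* v) :+ (:2 :* b :- :1) :* (k :* c)) := e :* k :* (c :* (:2 :* b) :+ (:1 :+ :2 :* b) :* (:1 :+ :2 :* b) :* v :- c)) refl
    l₂ : ∀ e s h b v → e * (s * h) * (two * b * v) ≡ ℕ→ℚ 4 * b * (e * s * (half * h) * v)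
    l₂ = solve 5 (λ e s h b v → e :* (s :* h) :* (:2 :* b :* v) := :4 :* b :* (e :* s :* (:½ :* h) :* v)) refl

  τ-0 : ∀ n → τ n 0ℚ ≡ signs n * half ^ n * θH n
  τ-0 n = trans (τ-closed n 0ℚ) (l (signs n * half ^ n) (θH n) (evalP (θT n) (two * 0ℚ)))
    where
    l : ∀ k c r → k * (c + two * 0ℚ * r) ≡ k * c
    l = solve 3 (λ k c r → k :* (c :+ :2 :* :0 :* r) := k :* c) refl

  -- Specialization to ξ₀ and ξ₁

  -- S_n at a arguments p and 2n + 1 − a arguments q
  s : ∀ n → ℕ → ℚ → ℚ → ℚ → ℚ
  s n a p q t = T n (map (pick p q) (fill (suc (dbl n)) a)) t

  T-pick : ∀ n (bs : Vec Bool (suc (dbl n))) p q t → T n (map (pick p q) bs) t ≡ s n (trues bs) p q t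
  T-pick n bs p q t = T-perm n t (perm-map (pick p q) (perm-fill bs))

  Sv-pick : ∀ n (x y : Fin n → Bool) z p q t → Sv n (λ i → pick p q (x i)) (λ i → pick p q (y i)) (pick p q z) t ≡ s n (count x ℕ.+ count y ℕ.+ bit z) p q t
  Sv-pick n x y z p q t = trans (sym (T-enc n (λ i → pick p q (x i)) (λ i → pick p q (y i)) (pick p q z) t))
    (trans (cong (λ v → T n v t) (sym (map-enc (pick p q) n x y z))) (trans (T-pick n (enc n x y z) p q t) (cong (λ a → s n a p q t) (trues-enc n x y z))))

  s-0 : ∀ a p q t → s 0 a p q t ≡ 1ℚ
  s-0 zero    p q t = T-0 q t
  s-0 (suc a) p q t = T-0 p t

  trues-fill : ∀ m a → a ℕ.≤ m → trues (fill m a) ≡ a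
  trues-fill zero    zero    _           = refl
  trues-fill (suc m) zero    _           = trues-fill m zero ℕ.z≤n
  trues-fill (suc m) (suc a) (ℕ.s≤s a≤m) = cong suc (trues-fill m a a≤m)

  P : ℕ → ℚ → ℚ
  P n t = s n (suc n) (ξ₀ t) (ξ₁ t) t

  S-envP : ∀ n t → evalM (S n) (envP n t) ≡ P n t
  -- For n = 0 the sole argument is ξ₁ on the left and ξ₀ on the right; both values are S_0 = 1.
  S-envP zero    t = trans (evalM-cong (S 0) (λ { zv → refl ; ζv → refl })) (trans (T-0 (ξ₁ t) t) (sym (s-0 1 (ξ₀ t) (ξ₁ t) t)))
  S-envP (suc m) t = trans (evalM-cong (S (suc m)) agree) (trans (Sv-pick (suc m) (λ _ → true) (first 1) false (ξ₀ t) (ξ₁ t) t)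
    (cong (λ a → s (suc m) a (ξ₀ t) (ξ₁ t) t) (trans (cong₂ (λ u v → u ℕ.+ v ℕ.+ 0) (count-true (suc m)) (count-first {suc m} 1 (ℕ.s≤s ℕ.z≤n)))
      (trans (ℕP.+-identityʳ (suc m ℕ.+ 1)) (ℕP.+-comm (suc m) 1)))))
    where
    agree : ∀ v → envP (suc m) t v ≡ envS {suc m} (λ i → pick (ξ₀ t) (ξ₁ t) true) (λ i → pick (ξ₀ t) (ξ₁ t) (first 1 i)) (ξ₁ t) t v
    agree (xv i)       = refl
    agree (yv zero)    = refl
    agree (yv (suc i)) = refl
    agree zv           = refl
    agree ζv           = refl

  -- The bilinear identity at a = c = ξ₀, b = d = ξ₁
  toda : ∀ m t → t + two ≢ 0ℚ → 1ℚ + t ≢ 0ℚ →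
    P (suc (suc m)) t * P m t ≡ t * t * (ξ₁ t * ξ₁ t * (s (suc m) (suc (suc (suc m))) (ξ₀ t) (ξ₁ t) t * s (suc m) (suc m) (ξ₀ t) (ξ₁ t) t) - ξ₀ t * ξ₀ t * (P (suc m) t * P (suc m) t))
  toda m t nz₂ nz₁ = *-cancelˡ-≢0 (g * g) (*-≢0 g≢0 g≢0) (begin
    g * g * (P₂ * P₀)
      -- Since ξ₀ - ξ₁ = 2(t + 1)²/(t + 2), the differences contribute the same constant g as the
      -- values of G, and all powers of t + 1 cancel.
      ≡⟨ cong (λ w → w * w * (P₂ * P₀)) (sym gap) ⟩
    (a - b) * (t + two) * ((a - b) * (t + two)) * (P₂ * P₀)
      ≡⟨ l₁ a b (t + two) P₂ P₀ ⟩
    (t + two) * (t + two) * ((b - a) * (b - a) * P₂ * P₀)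
      ≡⟨ cong ((t + two) * (t + two) *_) (trans (cong₂ (λ u w → (b - a) * (b - a) * u * w) (sym e₂) refl) (hirota m b b a a v t)) ⟩
    (t + two) * (t + two) * (Gp t a b * Gp t b a * (T (suc m) (a ∷ a ∷ v) t * T (suc m) (b ∷ b ∷ v) t) - Gp t a a * Gp t b b * (T (suc m) (a ∷ b ∷ v) t * T (suc m) (b ∷ a ∷ v) t))
      ≡⟨ cong ((t + two) * (t + two) *_) (cong₂ _-_ (cong₂ _*_ (cong₂ _*_ (Gp-ξ₀ t b) (Gp-ξ₁ t a nz₂)) (cong₂ _*_ eaa ebb))
                                                    (cong₂ _*_ (cong₂ _*_ (Gp-ξ₀ t a) (Gp-ξ₁ t b nz₂)) (cong₂ _*_ eab eba))) ⟩
    (t + two) * (t + two) * (g * (b * b) * (g * (b * b)) * (Z * Q) - g * (a * a) * (g * (b * b)) * (P₁ * P₁))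
      ≡⟨ l₂ (t + two) g b a Z Q P₁ ⟩
    g * g * (b * (t + two) * (b * (t + two)) * (b * b * (Z * Q) - a * a * (P₁ * P₁)))
      ≡⟨ cong (λ w → g * g * (w * w * (b * b * (Z * Q) - a * a * (P₁ * P₁)))) (ξ₁-spec t nz₂) ⟩
    g * g * (t * t * (b * b * (Z * Q) - a * a * (P₁ * P₁))) ∎)
    where
    open ≡-Reasoning
    a b g P₂ P₁ P₀ Z Q : ℚ
    a = ξ₀ t
    b = ξ₁ t
    g = two * (t + 1ℚ) * (t + 1ℚ)
    P₂ = P (suc (suc m)) t
    P₁ = P (suc m) t
    P₀ = P m t
    Z = s (suc m) (suc (suc (suc m))) a b t
    Q = s (suc m) (suc m) a b t
    v = map (pick a b) (fill (suc (dbl m)) (suc m))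
    cnt : trues (fill (suc (dbl m)) (suc m)) ≡ suc m
    cnt = trues-fill (suc (dbl m)) (suc m) (ℕ.s≤s (le m))
      where
      le : ∀ m → m ℕ.≤ dbl m
      le zero    = ℕ.z≤n
      le (suc m) = ℕ.s≤s (ℕP.m≤n⇒m≤1+n (le m))
    e₂ : T (suc (suc m)) (b ∷ b ∷ a ∷ a ∷ v) t ≡ P₂
    e₂ = trans (T-pick (suc (suc m)) (false ∷ false ∷ true ∷ true ∷ fill (suc (dbl m)) (suc m)) a b t) (cong (λ c → s (suc (suc m)) (suc (suc c)) a b t) cnt)
    pair : ∀ x y → T (suc m) (pick a b x ∷ pick a b y ∷ v) t ≡ s (suc m) (bit x ℕ.+ (bit y ℕ.+ suc m)) a b t
    pair x y = trans (T-pick (suc m) (x ∷ y ∷ fill (suc (dbl m)) (suc m)) a b t) (cong (λ c → s (suc m) (bit x ℕ.+ (bit y ℕ.+ c)) a b t) cnt)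
    eaa : T (suc m) (a ∷ a ∷ v) t ≡ Z
    eaa = pair true true
    ebb : T (suc m) (b ∷ b ∷ v) t ≡ Q
    ebb = pair false false
    eab : T (suc m) (a ∷ b ∷ v) t ≡ P₁
    eab = pair true false
    eba : T (suc m) (b ∷ a ∷ v) t ≡ P₁
    eba = pair false true
    gap : (a - b) * (t + two) ≡ g
    gap = trans (l₃ t b) (trans (cong (λ w → (two * t + 1ℚ) * (t + two) - w) (ξ₁-spec t nz₂)) (l₄ t))
      where
      l₃ : ∀ t b → (two * t + 1ℚ - b) * (t + two) ≡ (two * t + 1ℚ) * (t + two) - b * (t + two)
      l₃ = solve 2 (λ t b → (:2 :* t :+ :1 :- b) :* (t :+ :2) := (:2 :* t :+ :1) :* (t :+ :2) :- b :* (t :+ :2)) refl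
      l₄ : ∀ t → (two * t + 1ℚ) * (t + two) - t ≡ two * (t + 1ℚ) * (t + 1ℚ)
      l₄ = solve 1 (λ t → (:2 :* t :+ :1) :* (t :+ :2) :- t := :2 :* (t :+ :1) :* (t :+ :1)) refl
    t1≢0 : t + 1ℚ ≢ 0ℚ
    t1≢0 z = nz₁ (trans (ℚP.+-comm 1ℚ t) z)
    g≢0 : g ≢ 0ℚ
    g≢0 = *-≢0 (*-≢0 {two} (λ ()) t1≢0) t1≢0
    l₁ : ∀ a b c p q → (a - b) * c * ((a - b) * c) * (p * q) ≡ c * c * ((b - a) * (b - a) * p * q)
    l₁ = solve 5 (λ a b c p q → (a :- b) :* c :* ((a :- b) :* c) :* (p :* q) := c :* c :* ((b :- a) :* (b :- a) :* p :* q)) refl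
    l₂ : ∀ c g b a z q p → c * c * (g * (b * b) * (g * (b * b)) * (z * q) - g * (a * a) * (g * (b * b)) * (p * p)) ≡ g * g * (b * c * (b * c) * (b * b * (z * q) - a * a * (p * p)))
    l₂ = solve 7 (λ c g b a z q p → c :* c :* (g :* (b :* b) :* (g :* (b :* b)) :* (z :* q) :- g :* (a :* a) :* (g :* (b :* b)) :* (p :* p)) := g :* g :* (b :* c :* (b :* c) :* (b :* b :* (z :* q) :- a :* a :* (p :* p)))) refl

  module _ (t t' : ℚ) (tt' : t * t' ≡ 1ℚ) (nz : t + two ≢ 0ℚ) (nz' : t' + two ≢ 0ℚ) where

    private
      opp : Bool → Bool
      opp true  = false
      opp false = true
      inverse : ∀ b → pick (ξ₀ t) (ξ₁ t) b * pick (ξ₀ t') (ξ₁ t') (opp b) ≡ 1ℚ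
      inverse true  = ξ₀-inv t t' tt' nz'
      inverse false = ξ₁-inv t t' tt' nz

    -- Under t → 1/t the values ξ₀ and 1/ξ₁ are exchanged.
    s-inv : ∀ n (x y : Fin n → Bool) z →
      s n (count x ℕ.+ count y ℕ.+ bit z) (ξ₀ t) (ξ₁ t) t
        ≡ ((t * t) ^ n) ^ n * (prodF (λ i → pick (ξ₀ t) (ξ₁ t) (x i)) * prodF (λ i → pick (ξ₀ t) (ξ₁ t) (y i)) * pick (ξ₀ t) (ξ₁ t) z) ^ n
          * Sv n (λ i → pick (ξ₀ t') (ξ₁ t') (opp (x i))) (λ i → pick (ξ₀ t') (ξ₁ t') (opp (y i))) (pick (ξ₀ t') (ξ₁ t') (opp z)) t'
    s-inv n x y z = trans (sym (Sv-pick n x y z (ξ₀ t) (ξ₁ t) t))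
      (Sv-inv n _ (λ i → pick (ξ₀ t') (ξ₁ t') (opp (x i))) _ (λ i → pick (ξ₀ t') (ξ₁ t') (opp (y i))) _ (pick (ξ₀ t') (ξ₁ t') (opp z)) t t' tt' (λ i → inverse (x i)) (λ i → inverse (y i)) (inverse z))

    Q-inv : ∀ n → s n n (ξ₀ t) (ξ₁ t) t ≡ ((t * t) ^ n) ^ n * (ξ₀ t ^ n * ξ₁ t ^ n * ξ₁ t) ^ n * P n t'
    Q-inv n = trans (cong (λ a → s n a (ξ₀ t) (ξ₁ t) t) (sym (trans (cong₂ (λ u v → u ℕ.+ v ℕ.+ 0) (count-true n) (sumℕ-0 n)) (trans (ℕP.+-identityʳ (n ℕ.+ 0)) (ℕP.+-identityʳ n)))))
      (trans (s-inv n (λ _ → true) (λ _ → false) false)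
        (cong₂ (λ u w → ((t * t) ^ n) ^ n * (u * ξ₁ t) ^ n * w) (cong₂ _*_ (prodF-const n (ξ₀ t)) (prodF-const n (ξ₁ t)))
          (trans (Sv-pick n (λ _ → false) (λ _ → true) true (ξ₀ t') (ξ₁ t') t')
            (cong (λ a → s n a (ξ₀ t') (ξ₁ t') t') (trans (cong₂ (λ u v → u ℕ.+ v ℕ.+ 1) (sumℕ-0 n) (count-true n)) (ℕP.+-comm n 1))))))

    Z-inv : ∀ m → s (suc m) (suc (suc (suc m))) (ξ₀ t) (ξ₁ t) t
      ≡ ((t * t) ^ suc m) ^ suc m * (ξ₀ t ^ suc m * (ξ₀ t * ξ₁ t ^ m) * ξ₀ t) ^ suc m * s (suc m) m (ξ₀ t') (ξ₁ t') t'
    Z-inv m = trans (cong (λ a → s (suc m) a (ξ₀ t) (ξ₁ t) t) (sym (trans (cong₂ (λ u v → u ℕ.+ v ℕ.+ 1) (count-true (suc m)) (count-first {suc m} 1 (ℕ.s≤s ℕ.z≤n)))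
        (trans (cong (ℕ._+ 1) (ℕP.+-comm (suc m) 1)) (ℕP.+-comm (suc (suc m)) 1)))))
      (trans (s-inv (suc m) (λ _ → true) (first 1) true)
        (cong₂ (λ u w → ((t * t) ^ suc m) ^ suc m * (u * ξ₀ t) ^ suc m * w) (cong₂ _*_ (prodF-const (suc m) (ξ₀ t)) (cong (ξ₀ t *_) (prodF-const m (ξ₁ t))))
          (trans (Sv-pick (suc m) (λ _ → false) (λ i → opp (first 1 i)) false (ξ₀ t') (ξ₁ t') t')
            (cong (λ a → s (suc m) a (ξ₀ t') (ξ₁ t') t') (trans (cong₂ (λ u v → u ℕ.+ v ℕ.+ 0) (sumℕ-0 (suc m)) (count-true m)) (ℕP.+-identityʳ m))))))

  -- The trivial factors of Z

  -- Here n = m + 1, so the n - 1 copies of ξ₁ number m.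
  Z : ℕ → ℚ → ℚ
  Z m t = s (suc m) (suc (suc (suc m))) (ξ₀ t) (ξ₁ t) t

  -- Divisibility by c^N away from t = -2. The power of t + 2 clears the denominators of ξ₁ and is
  -- left open, because the exact exponent at -2 is determined separately.
  Factor : ℕ → (ℚ → ℚ) → ℕ → Set
  Factor m c N = Σ ℕ λ M → Σ (ℚ → ℚ) λ h → PolyFun h × (∀ t → t + two ≢ 0ℚ → Z m t * (t + two) ^ M ≡ c t ^ N * h t)

  factor-0 : ∀ m → Factor m (λ t → t) (m ℕ.* suc (suc m))
  factor-0 m = M , h , ph , λ t nz → trans (cong (_* (t + two) ^ M) (sym (value t nz))) (spec t (e t) (he t nz))
    where
    n = suc m
    b : Fin n → Bool
    b = first m
    module A = AtZero m b (count-first {n} m (ℕP.n≤1+n m))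
    e num : ℚ → V {n} → ℚ
    e t nothing       = t
    -- This coefficient solves t/2 + t² w = ξ₁.
    e t (just (xv i)) = if b i then (- half) ÷' (t + two) else ξ₀ t
    e t (just _)      = ξ₀ t
    num t nothing       = t * (t + two)
    num t (just (xv i)) = if b i then - half else ξ₀ t * (t + two)
    num t (just _)      = ξ₀ t * (t + two)
    pnum : ∀ v → PolyFun (λ t → num t v)
    pnum nothing = pf-* pf-id pf-t+2
    pnum (just (xv i)) with b i
    ... | true  = pf-con (- half)
    ... | false = pf-* pf-ξ₀ pf-t+2
    pnum (just (yv i)) = pf-* pf-ξ₀ pf-t+2
    pnum (just zv) = pf-* pf-ξ₀ pf-t+2
    pnum (just ζv) = pf-* pf-ξ₀ pf-t+2
    he : ∀ t → t + two ≢ 0ℚ → ∀ v → e t v * (t + two) ≡ num t v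
    he t nz nothing = refl
    he t nz (just (xv i)) with b i
    ... | true  = ÷'-* (- half) nz
    ... | false = refl
    he t nz (just (yv i)) = refl
    he t nz (just zv) = refl
    he t nz (just ζv) = refl
    path = ord-path A.order {num = λ v t → num t v} {d = λ t → t + two} pnum pf-t+2
    M = proj₁ path
    h = proj₁ (proj₂ path)
    ph = proj₁ (proj₂ (proj₂ path))
    spec = proj₂ (proj₂ (proj₂ path))
    opp : Bool → Bool
    opp true  = false
    opp false = true
    x-value : ∀ t → t + two ≢ 0ℚ → ∀ i → A.x i (e t) ≡ pick (ξ₀ t) (ξ₁ t) (opp (b i))
    x-value t nz i = go (b i) refl
      where
      val : Bool → ℚ
      val c = if c then (- half) ÷' (t + two) else ξ₀ t
      l₁ : ∀ t w → (t + two) * (half * t + t * (t * 1ℚ) * w) ≡ half * t * (t + two) + t * t * (w * (t + two))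
      l₁ = solve 2 (λ t w → (t :+ :2) :* (:½ :* t :+ t :* (t :* :1) :* w) := :½ :* t :* (t :+ :2) :+ t :* t :* (w :* (t :+ :2))) refl
      l₂ : ∀ t → half * t * (t + two) + t * t * - half ≡ t
      l₂ = solve 1 (λ t → :½ :* t :* (t :+ :2) :+ t :* t :* :- :½ := t) refl
      go : ∀ c → b i ≡ c → arg c A.A 2 (xv i) (e t) ≡ pick (ξ₀ t) (ξ₁ t) (opp c)
      go false eq = cong val eq
      go true  eq = trans (cong (λ c → half * t + t * (t * 1ℚ) * val c) eq)
        (*-cancelˡ-≢0 (t + two) nz (trans (l₁ t ((- half) ÷' (t + two))) (trans (cong (λ w → half * t * (t + two) + t * t * w) (÷'-* (- half) nz)) (trans (l₂ t) (trans (sym (ξ₁-spec t nz)) (ℚP.*-comm (ξ₁ t) (t + two)))))))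
    count-opp : ∀ m → count {suc m} (λ i → opp (first m i)) ≡ 1
    count-opp zero    = refl
    count-opp (suc m) = count-opp m
    value : ∀ t → t + two ≢ 0ℚ → Sv n (λ i → A.x i (e t)) (λ i → A.y i (e t)) (ξ₀ t) t ≡ Z m t
    value t nz = trans (Sv-cong n (ξ₀ t) t (x-value t nz) (λ i → refl)) (trans (Sv-pick n (λ i → opp (b i)) (λ _ → true) true (ξ₀ t) (ξ₁ t) t)
      (cong (λ a → s n a (ξ₀ t) (ξ₁ t) t) (trans (cong₂ (λ u v → u ℕ.+ v ℕ.+ 1) (count-opp m) (count-true n)) (ℕP.+-comm (suc (suc m)) 1))))

  factor-−1 : ∀ m → Factor m (λ t → 1ℚ + t) (suc m ℕ.* suc m)
  factor-−1 m = M , h , ph , λ t nz → trans (cong (_* (t + two) ^ M) (sym (value t nz))) (spec t (e t) (he t nz))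
    where
    n = suc m
    module A = AtMinusOne m
    bit-of : SVar n → Bool
    bit-of (yv i) = first 1 i
    bit-of _      = true
    val num₁ : ℚ → Bool → ℚ
    -- These coefficients w solve -1 + (1 + t) w = ξ₀ and -1 + (1 + t) w = ξ₁.
    val t b = pick two (two ÷' (t + two)) b
    num₁ t b = pick (two * (t + two)) two b
    e num : ℚ → V {n} → ℚ
    e t nothing  = 1ℚ + t
    e t (just v) = val t (bit-of v)
    num t nothing  = (1ℚ + t) * (t + two)
    num t (just v) = num₁ t (bit-of v)
    pnum : ∀ v → PolyFun (λ t → num t v)
    pnum nothing = pf-* (pf-+ (pf-con 1ℚ) pf-id) pf-t+2
    pnum (just v) with bit-of v
    ... | true  = pf-* (pf-con two) pf-t+2
    ... | false = pf-con two
    he : ∀ t → t + two ≢ 0ℚ → ∀ v → e t v * (t + two) ≡ num t v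
    he t nz nothing = refl
    he t nz (just v) with bit-of v
    ... | true  = refl
    ... | false = ÷'-* two nz
    path = ord-path A.order {num = λ v t → num t v} {d = λ t → t + two} pnum pf-t+2
    M = proj₁ path
    h = proj₁ (proj₂ path)
    ph = proj₁ (proj₂ (proj₂ path))
    spec = proj₂ (proj₂ (proj₂ path))
    point-value : ∀ t → t + two ≢ 0ℚ → ∀ b → - 1ℚ + (1ℚ + t) * val t b ≡ pick (ξ₀ t) (ξ₁ t) b
    point-value t nz true  = lem t
      where
      lem : ∀ t → - 1ℚ + (1ℚ + t) * two ≡ two * t + 1ℚ
      lem = solve 1 (λ t → :- :1 :+ (:1 :+ t) :* :2 := :2 :* t :+ :1) refl
    point-value t nz false = *-cancelˡ-≢0 (t + two) nz (trans (l₁ t (two ÷' (t + two))) (trans (cong (λ w → - (t + two) + (1ℚ + t) * w) (÷'-* two nz)) (trans (l₂ t) (trans (sym (ξ₁-spec t nz)) (ℚP.*-comm (ξ₁ t) (t + two))))))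
      where
      l₁ : ∀ t w → (t + two) * (- 1ℚ + (1ℚ + t) * w) ≡ - (t + two) + (1ℚ + t) * (w * (t + two))
      l₁ = solve 2 (λ t w → (t :+ :2) :* (:- :1 :+ (:1 :+ t) :* w) := :- (t :+ :2) :+ (:1 :+ t) :* (w :* (t :+ :2))) refl
      l₂ : ∀ t → - (t + two) + (1ℚ + t) * two ≡ t
      l₂ = solve 1 (λ t → :- (t :+ :2) :+ (:1 :+ t) :* :2 := t) refl
    t-value : ∀ t → - 1ℚ + (1ℚ + t) ≡ t
    t-value = solve 1 (λ t → :- :1 :+ (:1 :+ t) := t) refl
    value : ∀ t → t + two ≢ 0ℚ → Sv n (λ i → A.point (xv i) (e t)) (λ i → A.point (yv i) (e t)) (A.point zv (e t)) (A.zeta (e t)) ≡ Z m t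
    value t nz = trans (cong₂ (λ z r → Sv n (λ i → A.point (xv i) (e t)) (λ i → A.point (yv i) (e t)) z r) (point-value t nz true) (t-value t))
      (trans (Sv-cong n (ξ₀ t) t (λ i → point-value t nz true) (λ i → point-value t nz (first 1 i)))
      (trans (Sv-pick n (λ _ → true) (first 1) true (ξ₀ t) (ξ₁ t) t)
        (cong (λ a → s n a (ξ₀ t) (ξ₁ t) t) (trans (cong₂ (λ u v → u ℕ.+ v ℕ.+ 1) (count-true n) (count-first {n} 1 (ℕ.s≤s ℕ.z≤n)))
          (trans (cong (ℕ._+ 1) (ℕP.+-comm n 1)) (ℕP.+-comm (suc n) 1))))))

  module Half (n h : ℕ) (h≤n : h ℕ.≤ n) (bz : Bool) where
    private
      module A = AtMinusHalf n (first h) (first h) bz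
    bit-of : SVar n → Bool
    bit-of (xv i) = first h i
    bit-of (yv i) = first h i
    bit-of _      = bz
    order = A.order h (count-first h h≤n) (count-first h h≤n)
    e : ℚ → V {n} → ℚ
    e t nothing  = 1ℚ + two * t
    -- ξ₀ = 1 + 2t is the local parameter itself, so its scaled coordinate is 1.
    e t (just v) = pick 1ℚ (ξ₁ t) (bit-of v)
    arg-value : ∀ t b v → bit-of v ≡ b → arg b A.A 1 v (e t) ≡ pick (ξ₀ t) (ξ₁ t) b
    arg-value t true  v eq = trans (cong (λ w → 0ℚ + (1ℚ + two * t) * 1ℚ * pick 1ℚ (ξ₁ t) w) eq) (lem t)
      where
      lem : ∀ t → 0ℚ + (1ℚ + two * t) * 1ℚ * 1ℚ ≡ two * t + 1ℚ
      lem = solve 1 (λ t → :0 :+ (:1 :+ :2 :* t) :* :1 :* :1 := :2 :* t :+ :1) refl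
    arg-value t false v eq = cong (pick 1ℚ (ξ₁ t)) eq
    t-value : ∀ t → half * ((1ℚ + two * t) - 1ℚ) ≡ t
    t-value = solve 1 (λ t → :½ :* ((:1 :+ :2 :* t) :- :1) := t) refl
    value : ∀ t → Sv n (λ i → A.x i (e t)) (λ i → A.y i (e t)) (A.z (e t)) (A.zeta (e t)) ≡ s n (h ℕ.+ h ℕ.+ bit bz) (ξ₀ t) (ξ₁ t) t
    value t = trans (cong₂ (λ z r → Sv n (λ i → A.x i (e t)) (λ i → A.y i (e t)) z r) (arg-value t bz zv refl) (t-value t))
      (trans (Sv-cong n (pick (ξ₀ t) (ξ₁ t) bz) t (λ i → arg-value t (first h i) (xv i) refl) (λ i → arg-value t (first h i) (yv i) refl))
      (trans (Sv-pick n (first h) (first h) bz (ξ₀ t) (ξ₁ t) t)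
        (cong (λ a → s n a (ξ₀ t) (ξ₁ t) t) (cong₂ (λ u v → u ℕ.+ v ℕ.+ bit bz) (count-first {n} h h≤n) (count-first {n} h h≤n)))))

  halfOrder : ℕ → Bool → ℕ
  halfOrder h bz = h ℕ.* (ℕ.pred h ℕ.+ bit bz)

  factor-−½ : ∀ m h bz → h ℕ.≤ suc m → h ℕ.+ h ℕ.+ bit bz ≡ suc (suc (suc m)) → Factor m (λ t → 1ℚ + two * t) (halfOrder h bz)
  factor-−½ m h bz h≤n cnt = M , g , pg , λ t nz → trans (cong (_* (t + two) ^ M) (trans (cong (λ a → s (suc m) a (ξ₀ t) (ξ₁ t) t) (sym cnt)) (sym (value t)))) (spec t (e t) (he t nz))
    where
    open Half (suc m) h h≤n bz
    num : ℚ → V {suc m} → ℚ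
    num t nothing  = (1ℚ + two * t) * (t + two)
    num t (just v) = pick (t + two) t (bit-of v)
    pnum : ∀ v → PolyFun (λ t → num t v)
    pnum nothing = pf-* (pf-+ (pf-con 1ℚ) (pf-* (pf-con two) pf-id)) pf-t+2
    pnum (just v) with bit-of v
    ... | true  = pf-t+2
    ... | false = pf-id
    he : ∀ t → t + two ≢ 0ℚ → ∀ v → e t v * (t + two) ≡ num t v
    he t nz nothing = refl
    he t nz (just v) with bit-of v
    ... | true  = ℚP.*-identityˡ (t + two)
    ... | false = ξ₁-spec t nz
    path = ord-path order {num = λ v t → num t v} {d = λ t → t + two} pnum pf-t+2
    M = proj₁ path
    g = proj₁ (proj₂ path)
    pg = proj₁ (proj₂ (proj₂ path))
    spec = proj₂ (proj₂ (proj₂ path))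

  -- The factor t + 2, through the behaviour at −1/2 after inversion
  factor-−2 : ∀ m h bz → h ℕ.≤ suc m → h ℕ.+ h ℕ.+ bit bz ≡ m →
    Σ (ℚ → ℚ) λ D → Σ (ℚ → ℚ) λ g → PolyFun D × PolyFun g × D (- two) ≢ 0ℚ
      × (∀ t → t ≢ 0ℚ → 1ℚ + two * t ≢ 0ℚ → t + two ≢ 0ℚ → D t * (Z m t * (t + two) ^ (m ℕ.* suc m)) ≡ (t + two) ^ halfOrder h bz * g t)
  factor-−2 m h bz h≤n cnt = D , g' , pf-* (pf-^ pd M) (pf-^ pf-id E) , pg' , D≢0 , identity
    where
    open Half (suc m) h h≤n bz
    n = suc m
    E = halfOrder h bz
    d : ℚ → ℚ
    d t = t * (1ℚ + two * t)
    p1 : PolyFun (λ t → 1ℚ + two * t)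
    p1 = pf-+ (pf-con 1ℚ) (pf-* (pf-con two) pf-id)
    pd : PolyFun d
    pd = pf-* pf-id p1
    num : ℚ → V {n} → ℚ
    num t nothing  = (t + two) * (1ℚ + two * t)
    num t (just v) = pick (d t) t (bit-of v)
    pnum : ∀ v → PolyFun (λ t → num t v)
    pnum nothing = pf-* pf-t+2 p1
    pnum (just v) with bit-of v
    ... | true  = pd
    ... | false = pf-id
    path = ord-path order {num = λ v t → num t v} {d = d} pnum pd
    M = proj₁ path
    g = proj₁ (proj₂ path)
    pg = proj₁ (proj₂ (proj₂ path))
    spec = proj₂ (proj₂ (proj₂ path))
    D g' : ℚ → ℚ
    -- The factor t^E turns (1 + 2/t)^E, the local power at -1/2 in the variable 1/t, into (t +
    -- 2)^E.
    D t = d t ^ M * t ^ E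
    g' t = ((t * t) ^ n) ^ n * (ξ₀ t ^ n * ξ₀ t * ξ₀ t) ^ n * t ^ (m ℕ.* n) * g t
    pg' : PolyFun g'
    pg' = pf-* (pf-* (pf-* (pf-^ (pf-^ (pf-* pf-id pf-id) n) n) (pf-^ (pf-* (pf-* (pf-^ pf-ξ₀ n) pf-ξ₀) pf-ξ₀) n)) (pf-^ pf-id (m ℕ.* n))) pg
    m2 : - two ≢ 0ℚ
    m2 ()
    d2 : d (- two) ≢ 0ℚ
    d2 ()
    D≢0 : D (- two) ≢ 0ℚ
    D≢0 = *-≢0 (^-≢0 M d2) (^-≢0 E m2)
    module _ (t : ℚ) (t≢0 : t ≢ 0ℚ) (nz₁ : 1ℚ + two * t ≢ 0ℚ) (nz₂ : t + two ≢ 0ℚ) where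
      t' = proj₁ (inv t t≢0)
      tt' = proj₂ (inv t t≢0)
      t'+2 : t' + two ≢ 0ℚ
      t'+2 z = nz₁ (trans (trans (cong (_+ two * t) (sym tt')) (l t t')) (trans (cong (t *_) z) (ℚP.*-zeroʳ t)))
        where
        l : ∀ t t' → t * t' + two * t ≡ t * (t' + two)
        l = solve 2 (λ t t' → t :* t' :+ :2 :* t := t :* (t' :+ :2)) refl
      he : ∀ v → e t' v * d t ≡ num t v
      he nothing = trans (l₁ t t') (trans (cong (λ w → (t + two * w) * (1ℚ + two * t)) tt') (l₂ t))
        where
        l₁ : ∀ t t' → (1ℚ + two * t') * (t * (1ℚ + two * t)) ≡ (t + two * (t * t')) * (1ℚ + two * t)
        l₁ = solve 2 (λ t t' → (:1 :+ :2 :* t') :* (t :* (:1 :+ :2 :* t)) := (t :+ :2 :* (t :* t')) :* (:1 :+ :2 :* t)) refl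
        l₂ : ∀ t → (t + two * 1ℚ) * (1ℚ + two * t) ≡ (t + two) * (1ℚ + two * t)
        l₂ = solve 1 (λ t → (t :+ :2 :* :1) :* (:1 :+ :2 :* t) := (t :+ :2) :* (:1 :+ :2 :* t)) refl
      he (just v) with bit-of v
      ... | true  = ℚP.*-identityˡ (d t)
      ... | false = trans (l (ξ₁ t') t) (trans (cong (t *_) (ξ₀-inv t t' tt' t'+2)) (ℚP.*-identityʳ t))
        where
        l : ∀ x t → x * (t * (1ℚ + two * t)) ≡ t * ((two * t + 1ℚ) * x)
        l = solve 2 (λ x t → x :* (t :* (:1 :+ :2 :* t)) := t :* ((:2 :* t :+ :1) :* x)) refl
      Z' : ℚ
      Z' = s n m (ξ₀ t') (ξ₁ t') t'
      local : Z' * d t ^ M ≡ (1ℚ + two * t') ^ E * g t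
      local = trans (cong (_* d t ^ M) (trans (cong (λ a → s n a (ξ₀ t') (ξ₁ t') t') (sym cnt)) (sym (value t')))) (spec t (e t') he)
      rescale : t ^ E * (1ℚ + two * t') ^ E ≡ (t + two) ^ E
      rescale = trans (sym (*-^ t (1ℚ + two * t') E)) (cong (_^ E) (trans (l t t') (trans (cong (λ w → t + two * w) tt') (cong (t +_) (ℚP.*-identityʳ two)))))
        where
        l : ∀ t t' → t * (1ℚ + two * t') ≡ t + two * (t * t')
        l = solve 2 (λ t t' → t :* (:1 :+ :2 :* t') := t :+ :2 :* (t :* t')) refl
      identity : D t * (Z m t * (t + two) ^ (m ℕ.* n)) ≡ (t + two) ^ E * g' t
      identity = begin
        d t ^ M * t ^ E * (Z m t * (t + two) ^ (m ℕ.* n))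
          ≡⟨ cong (λ w → d t ^ M * t ^ E * (w * (t + two) ^ (m ℕ.* n))) (Z-inv t t' tt' nz₂ t'+2 m) ⟩
        d t ^ M * t ^ E * (a * (ξ₀ t ^ n * (ξ₀ t * ξ₁ t ^ m) * ξ₀ t) ^ n * Z' * (t + two) ^ (m ℕ.* n))
          ≡⟨ cong (λ w → d t ^ M * t ^ E * (a * w * Z' * (t + two) ^ (m ℕ.* n))) (trans (cong (_^ n) (l₁ (ξ₀ t ^ n) (ξ₀ t) (ξ₁ t ^ m))) (trans (*-^ (ξ₀ t ^ n * ξ₀ t * ξ₀ t) (ξ₁ t ^ m) n) (cong ((ξ₀ t ^ n * ξ₀ t * ξ₀ t) ^ n *_) (^-* (ξ₁ t) m n)))) ⟩
        d t ^ M * t ^ E * (a * (b * ξ₁ t ^ (m ℕ.* n)) * Z' * (t + two) ^ (m ℕ.* n))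
          ≡⟨ l₂ (d t ^ M) (t ^ E) a b (ξ₁ t ^ (m ℕ.* n)) Z' ((t + two) ^ (m ℕ.* n)) ⟩
        a * b * (ξ₁ t ^ (m ℕ.* n) * (t + two) ^ (m ℕ.* n)) * (t ^ E * (Z' * d t ^ M))
          ≡⟨ cong₂ (λ u w → a * b * u * (t ^ E * w)) (trans (sym (*-^ (ξ₁ t) (t + two) (m ℕ.* n))) (cong (_^ (m ℕ.* n)) (ξ₁-spec t nz₂))) local ⟩
        a * b * t ^ (m ℕ.* n) * (t ^ E * ((1ℚ + two * t') ^ E * g t))
          ≡⟨ l₃ (a * b * t ^ (m ℕ.* n)) (t ^ E) ((1ℚ + two * t') ^ E) (g t) ⟩
        t ^ E * (1ℚ + two * t') ^ E * (a * b * t ^ (m ℕ.* n) * g t)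
          ≡⟨ cong (_* g' t) rescale ⟩
        (t + two) ^ E * g' t ∎
        where
        open ≡-Reasoning
        a = ((t * t) ^ n) ^ n
        b = (ξ₀ t ^ n * ξ₀ t * ξ₀ t) ^ n
        l₁ : ∀ p q r → p * (q * r) * q ≡ p * q * q * r
        l₁ = solve 3 (λ p q r → p :* (q :* r) :* q := p :* q :* q :* r) refl
        l₂ : ∀ d e a b x z w → d * e * (a * (b * x) * z * w) ≡ a * b * (x * w) * (e * (z * d))
        l₂ = solve 7 (λ d e a b x z w → d :* e :* (a :* (b :* x) :* z :* w) := a :* b :* (x :* w) :* (e :* (z :* d))) refl
        l₃ : ∀ a b c d → a * (b * (c * d)) ≡ b * c * (a * d)
        l₃ = solve 4 (λ a b c d → a :* (b :* (c :* d)) := b :* c :* (a :* d)) refl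

  p1+t : PolyFun (λ t → 1ℚ + t)
  p1+t = pf-+ (pf-con 1ℚ) pf-id

  p1+2t : PolyFun (λ t → 1ℚ + two * t)
  p1+2t = pf-+ (pf-con 1ℚ) (pf-* (pf-con two) pf-id)

  -- At -2 the function Z itself has a pole through ξ₁, so the unknown power M of t + 2 has to be
  -- divided out of the numerator together with the known zero of order e. This is possible because
  -- D and `front` are nonzero at -2.
  divide-at-−2 : ∀ {Z N D g front : ℚ → ℚ} {M k e} → PolyFun N → PolyFun D → PolyFun g → PolyFun front → D (- two) ≢ 0ℚ → front (- two) ≢ 0ℚ →
    (∀ t → t + two ≢ 0ℚ → Z t * (t + two) ^ M ≡ front t * N t) →
    (∀ t → t ≢ 0ℚ → 1ℚ + two * t ≢ 0ℚ → t + two ≢ 0ℚ → D t * (Z t * (t + two) ^ k) ≡ (t + two) ^ e * g t) →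
    Σ (ℚ → ℚ) λ Y → PolyFun Y × (∀ t → t + two ≢ 0ℚ → Z t * (t + two) ^ k ≡ front t * (t + two) ^ e * Y t)
  divide-at-−2 {Z} {N} {D} {g} {front} {M} {k} {e} pN pD pg p-front D≢0 front≢0 Z≡ f₃ = Y , pY , final
    where
    open ≡-Reasoning
    w : ℚ → ℚ
    w t = t + two
    D₃ S₃ : ℚ → ℚ
    D₃ t = D t * front t
    S₃ t = N t * w t ^ k
    pD₃ : PolyFun D₃
    pD₃ = pf-* pD p-front
    pS₃ : PolyFun S₃
    pS₃ = pf-* pN (pf-^ pf-t+2 k)
    id₃ : ∀ t → D₃ t * S₃ t ≡ (t - (- two)) ^ (M ℕ.+ e) * g t
    id₃ = pf-dense-≡ (pf-* pD₃ pS₃) (pf-* (pf-^ (pf-sub pf-id (pf-con (- two))) (M ℕ.+ e)) pg) (pf-* (pf-* pf-id p1+2t) pf-t+2) 1ℚ one λ t nz →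
      let t≢0 = *-≢0ˡ {t} {1ℚ + two * t} (*-≢0ˡ {t * (1ℚ + two * t)} {w t} nz)
          u≢0 = *-≢0ʳ {t} {1ℚ + two * t} (*-≢0ˡ {t * (1ℚ + two * t)} {w t} nz)
          w≢0 = *-≢0ʳ {t * (1ℚ + two * t)} {w t} nz
      in begin
      D t * front t * (N t * w t ^ k)                     ≡⟨ l₁ (D t) (front t) (N t) (w t ^ k) ⟩
      D t * (front t * N t * w t ^ k)                     ≡⟨ cong (λ v → D t * (v * w t ^ k)) (sym (Z≡ t w≢0)) ⟩
      D t * (Z t * w t ^ M * w t ^ k)                   ≡⟨ l₂ (D t) (Z t) (w t ^ M) (w t ^ k) ⟩
      w t ^ M * (D t * (Z t * w t ^ k))                 ≡⟨ cong (w t ^ M *_) (f₃ t t≢0 u≢0 w≢0) ⟩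
      w t ^ M * (w t ^ e * g t)                           ≡⟨ sym (ℚP.*-assoc (w t ^ M) (w t ^ e) (g t)) ⟩
      w t ^ M * w t ^ e * g t                             ≡⟨ cong (_* g t) (sym (^-+ (w t) M e)) ⟩
      w t ^ (M ℕ.+ e) * g t                               ≡⟨ cong (λ v → v ^ (M ℕ.+ e) * g t) (l₃ t) ⟩
      (t - (- two)) ^ (M ℕ.+ e) * g t                     ∎
      where
      one : 1ℚ * (1ℚ + two * 1ℚ) * w 1ℚ ≢ 0ℚ
      one ()
      l₁ : ∀ a b c d → a * b * (c * d) ≡ a * (b * c * d)
      l₁ = solve 4 (λ a b c d → a :* b :* (c :* d) := a :* (b :* c :* d)) refl
      l₂ : ∀ a b c d → a * (b * c * d) ≡ c * (a * (b * d))
      l₂ = solve 4 (λ a b c d → a :* (b :* c :* d) := c :* (a :* (b :* d))) refl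
      l₃ : ∀ t → t + two ≡ t - (- two)
      l₃ = solve 1 (λ t → t :+ :2 := t :- (:- :2)) refl
    q₃ = pf-divide (- two) (M ℕ.+ e) pD₃ pS₃ pg id₃ (*-≢0 D≢0 front≢0)
    Y = proj₁ q₃
    pY = proj₁ (proj₂ q₃)
    S₃≡ : ∀ t → S₃ t ≡ w t ^ (M ℕ.+ e) * Y t
    S₃≡ t = trans (proj₁ (proj₂ (proj₂ q₃)) t) (cong (λ v → v ^ (M ℕ.+ e) * Y t) (l t))
      where
      l : ∀ t → t - (- two) ≡ t + two
      l = solve 1 (λ t → t :- (:- :2) := t :+ :2) refl
    final : ∀ t → t + two ≢ 0ℚ → Z t * w t ^ k ≡ front t * w t ^ e * Y t
    final t nz = *-cancelˡ-≢0 (w t ^ M) (^-≢0 M nz) (begin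
      w t ^ M * (Z t * w t ^ k)                  ≡⟨ l₁ (w t ^ M) (Z t) (w t ^ k) ⟩
      Z t * w t ^ M * w t ^ k                    ≡⟨ cong (_* w t ^ k) (Z≡ t nz) ⟩
      front t * N t * w t ^ k                      ≡⟨ ℚP.*-assoc (front t) (N t) (w t ^ k) ⟩
      front t * S₃ t                                 ≡⟨ cong (front t *_) (S₃≡ t) ⟩
      front t * (w t ^ (M ℕ.+ e) * Y t)            ≡⟨ cong (λ v → front t * (v * Y t)) (^-+ (w t) M e) ⟩
      front t * (w t ^ M * w t ^ e * Y t)          ≡⟨ l₂ (front t) (w t ^ M) (w t ^ e) (Y t) ⟩
      w t ^ M * (front t * w t ^ e * Y t)          ∎)
      where
      l₁ : ∀ a b c → a * (b * c) ≡ b * a * c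
      l₁ = solve 3 (λ a b c → a :* (b :* c) := b :* a :* c) refl
      l₂ : ∀ a b c d → a * (b * c * d) ≡ b * (a * c * d)
      l₂ = solve 4 (λ a b c d → a :* (b :* c :* d) := b :* (a :* c :* d)) refl

  -- The roots 0, -1, -1/2, -2 are distinct, so each prime power can be divided out of what the
  -- previous ones left: the other factors are nonzero at the root in question.
  combine : ∀ m {e₂ e₃} → Factor m (λ t → 1ℚ + two * t) e₂ →
    (Σ (ℚ → ℚ) λ D → Σ (ℚ → ℚ) λ g → PolyFun D × PolyFun g × D (- two) ≢ 0ℚ
      × (∀ t → t ≢ 0ℚ → 1ℚ + two * t ≢ 0ℚ → t + two ≢ 0ℚ → D t * (Z m t * (t + two) ^ (m ℕ.* suc m)) ≡ (t + two) ^ e₃ * g t)) →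
    Σ (ℚ → ℚ) λ Y → PolyFun Y × (∀ t → t + two ≢ 0ℚ →
      Z m t * (t + two) ^ (m ℕ.* suc m) ≡ t ^ (m ℕ.* suc (suc m)) * (1ℚ + t) ^ (suc m ℕ.* suc m) * (1ℚ + two * t) ^ e₂ * (t + two) ^ e₃ * Y t)
  combine m {e₂} {e₃} (M₂ , h₂ , ph₂ , f₂) (D , g , pD , pg , D≢0 , f₃) = divide-at-−2 {Z m} {M = M₀} {m ℕ.* suc m} {e₃} pN₂ pD pg p-front D≢0 front≢0 Z≡ f₃
    where
    open ≡-Reasoning
    e₀ = m ℕ.* suc (suc m)
    e₁ = suc m ℕ.* suc m
    F₀ = factor-0 m
    M₀ = proj₁ F₀
    N₀ = proj₁ (proj₂ F₀)
    pN₀ = proj₁ (proj₂ (proj₂ F₀))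
    f₀ = proj₂ (proj₂ (proj₂ F₀))
    F₁ = factor-−1 m
    M₁ = proj₁ F₁
    h₁ = proj₁ (proj₂ F₁)
    ph₁ = proj₁ (proj₂ (proj₂ F₁))
    f₁ = proj₂ (proj₂ (proj₂ F₁))
    w : ℚ → ℚ
    w t = t + two
    w^ : ∀ k → PolyFun (λ t → w t ^ k)
    w^ k = pf-^ pf-t+2 k
    w0 : w 0ℚ ≢ 0ℚ
    w0 ()
    D₁ R₁ : ℚ → ℚ
    D₁ t = w t ^ M₁ * t ^ e₀
    R₁ t = w t ^ M₀ * h₁ t
    pD₁ : PolyFun D₁
    pD₁ = pf-* (w^ M₁) (pf-^ pf-id e₀)
    id₁ : ∀ t → D₁ t * N₀ t ≡ (t - (- 1ℚ)) ^ e₁ * R₁ t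
    id₁ = pf-dense-≡ (pf-* pD₁ pN₀) (pf-* (pf-^ (pf-sub pf-id (pf-con (- 1ℚ))) e₁) (pf-* (w^ M₀) ph₁)) pf-t+2 0ℚ w0 λ t nz → begin
      w t ^ M₁ * t ^ e₀ * N₀ t               ≡⟨ ℚP.*-assoc (w t ^ M₁) (t ^ e₀) (N₀ t) ⟩
      w t ^ M₁ * (t ^ e₀ * N₀ t)             ≡⟨ cong (w t ^ M₁ *_) (sym (f₀ t nz)) ⟩
      w t ^ M₁ * (Z m t * w t ^ M₀)          ≡⟨ l₁ (w t ^ M₁) (Z m t) (w t ^ M₀) ⟩
      w t ^ M₀ * (Z m t * w t ^ M₁)          ≡⟨ cong (w t ^ M₀ *_) (f₁ t nz) ⟩
      w t ^ M₀ * ((1ℚ + t) ^ e₁ * h₁ t)      ≡⟨ l₂ (w t ^ M₀) ((1ℚ + t) ^ e₁) (h₁ t) ⟩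
      (1ℚ + t) ^ e₁ * R₁ t                   ≡⟨ cong (λ v → v ^ e₁ * R₁ t) (l₃ t) ⟩
      (t - (- 1ℚ)) ^ e₁ * R₁ t               ∎
      where
      l₁ : ∀ a b c → a * (b * c) ≡ c * (b * a)
      l₁ = solve 3 (λ a b c → a :* (b :* c) := c :* (b :* a)) refl
      l₂ : ∀ a b c → a * (b * c) ≡ b * (a * c)
      l₂ = solve 3 (λ a b c → a :* (b :* c) := b :* (a :* c)) refl
      l₃ : ∀ t → 1ℚ + t ≡ t - (- 1ℚ)
      l₃ = solve 1 (λ t → :1 :+ t := t :- (:- :1)) refl
    D₁≢0 : D₁ (- 1ℚ) ≢ 0ℚ
    D₁≢0 = *-≢0 (^-≢0 M₁ w1) (^-≢0 e₀ m1)
      where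
      w1 : w (- 1ℚ) ≢ 0ℚ
      w1 ()
      m1 : - 1ℚ ≢ 0ℚ
      m1 ()
    q₁ = pf-divide (- 1ℚ) e₁ pD₁ pN₀ (pf-* (w^ M₀) ph₁) id₁ D₁≢0
    N₁ = proj₁ q₁
    pN₁ = proj₁ (proj₂ q₁)
    N₀≡ : ∀ t → N₀ t ≡ (1ℚ + t) ^ e₁ * N₁ t
    N₀≡ t = trans (proj₁ (proj₂ (proj₂ q₁)) t) (cong (λ v → v ^ e₁ * N₁ t) (l t))
      where
      l : ∀ t → t - (- 1ℚ) ≡ 1ℚ + t
      l = solve 1 (λ t → t :- (:- :1) := :1 :+ t) refl
    D₂ R₂ : ℚ → ℚ
    D₂ t = w t ^ M₂ * t ^ e₀ * (1ℚ + t) ^ e₁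
    -- The power of two converts 1 + 2t into the monic t + 1/2 on which the division operates; `N₂`
    -- undoes it.
    R₂ t = w t ^ M₀ * (two ^ e₂ * h₂ t)
    pD₂ : PolyFun D₂
    pD₂ = pf-* (pf-* (w^ M₂) (pf-^ pf-id e₀)) (pf-^ p1+t e₁)
    pR₂ : PolyFun R₂
    pR₂ = pf-* (w^ M₀) (pf-* (pf-con (two ^ e₂)) ph₂)
    1+2t≡ : ∀ t → 1ℚ + two * t ≡ (t - (- half)) * two
    1+2t≡ = solve 1 (λ t → :1 :+ :2 :* t := (t :- (:- :½)) :* :2) refl
    id₂ : ∀ t → D₂ t * N₁ t ≡ (t - (- half)) ^ e₂ * R₂ t
    id₂ = pf-dense-≡ (pf-* pD₂ pN₁) (pf-* (pf-^ (pf-sub pf-id (pf-con (- half))) e₂) pR₂) pf-t+2 0ℚ w0 λ t nz → begin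
      w t ^ M₂ * t ^ e₀ * (1ℚ + t) ^ e₁ * N₁ t            ≡⟨ l₁ (w t ^ M₂) (t ^ e₀) ((1ℚ + t) ^ e₁) (N₁ t) ⟩
      w t ^ M₂ * (t ^ e₀ * ((1ℚ + t) ^ e₁ * N₁ t))        ≡⟨ cong (λ v → w t ^ M₂ * (t ^ e₀ * v)) (sym (N₀≡ t)) ⟩
      w t ^ M₂ * (t ^ e₀ * N₀ t)                          ≡⟨ cong (w t ^ M₂ *_) (sym (f₀ t nz)) ⟩
      w t ^ M₂ * (Z m t * w t ^ M₀)                       ≡⟨ l₂ (w t ^ M₂) (Z m t) (w t ^ M₀) ⟩
      w t ^ M₀ * (Z m t * w t ^ M₂)                       ≡⟨ cong (w t ^ M₀ *_) (f₂ t nz) ⟩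
      w t ^ M₀ * ((1ℚ + two * t) ^ e₂ * h₂ t)             ≡⟨ cong (λ v → w t ^ M₀ * (v * h₂ t)) (trans (cong (_^ e₂) (1+2t≡ t)) (*-^ (t - (- half)) two e₂)) ⟩
      w t ^ M₀ * ((t - (- half)) ^ e₂ * two ^ e₂ * h₂ t)  ≡⟨ l₃ (w t ^ M₀) ((t - (- half)) ^ e₂) (two ^ e₂) (h₂ t) ⟩
      (t - (- half)) ^ e₂ * R₂ t                          ∎
      where
      l₁ : ∀ a b c d → a * b * c * d ≡ a * (b * (c * d))
      l₁ = solve 4 (λ a b c d → a :* b :* c :* d := a :* (b :* (c :* d))) refl
      l₂ : ∀ a b c → a * (b * c) ≡ c * (b * a)
      l₂ = solve 3 (λ a b c → a :* (b :* c) := c :* (b :* a)) refl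
      l₃ : ∀ a b c d → a * (b * c * d) ≡ b * (a * (c * d))
      l₃ = solve 4 (λ a b c d → a :* (b :* c :* d) := b :* (a :* (c :* d))) refl
    D₂≢0 : D₂ (- half) ≢ 0ℚ
    D₂≢0 = *-≢0 (*-≢0 (^-≢0 M₂ wh) (^-≢0 e₀ mh)) (^-≢0 e₁ vh)
      where
      wh : w (- half) ≢ 0ℚ
      wh ()
      mh : - half ≢ 0ℚ
      mh ()
      vh : 1ℚ + - half ≢ 0ℚ
      vh ()
    q₂ = pf-divide (- half) e₂ pD₂ pN₁ pR₂ id₂ D₂≢0
    N₂ : ℚ → ℚ
    N₂ t = half ^ e₂ * proj₁ q₂ t
    pN₂ : PolyFun N₂
    pN₂ = pf-* (pf-con (half ^ e₂)) (proj₁ (proj₂ q₂))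
    N₁≡ : ∀ t → N₁ t ≡ (1ℚ + two * t) ^ e₂ * N₂ t
    N₁≡ t = trans (proj₁ (proj₂ (proj₂ q₂)) t) (trans (cong (λ v → v ^ e₂ * proj₁ q₂ t) (l t)) (trans (cong (_* proj₁ q₂ t) (*-^ (1ℚ + two * t) half e₂)) (ℚP.*-assoc ((1ℚ + two * t) ^ e₂) (half ^ e₂) (proj₁ q₂ t))))
      where
      l : ∀ t → t - (- half) ≡ (1ℚ + two * t) * half
      l = solve 1 (λ t → t :- (:- :½) := (:1 :+ :2 :* t) :* :½) refl
    front : ℚ → ℚ
    front t = t ^ e₀ * (1ℚ + t) ^ e₁ * (1ℚ + two * t) ^ e₂
    p-front : PolyFun front
    p-front = pf-* (pf-* (pf-^ pf-id e₀) (pf-^ p1+t e₁)) (pf-^ p1+2t e₂)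
    Z≡ : ∀ t → t + two ≢ 0ℚ → Z m t * w t ^ M₀ ≡ front t * N₂ t
    Z≡ t nz = trans (f₀ t nz) (trans (cong (t ^ e₀ *_) (trans (N₀≡ t) (cong ((1ℚ + t) ^ e₁ *_) (N₁≡ t)))) (l (t ^ e₀) ((1ℚ + t) ^ e₁) ((1ℚ + two * t) ^ e₂) (N₂ t)))
      where
      l : ∀ a b c d → a * (b * (c * d)) ≡ a * b * c * d
      l = solve 4 (λ a b c d → a :* (b :* (c :* d)) := a :* b :* c :* d) refl
    front≢0 : front (- two) ≢ 0ℚ
    front≢0 = *-≢0 (*-≢0 (^-≢0 e₀ a₀) (^-≢0 e₁ a₁)) (^-≢0 e₂ a₂)
      where
      a₀ : - two ≢ 0ℚ
      a₀ ()
      a₁ : 1ℚ + - two ≢ 0ℚ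
      a₁ ()
      a₂ : 1ℚ + two * - two ≢ 0ℚ
      a₂ ()

  YFactor : ℕ → Set
  YFactor m = Σ (ℚ → ℚ) λ Y → PolyFun Y × (∀ t → t + two ≢ 0ℚ →
    Z m t * (t + two) ^ (m ℕ.* suc m) ≡ t ^ (m ℕ.* suc (suc m)) * (1ℚ + t) ^ (suc m ℕ.* suc m) * (1ℚ + two * t) ^ δ (suc (suc m)) * (t + two) ^ δ (m ℕ.∸ 1) * Y t)

  -- The special arguments are shared equally between the x and the y, and z takes the odd one.
  -- There are m + 3 copies of ξ₀ at -1/2 and, after inversion, m of them at -2; the orders h(h - 1
  -- + `bit bz`) for these counts are δ at m + 2 and at m - 1.
  yfactor : ∀ m → YFactor m
  yfactor m with parity m
  ... | inj₁ (k , refl) = combine (k ℕ.+ k) {δ (suc (suc (k ℕ.+ k)))} {δ (k ℕ.+ k ℕ.∸ 1)}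
      (subst (Factor (k ℕ.+ k) (λ t → 1ℚ + two * t)) (trans (l₁ k) (sym (δ-even₂ k))) (factor-−½ (k ℕ.+ k) (suc k) true (ℕ.s≤s (ℕP.m≤m+n k k)) (l₂ k)))
      (subst (λ e → Σ (ℚ → ℚ) λ D → Σ (ℚ → ℚ) λ g → PolyFun D × PolyFun g × D (- two) ≢ 0ℚ
        × (∀ t → t ≢ 0ℚ → 1ℚ + two * t ≢ 0ℚ → t + two ≢ 0ℚ → D t * (Z (k ℕ.+ k) t * (t + two) ^ ((k ℕ.+ k) ℕ.* suc (k ℕ.+ k))) ≡ (t + two) ^ e * g t))
        (l₃ k) (factor-−2 (k ℕ.+ k) k false (ℕP.m≤n⇒m≤1+n (ℕP.m≤m+n k k)) (ℕP.+-identityʳ (k ℕ.+ k))))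
    where
    l₁ : ∀ k → suc k ℕ.* (k ℕ.+ 1) ≡ suc k ℕ.* suc k
    l₁ = ℕR.solve-∀
    l₂ : ∀ k → suc k ℕ.+ suc k ℕ.+ 1 ≡ suc (suc (suc (k ℕ.+ k)))
    l₂ = ℕR.solve-∀
    l₃ : ∀ k → halfOrder k false ≡ δ (k ℕ.+ k ℕ.∸ 1)
    l₃ zero    = refl
    l₃ (suc j) = trans (e j) (sym (trans (cong δ (ℕP.+-suc j j)) (δ-odd j)))
      where
      e : ∀ j → suc j ℕ.* (j ℕ.+ 0) ≡ j ℕ.* suc j
      e = ℕR.solve-∀
  ... | inj₂ (k , refl) = combine (suc (k ℕ.+ k)) {δ (suc (suc (suc (k ℕ.+ k))))} {δ (k ℕ.+ k)}
      (subst (Factor (suc (k ℕ.+ k)) (λ t → 1ℚ + two * t)) (trans (l₁ k) (sym (δ-odd₂ k))) (factor-−½ (suc (k ℕ.+ k)) (suc (suc k)) false (ℕ.s≤s (ℕ.s≤s (ℕP.m≤m+n k k))) (l₂ k)))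
      (subst (λ e → Σ (ℚ → ℚ) λ D → Σ (ℚ → ℚ) λ g → PolyFun D × PolyFun g × D (- two) ≢ 0ℚ
        × (∀ t → t ≢ 0ℚ → 1ℚ + two * t ≢ 0ℚ → t + two ≢ 0ℚ → D t * (Z (suc (k ℕ.+ k)) t * (t + two) ^ (suc (k ℕ.+ k) ℕ.* suc (suc (k ℕ.+ k)))) ≡ (t + two) ^ e * g t))
        (l₃ k) (factor-−2 (suc (k ℕ.+ k)) k true (ℕP.m≤n⇒m≤1+n (ℕP.m≤n⇒m≤1+n (ℕP.m≤m+n k k))) (ℕP.+-comm (k ℕ.+ k) 1)))
    where
    l₁ : ∀ k → suc (suc k) ℕ.* (suc k ℕ.+ 0) ≡ suc k ℕ.* suc (suc k)
    l₁ = ℕR.solve-∀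
    l₂ : ∀ k → suc (suc k) ℕ.+ suc (suc k) ℕ.+ 0 ≡ suc (suc (suc (suc (k ℕ.+ k))))
    l₂ = ℕR.solve-∀
    l₃ : ∀ k → halfOrder k true ≡ δ (k ℕ.+ k)
    l₃ k = trans (l₄ k) (sym (δ-even k))
      where
      l₄ : ∀ k → halfOrder k true ≡ k ℕ.* k
      l₄ zero    = refl
      l₄ (suc j) = cong (suc j ℕ.*_) (ℕP.+-comm j 1)

  -- The polynomials p_n and their inversion

  module Main (p : ℕ → Poly) (isP : (m : ℕ) → IsP m (S m) (p m)) where

    record Generic (t : ℚ) : Set where
      constructor gen
      field
        t≢0 : t ≢ 0ℚ
        v≢0 : 1ℚ + t ≢ 0ℚ
        u≢0 : 1ℚ + two * t ≢ 0ℚ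
        w≢0 : t + two ≢ 0ℚ

    bad : ℚ → ℚ
    bad t = t * (1ℚ + t) * ((1ℚ + two * t) * (t + two))

    pf-bad : PolyFun bad
    pf-bad = pf-* (pf-* pf-id p1+t) (pf-* p1+2t pf-t+2)

    bad-1≢0 : bad 1ℚ ≢ 0ℚ
    bad-1≢0 ()

    generic : ∀ t → bad t ≢ 0ℚ → Generic t
    generic t nz = gen (*-≢0ˡ {t} {1ℚ + t} a) (*-≢0ʳ {t} {1ℚ + t} a) (*-≢0ˡ {1ℚ + two * t} {t + two} b) (*-≢0ʳ {1ℚ + two * t} {t + two} b)
      where
      a = *-≢0ˡ {t * (1ℚ + t)} {(1ℚ + two * t) * (t + two)} nz
      b = *-≢0ʳ {t * (1ℚ + t)} {(1ℚ + two * t) * (t + two)} nz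

    h : ℚ → ℚ
    h t = 1ℚ + half * t

    pf-h : PolyFun h
    pf-h = pf-+ (pf-con 1ℚ) (pf-* (pf-con half) pf-id)

    w≡2h : ∀ t → t + two ≡ two * h t
    w≡2h = lem
      where
      lem : ∀ t → t + two ≡ two * (1ℚ + half * t)
      lem = solve 1 (λ t → t :+ :2 := :2 :* (:1 :+ :½ :* t)) refl

    h≢0 : ∀ {t} → t + two ≢ 0ℚ → h t ≢ 0ℚ
    h≢0 {t} nz z = nz (trans (w≡2h t) (trans (cong (two *_) z) refl))

    σ : ℕ → ℚ
    σ = signs

    σ≢0 : ∀ n → σ n ≢ 0ℚ
    σ≢0 n = inverse-≢0 {σ n} {σ n} (signs-square n)

    p-spec : ∀ n t → Generic t →
      evalP (p n) t * (σ n * t ^ (n ℕ.* n) * (1ℚ + t) ^ (n ℕ.* n) * (1ℚ + two * t) ^ δ n * h t ^ δ (n ℕ.∸ 1)) ≡ h t ^ (n ℕ.* n) * P n t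
    p-spec n t (gen a b c d) = trans (cong (λ x → evalP (p n) t * (x * t ^ (n ℕ.* n) * (1ℚ + t) ^ (n ℕ.* n) * (1ℚ + two * t) ^ δ n * h t ^ δ (n ℕ.∸ 1))) (sym (sgn-binomial n)))
      (trans (isP n t a b c d) (cong (h t ^ (n ℕ.* n) *_) (S-envP n t)))

    Q : ℕ → ℚ → ℚ
    Q n t = s n n (ξ₀ t) (ξ₁ t) t

    -- The defining relation of p_n at 1/t, transported by the inversion formula
    Q-spec : ∀ n t t' → t * t' ≡ 1ℚ → Generic t →
      Q n t * (t + two) ^ (n ℕ.* n ℕ.+ n) * half ^ (n ℕ.* n)
        ≡ σ n * t ^ (n ℕ.* n ℕ.+ n) * (t ^ tri (suc n) * evalP (p n) t') * (1ℚ + t) ^ (n ℕ.* n) * (t + two) ^ δ n * (half * (1ℚ + two * t)) ^ δ (n ℕ.∸ 1)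
    Q-spec n t t' tt' (gen t≢0 v≢0 u≢0 w≢0) = begin
      Q n t * w ^ (nn ℕ.+ n) * half ^ nn
        ≡⟨ cong₂ (λ x y → x * y * half ^ nn) (Q-inv t t' tt' w≢0 t'+2≢0 n) (^-+ w nn n) ⟩
      ((t * t) ^ n) ^ n * (ξ₀ t ^ n * X ^ n * X) ^ n * P' * (w ^ nn * w ^ n) * half ^ nn
        ≡⟨ cong₂ (λ x y → x * y * P' * (w ^ nn * w ^ n) * half ^ nn) (trans (^-* (t * t) n n) (*-^ t t nn))
             (trans (*-^ (ξ₀ t ^ n * X ^ n) X n) (cong (_* X ^ n) (trans (*-^ (ξ₀ t ^ n) (X ^ n) n) (cong₂ _*_ (trans (^-* (ξ₀ t) n n) (cong (_^ nn) (ℚP.+-comm (two * t) 1ℚ))) (^-* X n n))))) ⟩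
      t ^ nn * t ^ nn * (u ^ nn * X ^ nn * X ^ n) * P' * (w ^ nn * w ^ n) * half ^ nn
        ≡⟨ l₁ (t ^ nn) (u ^ nn) (X ^ nn) (X ^ n) P' (w ^ nn) (w ^ n) (half ^ nn) ⟩
      t ^ nn * t ^ nn * (X ^ nn * w ^ nn) * (X ^ n * w ^ n) * (half ^ nn * u ^ nn) * P'
        ≡⟨ cong₂ (λ x y → t ^ nn * t ^ nn * x * y * (half ^ nn * u ^ nn) * P') (Xw nn) (Xw n) ⟩
      t ^ nn * t ^ nn * t ^ nn * t ^ n * (half ^ nn * u ^ nn) * P'
        -- One power t^(n²) is split by `square-tri`: its δ parts clear the denominators of 1 + 2/t
        -- and 1 + 1/(2t), and the rest is the power n(n+1)/2 belonging to p̃_n.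
        ≡⟨ cong₂ (λ x y → t ^ nn * x * t ^ nn * t ^ n * y * P') split (sym (*-^ half u nn)) ⟩
      t ^ nn * (t ^ a * t ^ b * t ^ d) * t ^ nn * t ^ n * g ^ nn * P'
        ≡⟨ l₂ (t ^ nn) (t ^ a) (t ^ b) (t ^ d) (t ^ n) (g ^ nn) P' ⟩
      t ^ nn * t ^ n * t ^ d * (t ^ nn * t ^ a * t ^ b * g ^ nn * P')
        ≡⟨ cong (t ^ nn * t ^ n * t ^ d *_) cleared ⟩
      t ^ nn * t ^ n * t ^ d * (σ n * p' * v ^ nn * w ^ a * g ^ b)
        ≡⟨ l₃ (t ^ nn) (t ^ n) (t ^ d) (σ n) p' (v ^ nn) (w ^ a) (g ^ b) ⟩
      σ n * (t ^ nn * t ^ n) * (t ^ d * p') * v ^ nn * w ^ a * g ^ b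
        ≡⟨ cong (λ x → σ n * x * (t ^ d * p') * v ^ nn * w ^ a * g ^ b) (sym (^-+ t nn n)) ⟩
      σ n * t ^ (nn ℕ.+ n) * (t ^ d * p') * v ^ nn * w ^ a * g ^ b ∎
      where
      open ≡-Reasoning
      nn a b d : ℕ
      nn = n ℕ.* n
      a = δ n
      b = δ (n ℕ.∸ 1)
      d = tri (suc n)
      w v u g X P' p' : ℚ
      w = t + two
      v = 1ℚ + t
      u = 1ℚ + two * t
      g = half * u
      X = ξ₁ t
      P' = P n t'
      p' = evalP (p n) t'
      v' : 1ℚ + t' ≡ t' * v
      v' = trans (cong (_+ t') (sym tt')) (l t t')
        where
        l : ∀ t t' → t * t' + t' ≡ t' * (1ℚ + t)
        l = solve 2 (λ t t' → t :* t' :+ t' := t' :* (:1 :+ t)) refl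
      w' : 1ℚ + two * t' ≡ t' * w
      w' = trans (cong (_+ two * t') (sym tt')) (l t t')
        where
        l : ∀ t t' → t * t' + two * t' ≡ t' * (t + two)
        l = solve 2 (λ t t' → t :* t' :+ :2 :* t' := t' :* (t :+ :2)) refl
      g' : 1ℚ + half * t' ≡ t' * g
      g' = trans (cong (_+ half * t') (sym tt')) (l t t')
        where
        l : ∀ t t' → t * t' + half * t' ≡ t' * (half * (1ℚ + two * t))
        l = solve 2 (λ t t' → t :* t' :+ :½ :* t' := t' :* (:½ :* (:1 :+ :2 :* t))) refl
      u' : t' + two ≡ t' * u
      u' = trans (l₀ t') (trans (cong (λ x → t' + two * x) (sym tt')) (l t t'))
        where
        l₀ : ∀ t' → t' + two ≡ t' + two * 1ℚ
        l₀ = solve 1 (λ t' → t' :+ :2 := t' :+ :2 :* :1) refl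
        l : ∀ t t' → t' + two * (t * t') ≡ t' * (1ℚ + two * t)
        l = solve 2 (λ t t' → t' :+ :2 :* (t :* t') := t' :* (:1 :+ :2 :* t)) refl
      t'≢0 : t' ≢ 0ℚ
      t'≢0 = inverse-≢0 {t'} {t} (trans (ℚP.*-comm t' t) tt')
      t'+2≢0 : t' + two ≢ 0ℚ
      t'+2≢0 z = *-≢0 t'≢0 u≢0 (trans (sym u') z)
      gen' : Generic t'
      gen' = gen t'≢0 (λ z → *-≢0 t'≢0 v≢0 (trans (sym v') z)) (λ z → *-≢0 t'≢0 w≢0 (trans (sym w') z)) t'+2≢0
      Xw : ∀ k → X ^ k * w ^ k ≡ t ^ k
      Xw k = trans (sym (*-^ X w k)) (cong (_^ k) (ξ₁-spec t w≢0))
      split : t ^ nn ≡ t ^ a * t ^ b * t ^ d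
      split = trans (cong (t ^_) (square-tri n)) (trans (^-+ t (a ℕ.+ b) d) (cong (_* t ^ d) (^-+ t a b)))
      one : ∀ k → t ^ k * t' ^ k ≡ 1ℚ
      one k = pow-inverse k tt'
      cleared : t ^ nn * t ^ a * t ^ b * g ^ nn * P' ≡ σ n * p' * v ^ nn * w ^ a * g ^ b
      cleared = begin
        t ^ nn * t ^ a * t ^ b * g ^ nn * P'
          ≡⟨ m₁ (t ^ nn) (t ^ a) (t ^ b) (g ^ nn) P' ⟩
        1ℚ * (t ^ nn * t ^ a * t ^ b * (g ^ nn * P'))
          ≡⟨ cong (_* (t ^ nn * t ^ a * t ^ b * (g ^ nn * P'))) (sym (one nn)) ⟩
        t ^ nn * t' ^ nn * (t ^ nn * t ^ a * t ^ b * (g ^ nn * P'))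
          ≡⟨ m₂ (t ^ nn) (t' ^ nn) (t ^ a) (t ^ b) (g ^ nn) P' ⟩
        t ^ nn * t ^ nn * t ^ a * t ^ b * (t' ^ nn * g ^ nn * P')
          ≡⟨ cong (t ^ nn * t ^ nn * t ^ a * t ^ b *_) (sym relation) ⟩
        t ^ nn * t ^ nn * t ^ a * t ^ b * (p' * (σ n * t' ^ nn * (t' ^ nn * v ^ nn) * (t' ^ a * w ^ a) * (t' ^ b * g ^ b)))
          ≡⟨ m₃ (t ^ nn) (t ^ a) (t ^ b) p' (σ n) (t' ^ nn) (v ^ nn) (t' ^ a) (w ^ a) (t' ^ b) (g ^ b) ⟩
        (t ^ nn * t' ^ nn) * (t ^ nn * t' ^ nn) * ((t ^ a * t' ^ a) * (t ^ b * t' ^ b)) * (σ n * p' * v ^ nn * w ^ a * g ^ b)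
          ≡⟨ cong₂ (λ x y → x * x * y * (σ n * p' * v ^ nn * w ^ a * g ^ b)) (one nn) (cong₂ _*_ (one a) (one b)) ⟩
        1ℚ * 1ℚ * (1ℚ * 1ℚ) * (σ n * p' * v ^ nn * w ^ a * g ^ b)
          ≡⟨ m₄ (σ n * p' * v ^ nn * w ^ a * g ^ b) ⟩
        σ n * p' * v ^ nn * w ^ a * g ^ b ∎
        where
        relation : p' * (σ n * t' ^ nn * (t' ^ nn * v ^ nn) * (t' ^ a * w ^ a) * (t' ^ b * g ^ b)) ≡ t' ^ nn * g ^ nn * P'
        relation = begin
          p' * (σ n * t' ^ nn * (t' ^ nn * v ^ nn) * (t' ^ a * w ^ a) * (t' ^ b * g ^ b))
            ≡⟨ cong (p' *_) (cong₂ _*_ (cong₂ _*_ (cong (σ n * t' ^ nn *_) (trans (sym (*-^ t' v nn)) (cong (_^ nn) (sym v')))) (trans (sym (*-^ t' w a)) (cong (_^ a) (sym w')))) (trans (sym (*-^ t' g b)) (cong (_^ b) (sym g')))) ⟩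
          p' * (σ n * t' ^ nn * (1ℚ + t') ^ nn * (1ℚ + two * t') ^ a * (1ℚ + half * t') ^ b)
            ≡⟨ p-spec n t' gen' ⟩
          (1ℚ + half * t') ^ nn * P'
            ≡⟨ cong (_* P') (trans (cong (_^ nn) g') (*-^ t' g nn)) ⟩
          t' ^ nn * g ^ nn * P' ∎
        m₁ : ∀ x y z k q → x * y * z * k * q ≡ 1ℚ * (x * y * z * (k * q))
        m₁ = solve 5 (λ x y z k q → x :* y :* z :* k :* q := :1 :* (x :* y :* z :* (k :* q))) refl
        m₂ : ∀ x x' y z k q → x * x' * (x * y * z * (k * q)) ≡ x * x * y * z * (x' * k * q)
        m₂ = solve 6 (λ x x' y z k q → x :* x' :* (x :* y :* z :* (k :* q)) := x :* x :* y :* z :* (x' :* k :* q)) refl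
        m₃ : ∀ x y z p s x' v y' w z' g → x * x * y * z * (p * (s * x' * (x' * v) * (y' * w) * (z' * g))) ≡ (x * x') * (x * x') * ((y * y') * (z * z')) * (s * p * v * w * g)
        m₃ = solve 11 (λ x y z p s x' v y' w z' g → x :* x :* y :* z :* (p :* (s :* x' :* (x' :* v) :* (y' :* w) :* (z' :* g))) := (x :* x') :* (x :* x') :* ((y :* y') :* (z :* z')) :* (s :* p :* v :* w :* g)) refl
        m₄ : ∀ x → 1ℚ * 1ℚ * (1ℚ * 1ℚ) * x ≡ x
        m₄ = solve 1 (λ x → :1 :* :1 :* (:1 :* :1) :* x := x) refl
      l₁ : ∀ t u x y p w z k → t * t * (u * x * y) * p * (w * z) * k ≡ t * t * (x * w) * (y * z) * (k * u) * p
      l₁ = solve 8 (λ t u x y p w z k → t :* t :* (u :* x :* y) :* p :* (w :* z) :* k := t :* t :* (x :* w) :* (y :* z) :* (k :* u) :* p) refl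
      l₂ : ∀ t a b d n g p → t * (a * b * d) * t * n * g * p ≡ t * n * d * (t * a * b * g * p)
      l₂ = solve 7 (λ t a b d n g p → t :* (a :* b :* d) :* t :* n :* g :* p := t :* n :* d :* (t :* a :* b :* g :* p)) refl
      l₃ : ∀ t n d s p v w g → t * n * d * (s * p * v * w * g) ≡ s * (t * n) * (d * p) * v * w * g
      l₃ = solve 8 (λ t n d s p v w g → t :* n :* d :* (s :* p :* v :* w :* g) := s :* (t :* n) :* (d :* p) :* v :* w :* g) refl

    -- Values of p_n and of its reversal at 0

    -- The solution of t(1/2 + β) = ξ₁. It vanishes at t = 0, where the scaled coordinates become
    -- those of `τ`.
    β : ℚ → ℚ
    β t = (- half * t) ÷' (t + two)

    η-value : ∀ t → t + two ≢ 0ℚ → t * (half + β t) ≡ ξ₁ t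
    η-value t nz = *-cancelˡ-≢0 (t + two) nz (trans (l₁ t (β t)) (trans (cong (λ x → t * half * (t + two) + t * x) (÷'-* (- half * t) nz)) (trans (l₂ t) (trans (sym (ξ₁-spec t nz)) (ℚP.*-comm (ξ₁ t) (t + two))))))
      where
      l₁ : ∀ t b → (t + two) * (t * (half + b)) ≡ t * half * (t + two) + t * (b * (t + two))
      l₁ = solve 2 (λ t b → (t :+ :2) :* (t :* (:½ :+ b)) := t :* :½ :* (t :+ :2) :+ t :* (b :* (t :+ :2))) refl
      l₂ : ∀ t → t * half * (t + two) + t * (- half * t) ≡ t
      l₂ = solve 1 (λ t → t :* :½ :* (t :+ :2) :+ t :* (:- :½ :* t) := t) refl

    ξ₀-value : ∀ t → 1ℚ + t * two ≡ ξ₀ t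
    ξ₀-value = lem
      where
      lem : ∀ t → 1ℚ + t * two ≡ two * t + 1ℚ
      lem = solve 1 (λ t → :1 :+ t :* :2 := :2 :* t :+ :1) refl

    module Path (n : ℕ) where
      num : ℚ → (ℚ → ℚ) → Maybe (SVar n) → ℚ
      num t z nothing       = t * (t + two)
      num t z (just (xv i)) = two * (t + two)
      num t z (just (yv i)) = - half * t
      num t z (just zv)     = z t
      num t z (just ζv)     = 0ℚ
      pnum : ∀ {z} → PolyFun z → ∀ v → PolyFun (λ t → num t z v)
      pnum pz nothing       = pf-* pf-id pf-t+2
      pnum pz (just (xv i)) = pf-* (pf-con two) pf-t+2
      pnum pz (just (yv i)) = pf-* (pf-con (- half)) pf-id
      pnum pz (just zv)     = pz
      pnum pz (just ζv)     = pf-con 0ℚ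

      -- The leading coefficient is followed along the curve u = 2, β = β(t), which has the
      -- denominator t + 2. This denominator is 2 at t = 0, so the value there is not lost.
      lead : ∀ {f : Env (Maybe (SVar n)) → ℚ} → IsPoly f → ∀ {z : ℚ → ℚ} → PolyFun z → (zv' : ℚ → ℚ) → (∀ t → t + two ≢ 0ℚ → zv' t * (t + two) ≡ z t) →
        Σ ℕ λ M → Σ (ℚ → ℚ) λ k → PolyFun k × (∀ t → t + two ≢ 0ℚ → f (envM n t twos (λ _ → β t) (zv' t)) * (t + two) ^ M ≡ k t)
      lead {f} (F , eq) {z} pz zv' hz =
        let (M , k , pk , spec) = pf-clear F {num = λ v t → num t z v} {d = λ t → t + two} (pnum pz) pf-t+2
        in M , k , pk , λ t nz → trans (cong (_* (t + two) ^ M) (sym (eq (envM n t twos (λ _ → β t) (zv' t))))) (spec t _ (he t nz))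
        where
        he : ∀ t → t + two ≢ 0ℚ → ∀ v → envM n t twos (λ _ → β t) (zv' t) v * (t + two) ≡ num t z v
        he t nz nothing       = refl
        he t nz (just (xv i)) = refl
        he t nz (just (yv i)) = ÷'-* (- half * t) nz
        he t nz (just zv)     = hz t nz
        he t nz (just ζv)     = ℚP.*-zeroˡ (t + two)

    0+2≢0 : 0ℚ + two ≢ 0ℚ
    0+2≢0 ()

    module _ (n : ℕ) where
      private
        nn = n ℕ.* n
        open Path n
        lead-H = lead (proj₁ (proj₂ (Leading.H.result n))) (pf-* (pf-con (- half)) pf-id) β (λ t nz → ÷'-* (- half * t) nz)
        M k-H : _
        M = proj₁ lead-H
        k-H = proj₁ (proj₂ lead-H)
        lead-R = lead (proj₁ (proj₂ (Leading.R.result n))) (pf-* (pf-con two) pf-t+2) (λ _ → two) (λ t nz → refl)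
        M' = proj₁ lead-R
        k-R = proj₁ (proj₂ lead-R)

      Q-lead : ∀ t → t + two ≢ 0ℚ → Q n t * (t + two) ^ M ≡ t ^ (nn ℕ.+ n) * k-H t
      Q-lead t nz = trans (cong (_* (t + two) ^ M) value) (trans (ℚP.*-assoc (t ^ (nn ℕ.+ n)) (Ĥ n t twos (λ _ → β t) (β t)) ((t + two) ^ M)) (cong (t ^ (nn ℕ.+ n) *_) (proj₂ (proj₂ (proj₂ lead-H)) t nz)))
        where
        exponent : ∀ n → n ℕ.* (2 ℕ.+ ℕ.pred n) ≡ n ℕ.* n ℕ.+ n
        exponent zero    = refl
        exponent (suc m) = e m
          where
          e : ∀ m → suc m ℕ.* (2 ℕ.+ m) ≡ suc m ℕ.* suc m ℕ.+ suc m
          e = ℕR.solve-∀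
        value : Q n t ≡ t ^ (nn ℕ.+ n) * Ĥ n t twos (λ _ → β t) (β t)
        value = trans (cong (λ a → s n a (ξ₀ t) (ξ₁ t) t) (sym (trans (cong₂ (λ u v → u ℕ.+ v ℕ.+ 0) (count-true n) (sumℕ-0 n)) (trans (ℕP.+-identityʳ (n ℕ.+ 0)) (ℕP.+-identityʳ n)))))
          (trans (sym (Sv-pick n (λ _ → true) (λ _ → false) false (ξ₀ t) (ξ₁ t) t))
          (trans (Sv-cong n (ξ₁ t) t (λ i → sym (ξ₀-value t)) (λ i → sym (η-value t nz)))
          (trans (cong (λ z → Sv n (λ i → 1ℚ + t * two) (λ i → t * (half + β t)) z t) (sym (η-value t nz)))
          (trans (Ĥ-spec n t twos (λ _ → β t) (β t)) (cong (λ e → t ^ e * Ĥ n t twos (λ _ → β t) (β t)) (exponent n))))))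

      P-lead : ∀ t → t + two ≢ 0ℚ → P n t * (t + two) ^ M' ≡ t ^ nn * k-R t
      P-lead t nz = trans (cong (_* (t + two) ^ M') value) (trans (ℚP.*-assoc (t ^ nn) (R̂ n t twos (λ _ → β t) two) ((t + two) ^ M')) (cong (t ^ nn *_) (proj₂ (proj₂ (proj₂ lead-R)) t nz)))
        where
        exponent : ∀ n → n ℕ.* (1 ℕ.+ ℕ.pred n) ≡ n ℕ.* n
        exponent zero    = refl
        exponent (suc m) = refl
        value : P n t ≡ t ^ nn * R̂ n t twos (λ _ → β t) two
        value = trans (cong (λ a → s n a (ξ₀ t) (ξ₁ t) t) (sym (trans (cong₂ (λ u v → u ℕ.+ v ℕ.+ 1) (count-true n) (sumℕ-0 n)) (trans (cong (ℕ._+ 1) (ℕP.+-identityʳ n)) (ℕP.+-comm n 1)))))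
          (trans (sym (Sv-pick n (λ _ → true) (λ _ → false) true (ξ₀ t) (ξ₁ t) t))
          (trans (Sv-cong n (ξ₀ t) t (λ i → sym (ξ₀-value t)) (λ i → sym (η-value t nz)))
          (trans (cong (λ z → Sv n (λ i → 1ℚ + t * two) (λ i → t * (half + β t)) z t) (sym (ξ₀-value t)))
          (trans (R̂-spec n t twos (λ _ → β t) two) (cong (λ e → t ^ e * R̂ n t twos (λ _ → β t) two) (exponent n))))))

      -- P_n has n + 1 arguments ξ₀, so its leading coefficient at t = 0 is of type R, an explicit
      -- nonzero product.
      p-at-0 : evalP (p n) 0ℚ ≢ 0ℚ
      p-at-0 p0 = *-≢0 (closedR-zeros≢0 n) (^-≢0 M' 0+2≢0) (trans (trans (cong (_* (0ℚ + two) ^ M') (sym (R̂-0 n twos zeros two))) (proj₂ (proj₂ (proj₂ lead-R)) 0ℚ 0+2≢0))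
          (trans (trans (sym (ℚP.*-identityˡ (k-R 0ℚ))) (cong (_* k-R 0ℚ) (sym (1-^ nn)))) (trans (sym (all 0ℚ)) (trans (cong (_* rest 0ℚ) p0) (ℚP.*-zeroˡ (rest 0ℚ))))))
        where
        open ≡-Reasoning
        rest : ℚ → ℚ
        rest t = σ n * (1ℚ + t) ^ nn * (1ℚ + two * t) ^ δ n * h t ^ δ (n ℕ.∸ 1) * (t + two) ^ M'
        p-rest : PolyFun rest
        p-rest = pf-* (pf-* (pf-* (pf-* (pf-con (σ n)) (pf-^ p1+t nn)) (pf-^ p1+2t (δ n))) (pf-^ pf-h (δ (n ℕ.∸ 1)))) (pf-^ pf-t+2 M')
        all : ∀ t → evalP (p n) t * rest t ≡ h t ^ nn * k-R t
        all = pf-dense-≡ (pf-* (pf-evalP (p n)) p-rest) (pf-* (pf-^ pf-h nn) (proj₁ (proj₂ (proj₂ lead-R)))) pf-bad 1ℚ bad-1≢0 λ t nz → go t (generic t nz)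
          where
          go : ∀ t → Generic t → evalP (p n) t * rest t ≡ h t ^ nn * k-R t
          go t G@(gen t≢0 _ _ w≢0) = *-cancelˡ-≢0 (t ^ nn) (^-≢0 nn t≢0) (begin
            t ^ nn * (evalP (p n) t * rest t)
              ≡⟨ l₁ (t ^ nn) (evalP (p n) t) (σ n) ((1ℚ + t) ^ nn) ((1ℚ + two * t) ^ δ n) (h t ^ δ (n ℕ.∸ 1)) ((t + two) ^ M') ⟩
            evalP (p n) t * (σ n * t ^ nn * (1ℚ + t) ^ nn * (1ℚ + two * t) ^ δ n * h t ^ δ (n ℕ.∸ 1)) * (t + two) ^ M'
              ≡⟨ cong (_* (t + two) ^ M') (p-spec n t G) ⟩
            h t ^ nn * P n t * (t + two) ^ M'
              ≡⟨ ℚP.*-assoc (h t ^ nn) (P n t) ((t + two) ^ M') ⟩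
            h t ^ nn * (P n t * (t + two) ^ M')
              ≡⟨ cong (h t ^ nn *_) (P-lead t w≢0) ⟩
            h t ^ nn * (t ^ nn * k-R t)
              ≡⟨ l₂ (h t ^ nn) (t ^ nn) (k-R t) ⟩
            t ^ nn * (h t ^ nn * k-R t) ∎)
            where
            l₁ : ∀ t p s v u h w → t * (p * (s * v * u * h * w)) ≡ p * (s * t * v * u * h) * w
            l₁ = solve 7 (λ t p s v u h w → t :* (p :* (s :* v :* u :* h :* w)) := p :* (s :* t :* v :* u :* h) :* w) refl
            l₂ : ∀ a b c → a * (b * c) ≡ b * (a * c)
            l₂ = solve 3 (λ a b c → a :* (b :* c) := b :* (a :* c)) refl

      private
        U₀ V₀ : ℚ → ℚ
        U₀ t = σ n * (1ℚ + t) ^ nn * (t + two) ^ δ n * (half * (1ℚ + two * t)) ^ δ (n ℕ.∸ 1) * (t + two) ^ M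
        V₀ t = k-H t * (t + two) ^ (nn ℕ.+ n) * half ^ nn
        pU₀ : PolyFun U₀
        pU₀ = pf-* (pf-* (pf-* (pf-* (pf-con (σ n)) (pf-^ p1+t nn)) (pf-^ pf-t+2 (δ n))) (pf-^ (pf-* (pf-con half) p1+2t) (δ (n ℕ.∸ 1)))) (pf-^ pf-t+2 M)
        pV₀ : PolyFun V₀
        pV₀ = pf-* (pf-* (proj₁ (proj₂ (proj₂ lead-H))) (pf-^ pf-t+2 (nn ℕ.+ n))) (pf-con (half ^ nn))
        U₀≢0 : U₀ 0ℚ ≢ 0ℚ
        U₀≢0 = *-≢0 (*-≢0 (*-≢0 (*-≢0 (σ≢0 n) (^-≢0 nn one)) (^-≢0 (δ n) 0+2≢0)) (^-≢0 (δ (n ℕ.∸ 1)) hh)) (^-≢0 M 0+2≢0)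
          where
          one : 1ℚ + 0ℚ ≢ 0ℚ
          one ()
          hh : half * (1ℚ + two * 0ℚ) ≢ 0ℚ
          hh ()
        -- The factor t^(n² + n) in `Q-spec` is matched by the order of Q_n at 0 and cancels; the
        -- remaining cofactor U₀ is nonzero at 0.
        rev-data = reversal (tri (suc n)) (p n) {U₀} {V₀} {bad} pU₀ pV₀ pf-bad bad-1≢0 U₀≢0 λ t u tu nz → go t u tu (generic t nz)
          where
          open ≡-Reasoning
          go : ∀ t u → t * u ≡ 1ℚ → Generic t → U₀ t * (t ^ tri (suc n) * evalP (p n) u) ≡ V₀ t
          go t u tu G@(gen t≢0 _ _ w≢0) = *-cancelˡ-≢0 (t ^ (nn ℕ.+ n)) (^-≢0 (nn ℕ.+ n) t≢0) (begin
            t ^ (nn ℕ.+ n) * (U₀ t * (t ^ tri (suc n) * evalP (p n) u))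
              ≡⟨ l₁ (t ^ (nn ℕ.+ n)) (σ n) ((1ℚ + t) ^ nn) ((t + two) ^ δ n) ((half * (1ℚ + two * t)) ^ δ (n ℕ.∸ 1)) ((t + two) ^ M) (t ^ tri (suc n) * evalP (p n) u) ⟩
            σ n * t ^ (nn ℕ.+ n) * (t ^ tri (suc n) * evalP (p n) u) * (1ℚ + t) ^ nn * (t + two) ^ δ n * (half * (1ℚ + two * t)) ^ δ (n ℕ.∸ 1) * (t + two) ^ M
              ≡⟨ cong (_* (t + two) ^ M) (sym (Q-spec n t u tu G)) ⟩
            Q n t * (t + two) ^ (nn ℕ.+ n) * half ^ nn * (t + two) ^ M
              ≡⟨ l₂ (Q n t) ((t + two) ^ (nn ℕ.+ n)) (half ^ nn) ((t + two) ^ M) ⟩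
            Q n t * (t + two) ^ M * (t + two) ^ (nn ℕ.+ n) * half ^ nn
              ≡⟨ cong (λ x → x * (t + two) ^ (nn ℕ.+ n) * half ^ nn) (Q-lead t w≢0) ⟩
            t ^ (nn ℕ.+ n) * k-H t * (t + two) ^ (nn ℕ.+ n) * half ^ nn
              ≡⟨ l₃ (t ^ (nn ℕ.+ n)) (k-H t) ((t + two) ^ (nn ℕ.+ n)) (half ^ nn) ⟩
            t ^ (nn ℕ.+ n) * V₀ t ∎)
            where
            l₁ : ∀ t s v w g m x → t * (s * v * w * g * m * x) ≡ s * t * x * v * w * g * m
            l₁ = solve 7 (λ t s v w g m x → t :* (s :* v :* w :* g :* m :* x) := s :* t :* x :* v :* w :* g :* m) refl
            l₂ : ∀ a b c d → a * b * c * d ≡ a * d * b * c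
            l₂ = solve 4 (λ a b c d → a :* b :* c :* d := a :* d :* b :* c) refl
            l₃ : ∀ a b c d → a * b * c * d ≡ a * (b * c * d)
            l₃ = solve 4 (λ a b c d → a :* b :* c :* d := a :* (b :* c :* d)) refl

      r : ℚ → ℚ
      r = proj₁ rev-data
      pf-r : PolyFun r
      pf-r = proj₁ (proj₂ rev-data)
      r-reversal : Reversal (tri (suc n)) (p n) r
      r-reversal = proj₁ (proj₂ (proj₂ rev-data))

      -- Comparison of `Q-spec` at t = 0 with the leading coefficient `τ-0`. The signs cancel, and
      -- of the powers of two only those of the δ factors remain.
      r-0 : r 0ℚ * two ^ δ n * half ^ δ (n ℕ.∸ 1) ≡ θH n
      r-0 = *-cancelˡ-≢0 (σ n * two ^ M) (*-≢0 (σ≢0 n) (^-≢0 M two≢0)) (begin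
        σ n * two ^ M * (r 0ℚ * two ^ δ n * half ^ δ (n ℕ.∸ 1))
          ≡⟨ l₁ (σ n) (two ^ M) (r 0ℚ) (two ^ δ n) (half ^ δ (n ℕ.∸ 1)) ⟩
        σ n * 1ℚ * two ^ δ n * half ^ δ (n ℕ.∸ 1) * two ^ M * r 0ℚ
          ≡⟨ cong (λ x → σ n * x * two ^ δ n * half ^ δ (n ℕ.∸ 1) * two ^ M * r 0ℚ) (sym (1-^ nn)) ⟩
        U₀ 0ℚ * r 0ℚ
          ≡⟨ proj₂ (proj₂ (proj₂ rev-data)) 0ℚ ⟩
        k-H 0ℚ * two ^ (nn ℕ.+ n) * half ^ nn
          ≡⟨ cong (λ x → x * two ^ (nn ℕ.+ n) * half ^ nn) (trans (sym (proj₂ (proj₂ (proj₂ lead-H)) 0ℚ 0+2≢0)) (cong (_* two ^ M) (τ-0 n))) ⟩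
        σ n * half ^ n * θH n * two ^ M * two ^ (nn ℕ.+ n) * half ^ nn
          ≡⟨ cong (λ x → σ n * half ^ n * θH n * two ^ M * x * half ^ nn) (^-+ two nn n) ⟩
        σ n * half ^ n * θH n * two ^ M * (two ^ nn * two ^ n) * half ^ nn
          ≡⟨ l₂ (σ n) (half ^ n) (θH n) (two ^ M) (two ^ nn) (two ^ n) (half ^ nn) ⟩
        σ n * two ^ M * ((two ^ nn * half ^ nn) * (two ^ n * half ^ n) * θH n)
          ≡⟨ cong (λ x → σ n * two ^ M * (x * θH n)) (cong₂ _*_ (pow-inverse nn refl) (pow-inverse n refl)) ⟩
        σ n * two ^ M * (1ℚ * 1ℚ * θH n)
          ≡⟨ cong (σ n * two ^ M *_) (l₃ (θH n)) ⟩
        σ n * two ^ M * θH n ∎)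
        where
        open ≡-Reasoning
        two≢0 : two ≢ 0ℚ
        two≢0 ()
        l₁ : ∀ s m r d h → s * m * (r * d * h) ≡ s * 1ℚ * d * h * m * r
        l₁ = solve 5 (λ s m r d h → s :* m :* (r :* d :* h) := s :* :1 :* d :* h :* m :* r) refl
        l₂ : ∀ s h θ m a b c → s * h * θ * m * (a * b) * c ≡ s * m * ((a * c) * (b * h) * θ)
        l₂ = solve 7 (λ s h θ m a b c → s :* h :* θ :* m :* (a :* b) :* c := s :* m :* ((a :* c) :* (b :* h) :* θ)) refl
        l₃ : ∀ x → 1ℚ * 1ℚ * x ≡ x
        l₃ = solve 1 (λ x → :1 :* :1 :* x := x) refl

      r-0≢0 : r 0ℚ ≢ 0ℚ
      r-0≢0 z = θH≢0 n (trans (sym r-0) (trans (cong (λ x → x * two ^ δ n * half ^ δ (n ℕ.∸ 1)) z) (l (two ^ δ n) (half ^ δ (n ℕ.∸ 1)))))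
        where
        l : ∀ a b → 0ℚ * a * b ≡ 0ℚ
        l = solve 2 (λ a b → :0 :* a :* b := :0) refl

    -- The equation and the degree of Y

    module Final (m : ℕ) where

      private
        n = suc m
        nn = n ℕ.* n
        χe = χeven n
        χo = χodd n
        Y₀ = proj₁ (yfactor m)
        -- Powers of two that arise because p_n is normalized by 1 + t/2 while Z and Q are expressed
        -- through t + 2 = 2(1 + t/2); κ₃ is the inverse of κ₁, and κ₂ also carries the sign of p_n.
        κ₁ κ₂ κ₃ : ℚ
        κ₁ = two ^ 2 * (two ^ nn * two ^ nn) * half ^ nn
        κ₂ = σ n * half ^ δ m * (two ^ δ m * two ^ δ m * two ^ χe)
        κ₃ = half ^ 2 * (half ^ nn * half ^ nn) * two ^ nn

        κ₁κ₃ : κ₁ * κ₃ ≡ 1ℚ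
        κ₁κ₃ = trans (l (two ^ 2) (two ^ nn) (half ^ nn) (half ^ 2)) (cong₂ _*_ (cong₂ _*_ (pow-inverse {two} {half} 2 refl) (pow-inverse {two} {half} nn refl)) (cong₂ _*_ (pow-inverse {two} {half} nn refl) (pow-inverse {half} {two} nn refl)))
          where
          l : ∀ a b c d → a * (b * b) * c * (d * (c * c) * b) ≡ (a * d) * (b * c) * ((b * c) * (c * b))
          l = solve 4 (λ a b c d → a :* (b :* b) :* c :* (d :* (c :* c) :* b) := (a :* d) :* (b :* c) :* ((b :* c) :* (c :* b))) refl

      -- The minus sign stems from the normalizing signs of p_{n-1} and p_{n+1}, whose product is
      -- -1.
      Ȳ : ℚ → ℚ
      Ȳ t = - (κ₂ * κ₃) * Y₀ t

      pf-Ȳ : PolyFun Ȳ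
      pf-Ȳ = pf-* (pf-con (- (κ₂ * κ₃))) (proj₁ (proj₂ (yfactor m)))

      C : ℚ → ℚ
      C t = (1ℚ + two * t) ^ suc χe * h t ^ suc χo * (evalP (p n) t * evalP (p n) t)

      module _ (t : ℚ) (G : Generic t) where
        open Generic G
        open ≡-Reasoning
        private
          t' = proj₁ (inv t t≢0)
          u v w X ht r' p₀ p₁ p₂ Tt Vv Uu Hd H ZQ K₀ K : ℚ
          u = 1ℚ + two * t
          v = 1ℚ + t
          w = t + two
          X = ξ₁ t
          ht = h t
          r' = r n t
          p₀ = evalP (p m) t
          p₁ = evalP (p n) t
          p₂ = evalP (p (suc n)) t
          Tt = t ^ nn
          Vv = v ^ nn
          Uu = u ^ δ n
          Hd = ht ^ δ m
          H = ht ^ nn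
          ZQ = Z m t * Q n t
          K₀ = Tt * Vv * Uu * Hd * (Tt * Vv * Uu * Hd)
          K = K₀ * t ^ 2 * u ^ χo * ht ^ χe

          squares : m ℕ.* m ℕ.+ suc n ℕ.* suc n ≡ nn ℕ.+ nn ℕ.+ 2
          squares = e m
            where
            e : ∀ m → m ℕ.* m ℕ.+ suc (suc m) ℕ.* suc (suc m) ≡ suc m ℕ.* suc m ℕ.+ suc m ℕ.* suc m ℕ.+ 2
            e = ℕR.solve-∀

          outer : p₀ * p₂ * (- 1ℚ * ((Tt * Tt * t ^ 2) * (Vv * Vv * v ^ 2) * (Uu * Uu * u ^ χo) * (Hd * Hd * ht ^ χe))) ≡ H * H * ht ^ 2 * (P (suc n) t * P m t)
          outer = begin
            p₀ * p₂ * (- 1ℚ * ((Tt * Tt * t ^ 2) * (Vv * Vv * v ^ 2) * (Uu * Uu * u ^ χo) * (Hd * Hd * ht ^ χe)))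
              -- The exponents at n - 1 and n + 1 add up to twice those at n plus their second
              -- differences: 2 for the squares, χodd and χeven for the δ.
              ≡⟨ cong (p₀ * p₂ *_) (sym (cong₂ _*_ (signs-alternate m) (cong₂ _*_ (cong₂ _*_ (cong₂ _*_ (pow₂₃ t (m ℕ.* m) (suc n ℕ.* suc n) nn 2 squares) (pow₂₃ v (m ℕ.* m) (suc n ℕ.* suc n) nn 2 squares))
                   (pow₂₃ u (δ m) (δ (suc n)) (δ n) χo (δ-second m))) (pow₂₃ ht (δ (m ∸ 1)) (δ n) (δ m) χe (δ-second' m))))) ⟩
            p₀ * p₂ * (σ (suc n) * σ m * ((t ^ (m ℕ.* m) * t ^ (suc n ℕ.* suc n)) * (v ^ (m ℕ.* m) * v ^ (suc n ℕ.* suc n)) * (u ^ δ m * u ^ δ (suc n)) * (ht ^ δ (m ∸ 1) * ht ^ δ n)))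
              ≡⟨ l₁ p₀ p₂ (σ (suc n)) (σ m) (t ^ (m ℕ.* m)) (t ^ (suc n ℕ.* suc n)) (v ^ (m ℕ.* m)) (v ^ (suc n ℕ.* suc n)) (u ^ δ m) (u ^ δ (suc n)) (ht ^ δ (m ∸ 1)) (ht ^ δ n) ⟩
            (p₀ * (σ m * t ^ (m ℕ.* m) * v ^ (m ℕ.* m) * u ^ δ m * ht ^ δ (m ∸ 1))) * (p₂ * (σ (suc n) * t ^ (suc n ℕ.* suc n) * v ^ (suc n ℕ.* suc n) * u ^ δ (suc n) * ht ^ δ n))
              ≡⟨ cong₂ _*_ (p-spec m t G) (p-spec (suc n) t G) ⟩
            (ht ^ (m ℕ.* m) * P m t) * (ht ^ (suc n ℕ.* suc n) * P (suc n) t)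
              ≡⟨ l₂ (ht ^ (m ℕ.* m)) (P m t) (ht ^ (suc n ℕ.* suc n)) (P (suc n) t) ⟩
            ht ^ (m ℕ.* m) * ht ^ (suc n ℕ.* suc n) * (P (suc n) t * P m t)
              ≡⟨ cong (_* (P (suc n) t * P m t)) (pow₂₃ ht (m ℕ.* m) (suc n ℕ.* suc n) nn 2 squares) ⟩
            H * H * ht ^ 2 * (P (suc n) t * P m t) ∎
            where
            l₁ : ∀ p q s s' a b c d e f g k → p * q * (s * s' * ((a * b) * (c * d) * (e * f) * (g * k))) ≡ (p * (s' * a * c * e * g)) * (q * (s * b * d * f * k))
            l₁ = solve 12 (λ p q s s' a b c d e f g k → p :* q :* (s :* s' :* ((a :* b) :* (c :* d) :* (e :* f) :* (g :* k))) := (p :* (s' :* a :* c :* e :* g)) :* (q :* (s :* b :* d :* f :* k))) refl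
            l₂ : ∀ a b c d → (a * b) * (c * d) ≡ a * c * (d * b)
            l₂ = solve 4 (λ a b c d → (a :* b) :* (c :* d) := a :* c :* (d :* b)) refl

          middle : p₁ * p₁ * K₀ ≡ H * H * (P n t * P n t)
          middle = begin
            p₁ * p₁ * K₀                                                    ≡⟨ l₁ p₁ Tt Vv Uu Hd ⟩
            1ℚ * (p₁ * (Tt * Vv * Uu * Hd) * (p₁ * (Tt * Vv * Uu * Hd)))      ≡⟨ cong (_* (p₁ * (Tt * Vv * Uu * Hd) * (p₁ * (Tt * Vv * Uu * Hd)))) (sym (signs-square n)) ⟩
            σ n * σ n * (p₁ * (Tt * Vv * Uu * Hd) * (p₁ * (Tt * Vv * Uu * Hd)))  ≡⟨ l₂ (σ n) p₁ Tt Vv Uu Hd ⟩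
            p₁ * (σ n * Tt * Vv * Uu * Hd) * (p₁ * (σ n * Tt * Vv * Uu * Hd))  ≡⟨ cong₂ _*_ (p-spec n t G) (p-spec n t G) ⟩
            H * P n t * (H * P n t)                                          ≡⟨ l₃ H (P n t) ⟩
            H * H * (P n t * P n t)                                          ∎
            where
            l₁ : ∀ p a b c d → p * p * (a * b * c * d * (a * b * c * d)) ≡ 1ℚ * (p * (a * b * c * d) * (p * (a * b * c * d)))
            l₁ = solve 5 (λ p a b c d → p :* p :* (a :* b :* c :* d :* (a :* b :* c :* d)) := :1 :* (p :* (a :* b :* c :* d) :* (p :* (a :* b :* c :* d)))) refl
            l₂ : ∀ s p a b c d → s * s * (p * (a * b * c * d) * (p * (a * b * c * d))) ≡ p * (s * a * b * c * d) * (p * (s * a * b * c * d))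
            l₂ = solve 6 (λ s p a b c d → s :* s :* (p :* (a :* b :* c :* d) :* (p :* (a :* b :* c :* d))) := p :* (s :* a :* b :* c :* d) :* (p :* (s :* a :* b :* c :* d))) refl
            l₃ : ∀ a b → a * b * (a * b) ≡ a * a * (b * b)
            l₃ = solve 2 (λ a b → a :* b :* (a :* b) := a :* a :* (b :* b)) refl

          w^ : ∀ k → w ^ k ≡ two ^ k * ht ^ k
          w^ k = trans (cong (_^ k) (w≡2h t)) (*-^ two ht k)

          -- Q contributes p̃_n and Z contributes Y; ξ₁² is absorbed by (t + 2)², since ξ₁ (t + 2) =
          -- t.
          product : t * t * (X * X * ZQ) * (ht ^ 2 * (H * H)) * κ₁ ≡ K * (t ^ suc n * r') * (κ₂ * Y₀ t)
          product = begin
            t * t * (X * X * ZQ) * (ht ^ 2 * (H * H)) * (two ^ 2 * (two ^ nn * two ^ nn) * half ^ nn)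
              ≡⟨ l₁ t X (Z m t) (Q n t) (ht ^ 2) H (two ^ 2) (two ^ nn) (half ^ nn) ⟩
            t * t * (X * X * (two ^ 2 * ht ^ 2)) * (Z m t * Q n t * ((two ^ nn * H) * (two ^ nn * H)) * half ^ nn)
              ≡⟨ cong₂ (λ a b → t * t * (X * X * a) * (Z m t * Q n t * b * half ^ nn)) (sym (w^ 2)) (trans (sym (cong₂ _*_ (w^ nn) (w^ nn))) (trans (sym (^-+ w nn nn)) (trans (cong (w ^_) (e₁ m)) (^-+ w (m ℕ.* suc m) (nn ℕ.+ n))))) ⟩
            t * t * (X * X * w ^ 2) * (Z m t * Q n t * (w ^ (m ℕ.* suc m) * w ^ (nn ℕ.+ n)) * half ^ nn)
              ≡⟨ l₂ t X w (Z m t) (Q n t) (w ^ (m ℕ.* suc m)) (w ^ (nn ℕ.+ n)) (half ^ nn) ⟩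
            t * t * ((X * w) * (X * w)) * ((Z m t * w ^ (m ℕ.* suc m)) * (Q n t * w ^ (nn ℕ.+ n) * half ^ nn))
              ≡⟨ cong₂ (λ a b → t * t * (a * a) * b) (ξ₁-spec t w≢0) (cong₂ _*_ (proj₂ (proj₂ (yfactor m)) t w≢0) (trans (Q-spec n t t' (proj₂ (inv t t≢0)) G)
                   (cong₂ (λ a b → σ n * t ^ (nn ℕ.+ n) * a * Vv * w ^ δ n * b) (sym (r-reversal n t t' (proj₂ (inv t t≢0)))) (*-^ half u (δ m))))) ⟩
            t * t * (t * t) * (t ^ (m ℕ.* suc (suc m)) * Vv * u ^ δ (suc n) * w ^ δ (m ∸ 1) * Y₀ t * (σ n * t ^ (nn ℕ.+ n) * r' * Vv * w ^ δ n * (half ^ δ m * u ^ δ m)))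
              ≡⟨ l₃ t (t ^ (m ℕ.* suc (suc m))) Vv (u ^ δ (suc n)) (w ^ δ (m ∸ 1)) (Y₀ t) (σ n) (t ^ (nn ℕ.+ n)) r' (w ^ δ n) (half ^ δ m) (u ^ δ m) ⟩
            (t ^ 4 * t ^ (m ℕ.* suc (suc m)) * t ^ (nn ℕ.+ n)) * (Vv * Vv) * (u ^ δ m * u ^ δ (suc n)) * (w ^ δ (m ∸ 1) * w ^ δ n) * r' * (σ n * half ^ δ m) * Y₀ t
              ≡⟨ cong₂ (λ a b → a * (Vv * Vv) * (u ^ δ m * u ^ δ (suc n)) * b * r' * (σ n * half ^ δ m) * Y₀ t) tpow
                   (trans (pow₂₃ w (δ (m ∸ 1)) (δ n) (δ m) χe (δ-second' m)) (cong₂ _*_ (cong₂ _*_ (w^ (δ m)) (w^ (δ m))) (w^ χe))) ⟩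
            (Tt * Tt * t ^ 2 * t ^ suc n) * (Vv * Vv) * (u ^ δ m * u ^ δ (suc n)) * ((two ^ δ m * Hd) * (two ^ δ m * Hd) * (two ^ χe * ht ^ χe)) * r' * (σ n * half ^ δ m) * Y₀ t
              ≡⟨ cong (λ a → (Tt * Tt * t ^ 2 * t ^ suc n) * (Vv * Vv) * a * ((two ^ δ m * Hd) * (two ^ δ m * Hd) * (two ^ χe * ht ^ χe)) * r' * (σ n * half ^ δ m) * Y₀ t) (pow₂₃ u (δ m) (δ (suc n)) (δ n) χo (δ-second m)) ⟩
            (Tt * Tt * t ^ 2 * t ^ suc n) * (Vv * Vv) * (Uu * Uu * u ^ χo) * ((two ^ δ m * Hd) * (two ^ δ m * Hd) * (two ^ χe * ht ^ χe)) * r' * (σ n * half ^ δ m) * Y₀ t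
              ≡⟨ l₄ Tt (t ^ 2) (t ^ suc n) Vv Uu (u ^ χo) (two ^ δ m) Hd (two ^ χe) (ht ^ χe) r' (σ n * half ^ δ m) (Y₀ t) ⟩
            K * (t ^ suc n * r') * (κ₂ * Y₀ t) ∎
            where
            e₁ : ∀ m → suc m ℕ.* suc m ℕ.+ suc m ℕ.* suc m ≡ m ℕ.* suc m ℕ.+ (suc m ℕ.* suc m ℕ.+ suc m)
            e₁ = ℕR.solve-∀
            e₂ : ∀ m → 4 ℕ.+ m ℕ.* suc (suc m) ℕ.+ (suc m ℕ.* suc m ℕ.+ suc m) ≡ suc m ℕ.* suc m ℕ.+ suc m ℕ.* suc m ℕ.+ 2 ℕ.+ suc (suc m)
            e₂ = ℕR.solve-∀
            tpow : t ^ 4 * t ^ (m ℕ.* suc (suc m)) * t ^ (nn ℕ.+ n) ≡ Tt * Tt * t ^ 2 * t ^ suc n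
            tpow = trans (cong (_* t ^ (nn ℕ.+ n)) (sym (^-+ t 4 (m ℕ.* suc (suc m))))) (trans (sym (^-+ t (4 ℕ.+ m ℕ.* suc (suc m)) (nn ℕ.+ n)))
              (trans (cong (t ^_) (e₂ m)) (trans (^-+ t (nn ℕ.+ nn ℕ.+ 2) (suc n)) (cong (_* t ^ suc n) (trans (^-+ t (nn ℕ.+ nn) 2) (cong (_* t ^ 2) (^-+ t nn nn)))))))
            l₁ : ∀ t x z q k h a b c → t * t * (x * x * (z * q)) * (k * (h * h)) * (a * (b * b) * c) ≡ t * t * (x * x * (a * k)) * (z * q * ((b * h) * (b * h)) * c)
            l₁ = solve 9 (λ t x z q k h a b c → t :* t :* (x :* x :* (z :* q)) :* (k :* (h :* h)) :* (a :* (b :* b) :* c) := t :* t :* (x :* x :* (a :* k)) :* (z :* q :* ((b :* h) :* (b :* h)) :* c)) refl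
            l₂ : ∀ t x w z q a b c → t * t * (x * x * (w * (w * 1ℚ))) * (z * q * (a * b) * c) ≡ t * t * ((x * w) * (x * w)) * ((z * a) * (q * b * c))
            l₂ = solve 8 (λ t x w z q a b c → t :* t :* (x :* x :* (w :* (w :* :1))) :* (z :* q :* (a :* b) :* c) := t :* t :* ((x :* w) :* (x :* w)) :* ((z :* a) :* (q :* b :* c))) refl
            l₃ : ∀ t a v u w y s b r w' k u' → t * t * (t * t) * (a * v * u * w * y * (s * b * r * v * w' * (k * u'))) ≡ (t * (t * (t * (t * 1ℚ))) * a * b) * (v * v) * (u' * u) * (w * w') * r * (s * k) * y
            l₃ = solve 12 (λ t a v u w y s b r w' k u' → t :* t :* (t :* t) :* (a :* v :* u :* w :* y :* (s :* b :* r :* v :* w' :* (k :* u'))) := (t :* (t :* (t :* (t :* :1))) :* a :* b) :* (v :* v) :* (u' :* u) :* (w :* w') :* r :* (s :* k) :* y) refl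
            l₄ : ∀ Tt q s v u x b h c y r k z → (Tt * Tt * q * s) * (v * v) * (u * u * x) * ((b * h) * (b * h) * (c * y)) * r * k * z
              ≡ (Tt * v * u * h * (Tt * v * u * h) * q * x * y) * (s * r) * (k * (b * b * c) * z)
            l₄ = solve 13 (λ Tt q s v u x b h c y r k z → (Tt :* Tt :* q :* s) :* (v :* v) :* (u :* u :* x) :* ((b :* h) :* (b :* h) :* (c :* y)) :* r :* k :* z := (Tt :* v :* u :* h :* (Tt :* v :* u :* h) :* q :* x :* y) :* (s :* r) :* (k :* (b :* b :* c) :* z)) refl

          K≢0 : K ≢ 0ℚ
          K≢0 = *-≢0 (*-≢0 (*-≢0 (*-≢0 k₀ k₀) (^-≢0 2 t≢0)) (^-≢0 χo u≢0)) (^-≢0 χe (h≢0 {t} w≢0))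
            where
            k₀ : Tt * Vv * Uu * Hd ≢ 0ℚ
            k₀ = *-≢0 (*-≢0 (*-≢0 (^-≢0 nn t≢0) (^-≢0 nn v≢0)) (^-≢0 (δ n) u≢0)) (^-≢0 (δ m) (h≢0 {t} w≢0))

          -- Exactly one of χeven, χodd is 1, so the leftover exponent from the second difference
          -- and the exponent in C complete each other to 2.
          χ₂ : ∀ a → a ^ χo * a ^ suc χe ≡ a ^ 2
          χ₂ a = trans (sym (^-+ a χo (suc χe))) (cong (a ^_) (trans (ℕP.+-suc χo χe) (cong suc (trans (ℕP.+-comm χo χe) (χ-sum n)))))
          χ₂' : ∀ a → a ^ χe * a ^ suc χo ≡ a ^ 2
          χ₂' a = trans (sym (^-+ a χe (suc χo))) (cong (a ^_) (trans (ℕP.+-suc χe χo) (cong suc (χ-sum n))))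

        -- Multiplied by K, the three terms become those of the specialized bilinear identity:
        -- `outer` supplies p_{n-1} p_{n+1}, `product` the term with B and Y, and `middle` the
        -- square of p_n.
        identity-generic : v * v * (p₀ * p₂) - t ^ suc n * r' * Ȳ t ≡ C t
        identity-generic = *-cancelˡ-≢0 K K≢0 (begin
          K * (v * v * (p₀ * p₂) - t ^ suc n * r' * (- (κ₂ * κ₃) * Y₀ t))
            ≡⟨ l₁ Tt (t ^ 2) Vv v Uu (u ^ χo) Hd (ht ^ χe) p₀ p₂ (t ^ suc n * r') κ₂ κ₃ (Y₀ t) ⟩
          - (p₀ * p₂ * (- 1ℚ * ((Tt * Tt * t ^ 2) * (Vv * Vv * v ^ 2) * (Uu * Uu * u ^ χo) * (Hd * Hd * ht ^ χe)))) + K * (t ^ suc n * r') * (κ₂ * Y₀ t) * κ₃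
            ≡⟨ cong₂ (λ a b → - a + b * κ₃) outer (sym product) ⟩
          - (H * H * ht ^ 2 * (P (suc n) t * P m t)) + t * t * (X * X * ZQ) * (ht ^ 2 * (H * H)) * κ₁ * κ₃
            ≡⟨ cong (λ a → - (H * H * ht ^ 2 * a) + t * t * (X * X * ZQ) * (ht ^ 2 * (H * H)) * κ₁ * κ₃) (trans (toda m t w≢0 v≢0) (cong (λ a → t * t * (X * X * ZQ - a * a * (P n t * P n t))) (ℚP.+-comm (two * t) 1ℚ))) ⟩
          - (H * H * ht ^ 2 * (t * t * (X * X * ZQ - u * u * (P n t * P n t)))) + t * t * (X * X * ZQ) * (ht ^ 2 * (H * H)) * κ₁ * κ₃
            ≡⟨ trans (l₂ H (ht ^ 2) t (X * X * ZQ) (u * u) (P n t * P n t) κ₁ κ₃) (cong (λ a → t * t * (X * X * ZQ) * (ht ^ 2 * (H * H)) * (a - 1ℚ) + t * t * (u * u) * ht ^ 2 * (H * H * (P n t * P n t))) κ₁κ₃) ⟩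
          t * t * (X * X * ZQ) * (ht ^ 2 * (H * H)) * (1ℚ - 1ℚ) + t * t * (u * u) * ht ^ 2 * (H * H * (P n t * P n t))
            ≡⟨ trans (l₃ (t * t * (X * X * ZQ) * (ht ^ 2 * (H * H))) (t * t * (u * u) * ht ^ 2 * (H * H * (P n t * P n t)))) (cong (t * t * (u * u) * ht ^ 2 *_) (sym middle)) ⟩
          t * t * (u * u) * ht ^ 2 * (p₁ * p₁ * K₀)
            ≡⟨ l₄ t u (ht ^ 2) p₁ K₀ ⟩
          K₀ * t ^ 2 * u ^ 2 * ht ^ 2 * (p₁ * p₁)
            ≡⟨ cong₂ (λ a b → K₀ * t ^ 2 * a * b * (p₁ * p₁)) (sym (χ₂ u)) (sym (χ₂' ht)) ⟩
          K₀ * t ^ 2 * (u ^ χo * u ^ suc χe) * (ht ^ χe * ht ^ suc χo) * (p₁ * p₁)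
            ≡⟨ l₅ (K₀ * t ^ 2) (u ^ χo) (u ^ suc χe) (ht ^ χe) (ht ^ suc χo) (p₁ * p₁) ⟩
          K * C t ∎)
          where
          l₁ : ∀ Tt q V v U x H y p p' b k k' z → (Tt * V * U * H * (Tt * V * U * H) * q * x * y) * (v * v * (p * p') - b * (- (k * k') * z))
            ≡ - (p * p' * (- 1ℚ * ((Tt * Tt * q) * (V * V * (v * (v * 1ℚ))) * (U * U * x) * (H * H * y)))) + (Tt * V * U * H * (Tt * V * U * H) * q * x * y) * b * (k * z) * k'
          l₁ = solve 14 (λ Tt q V v U x H y p p' b k k' z → (Tt :* V :* U :* H :* (Tt :* V :* U :* H) :* q :* x :* y) :* (v :* v :* (p :* p') :- b :* (:- (k :* k') :* z)) := :- (p :* p' :* (:- :1 :* ((Tt :* Tt :* q) :* (V :* V :* (v :* (v :* :1))) :* (U :* U :* x) :* (H :* H :* y)))) :+ (Tt :* V :* U :* H :* (Tt :* V :* U :* H) :* q :* x :* y) :* b :* (k :* z) :* k') refl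
          l₂ : ∀ H k t x u q a b → - (H * H * k * (t * t * (x - u * q))) + t * t * x * (k * (H * H)) * a * b ≡ t * t * x * (k * (H * H)) * (a * b - 1ℚ) + t * t * u * k * (H * H * q)
          l₂ = solve 8 (λ H k t x u q a b → :- (H :* H :* k :* (t :* t :* (x :- u :* q))) :+ t :* t :* x :* (k :* (H :* H)) :* a :* b := t :* t :* x :* (k :* (H :* H)) :* (a :* b :- :1) :+ t :* t :* u :* k :* (H :* H :* q)) refl
          l₃ : ∀ a b → a * (1ℚ - 1ℚ) + b ≡ b
          l₃ = solve 2 (λ a b → a :* (:1 :- :1) :+ b := b) refl
          l₄ : ∀ t u k p K → t * t * (u * u) * k * (p * p * K) ≡ K * (t * (t * 1ℚ)) * (u * (u * 1ℚ)) * k * (p * p)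
          l₄ = solve 5 (λ t u k p K → t :* t :* (u :* u) :* k :* (p :* p :* K) := K :* (t :* (t :* :1)) :* (u :* (u :* :1)) :* k :* (p :* p)) refl
          l₅ : ∀ k a b c d e → k * (a * b) * (c * d) * e ≡ k * a * c * (b * d * e)
          l₅ = solve 6 (λ k a b c d e → k :* (a :* b) :* (c :* d) :* e := k :* a :* c :* (b :* d :* e)) refl

      identity : ∀ t → (1ℚ + t) * (1ℚ + t) * (evalP (p m) t * evalP (p (suc n)) t) - t ^ suc n * r n t * Ȳ t ≡ C t
      identity = pf-dense-≡ (pf-sub (pf-* (pf-* p1+t p1+t) (pf-* (pf-evalP (p m)) (pf-evalP (p (suc n))))) (pf-* (pf-* (pf-^ pf-id (suc n)) (pf-r n)) pf-Ȳ))
        (pf-* (pf-* (pf-^ p1+2t (suc χe)) (pf-^ pf-h (suc χo))) (pf-* (pf-evalP (p n)) (pf-evalP (p n)))) pf-bad 1ℚ bad-1≢0 (λ t nz → identity-generic t (generic t nz))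

      Y : Poly
      Y = proj₁ pf-Ȳ

      evalP-Apoly : ∀ Q t → evalP (Apoly Q) t ≡ (1ℚ + t) * (1ℚ + t) * evalP Q t
      evalP-Apoly Q t = trans (evalP-mulP (1ℚ ∷ two ∷ 1ℚ ∷ []) Q t) (cong (_* evalP Q t) (lem t))
        where
        lem : ∀ t → 1ℚ + t * (two + t * (1ℚ + t * 0ℚ)) ≡ (1ℚ + t) * (1ℚ + t)
        lem = solve 1 (λ t → :1 :+ t :* (:2 :+ t :* (:1 :+ t :* :0)) := (:1 :+ t) :* (:1 :+ t)) refl

      equation : ∀ t → t ≢ 0ℚ → evalP (Apoly (p m)) t * evalP (p (suc n)) t - Bval n (p n) t * evalP Y t ≡ Cval n (p n) t
      equation t t≢0 = trans (cong₂ _-_ (trans (cong (_* evalP (p (suc n)) t) (evalP-Apoly (p m) t)) (ℚP.*-assoc ((1ℚ + t) * (1ℚ + t)) (evalP (p m) t) (evalP (p (suc n)) t)))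
          (cong₂ _*_ (cong (t ^ suc n *_) (trans (cong (λ e → t ^ e * evalP (p n) (1ℚ ÷' t)) (half-square n)) (sym (r-reversal n t (1ℚ ÷' t) (trans (ℚP.*-comm t (1ℚ ÷' t)) (÷'-* 1ℚ t≢0)))))) (proj₂ pf-Ȳ t)))
        (identity t)

      private
        -- The degree of A: n(n - 1)/2 from p_{n-1}, whose reversal with this exponent is nonzero at
        -- 0, and 2 from (1 + t)².
        d = tri (suc m) ℕ.+ 2

        shift² : ∀ t u → t * u ≡ 1ℚ → t ^ 2 * ((1ℚ + u) * (1ℚ + u)) ≡ (1ℚ + t) * (1ℚ + t)
        shift² t u tu = trans (l₁ t u) (trans (cong (λ x → (t + x) * (t + x)) tu) (l₂ t))
          where
          l₁ : ∀ t u → t * (t * 1ℚ) * ((1ℚ + u) * (1ℚ + u)) ≡ (t + t * u) * (t + t * u)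
          l₁ = solve 2 (λ t u → t :* (t :* :1) :* ((:1 :+ u) :* (:1 :+ u)) := (t :+ t :* u) :* (t :+ t :* u)) refl
          l₂ : ∀ t → (t + 1ℚ) * (t + 1ℚ) ≡ (1ℚ + t) * (1ℚ + t)
          l₂ = solve 1 (λ t → (t :+ :1) :* (t :+ :1) := (:1 :+ t) :* (:1 :+ t)) refl

      deg-A : deg (Apoly (p m)) ≡ just d
      deg-A = deg-reversal d (Apoly (p m)) (pf-* (pf-* p1+t p1+t) (pf-r m))
        (λ t u tu → sym (begin
          t ^ (tri (suc m) ℕ.+ 2) * evalP (Apoly (p m)) u
            ≡⟨ cong₂ _*_ (^-+ t (tri (suc m)) 2) (evalP-Apoly (p m) u) ⟩
          t ^ tri (suc m) * t ^ 2 * ((1ℚ + u) * (1ℚ + u) * evalP (p m) u)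
            ≡⟨ l (t ^ tri (suc m)) (t ^ 2) ((1ℚ + u) * (1ℚ + u)) (evalP (p m) u) ⟩
          t ^ 2 * ((1ℚ + u) * (1ℚ + u)) * (t ^ tri (suc m) * evalP (p m) u)
            ≡⟨ cong₂ _*_ (shift² t u tu) (sym (r-reversal m t u tu)) ⟩
          (1ℚ + t) * (1ℚ + t) * r m t ∎))
        (λ z → r-0≢0 m (trans (l₀ (r m 0ℚ)) z))
        where
        open ≡-Reasoning
        l : ∀ a b c d → a * b * (c * d) ≡ b * c * (a * d)
        l = solve 4 (λ a b c d → a :* b :* (c :* d) := b :* c :* (a :* d)) refl
        l₀ : ∀ x → x ≡ (1ℚ + 0ℚ) * (1ℚ + 0ℚ) * x
        l₀ = solve 1 (λ x → x := (:1 :+ :0) :* (:1 :+ :0) :* x) refl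

      private
        -- The reversal of A X - C. The coefficient B of Y reverses to p_n itself, as p̃_n is its
        -- reversal.
        W : ℚ → ℚ
        W t = (1ℚ + t) * (1ℚ + t) * (r m t * r (suc n) t) - (t + two) ^ suc χe * (t + half) ^ suc χo * (r n t * r n t)

        pf-W : PolyFun W
        pf-W = pf-sub (pf-* (pf-* p1+t p1+t) (pf-* (pf-r m) (pf-r (suc n)))) (pf-* (pf-* (pf-^ pf-t+2 (suc χe)) (pf-^ (pf-+ pf-id (pf-con half)) (suc χo))) (pf-* (pf-r n) (pf-r n)))

        -- The equation at 1/t, multiplied by t^(n² + n + 3)
        reversed : ∀ t u → t * u ≡ 1ℚ → evalP (p n) t * (t ^ d * evalP Y u) ≡ W t
        reversed t u tu = begin
          evalP (p n) t * (t ^ d * evalP Y u)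
            ≡⟨ cong (λ y → evalP (p n) t * (t ^ d * y)) (proj₂ pf-Ȳ u) ⟩
          evalP (p n) t * (t ^ d * Ȳ u)
            ≡⟨ l₁ (evalP (p n) t) (t ^ d) (Ȳ u) ⟩
          t ^ d * (1ℚ * 1ℚ) * (evalP (p n) t * Ȳ u)
            ≡⟨ cong₂ (λ a b → t ^ d * (a * b) * (evalP (p n) t * Ȳ u)) (sym (pow-inverse {t} {u} (suc n) tu)) (sym (pow-inverse {t} {u} (tri (suc n)) tu)) ⟩
          t ^ d * (t ^ suc n * u ^ suc n * (t ^ tri (suc n) * u ^ tri (suc n))) * (evalP (p n) t * Ȳ u)
            ≡⟨ l₂ (t ^ d) (t ^ suc n) (u ^ suc n) (t ^ tri (suc n)) (u ^ tri (suc n)) (evalP (p n) t) (Ȳ u) ⟩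
          D * (u ^ suc n * (u ^ tri (suc n) * evalP (p n) t) * Ȳ u)
            ≡⟨ cong (λ a → D * (u ^ suc n * a * Ȳ u)) (sym (r-reversal n u t (trans (ℚP.*-comm u t) tu))) ⟩
          D * (u ^ suc n * r n u * Ȳ u)
            ≡⟨ cong (D *_) (trans (l₃ ((1ℚ + u) * (1ℚ + u) * (evalP (p m) u * evalP (p (suc n)) u)) (u ^ suc n * r n u * Ȳ u)) (cong (λ x → (1ℚ + u) * (1ℚ + u) * (evalP (p m) u * evalP (p (suc n)) u) - x) (identity u))) ⟩
          D * ((1ℚ + u) * (1ℚ + u) * (evalP (p m) u * evalP (p (suc n)) u) - C u)
            ≡⟨ l₄ D ((1ℚ + u) * (1ℚ + u) * (evalP (p m) u * evalP (p (suc n)) u)) (C u) ⟩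
          D * ((1ℚ + u) * (1ℚ + u) * (evalP (p m) u * evalP (p (suc n)) u)) - D * C u
            ≡⟨ cong₂ _-_ first-part second-part ⟩
          W t ∎
          where
          open ≡-Reasoning
          D = t ^ d * (t ^ suc n * t ^ tri (suc n))
          first-part : D * ((1ℚ + u) * (1ℚ + u) * (evalP (p m) u * evalP (p (suc n)) u)) ≡ (1ℚ + t) * (1ℚ + t) * (r m t * r (suc n) t)
          first-part = begin
            t ^ d * (t ^ suc n * t ^ tri (suc n)) * ((1ℚ + u) * (1ℚ + u) * (evalP (p m) u * evalP (p (suc n)) u))
              ≡⟨ cong₂ (λ a b → a * b * ((1ℚ + u) * (1ℚ + u) * (evalP (p m) u * evalP (p (suc n)) u))) (^-+ t (tri (suc m)) 2) (sym (^-+ t (suc n) (tri (suc n)))) ⟩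
            t ^ tri (suc m) * t ^ 2 * t ^ tri (suc (suc n)) * ((1ℚ + u) * (1ℚ + u) * (evalP (p m) u * evalP (p (suc n)) u))
              ≡⟨ k₁ (t ^ tri (suc m)) (t ^ 2) (t ^ tri (suc (suc n))) ((1ℚ + u) * (1ℚ + u)) (evalP (p m) u) (evalP (p (suc n)) u) ⟩
            t ^ 2 * ((1ℚ + u) * (1ℚ + u)) * ((t ^ tri (suc m) * evalP (p m) u) * (t ^ tri (suc (suc n)) * evalP (p (suc n)) u))
              ≡⟨ cong₂ _*_ (shift² t u tu) (sym (cong₂ _*_ (r-reversal m t u tu) (r-reversal (suc n) t u tu))) ⟩
            (1ℚ + t) * (1ℚ + t) * (r m t * r (suc n) t) ∎
            where
            k₁ : ∀ a b c e p q → a * b * c * (e * (p * q)) ≡ b * e * ((a * p) * (c * q))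
            k₁ = solve 6 (λ a b c e p q → a :* b :* c :* (e :* (p :* q)) := b :* e :* ((a :* p) :* (c :* q))) refl
          exponents : d ℕ.+ (suc n ℕ.+ tri (suc n)) ≡ suc χe ℕ.+ suc χo ℕ.+ (tri (suc n) ℕ.+ tri (suc n))
          exponents = trans (e₁ m (tri (suc m))) (cong (ℕ._+ (tri (suc n) ℕ.+ tri (suc n))) (sym (trans (cong suc (ℕP.+-suc χe χo)) (cong (λ x → suc (suc x)) (χ-sum n)))))
            where
            e₁ : ∀ m r → r ℕ.+ 2 ℕ.+ (suc (suc m) ℕ.+ (suc m ℕ.+ r)) ≡ 3 ℕ.+ (suc m ℕ.+ r ℕ.+ (suc m ℕ.+ r))
            e₁ = ℕR.solve-∀
          second-part : D * C u ≡ (t + two) ^ suc χe * (t + half) ^ suc χo * (r n t * r n t)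
          second-part = begin
            D * C u
              ≡⟨ cong (_* C u) (trans (cong (t ^ d *_) (sym (^-+ t (suc n) (tri (suc n))))) (trans (sym (^-+ t d (suc n ℕ.+ tri (suc n)))) (trans (cong (t ^_) exponents)
                   (trans (^-+ t (suc χe ℕ.+ suc χo) (tri (suc n) ℕ.+ tri (suc n))) (cong₂ _*_ (^-+ t (suc χe) (suc χo)) (^-+ t (tri (suc n)) (tri (suc n)))))))) ⟩
            t ^ suc χe * t ^ suc χo * (t ^ tri (suc n) * t ^ tri (suc n)) * ((1ℚ + two * u) ^ suc χe * h u ^ suc χo * (evalP (p n) u * evalP (p n) u))
              ≡⟨ k₁ (t ^ suc χe) (t ^ suc χo) (t ^ tri (suc n)) ((1ℚ + two * u) ^ suc χe) (h u ^ suc χo) (evalP (p n) u) ⟩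
            (t ^ suc χe * (1ℚ + two * u) ^ suc χe) * (t ^ suc χo * h u ^ suc χo) * ((t ^ tri (suc n) * evalP (p n) u) * (t ^ tri (suc n) * evalP (p n) u))
              ≡⟨ cong₂ _*_ (cong₂ _*_ (trans (sym (*-^ t (1ℚ + two * u) (suc χe))) (cong (_^ suc χe) a₁)) (trans (sym (*-^ t (h u) (suc χo))) (cong (_^ suc χo) a₂))) (sym (cong₂ _*_ (r-reversal n t u tu) (r-reversal n t u tu))) ⟩
            (t + two) ^ suc χe * (t + half) ^ suc χo * (r n t * r n t) ∎
            where
            k₁ : ∀ a b c e f q → a * b * (c * c) * (e * f * (q * q)) ≡ (a * e) * (b * f) * ((c * q) * (c * q))
            k₁ = solve 6 (λ a b c e f q → a :* b :* (c :* c) :* (e :* f :* (q :* q)) := (a :* e) :* (b :* f) :* ((c :* q) :* (c :* q))) refl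
            a₁ : t * (1ℚ + two * u) ≡ t + two
            a₁ = trans (b₁ t u) (cong (λ x → t + two * x) tu)
              where
              b₁ : ∀ t u → t * (1ℚ + two * u) ≡ t + two * (t * u)
              b₁ = solve 2 (λ t u → t :* (:1 :+ :2 :* u) := t :+ :2 :* (t :* u)) refl
            a₂ : t * h u ≡ t + half
            a₂ = trans (b₂ t u) (cong (λ x → t + half * x) tu)
              where
              b₂ : ∀ t u → t * (1ℚ + half * u) ≡ t + half * (t * u)
              b₂ = solve 2 (λ t u → t :* (:1 :+ :½ :* u) := t :+ :½ :* (t :* u)) refl
          l₁ : ∀ a b c → a * (b * c) ≡ b * (1ℚ * 1ℚ) * (a * c)
          l₁ = solve 3 (λ a b c → a :* (b :* c) := b :* (:1 :* :1) :* (a :* c)) refl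
          l₂ : ∀ d a b c e p y → d * (a * b * (c * e)) * (p * y) ≡ d * (a * c) * (b * (e * p) * y)
          l₂ = solve 7 (λ d a b c e p y → d :* (a :* b :* (c :* e)) :* (p :* y) := d :* (a :* c) :* (b :* (e :* p) :* y)) refl
          l₃ : ∀ a b → b ≡ a - (a - b)
          l₃ = solve 2 (λ a b → b := a :- (a :- b)) refl
          l₄ : ∀ d a c → d * (a - c) ≡ d * a - d * c
          l₄ = solve 3 (λ d a c → d :* (a :- c) := d :* a :- d :* c) refl

        W-0≢0 : W 0ℚ ≢ 0ℚ
        W-0≢0 z = θH-convex m (begin
          θH m * θH (suc n)
            ≡⟨ sym (cong₂ _*_ (r-0 m) (r-0 (suc n))) ⟩
          r m 0ℚ * two ^ δ m * half ^ δ (m ∸ 1) * (r (suc n) 0ℚ * two ^ δ (suc n) * half ^ δ n)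
            ≡⟨ l₁ (r m 0ℚ) (two ^ δ m) (half ^ δ (m ∸ 1)) (r (suc n) 0ℚ) (two ^ δ (suc n)) (half ^ δ n) ⟩
          r m 0ℚ * r (suc n) 0ℚ * (two ^ δ m * two ^ δ (suc n)) * (half ^ δ (m ∸ 1) * half ^ δ n)
            ≡⟨ cong₂ (λ a b → r m 0ℚ * r (suc n) 0ℚ * a * b) (pow₂₃ two (δ m) (δ (suc n)) (δ n) χo (δ-second m)) (pow₂₃ half (δ (m ∸ 1)) (δ n) (δ m) χe (δ-second' m)) ⟩
          r m 0ℚ * r (suc n) 0ℚ * (two ^ δ n * two ^ δ n * two ^ χo) * (half ^ δ m * half ^ δ m * half ^ χe)
            ≡⟨ cong (λ a → a * (two ^ δ n * two ^ δ n * two ^ χo) * (half ^ δ m * half ^ δ m * half ^ χe)) balance ⟩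
          two ^ suc χe * half ^ suc χo * (r n 0ℚ * r n 0ℚ) * (two ^ δ n * two ^ δ n * two ^ χo) * (half ^ δ m * half ^ δ m * half ^ χe)
            ≡⟨ l₂ (two ^ suc χe) (half ^ suc χo) (r n 0ℚ) (two ^ δ n) (two ^ χo) (half ^ δ m) (half ^ χe) ⟩
          (two ^ χo * two ^ suc χe) * (half ^ χe * half ^ suc χo) * (r n 0ℚ * two ^ δ n * half ^ δ m * (r n 0ℚ * two ^ δ n * half ^ δ m))
            -- The powers that remain are 2² and (1/2)², so only the binomials are left and W(0) = 0
            -- contradicts their strict convexity.
            ≡⟨ cong₂ _*_ (trans (cong₂ _*_ (trans (sym (^-+ two χo (suc χe))) (cong (two ^_) s₁)) (trans (sym (^-+ half χe (suc χo))) (cong (half ^_) s₂))) refl) (cong₂ _*_ (r-0 n) (r-0 n)) ⟩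
          1ℚ * (θH n * θH n)
            ≡⟨ ℚP.*-identityˡ (θH n * θH n) ⟩
          θH n * θH n ∎)
          where
          open ≡-Reasoning
          s₁ : χo ℕ.+ suc χe ≡ 2
          s₁ = trans (ℕP.+-suc χo χe) (cong suc (trans (ℕP.+-comm χo χe) (χ-sum n)))
          s₂ : χe ℕ.+ suc χo ≡ 2
          s₂ = trans (ℕP.+-suc χe χo) (cong suc (χ-sum n))
          balance : r m 0ℚ * r (suc n) 0ℚ ≡ two ^ suc χe * half ^ suc χo * (r n 0ℚ * r n 0ℚ)
          balance = trans (l₀ (r m 0ℚ * r (suc n) 0ℚ)) (-≡0 z)
            where
            l₀ : ∀ x → x ≡ (1ℚ + 0ℚ) * (1ℚ + 0ℚ) * x
            l₀ = solve 1 (λ x → x := (:1 :+ :0) :* (:1 :+ :0) :* x) refl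
          l₁ : ∀ a b c d e f → a * b * c * (d * e * f) ≡ a * d * (b * e) * (c * f)
          l₁ = solve 6 (λ a b c d e f → a :* b :* c :* (d :* e :* f) := a :* d :* (b :* e) :* (c :* f)) refl
          l₂ : ∀ a b r c d e f → a * b * (r * r) * (c * c * d) * (e * e * f) ≡ (d * a) * (f * b) * (r * c * e * (r * c * e))
          l₂ = solve 7 (λ a b r c d e f → a :* b :* (r :* r) :* (c :* c :* d) :* (e :* e :* f) := (d :* a) :* (f :* b) :* (r :* c :* e :* (r :* c :* e))) refl

        -- That p_n is nonzero at 0 permits dividing W by p_n, so t^d Y(1/t) is a polynomial whose
        -- value at 0 is nonzero with W(0).
        Y-reversal = reversal d Y (pf-evalP (p n)) pf-W (pf-con 1ℚ) 1≢0 (p-at-0 n) (λ t u tu _ → reversed t u tu)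

      deg-Y : deg Y ≡ just d
      deg-Y = deg-reversal d Y (proj₁ (proj₂ Y-reversal)) (proj₁ (proj₂ (proj₂ Y-reversal)))
        (λ z → W-0≢0 (trans (sym (proj₂ (proj₂ (proj₂ Y-reversal)) 0ℚ)) (trans (cong (evalP (p n) 0ℚ *_) z) (ℚP.*-zeroʳ (evalP (p n) 0ℚ)))))

theorem3p7 : (S : (m : ℕ) → MPoly (SVar m)) → ((m : ℕ) → IsS m (S m))
    → (p : ℕ → Poly) → ((m : ℕ) → IsP m (S m) (p m))
    → (n : ℕ) → 1 ≤ n
    → Σ Poly (λ Y → deg Y ≡ deg (Apoly (p (n ∸ 1)))
    × ((t : ℚ) → t ≢ 0ℚ
    → evalP (Apoly (p (n ∸ 1))) t * evalP (p (suc n)) t - Bval n (p n) t * evalP Y t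
    ≡ Cval n (p n) t))
theorem3p7 S isS p isP (suc m) _ = Y , trans deg-Y (sym deg-A) , equation
  where open Development.Main.Final S isS p isP m
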